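{- The (decoupled) \textsc{Spanner} problem parameterized by the maximum number $\mu$ of nontrivial edges in the spanner and the bundle-size $s$ of the instance can be decided (including finding a witness if it exists) in $$\mathcal{O}\big(s^{\mu}\cdot\mathrm{APSP}(n,m)+m^3+m^2n\log n\big)$$ time. That is, given a connected undirected graph $G=(V,E)$ with $n=|V|$, $m=|E|$, edge weights $w\colon E\to\mathbb{N}_{\ge0}$, edge lengths $\ell\colon E\to\mathbb{N}_{\ge1}$, a stretch factor $\alpha\ge1$, a weight bound $W\in\mathbb{N}$ and a number $\mu$, it can be decided within this time whether $G$ has an $\alpha$-spanner $H=(V,F)$ with $w(H)\le W$ and $|F\cap N|\le\mu$, where $N$ is the set of nontrivial edges, and such a spanner is returned if it exists.
   Context: For a subgraph $G'\subseteq G$ and $u,v\in V$, $\ell_{G'}[u,v]$ is the length of a shortest $u$-$v$-path in $G'$ w.r.t. $\ell$. A subgraph $H=(V,F)$, $F\subseteq E$, is an $\alpha$-spanner of $G$ if $\ell_H[u,v]\le\alpha\,\ell_G[u,v]$ for all $u,v\in V$; equivalently, for all $\{u,v\}\in E$. Its weight is $w(H)=\sum_{e\in F}w(e)$. The set of terminal pairs is $K=E$. For $\{u,v\}\in E$, a simple $u$-$v$-path $P$ is settling if $\ell(P)\le\alpha\,\ell_G[u,v]$; it is alternative if it does not contain the edge $\{u,v\}$. $\mathcal{P}_{uv}$ is the set of all settling $u$-$v$-paths. As a preprocessing convention, edges that do not settle themselves (i.e., $\ell(\{u,v\})>\alpha\,\ell_G[u,v]$) are assumed to have been removed from the instance.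 An edge $\{u,v\}$ is mandatory if $\mathcal{P}_{uv}$ contains no alternative path. The trivial edges $T\subseteq E$ are the mandatory edges and the edges of weight $0$; the nontrivial edges are $N=E\setminus T$. A terminal pair $\{u,v\}\in E$ is critical if no settling $u$-$v$-path consists only of trivial edges; $C$ denotes the set of critical terminal pairs. The bundle-size is $s=\max_{\{u,v\}\in C}\big|\bigcup_{P\in\mathcal{P}_{uv}}(P\cap N)\big|$, the maximum number of nontrivial edges lying on settling paths, over all critical terminal pairs. $\mathrm{APSP}(n,m)$ denotes the running time of a suitable algorithm for the all-pairs shortest paths problem on a graph with $n$ nodes and $m$ edges.
   Formalization: The stretch factor α ≥ 1 is taken to be a rational number, given to the algorithm as numerator and denominator. -}

module Defs where

open import Data.Bool.Base using (if_then_else_)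
open import Data.Fin.Base as Fin using (Fin; toℕ)
open import Data.Fin.Subset using (Subset; _∈_; ⊤; ∣_∣)
import Data.Integer.Base as ℤ
open import Data.List.Base
  using (List; []; _∷_; length; map; concatMap; allFin; applyUpTo)
open import Data.List.Extrema.Nat using (max)
open import Data.List.Membership.Propositional using () renaming (_∈_ to _∈ˡ_)
open import Data.List.Relation.Unary.All using (All)
open import Data.List.Relation.Unary.Unique.Propositional using (Unique)
open import Data.Nat.Base using (ℕ; zero; suc; _+_; _∸_; _*_; _/_; _^_; _≤_; _≡ᵇ_)
open import Data.Nat.ListAction using (sum)
open import Data.Product.Base using (_×_; Σ-syntax; ∃-syntax)
open import Data.Rational.Unnormalised.Base as ℚ using (ℚᵘ; 1ℚᵘ; ↥_; ↧ₙ_)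
open import Data.Sum.Base using (_⊎_)
open import Data.Vec.Base as Vec using (lookup; toList)
open import Function.Bundles using (_⇔_)
open import Relation.Binary.PropositionalEquality.Core using (_≡_; _≢_)
open import Relation.Nullary.Negation.Core using (¬_)

------------------------------------------------------------------------
-- Model of computation: a word RAM with structured control flow.
--
-- The memory consists of arrays of natural numbers; a program mentions
-- only finitely many of them, and a scalar variable is cell 0 of an
-- array.  Every operation on a word takes unit time.  To make this a
-- reasonable cost measure, every number computed (including addresses)
-- has to stay below a bound B, which for complete runs is polynomial in
-- the input length and the largest input number, i.e. a word has
-- O(log (length + largest number)) bits.  Exceeding B is an error.

data Op : Set where
  add monus mul div : Op

-- Division by zero yields zero.
apply : Op → ℕ → ℕ → ℕ
apply add   x y       = x + y
apply monus x y       = x ∸ y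
apply mul   x y       = x * y
apply div   x zero    = zero
apply div   x (suc y) = x / suc y

infix  8 _⟦_⟧
infix  5 _⟦_⟧≔_
infixr 4 _⨾_

data Exp : Set where
  lit  : ℕ → Exp
  _⟦_⟧ : (a : ℕ) (i : Exp) → Exp
  op   : Op → Exp → Exp → Exp

data Cmd : Set where
  skip   : Cmd
  _⟦_⟧≔_ : (a : ℕ) (i e : Exp) → Cmd
  _⨾_    : Cmd → Cmd → Cmd
  if     : Exp → Cmd → Cmd → Cmd
  while  : Exp → Cmd → Cmd
  -- call p a b runs p on a fresh memory, with the list stored in array a
  -- as its input, and stores the list it returns in array b.  There is
  -- no recursion, so the memory of p can be allocated statically.
  call   : Cmd → (a b : ℕ) → Cmd

Store : Set
Store = ℕ → ℕ → ℕ

eval : Store → Exp → ℕ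
eval σ (lit n)      = n
eval σ (a ⟦ i ⟧)    = σ a (eval σ i)
eval σ (op o e₁ e₂) = apply o (eval σ e₁) (eval σ e₂)

Fits : ℕ → Store → Exp → Set
Fits B σ (lit n)      = n ≤ B
Fits B σ (a ⟦ i ⟧)    = Fits B σ i × σ a (eval σ i) ≤ B
Fits B σ (op o e₁ e₂) =
  Fits B σ e₁ × Fits B σ e₂ × apply o (eval σ e₁) (eval σ e₂) ≤ B

cost : Exp → ℕ
cost (lit n)      = 1
cost (a ⟦ i ⟧)    = 1 + cost i
cost (op o e₁ e₂) = 1 + cost e₁ + cost e₂

-- A list is stored in an array with its length in cell 0 and its
-- elements in the cells from 1 on.

overwrite : List ℕ → (ℕ → ℕ) → (ℕ → ℕ)
overwrite []       f i       = f i
overwrite (x ∷ xs) f zero    = x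
overwrite (x ∷ xs) f (suc i) = overwrite xs (λ j → f (suc j)) i

putList : List ℕ → (ℕ → ℕ) → (ℕ → ℕ)
putList xs = overwrite (length xs ∷ xs)

getList : (ℕ → ℕ) → List ℕ
getList f = applyUpTo (λ i → f (suc i)) (f 0)

setArray : ℕ → (ℕ → ℕ) → Store → Store
setArray a f σ b = if a ≡ᵇ b then f else σ b

setCell : ℕ → ℕ → ℕ → Store → Store
setCell a i v σ = setArray a (λ j → if i ≡ᵇ j then v else σ a j) σ

-- A program finds its input in array 0 and leaves its output in array 1.
initial : List ℕ → Store
initial xs = setArray 0 (putList xs (λ _ → 0)) (λ _ _ → 0)

output : Store → List ℕ
output σ = getList (σ 1)

-- Exec B c σ τ t: started in σ, c halts in τ after time t, without
-- exceeding the bound B.  A call pays for transferring its input and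
-- output.
data Exec (B : ℕ) : Cmd → Store → Store → ℕ → Set where

  skip : ∀ {σ} → Exec B skip σ σ 1

  assign : ∀ {σ a i e} → Fits B σ i → Fits B σ e →
           Exec B (a ⟦ i ⟧≔ e) σ (setCell a (eval σ i) (eval σ e) σ)
                (1 + cost i + cost e)

  seq : ∀ {c d σ ρ τ s t} → Exec B c σ ρ s → Exec B d ρ τ t →
        Exec B (c ⨾ d) σ τ (s + t)

  if-true : ∀ {e c d σ τ t} → Fits B σ e → eval σ e ≢ 0 →
            Exec B c σ τ t → Exec B (if e c d) σ τ (1 + cost e + t)

  if-false : ∀ {e c d σ τ t} → Fits B σ e → eval σ e ≡ 0 →
             Exec B d σ τ t → Exec B (if e c d) σ τ (1 + cost e + t)

  while-true : ∀ {e c σ ρ τ s t} → Fits B σ e → eval σ e ≢ 0 →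
               Exec B c σ ρ s → Exec B (while e c) ρ τ t →
               Exec B (while e c) σ τ (1 + cost e + s + t)

  while-false : ∀ {e c σ} → Fits B σ e → eval σ e ≡ 0 →
                Exec B (while e c) σ σ (1 + cost e)

  call : ∀ {p a b σ ρ t} → Exec B p (initial (getList (σ a))) ρ t →
         Exec B (call p a b) σ (setArray b (putList (output ρ) (σ b)) σ)
              (1 + length (getList (σ a)) + t + length (output ρ))

wordBound : ℕ → List ℕ → ℕ
wordBound k xs = (2 + length xs + max 0 xs) ^ k

-- On input xs, the program p halts with output ys; the running time,
-- including reading the input and writing the output, is at most T.
RunsWithin : ℕ → Cmd → List ℕ → List ℕ → ℕ → Set
RunsWithin k p xs ys T =
  ∃[ τ ] ∃[ t ] Exec (wordBound k xs) p (initial xs) τ t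
              × output τ ≡ ys
              × length xs + t + length ys ≤ T

------------------------------------------------------------------------
-- Graphs

-- A simple undirected graph on the vertex set Fin n with edge set Fin m;
-- an edge is a two-element set of vertices, given by its smaller and its
-- larger element.
record Graph (n m : ℕ) : Set where
  field
    lo hi  : Fin m → Fin n
    lo<hi  : ∀ e → lo e Fin.< hi e
    simple : ∀ {e f} → lo e ≡ lo f → hi e ≡ hi f → e ≡ f

  Joins : Fin m → Fin n → Fin n → Set
  Joins e u v = (lo e ≡ u × hi e ≡ v) ⊎ (lo e ≡ v × hi e ≡ u)

  data Walk : Fin n → Fin n → Set where
    stop : ∀ {u} → Walk u u
    step : ∀ {u v x} (e : Fin m) → Joins e u v → Walk v x → Walk u x

  vertices : ∀ {u v} → Walk u v → List (Fin n)
  vertices {u} stop         = u ∷ []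
  vertices {u} (step _ _ p) = u ∷ vertices p

  edges : ∀ {u v} → Walk u v → List (Fin m)
  edges stop         = []
  edges (step e _ p) = e ∷ edges p

  IsPath : ∀ {u v} → Walk u v → Set
  IsPath p = Unique (vertices p)

  _⊑_ : ∀ {u v} → Walk u v → Subset m → Set
  p ⊑ F = All (_∈ F) (edges p)

record Network (n m : ℕ) : Set where
  field
    graph     : Graph n m

  open Graph graph public

  field
    connected : ∀ u v → Walk u v
    ℓ         : Fin m → ℕ
    ℓ-pos     : ∀ e → 1 ≤ ℓ e

  ℓ* : ∀ {u v} → Walk u v → ℕ
  ℓ* p = sum (map ℓ (edges p))

  -- d is the length of a shortest u-v-path in the subgraph (V , F); there
  -- is no such d if u and v are not connected in it.
  Dist : Subset m → Fin n → Fin n → ℕ → Set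
  Dist F u v d =
      (∃[ p ] IsPath {u} {v} p × p ⊑ F × ℓ* p ≡ d)
    × (∀ (p : Walk u v) → IsPath p → p ⊑ F → d ≤ ℓ* p)

------------------------------------------------------------------------
-- All-pairs shortest paths

encodeNetwork : ∀ {n m} → Network n m → List ℕ
encodeNetwork {n} {m} N =
  n ∷ m ∷ concatMap (λ e → toℕ (lo e) ∷ toℕ (hi e) ∷ ℓ e ∷ []) (allFin m)
  where open Network N

-- The distances in row-major order.
IsDistanceMatrix : ∀ {n m} → Network n m → List ℕ → Set
IsDistanceMatrix {n} N ys =
  Σ[ D ∈ (Fin n → Fin n → ℕ) ]
    (∀ u v → Dist ⊤ u v (D u v))
    × ys ≡ concatMap (λ u → map (D u) (allFin n)) (allFin n)
  where open Network N

SolvesAPSP : Cmd → (ℕ → ℕ → ℕ) → Set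
SolvesAPSP p T =
  ∃[ k ] (∀ {n m} (N : Network n m) →
    ∃[ ys ] RunsWithin k p (encodeNetwork N) ys (T n m)
          × IsDistanceMatrix N ys)

------------------------------------------------------------------------
-- The spanner problem

fromℕ : ℕ → ℚᵘ
fromℕ x = (ℤ.+ x) ℚ./ 1

record Instance (n m : ℕ) : Set where
  field
    network : Network n m

  open Network network public

  field
    w   : Fin m → ℕ
    α   : ℚᵘ
    1≤α : 1ℚᵘ ℚ.≤ α
    W   : ℕ
    μ   : ℕ

  weight : Subset m → ℕ
  weight F = Vec.sum (Vec.tabulate λ e → if lookup F e then w e else 0)

  IsSpanner : Subset m → Set
  IsSpanner F =
    ∀ u v d → Dist ⊤ u v d →
    ∃[ d′ ] Dist F u v d′ × fromℕ d′ ℚ.≤ α ℚ.* fromℕ d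

  SettlingLength : Fin n → Fin n → ℕ → Set
  SettlingLength u v x = ∃[ d ] Dist ⊤ u v d × fromℕ x ℚ.≤ α ℚ.* fromℕ d

  𝒫 : (e : Fin m) → Walk (lo e) (hi e) → Set
  𝒫 e p = IsPath p × SettlingLength (lo e) (hi e) (ℓ* p)

  -- Every edge settles itself.
  Preprocessed : Set
  Preprocessed = ∀ e → SettlingLength (lo e) (hi e) (ℓ e)

  Mandatory : Fin m → Set
  Mandatory e = ¬ (∃[ p ] 𝒫 e p × ¬ (e ∈ˡ edges p))

  Trivial : Fin m → Set
  Trivial e = Mandatory e ⊎ w e ≡ 0

  Nontrivial : Fin m → Set
  Nontrivial e = ¬ Trivial e

  Critical : Fin m → Set
  Critical e = ¬ (∃[ p ] 𝒫 e p × All Trivial (edges p))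

  Bundle : Fin m → Fin m → Set
  Bundle e f = (∃[ p ] 𝒫 e p × f ∈ˡ edges p) × Nontrivial f

  HasSize : (Fin m → Set) → ℕ → Set
  HasSize P k = ∃[ S ] (∀ e → (e ∈ S) ⇔ P e) × ∣ S ∣ ≡ k

  -- The maximum over no critical pairs is 0.
  IsBundleSize : ℕ → Set
  IsBundleSize s =
      (∀ e → Critical e → ∀ k → HasSize (Bundle e) k → k ≤ s)
    × ((∃[ e ] Critical e × HasSize (Bundle e) s)
       ⊎ ((∀ e → ¬ Critical e) × s ≡ 0))

  IsSolution : Subset m → Set
  IsSolution F =
      IsSpanner F
    × weight F ≤ W
    × (∃[ k ] HasSize (λ e → e ∈ F × Nontrivial e) k × k ≤ μ)

encode : ∀ {n m} → Instance n m → List ℕ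
encode {n} {m} I =
  n ∷ m ∷ ℤ.∣ ↥ α ∣ ∷ ↧ₙ α ∷ W ∷ μ ∷
  concatMap (λ e → toℕ (lo e) ∷ toℕ (hi e) ∷ ℓ e ∷ w e ∷ []) (allFin m)
  where open Instance I

indicator : ∀ {m} → Subset m → List ℕ
indicator F = map (λ b → if b then 1 else 0) (toList F)

IsAnswer : ∀ {n m} → Instance n m → List ℕ → Set
IsAnswer I ys =
    (∃[ F ] IsSolution F × ys ≡ 1 ∷ indicator F)
  ⊎ ((∀ F → ¬ IsSolution F) × ys ≡ 0 ∷ [])
  where open Instance I

-- An edge f lies on a settling path of e = {s, t} iff walks from s and t to the two ends of f exist that are disjoint and
-- short enough. With a shortest path forest rooted at s and t, the least total length of such a pair is found by a
-- Dijkstra scan over reduced lengths in which f becomes usable once a vertex of the tree path between its ends is scanned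
-- (as in Suurballe and Tarjan's algorithm). This yields all bundles, trivial edges and critical pairs in O(m³) steps.
--
-- The search branches on an edge e that no path of chosen edges settles: every solution extending the choice contains a
-- nontrivial edge of the bundle of e that is not yet chosen, so there are at most s branches. Distances in the graph where
-- unchosen edges are prohibitively long, one call of the APSP program, tell which edges are settled. A stack entry with k
-- choices left has potential G s k, where G s (k + 1) = 1 + s * G s k, so each node lowers the total potential. For s ≥ 2
-- it starts below 2 * s ^ μ. If the bundle of each critical pair e is {e}, then all critical edges are forced and no
-- search is needed.
module Submission where

open import Defs
open import Data.Bool.Base using (Bool; true; false; T; not; _∧_; _∨_; if_then_else_)
open import Data.Empty using (⊥; ⊥-elim)
open import Data.Fin.Base as Fin using (Fin; toℕ; fromℕ<)
import Data.Fin.Properties as Fin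
open import Data.Nat.Base using (ℕ; zero; suc; _+_; _*_; _∸_; _^_; _≤_; _<_; _≡ᵇ_; _≤ᵇ_; _⊔_; z≤n; s≤s; _/_; >-nonZero)
open import Data.Nat.Properties
open import Data.Product.Base using (_×_; _,_; proj₁; proj₂; ∃-syntax; Σ-syntax)
open import Data.Sum.Base using (_⊎_; inj₁; inj₂; [_,_]′)
open import Data.Unit.Base using (tt) renaming (⊤ to Unit)
open import Function.Base using (_∘_; id; _$_; case_of_)
open import Relation.Binary.PropositionalEquality using (_≡_; _≢_; refl; sym; trans; cong; cong₂; subst; subst₂; ≢-sym; module ≡-Reasoning)
open import Relation.Nullary using (¬_; Dec; yes; no)
open import Data.Nat.Solver using (module +-*-Solver)
open import Data.Nat.DivMod using (m/n≤m)
open import Data.Fin.Subset using (Subset) renaming (_∈_ to _∈ˢ_; ⊤ to full; ∣_∣ to card)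
import Data.Fin.Subset.Properties as Subset
open import Data.List.Base using (List; []; _∷_; length; map; concatMap; allFin; applyUpTo; tabulate; _++_)
open import Data.List.Membership.Propositional using () renaming (_∈_ to _∈ˡ_)
import Data.List.Membership.DecPropositional as DecMembership
open import Data.List.Relation.Unary.All as All using (All; []; _∷_)
open import Data.List.Relation.Unary.AllPairs using ([]; _∷_)
open import Data.List.Relation.Unary.Any as Any using (here; there)
open import Data.List.Relation.Unary.Unique.Propositional using (Unique)
open import Data.Nat.ListAction using (sum)
open import Induction.WellFounded using (Acc; acc)
open import Data.Nat.Induction using (<-wellFounded)
import Data.Integer.Base as ℤ
import Data.Integer.Properties as ℤ
open import Data.Rational.Unnormalised.Base as ℚ using (ℚᵘ; mkℚᵘ; 1ℚᵘ; ↥_; ↧ₙ_)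
open import Data.Nat.DivMod using (m*n/n≡m; /-monoˡ-≤; m/n*n≤m)
import Data.Vec.Base as Vec
open import Data.Vec.Base using () renaming (_∷_ to _∷ᵛ_)
import Data.Vec.Properties as Vec
open import Data.List.Relation.Unary.All.Properties.Core using (¬All⇒Any¬)
open import Function.Bundles using (mk⇔; Equivalence)
import Data.List.Properties as List
import Data.List.Relation.Unary.All.Properties as AllP
open import Data.List.Extrema.Nat using (max; max≤v⁺; xs≤max)
open import Data.Nat.Logarithm using (⌊log₂_⌋)

-- Words must stay polynomial in the input although distances, weights and stack indices are added
-- up all the time. So a cap `V` is computed once, and the programs after it store only values that
-- a syntactic test shows to be at most 8 or at most a value already stored; sums are stored as
-- minima with the cap or an old value. As the loops of these programs run over vertices or edges,
-- time and word size are read off the program text, and `n ≤ 1 + m` makes `1 + m` the only unit of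
-- time. The program does not know s. For s = 1 the initial potential is μ + 1, which no fixed
-- multiple of 1 ^ μ bounds; hence the test whether the bundle of some critical pair has a second
-- edge. If none has, no search takes place; otherwise s ≥ 2. The APSP program accepts connected
-- networks only, so unchosen edges are lengthened and never deleted. Its correctness is used twice:
-- it drives the search, and it yields the existence of distances and the decidability of
-- settledness, on which the correctness proof rests.

infixl 6 _⊕_ _⊖_
infixl 7 _⊗_
infix  9 $$_

_⊕_ _⊖_ _⊗_ : Exp → Exp → Exp
_⊕_ = op add
_⊖_ = op monus
_⊗_ = op mul

$$_ : ℕ → Exp
$$ a = a ⟦ lit 0 ⟧

-- Programs with bounded loops and their meaning on stores

infix  5 _[_]:=_
infixr 4 _⨟_

-- This fragment of `Cmd` always terminates, so its meaning is a function `sem` on stores. Only the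
-- computation of the cap, the search loop and the APSP call are written as commands directly.
data Prog : Set where
  nop     : Prog
  _[_]:=_ : (a : ℕ) (i e : Exp) → Prog
  _⨟_     : Prog → Prog → Prog
  ifz     : Exp → Prog → Prog → Prog
  -- for x c p runs p for each value of the counter x below the input word number c.
  for     : (x c : ℕ) → Prog → Prog

caseZ : {A : Set} → ℕ → A → A → A
caseZ zero    a b = a
caseZ (suc _) a b = b

runFor : ℕ → (Store → Store) → ℕ → Store → Store
runFor x f zero    σ = setCell x 0 0 σ
runFor x f (suc k) σ = setCell x 0 (suc k) (f (runFor x f k σ))

sem : Prog → Store → Store
sem nop           σ = σ
sem (a [ i ]:= e) σ = setCell a (eval σ i) (eval σ e) σ
sem (p ⨟ q)       σ = sem q (sem p σ)
sem (ifz e p q)   σ = caseZ (eval σ e) (sem p σ) (sem q σ)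
sem (for x c p)   σ = runFor x (sem p) (σ 0 c) σ

compile : Prog → Cmd
compile nop           = skip
compile (a [ i ]:= e) = a ⟦ i ⟧≔ e
compile (p ⨟ q)       = compile p ⨾ compile q
compile (ifz e p q)   = if e (compile q) (compile p)
compile (for x c p)   =
  (x ⟦ lit 0 ⟧≔ lit 0) ⨾
  while (0 ⟦ lit c ⟧ ⊖ $$ x) (compile p ⨾ (x ⟦ lit 0 ⟧≔ $$ x ⊕ lit 1))

writes : Prog → ℕ → Bool
writes nop           b = false
writes (a [ i ]:= e) b = a ≡ᵇ b
writes (p ⨟ q)       b = writes p b ∨ writes q b
writes (ifz e p q)   b = writes p b ∨ writes q b
writes (for x c p)   b = (x ≡ᵇ b) ∨ writes p b

-- The value of a bounded expression is at most 8 or at most a value in the store.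
bounded : Exp → Bool
bounded (lit k)        = k ≤ᵇ 8
bounded (a ⟦ i ⟧)      = true
bounded (op add e f)   = false
bounded (op mul e f)   = false
bounded (op monus e f) = bounded e
bounded (op div e f)   = bounded e

-- Arrays 0 and 2 hold the input and constants derived from it.
writable : ℕ → Bool
writable a = (a ≡ᵇ 1) ∨ (3 ≤ᵇ a)

-- A program that passes keeps every cell within the bound it started with: it stores bounded values
-- only, leaves the input and the constants alone, and its loops run up to word 1 or word 2 of the
-- input, which are n and m.
ok : Prog → Bool
ok nop           = true
ok (a [ i ]:= e) = writable a ∧ bounded e
ok (p ⨟ q)       = ok p ∧ ok q
ok (ifz e p q)   = ok p ∧ ok q
ok (for x c p)   = (writable x ∧ ((c ≡ᵇ 1) ∨ (c ≡ᵇ 2))) ∧ (not (writes p x) ∧ ok p)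

∧-T : ∀ {a b} → T (a ∧ b) → T a × T b
∧-T {true} {true} _ = tt , tt

∨-F : ∀ {a b} → T (not (a ∨ b)) → T (not a) × T (not b)
∨-F {false} {false} _ = tt , tt

T-cases : ∀ {a b} → T (a ∨ b) → T a ⊎ T b
T-cases {true}  _ = inj₁ tt
T-cases {false} t = inj₂ t

setCell-other : ∀ a {b} i v σ → T (not (a ≡ᵇ b)) → setCell a i v σ b ≡ σ b
setCell-other a {b} i v σ t with a ≡ᵇ b
... | false = refl

≡ᵇ-refl : ∀ a → (a ≡ᵇ a) ≡ true
≡ᵇ-refl zero    = refl
≡ᵇ-refl (suc a) = ≡ᵇ-refl a

setCell-same : ∀ a i v σ → setCell a i v σ a i ≡ v
setCell-same a i v σ rewrite ≡ᵇ-refl a | ≡ᵇ-refl i = refl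

-- For a concrete program and a concrete array the hypothesis computes to the unit type, so nearly
-- all uses are discharged by `tt`.
frame : ∀ p σ b → T (not (writes p b)) → sem p σ b ≡ σ b
frame-for : ∀ x p k σ b → T (not ((x ≡ᵇ b) ∨ writes p b)) → runFor x (sem p) k σ b ≡ σ b

frame nop           σ b t = refl
frame (a [ i ]:= e) σ b t = setCell-other a (eval σ i) (eval σ e) σ t
frame (p ⨟ q)       σ b t =
  trans (frame q (sem p σ) b (proj₂ (∨-F {writes p b} t))) (frame p σ b (proj₁ (∨-F {writes p b} t)))
frame (ifz e p q)   σ b t with eval σ e
... | zero  = frame p σ b (proj₁ (∨-F {writes p b} t))
... | suc _ = frame q σ b (proj₂ (∨-F {writes p b} t))
frame (for x c p)   σ b t = frame-for x p (σ 0 c) σ b t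

frame-for x p zero    σ b t = setCell-other x 0 0 σ (proj₁ (∨-F {x ≡ᵇ b} t))
frame-for x p (suc k) σ b t =
  trans (setCell-other x 0 (suc k) (sem p (runFor x (sem p) k σ)) (proj₁ (∨-F {x ≡ᵇ b} t)))
    (trans (frame p (runFor x (sem p) k σ) b (proj₂ (∨-F {x ≡ᵇ b} t)))
      (frame-for x p k σ b t))

counter : ∀ x f k σ → runFor x f k σ x 0 ≡ k
counter x f zero    σ = setCell-same x 0 0 σ
counter x f (suc k) σ = setCell-same x 0 (suc k) (f (runFor x f k σ))

-- The step receives the loop variable as an element of `Fin N`, hence as a vertex or an edge, and a
-- frame condition that compares the current store with the one before the loop. Invariants
-- therefore mention only arrays that the loop changes.
for-ind : ∀ x c p σ {N} → σ 0 c ≡ N → (P : ℕ → Store → Set) →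
          P 0 (setCell x 0 0 σ) →
          (∀ (k : Fin N) τ → τ x 0 ≡ toℕ k →
             (∀ b → T (not ((x ≡ᵇ b) ∨ writes p b)) → τ b ≡ σ b) →
             P (toℕ k) τ → P (suc (toℕ k)) (setCell x 0 (suc (toℕ k)) (sem p τ))) →
          P N (sem (for x c p) σ)
for-ind x c p σ refl P base step = go (σ 0 c) ≤-refl
  where
  go : ∀ k → k ≤ σ 0 c → P k (runFor x (sem p) k σ)
  go zero    _  = base
  go (suc k) lt = subst (λ j → P (suc j) (setCell x 0 (suc j) (sem p (runFor x (sem p) k σ)))) eq
      (step (fromℕ< lt) (runFor x (sem p) k σ) (trans (counter x (sem p) k σ) (sym eq))
            (λ b → frame-for x p k σ b)
            (subst (λ j → P j (runFor x (sem p) k σ)) (sym eq) (go k (<⇒≤ lt))))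
    where
    eq : toℕ (fromℕ< lt) ≡ k
    eq = Fin.toℕ-fromℕ< lt

-- Time and word size

-- An exponent for the word size: with all cells at most `Z`, the value of `e` is at most
-- `Z ^ width e`. An operation at most adds the exponents, and the additional factor `Z` pays for
-- the doubling in a sum.
width : Exp → ℕ
width (lit k)      = k
width (a ⟦ i ⟧)    = 1 + width i
width (op o e₁ e₂) = 1 + width e₁ + width e₂

span : Prog → ℕ
span nop           = 0
span (a [ i ]:= e) = width i + width e
span (p ⨟ q)       = span p + span q
span (ifz e p q)   = width e + (span p + span q)
span (for x c p)   = (5 + c) + span p

-- `X` bounds the number of rounds of every loop. In a loop, 3 is the cost of resetting the counter,
-- the two 6 in each round are the test and the increment, and the last 6 is the test that fails.
time : ℕ → Prog → ℕ
time X nop           = 1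
time X (a [ i ]:= e) = 1 + cost i + cost e
time X (p ⨟ q)       = time X p + time X q
time X (ifz e p q)   = 1 + cost e + (time X p + time X q)
time X (for x c p)   = 3 + (X * (6 + (time X p + 6)) + 6)

coef : Prog → ℕ
coef nop           = 1
coef (a [ i ]:= e) = 1 + cost i + cost e
coef (p ⨟ q)       = coef p + coef q
coef (ifz e p q)   = 1 + cost e + (coef p + coef q)
coef (for x c p)   = coef p + 21

depth : Prog → ℕ
depth nop           = 0
depth (a [ i ]:= e) = 0
depth (p ⨟ q)       = depth p ⊔ depth q
depth (ifz e p q)   = depth p ⊔ depth q
depth (for x c p)   = suc (depth p)

^-pos : ∀ {x} k → 1 ≤ x → 1 ≤ x ^ k
^-pos zero    h = ≤-refl
^-pos (suc k) h = *-mono-≤ h (^-pos k h)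

^-mono : ∀ {x j k} → 1 ≤ x → j ≤ k → x ^ j ≤ x ^ k
^-mono {suc x} _ h = ^-monoʳ-≤ (suc x) h

private
  plus-poly : ∀ {X} → 1 ≤ X → ∀ a b j k {s t} → s ≤ a * X ^ j → t ≤ b * X ^ k →
              s + t ≤ (a + b) * X ^ (j ⊔ k)
  plus-poly {X} h a b j k {s} {t} p q = begin
    s + t                                ≤⟨ +-mono-≤ p q ⟩
    a * X ^ j + b * X ^ k                ≤⟨ +-mono-≤ (*-monoʳ-≤ a (^-mono h (m≤m⊔n j k))) (*-monoʳ-≤ b (^-mono h (m≤n⊔m j k))) ⟩
    a * X ^ (j ⊔ k) + b * X ^ (j ⊔ k)    ≡⟨ sym (*-distribʳ-+ (X ^ (j ⊔ k)) a b) ⟩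
    (a + b) * X ^ (j ⊔ k)                ∎
    where open ≤-Reasoning

  const-poly : ∀ {X} → 1 ≤ X → ∀ a k → a ≤ a * X ^ k
  const-poly h a k = ≤-trans (≤-reflexive (sym (*-identityʳ a))) (*-monoʳ-≤ a (^-pos k h))

time-poly : ∀ {X} → 1 ≤ X → ∀ p → time X p ≤ coef p * X ^ depth p
time-poly h nop           = ≤-refl
time-poly h (a [ i ]:= e) = ≤-reflexive (sym (*-identityʳ (1 + cost i + cost e)))
time-poly h (p ⨟ q)       = plus-poly h (coef p) (coef q) (depth p) (depth q) (time-poly h p) (time-poly h q)
time-poly {X} h (ifz e p q)   =
  plus-poly h (1 + cost e) (coef p + coef q) 0 (depth p ⊔ depth q) (≤-reflexive (sym (*-identityʳ (1 + cost e))))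
    (plus-poly h (coef p) (coef q) (depth p) (depth q) (time-poly h p) (time-poly h q))
-- Besides its body, a round costs 12, and the loop as a whole costs another 9; together these are
-- the 21 in `coef`.
time-poly {X} h (for x c p) = begin
  3 + (X * (6 + (time X p + 6)) + 6)  ≡⟨ solve 2 (λ u v → con 3 :+ (u :* (con 6 :+ (v :+ con 6)) :+ con 6) := u :* v :+ (con 12 :* u :+ con 9)) refl X (time X p) ⟩
  X * time X p + (12 * X + 9)         ≤⟨ +-mono-≤ (*-monoʳ-≤ X (time-poly h p)) (+-mono-≤ (*-monoʳ-≤ 12 (≤-trans (≤-reflexive (sym (*-identityʳ X))) (*-monoʳ-≤ X (^-pos (depth p) h)))) (const-poly h 9 (suc (depth p)))) ⟩
  X * (coef p * Y) + (12 * (X * Y) + 9 * (X * Y)) ≡⟨ solve 3 (λ u v w → u :* (v :* w) :+ (con 12 :* (u :* w) :+ con 9 :* (u :* w)) := (v :+ con 21) :* (u :* w)) refl X (coef p) Y ⟩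
  (coef p + 21) * (X * Y) ∎
  where
  open ≤-Reasoning
  open +-*-Solver
  Y = X ^ depth p

-- The guard evaluates to the number of rounds left, so its value yields both its truth in each
-- round and the end of the loop.
whileFor : ∀ {B e c} (s : ℕ → Store) N T →
  (∀ k → k ≤ N → Fits B (s k) e) → (∀ k → k ≤ N → eval (s k) e ≡ N ∸ k) →
  (∀ k → k < N → ∃[ t ] Exec B c (s k) (s (suc k)) t × t ≤ T) →
  ∀ j k → j + k ≡ N → ∃[ t ] Exec B (while e c) (s k) (s N) t × t ≤ j * (1 + cost e + T) + (1 + cost e)
whileFor s N T fit val body zero    k refl = _ , while-false (fit N ≤-refl) (trans (val N ≤-refl) (n∸n≡0 N)) , ≤-refl
whileFor {e = e} s N T fit val body (suc j) k eq =
  let k<N = ≤-trans (m≤n+m (suc k) j) (≤-reflexive (trans (+-suc j k) eq))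
      (t₁ , r₁ , b₁) = body k k<N
      (t₂ , r₂ , b₂) = whileFor s N T fit val body j (suc k) (trans (+-suc j k) eq)
  in  _ , while-true (fit k (<⇒≤ k<N)) (λ z → m>n⇒m∸n≢0 k<N (trans (sym (val k (<⇒≤ k<N))) z)) r₁ r₂ ,
      (begin
        1 + cost e + t₁ + t₂ ≤⟨ +-mono-≤ (+-monoʳ-≤ (1 + cost e) b₁) b₂ ⟩
        1 + cost e + T + (j * (1 + cost e + T) + (1 + cost e)) ≡⟨ sym (+-assoc (1 + cost e + T) _ _) ⟩
        suc j * (1 + cost e + T) + (1 + cost e) ∎)
  where open ≤-Reasoning

n≤b^n : ∀ {b} → 2 ≤ b → ∀ n → n ≤ b ^ n
n≤b^n h zero    = z≤n
n≤b^n {b} h (suc n) = begin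
  1 + n           ≤⟨ +-mono-≤ (^-pos n (<⇒≤ h)) (n≤b^n h n) ⟩
  b ^ n + b ^ n   ≡⟨ cong (b ^ n +_) (sym (+-identityʳ (b ^ n))) ⟩
  2 * b ^ n       ≤⟨ *-monoˡ-≤ (b ^ n) h ⟩
  b * b ^ n       ∎
  where open ≤-Reasoning

-- There are two scales: `Z` limits the words and thereby the word size, `X` limits the loop counts
-- and thereby the time.
record Small (Z X : ℕ) (σ : Store) : Set where
  constructor small
  field
    cells : ∀ a i → σ a i ≤ Z
    size₁ : σ 0 1 ≤ X
    size₂ : σ 0 2 ≤ X
open Small

module Execution {B Z X : ℕ} (8≤Z : 8 ≤ Z) where

  private
    2≤Z : 2 ≤ Z
    2≤Z = ≤-trans (s≤s (s≤s z≤n)) 8≤Z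
    1≤Z : 1 ≤ Z
    1≤Z = <⇒≤ 2≤Z

  eval≤ : ∀ {σ} → (∀ a i → σ a i ≤ Z) → ∀ e → eval σ e ≤ Z ^ width e
  apply≤ : ∀ o {x y a b} → x ≤ Z ^ a → y ≤ Z ^ b → apply o x y ≤ Z ^ (1 + a + b)
  eval≤ s (lit k)      = n≤b^n 2≤Z k
  eval≤ {σ} s (a ⟦ i ⟧) = ≤-trans (s a (eval σ i)) (≤-trans (≤-reflexive (sym (*-identityʳ Z))) (*-monoʳ-≤ Z (^-pos (width i) 1≤Z)))
  eval≤ s (op o e₁ e₂) = apply≤ o {a = width e₁} {width e₂} (eval≤ s e₁) (eval≤ s e₂)
  apply≤ add {x} {y} {a} {b} p q = begin
    x + y                   ≤⟨ +-mono-≤ (≤-trans p (^-mono 1≤Z (m≤m+n a b))) (≤-trans q (^-mono 1≤Z (m≤n+m b a))) ⟩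
    Z ^ (a + b) + Z ^ (a + b) ≡⟨ cong (Z ^ (a + b) +_) (sym (+-identityʳ _)) ⟩
    2 * Z ^ (a + b)         ≤⟨ *-monoˡ-≤ (Z ^ (a + b)) 2≤Z ⟩
    Z * Z ^ (a + b)         ∎
    where open ≤-Reasoning
  apply≤ mul {x} {y} {a} {b} p q =
    ≤-trans (*-mono-≤ p q) (≤-trans (≤-reflexive (sym (^-distribˡ-+-* Z a b))) (^-mono 1≤Z (n≤1+n (a + b))))
  apply≤ monus {x} {y} {a} {b} p q = ≤-trans (m∸n≤m x y) (≤-trans p (^-mono 1≤Z (m≤n⇒m≤1+n (m≤m+n a b))))
  apply≤ div {y = zero} p q = z≤n
  apply≤ div {x} {suc y} {a} {b} p q = ≤-trans (m/n≤m x (suc y)) (≤-trans p (^-mono 1≤Z (m≤n⇒m≤1+n (m≤m+n a b))))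

  fits : ∀ {σ} → (∀ a i → σ a i ≤ Z) → ∀ e → Z ^ width e ≤ B → Fits B σ e
  fits s (lit k)      h = ≤-trans (n≤b^n 2≤Z k) h
  fits s (a ⟦ i ⟧)    h = fits s i (≤-trans (^-mono 1≤Z (n≤1+n (width i))) h) , ≤-trans (eval≤ s (a ⟦ i ⟧)) h
  fits s (op o e₁ e₂) h =
    fits s e₁ (≤-trans (^-mono 1≤Z (m≤n⇒m≤1+n (m≤m+n (width e₁) (width e₂)))) h) ,
    fits s e₂ (≤-trans (^-mono 1≤Z (m≤n⇒m≤1+n (m≤n+m (width e₂) (width e₁)))) h) ,
    ≤-trans (eval≤ s (op o e₁ e₂)) h

  bounded≤ : ∀ {σ} → (∀ a i → σ a i ≤ Z) → ∀ e → T (bounded e) → eval σ e ≤ Z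
  bounded≤ s (lit k)        t = ≤-trans (≤ᵇ⇒≤ k 8 t) 8≤Z
  bounded≤ {σ} s (a ⟦ i ⟧)  t = s a (eval σ i)
  bounded≤ {σ} s (op monus e f) t = ≤-trans (m∸n≤m (eval σ e) (eval σ f)) (bounded≤ s e t)
  bounded≤ {σ} s (op div e f) t = ≤-trans (div≤ (eval σ e) (eval σ f)) (bounded≤ s e t)
    where
    div≤ : ∀ x y → apply div x y ≤ x
    div≤ x zero    = z≤n
    div≤ x (suc y) = m/n≤m x (suc y)

  small-setCell : ∀ {σ} → Small Z X σ → ∀ a i v → T (writable a) → v ≤ Z → Small Z X (setCell a i v σ)
  small-setCell {σ} s a i v w v≤ = small cells′ (subst (_≤ X) (sym (eq₀ 1)) (size₁ s)) (subst (_≤ X) (sym (eq₀ 2)) (size₂ s))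
    where
    eq₀ : ∀ j → setCell a i v σ 0 j ≡ σ 0 j
    eq₀ j = readonly a w j
      where
      readonly : ∀ a → T (writable a) → ∀ j → setCell a i v σ 0 j ≡ σ 0 j
      readonly (suc a) _ j = refl
    cells′ : ∀ b j → setCell a i v σ b j ≤ Z
    cells′ b j with a ≡ᵇ b
    ... | false = cells s b j
    ... | true with i ≡ᵇ j
    ... | true  = v≤
    ... | false = cells s a j

  -- Execution, time and the bound on the cells are proved in one induction, because each step fits
  -- into words only by the bound that the preceding steps have preserved.
  exec : ∀ p → T (ok p) → Z ^ span p ≤ B → ∀ {σ} → Small Z X σ →
         ∃[ t ] Exec B (compile p) σ (sem p σ) t × t ≤ time X p × Small Z X (sem p σ)
  exec nop t h s = _ , skip , ≤-refl , s
  exec (a [ i ]:= e) t h {σ} s =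
    _ , assign (fits (cells s) i (≤-trans (^-mono 1≤Z (m≤m+n (width i) (width e))) h))
               (fits (cells s) e (≤-trans (^-mono 1≤Z (m≤n+m (width e) (width i))) h)) ,
    ≤-refl , small-setCell s a (eval σ i) (eval σ e) (proj₁ (∧-T {writable a} t)) (bounded≤ (cells s) e (proj₂ (∧-T {writable a} t)))
  exec (p ⨟ q) t h s =
    let (t₁ , r₁ , b₁ , s₁) = exec p (proj₁ (∧-T {ok p} t)) (≤-trans (^-mono 1≤Z (m≤m+n (span p) (span q))) h) s
        (t₂ , r₂ , b₂ , s₂) = exec q (proj₂ (∧-T {ok p} t)) (≤-trans (^-mono 1≤Z (m≤n+m (span q) (span p))) h) s₁
    in  _ , seq r₁ r₂ , +-mono-≤ b₁ b₂ , s₂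
  exec (ifz e p q) t h {σ} s with eval σ e in eq
  ... | zero =
    let (t₁ , r₁ , b₁ , s₁) = exec p (proj₁ (∧-T {ok p} t)) (≤-trans (^-mono 1≤Z (≤-trans (m≤m+n (span p) (span q)) (m≤n+m _ (width e)))) h) s
    in  _ , if-false (fits (cells s) e (≤-trans (^-mono 1≤Z (m≤m+n (width e) _)) h)) eq r₁ ,
        +-monoʳ-≤ (1 + cost e) (≤-trans b₁ (m≤m+n _ _)) , s₁
  ... | suc _ =
    let (t₁ , r₁ , b₁ , s₁) = exec q (proj₂ (∧-T {ok p} t)) (≤-trans (^-mono 1≤Z (≤-trans (m≤n+m (span q) (span p)) (m≤n+m _ (width e)))) h) s
    in  _ , if-true (fits (cells s) e (≤-trans (^-mono 1≤Z (m≤m+n (width e) _)) h)) (λ z → case trans (sym eq) z of λ ()) r₁ ,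
        +-monoʳ-≤ (1 + cost e) (≤-trans b₁ (m≤n+m _ _)) , s₁
  exec (for x c p) t h {σ} s =
    let (tw , rw , bw) = whileFor {B} {guard} {body} st N (time X p + 6) fit val run N 0 (+-identityʳ N)
    in  _ , seq (assign z≤n z≤n) rw ,
        +-monoʳ-≤ 3 (≤-trans bw (+-monoˡ-≤ 6 (*-monoˡ-≤ (6 + (time X p + 6)) N≤X))) , proj₂ (inv N ≤-refl)
    where
    guard = 0 ⟦ lit c ⟧ ⊖ $$ x
    body  = compile p ⨾ (x ⟦ lit 0 ⟧≔ $$ x ⊕ lit 1)
    N  = σ 0 c
    st = λ k → runFor x (sem p) k σ
    t₁ = ∧-T {writable x ∧ ((c ≡ᵇ 1) ∨ (c ≡ᵇ 2))} t
    wx = proj₁ (∧-T {writable x} (proj₁ t₁))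
    cc = proj₂ (∧-T {writable x} (proj₁ t₁))
    nw = proj₁ (∧-T {not (writes p x)} (proj₂ t₁))
    okp = proj₂ (∧-T {not (writes p x)} (proj₂ t₁))
    hp : Z ^ span p ≤ B
    hp = ≤-trans (^-mono 1≤Z (m≤n+m (span p) (5 + c))) h
    N≤X : N ≤ X
    N≤X with T-cases {c ≡ᵇ 1} cc
    ... | inj₁ e = subst (λ j → σ 0 j ≤ X) (sym (≡ᵇ⇒≡ c 1 e)) (size₁ s)
    ... | inj₂ e = subst (λ j → σ 0 j ≤ X) (sym (≡ᵇ⇒≡ c 2 e)) (size₂ s)
    inv : ∀ k → k ≤ N → Unit × Small Z X (st k)
    run : ∀ k → k < N → ∃[ u ] Exec B body (st k) (st (suc k)) u × u ≤ time X p + 6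
    step : ∀ k → k < N → Small Z X (st k) →
           (∃[ u ] Exec B body (st k) (st (suc k)) u × u ≤ time X p + 6) × Small Z X (st (suc k))
    -- The limit of the loop is read from the input in every test. It is still `N`, since a program
    -- that passes `ok` never writes to array 0.
    same : ∀ k → st k 0 c ≡ σ 0 c
    same k = same′ x wx k
      where
      same′ : ∀ x → T (writable x) → ∀ k → runFor x (sem p) k σ 0 c ≡ σ 0 c
      same′ (suc x) w zero    = refl
      same′ (suc x) w (suc k) = trans (cong (λ f → f c) (frame p (runFor (suc x) (sem p) k σ) 0 (ro p okp))) (same′ (suc x) w k)
        where
        ∨-FF : ∀ {a b} → T (not a) → T (not b) → T (not (a ∨ b))
        ∨-FF {false} {false} _ _ = tt
        ro : ∀ p → T (ok p) → T (not (writes p 0))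
        ro nop _ = tt
        ro (suc a [ i ]:= e) _ = tt
        ro (p ⨟ q) o = ∨-FF {writes p 0} (ro p (proj₁ (∧-T {ok p} o))) (ro q (proj₂ (∧-T {ok p} o)))
        ro (ifz e p q) o = ∨-FF {writes p 0} (ro p (proj₁ (∧-T {ok p} o))) (ro q (proj₂ (∧-T {ok p} o)))
        ro (for (suc x) c p) o = ro p (proj₂ (∧-T {not (writes p (suc x))} (proj₂ (∧-T {writable (suc x) ∧ ((c ≡ᵇ 1) ∨ (c ≡ᵇ 2))} o))))
    step k k<N sk with exec p okp hp sk
    ... | (u , r , b , s′) =
      (_ , seq r (subst (λ v → Exec B (x ⟦ lit 0 ⟧≔ $$ x ⊕ lit 1) ρ (setCell x 0 v ρ) 6) e₂
                   (assign {a = x} {lit 0} {$$ x ⊕ lit 1} (≤-trans z≤n 1≤B) (fits (cells s′) ($$ x ⊕ lit 1) (≤-trans (^-mono 1≤Z (≤-trans (s≤s (s≤s (s≤s (z≤n {2 + c})))) (m≤m+n (5 + c) (span p)))) h)))) ,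
       +-monoˡ-≤ 6 b) ,
      small-setCell s′ x 0 (suc k) wx (≤-trans k<N (cells s 0 c))
      where
      ρ = sem p (st k)
      1≤B : 1 ≤ B
      1≤B = ≤-trans (^-pos (span (for x c p)) 1≤Z) h
      e₂ : ρ x 0 + 1 ≡ suc k
      e₂ = trans (+-comm (ρ x 0) 1) (cong suc (trans (cong (λ f → f 0) (frame p (st k) x nw)) (counter x (sem p) k σ)))
    inv zero    _  = tt , small-setCell s x 0 0 wx z≤n
    inv (suc k) lt = tt , proj₂ (step k lt (proj₂ (inv k (<⇒≤ lt))))
    run k lt = proj₁ (step k lt (proj₂ (inv k (<⇒≤ lt))))
    fit : ∀ k → k ≤ N → Fits B (st k) guard
    fit k le = fits (cells (proj₂ (inv k le))) guard
      (≤-trans (^-mono 1≤Z (≤-trans (≤-reflexive (solve 1 (λ u → con 1 :+ (con 1 :+ u) :+ con 1 := con 3 :+ u) refl c)) (≤-trans (m≤n+m (3 + c) 2) (m≤m+n (5 + c) (span p))))) h)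
      where open +-*-Solver
    val : ∀ k → k ≤ N → eval (st k) guard ≡ N ∸ k
    val k le = cong₂ _∸_ (same k) (counter x (sem p) k σ)

-- Unfolding sem on a composite program duplicates the store in every loop.
abstract
  run : Prog → Store → Store
  run = sem

  run-sem : ∀ p σ → run p σ ≡ sem p σ
  run-sem p σ = refl

  run-seq : ∀ p q σ → run (p ⨟ q) σ ≡ run q (run p σ)
  run-seq p q σ = refl

  run-ifz : ∀ e p q σ → run (ifz e p q) σ ≡ caseZ (eval σ e) (run p σ) (run q σ)
  run-ifz e p q σ = refl

  run-frame : ∀ p σ b → T (not (writes p b)) → run p σ b ≡ σ b
  run-frame = frame

  for-run : ∀ x c p σ {N} → σ 0 c ≡ N → (P : ℕ → Store → Set) →
            P 0 (setCell x 0 0 σ) →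
            (∀ (k : Fin N) τ → τ x 0 ≡ toℕ k →
               (∀ b → T (not ((x ≡ᵇ b) ∨ writes p b)) → τ b ≡ σ b) →
               P (toℕ k) τ → P (suc (toℕ k)) (setCell x 0 (suc (toℕ k)) (run p τ))) →
            P N (run (for x c p) σ)
  for-run = for-ind

leaf : ∀ p σ A {f} → sem p σ A ≡ f → run p σ A ≡ f
leaf p σ A = trans (cong (λ τ → τ A) (run-sem p σ))

run-seq₂ : ∀ {p q σ τ} → run p σ ≡ τ → run (p ⨟ q) σ ≡ run q τ
run-seq₂ {p} {q} {σ} refl = run-seq p q σ

-- Walks

unique-length : ∀ {n} {xs : List (Fin n)} → Unique xs → length xs ≤ n
unique-length {n} {xs} u = Fin.injective⇒≤ {f = Data.List.Base.lookup xs} (λ {i} {j} → inj u i j)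
  where
  import Data.List.Base
  open import Data.List.Membership.Propositional.Properties using (∈-lookup)
  inj : ∀ {xs : List (Fin n)} → Unique xs → ∀ i j → Data.List.Base.lookup xs i ≡ Data.List.Base.lookup xs j → i ≡ j
  inj (_ ∷ _)  Fin.zero    Fin.zero    _  = refl
  inj (a ∷ _)  Fin.zero    (Fin.suc j) eq = ⊥-elim (All.lookup a (∈-lookup j) eq)
  inj (a ∷ _)  (Fin.suc i) Fin.zero    eq = ⊥-elim (All.lookup a (∈-lookup i) (sym eq))
  inj (_ ∷ us) (Fin.suc i) (Fin.suc j) eq = cong Fin.suc (inj us i j eq)

module Walks {n m} (G : Graph n m) where

  open Graph G public
  open DecMembership (Fin._≟_ {n}) using (_∈?_) public

  -- Costs may depend on the direction of traversal, since the reduced lengths used later are not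
  -- symmetric.
  Cost : Set
  Cost = Fin m → Fin n → Fin n → ℕ

  κ : Cost → ∀ {u v} → Walk u v → ℕ
  κ c stop                     = 0
  κ c (step {u} {v} e _ p) = c e u v + κ c p

  joins-sym : ∀ {e u v} → Joins e u v → Joins e v u
  joins-sym (inj₁ (p , q)) = inj₂ (p , q)
  joins-sym (inj₂ (p , q)) = inj₁ (p , q)

  joins-≢ : ∀ {e u v} → Joins e u v → u ≢ v
  joins-≢ {e} (inj₁ (refl , q)) refl = <-irrefl (cong toℕ (sym q)) (lo<hi e)
  joins-≢ {e} (inj₂ (refl , q)) refl = <-irrefl (cong toℕ (sym q)) (lo<hi e)

  joins-ends : ∀ {e u v u′ v′} → Joins e u v → Joins e u′ v′ → (u ≡ u′ × v ≡ v′) ⊎ (u ≡ v′ × v ≡ u′)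
  joins-ends (inj₁ (refl , refl)) (inj₁ (refl , refl)) = inj₁ (refl , refl)
  joins-ends (inj₁ (refl , refl)) (inj₂ (refl , refl)) = inj₂ (refl , refl)
  joins-ends (inj₂ (refl , refl)) (inj₁ (refl , refl)) = inj₂ (refl , refl)
  joins-ends (inj₂ (refl , refl)) (inj₂ (refl , refl)) = inj₁ (refl , refl)

  joins-unique : ∀ {e f u v} → Joins e u v → Joins f u v → e ≡ f
  joins-unique (inj₁ (refl , refl)) (inj₁ (p , q)) = simple (sym p) (sym q)
  joins-unique (inj₂ (refl , refl)) (inj₂ (p , q)) = simple (sym p) (sym q)
  joins-unique {e} {f} (inj₁ (refl , refl)) (inj₂ (p , q)) =
    ⊥-elim (<-asym (lo<hi e) (subst₂ (λ x y → toℕ x < toℕ y) p q (lo<hi f)))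
  joins-unique {e} {f} (inj₂ (refl , refl)) (inj₁ (p , q)) =
    ⊥-elim (<-asym (lo<hi e) (subst₂ (λ x y → toℕ x < toℕ y) p q (lo<hi f)))

  first∈ : ∀ {u v} (p : Walk u v) → u ∈ˡ vertices p
  first∈ stop         = here refl
  first∈ (step _ _ _) = here refl

  last∈ : ∀ {u v} (p : Walk u v) → v ∈ˡ vertices p
  last∈ stop         = here refl
  last∈ (step _ _ p) = there (last∈ p)

  length-vertices : ∀ {u v} (p : Walk u v) → length (vertices p) ≡ suc (length (edges p))
  length-vertices stop         = refl
  length-vertices (step _ _ p) = cong suc (length-vertices p)

  path-length : ∀ {u v} (p : Walk u v) → IsPath p → length (edges p) < n
  path-length p u = subst (_≤ n) (length-vertices p) (unique-length u)

  -- The relation between a walk and what is left of it after cutting out pieces. The comparison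
  -- holds for all costs at once, so that one erased walk serves for the length, the reduced length
  -- and the number of nontree arcs.
  record _≼_ {z a y b} (A : Walk y b) (B : Walk z a) : Set where
    field
      ≼-vertices : ∀ {r} → r ∈ˡ vertices A → r ∈ˡ vertices B
      ≼-edges    : ∀ {f} → f ∈ˡ edges A → f ∈ˡ edges B
      ≼-cost     : ∀ c → κ c A ≤ κ c B
  open _≼_ public

  suffix : ∀ {z a y} (A : Walk z a) → y ∈ˡ vertices A → Σ[ B ∈ Walk y a ] B ≼ A × (IsPath A → IsPath B)
  suffix stop         (here refl) = stop , record { ≼-vertices = id ; ≼-edges = id ; ≼-cost = λ _ → ≤-refl } , id
  suffix (step e j A) (here refl) = step e j A , record { ≼-vertices = id ; ≼-edges = id ; ≼-cost = λ _ → ≤-refl } , id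
  suffix (step e j A) (there i) with suffix A i
  ... | B , s , u = B , record { ≼-vertices = there ∘ ≼-vertices s ; ≼-edges = there ∘ ≼-edges s
                               ; ≼-cost = λ c → ≤-trans (≼-cost s c) (m≤n+m _ _) } , λ { (_ ∷ us) → u us }

  erase : ∀ {z a} (A : Walk z a) → Σ[ B ∈ Walk z a ] B ≼ A × IsPath B
  erase stop = stop , record { ≼-vertices = id ; ≼-edges = id ; ≼-cost = λ _ → ≤-refl } , [] ∷ []
  erase (step {u} {v} e j A) with erase A
  ... | B , s , p with u ∈? vertices B
  ... | no ∉B = step e j B ,
    record { ≼-vertices = λ { (here q) → here q ; (there i) → there (≼-vertices s i) }
           ; ≼-edges = λ { (here q) → here q ; (there i) → there (≼-edges s i) }
           ; ≼-cost = λ c → +-monoʳ-≤ (c e u v) (≼-cost s c) } ,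
    All.tabulate (λ {r} i q → ∉B (subst (_∈ˡ vertices B) (sym q) i)) ∷ p
  ... | yes ∈B with suffix B ∈B
  ... | C , t , q = C ,
    record { ≼-vertices = there ∘ ≼-vertices s ∘ ≼-vertices t ; ≼-edges = there ∘ ≼-edges s ∘ ≼-edges t
           ; ≼-cost = λ c → ≤-trans (≼-cost t c) (≤-trans (≼-cost s c) (m≤n+m _ _)) } , q p

  ⊑-≼ : ∀ {z a y b F} {A : Walk y b} {B : Walk z a} → A ≼ B → B ⊑ F → A ⊑ F
  ⊑-≼ s h = All.tabulate (λ i → All.lookup h (≼-edges s i))

  Disjoint : ∀ {x a z b} → Walk x a → Walk z b → Set
  Disjoint A B = ∀ {r} → r ∈ˡ vertices A → r ∈ˡ vertices B → ⊥

  -- Joins two walks with a common start, reversing the first one. Walks to the ends of an edge are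
  -- always kept with their start at that edge, so this is how they are assembled to a path.
  revOnto : ∀ {x a c} → Walk x a → Walk x c → Walk a c
  revOnto stop         B = B
  revOnto (step e j A) B = revOnto A (step e (joins-sym j) B)

  revOnto-path : ∀ {x a c} (A : Walk x a) (B : Walk x c) → IsPath A → IsPath B →
                 (∀ {r} → r ∈ˡ vertices A → r ∈ˡ vertices B → r ≡ x) → IsPath (revOnto A B)
  revOnto-path stop B _ q _ = q
  revOnto-path (step {u} {v} e j A) B (a ∷ p) q h =
    revOnto-path A (step e (joins-sym j) B) p
      (All.tabulate (λ {r} i eq → All.lookup a (first∈ A) (sym (h (there (first∈ A)) (subst (_∈ˡ vertices B) (sym eq) i)))) ∷ q)
      λ { i (here eq) → eq ; i (there k) → ⊥-elim (All.lookup a i (sym (h (there i) k))) }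

  revOnto-edges : ∀ {x a c f} (A : Walk x a) (B : Walk x c) → f ∈ˡ edges B → f ∈ˡ edges (revOnto A B)
  revOnto-edges stop         B i = i
  revOnto-edges (step e j A) B i = revOnto-edges A _ (there i)

  module Lengths (ℓ : Fin m → ℕ) where

    len : ∀ {u v} → Walk u v → ℕ
    len p = sum (map ℓ (edges p))

    len-κ : ∀ {u v} (p : Walk u v) → len p ≡ κ (λ e _ _ → ℓ e) p
    len-κ stop         = refl
    len-κ (step e _ p) = cong (ℓ e +_) (len-κ p)

    len-≼ : ∀ {z a y b} {A : Walk y b} {B : Walk z a} → A ≼ B → len A ≤ len B
    len-≼ {A = A} {B} s = subst₂ _≤_ (sym (len-κ A)) (sym (len-κ B)) (≼-cost s _)

    revOnto-len : ∀ {x a c} (A : Walk x a) (B : Walk x c) → len (revOnto A B) ≡ len A + len B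
    revOnto-len stop         B = refl
    revOnto-len (step e j A) B = trans (revOnto-len A _)
      (trans (sym (+-assoc (len A) (ℓ e) (len B))) (cong (_+ len B) (+-comm (len A) (ℓ e))))

    -- `A` is the part of the path passed so far, already reversed, so that at `f` both parts run
    -- away from the edge. They are disjoint because the whole walk is a path.
    split : ∀ {u v a f} (A : Walk u a) (P : Walk u v) → IsPath P →
            (∀ {r} → r ∈ˡ vertices A → r ∈ˡ vertices P → r ≡ u) → f ∈ˡ edges P →
            ∃[ x ] ∃[ z ] Joins f x z × Σ[ X ∈ Walk x a ] Σ[ Z ∈ Walk z v ]
              Disjoint X Z × len X + ℓ f + len Z ≡ len A + len P
    split A (step {u} {v} e j P) (a ∷ p) h (here refl) =
      u , v , j , A , P , (λ i k → All.lookup a k (sym (h i (there k)))) , +-assoc (len A) (ℓ e) (len P)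
    split A (step {u} {v} e j P) (a ∷ p) h (there i)
      with split (step e (joins-sym j) A) P p (λ { (here eq) _ → eq ; (there k) l → ⊥-elim (All.lookup a l (sym (h k (there l)))) }) i
    ... | x , z , jf , X , Z , d , eq = x , z , jf , X , Z , d ,
      trans eq (trans (cong (_+ len P) (+-comm (ℓ e) (len A))) (+-assoc (len A) (ℓ e) (len P)))

-- Pairs of disjoint walks from two sources

module Forest {n m} (G : Graph n m) (s₁ s₂ : Fin n) (s₁≢s₂ : s₁ ≢ s₂)
  (par : Fin n → Fin n) (rank : Fin n → ℕ)
  (tree : ∀ z → z ≢ s₁ → z ≢ s₂ → ∃[ e ] Graph.Joins G e z (par z) × rank (par z) < rank z) where

  open Walks G

  Src : Fin n → Set
  Src z = z ≡ s₁ ⊎ z ≡ s₂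

  src? : ∀ z → Dec (Src z)
  src? z with z Fin.≟ s₁ | z Fin.≟ s₂
  ... | yes p | _     = yes (inj₁ p)
  ... | no _  | yes q = yes (inj₂ q)
  ... | no p  | no q  = no [ p , q ]′

  tree′ : ∀ {z} → ¬ Src z → ∃[ e ] Joins e z (par z) × rank (par z) < rank z
  tree′ {z} ns = tree z (ns ∘ inj₁) (ns ∘ inj₂)

  data Anc (w : Fin n) : Fin n → Set where
    here : Anc w w
    up   : ∀ {z} → ¬ Src z → Anc w (par z) → Anc w z

  anc-trans : ∀ {x y z} → Anc x y → Anc y z → Anc x z
  anc-trans p here      = p
  anc-trans p (up ns q) = up ns (anc-trans p q)

  anc-linear : ∀ {w w′ x} → Anc w x → Anc w′ x → Anc w w′ ⊎ Anc w′ w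
  anc-linear here     q        = inj₂ q
  anc-linear p        here     = inj₁ p
  anc-linear (up _ p) (up _ q) = anc-linear p q

  anc-rank : ∀ {w z} → Anc w z → w ≡ z ⊎ rank w < rank z
  anc-rank here = inj₁ refl
  anc-rank (up ns p) with anc-rank p | tree′ ns
  ... | inj₁ refl | _ , _ , lt = inj₂ lt
  ... | inj₂ lt′  | _ , _ , lt = inj₂ (<-trans lt′ lt)

  anc-antisym : ∀ {w z} → Anc w z → Anc z w → w ≡ z
  anc-antisym p q with anc-rank p | anc-rank q
  ... | inj₁ eq | _       = eq
  ... | inj₂ _  | inj₁ eq = sym eq
  ... | inj₂ a  | inj₂ b  = ⊥-elim (<-asym a b)

  anc? : ∀ w z → Dec (Anc w z)
  anc? w z = go z (<-wellFounded (rank z))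
    where
    go : ∀ z → Acc _<_ (rank z) → Dec (Anc w z)
    go z (acc rs) with w Fin.≟ z | src? z
    ... | yes refl | _ = yes here
    ... | no w≢z | yes s = no λ { here → w≢z refl ; (up ns _) → ns s }
    ... | no w≢z | no ns with go (par z) (rs (proj₂ (proj₂ (tree′ ns))))
    ... | yes p = yes (up ns p)
    ... | no ¬p = no λ { here → w≢z refl ; (up _ p) → ¬p p }

  root : ∀ z → ∃[ s ] Src s × Anc s z
  root z = go z (<-wellFounded (rank z))
    where
    go : ∀ z → Acc _<_ (rank z) → ∃[ s ] Src s × Anc s z
    go z (acc rs) with src? z
    ... | yes s = z , s , here
    ... | no ns with go (par z) (rs (proj₂ (proj₂ (tree′ ns))))
    ... | s , σ , p = s , σ , up ns p

  -- The vertices of the tree path between x and z below their nearest common ancestor.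
  Between : Fin n → Fin n → Fin n → Set
  Between x z w = (Anc w x × ¬ Anc w z) ⊎ (Anc w z × ¬ Anc w x)

  between-swap : ∀ {x z w} → Between x z w → Between z x w
  between-swap = [ inj₂ , inj₁ ]′

  between? : ∀ x z w → Dec (Between x z w)
  between? x z w with anc? w x | anc? w z
  ... | yes p | no q  = yes (inj₁ (p , q))
  ... | no p  | yes q = yes (inj₂ (q , p))
  ... | yes p | yes q = no λ { (inj₁ (_ , r)) → r q ; (inj₂ (_ , r)) → r p }
  ... | no p  | no q  = no λ { (inj₁ (r , _)) → p r ; (inj₂ (r , _)) → q r }

  below : ∀ {x z t y} → Between x z t → Anc y x → Anc y z → Anc y t
  below (inj₁ (p , q)) u v = [ id , (λ w → ⊥-elim (q (anc-trans w v))) ]′ (anc-linear u p)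
  below (inj₂ (p , q)) u v = [ id , (λ w → ⊥-elim (q (anc-trans w u))) ]′ (anc-linear v p)

  -- `t` lies on the root path of one of the two vertices, and so does its ancestor `y`. If `y` is
  -- not between them, it must lie on the other root path as well.
  above : ∀ {x z t y} → Between x z t → Anc y t → ¬ Between x z y → Anc y x × Anc y z
  above {x} {z} {t} {y} b p nb with anc? y x | anc? y z
  ... | yes u | yes v = u , v
  ... | yes u | no v  = ⊥-elim (nb (inj₁ (u , v)))
  ... | no u  | yes v = ⊥-elim (nb (inj₂ (v , u)))
  above (inj₁ (q , _)) p nb | no u | no v = ⊥-elim (u (anc-trans p q))
  above (inj₂ (q , _)) p nb | no u | no v = ⊥-elim (v (anc-trans p q))

  -- Reduced lengths have this property: going towards a source along the tree is free. All the
  -- exchange arguments below prolong walks by tree paths and rely on it.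
  Vanishing : Cost → Set
  Vanishing c = ∀ {e z} → ¬ Src z → Joins e z (par z) → c e z (par z) ≡ 0

  Sources : Fin n → Fin n → Set
  Sources a b = (a ≡ s₁ × b ≡ s₂) ⊎ (a ≡ s₂ × b ≡ s₁)

  sources-swap : ∀ {a b} → Sources a b → Sources b a
  sources-swap = [ (λ (p , q) → inj₂ (q , p)) , (λ (p , q) → inj₁ (q , p)) ]′

  sources-cover : ∀ {a b s} → Sources a b → Src s → s ≡ a ⊎ s ≡ b
  sources-cover (inj₁ (refl , refl)) = id
  sources-cover (inj₂ (refl , refl)) = [ inj₂ , inj₁ ]′

  sources-src : ∀ {a b} → Sources a b → Src a × Src b
  sources-src (inj₁ (p , q)) = inj₁ p , inj₂ q
  sources-src (inj₂ (p , q)) = inj₂ p , inj₁ q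

  sources-≢ : ∀ {a b} → Sources a b → a ≢ b
  sources-≢ (inj₁ (refl , refl)) eq = s₁≢s₂ eq
  sources-≢ (inj₂ (refl , refl)) eq = s₁≢s₂ (sym eq)

  src-pair : ∀ {a b} → Src a → Src b → a ≢ b → Sources a b
  src-pair (inj₁ refl) (inj₁ refl) ne = ⊥-elim (ne refl)
  src-pair (inj₁ p)    (inj₂ q)    ne = inj₁ (p , q)
  src-pair (inj₂ p)    (inj₁ q)    ne = inj₂ (p , q)
  src-pair (inj₂ refl) (inj₂ refl) ne = ⊥-elim (ne refl)

  -- `K` bounds all vanishing costs of the same two walks. Two of them matter: the reduced length,
  -- which is to be minimised, and the number of nontree arcs, on which an induction runs.
  Pair : (Cost → ℕ) → Fin n → Fin n → Set
  Pair K x z = ∃[ a ] ∃[ b ] Sources a b × Σ[ X ∈ Walk x a ] Σ[ Z ∈ Walk z b ]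
    Disjoint X Z × (∀ c → Vanishing c → κ c X + κ c Z ≤ K c)

  -- What the label of a vertex other than a source stands for in the scan. Adding an edge to a pair
  -- for its ends produces such walks at either end; how they in turn produce pairs for other edges
  -- is the content of `meet⇒pair`.
  Meet : (Cost → ℕ) → Fin n → Set
  Meet K w = ∃[ a ] ∃[ b ] Sources a b × Σ[ X ∈ Walk w a ] Σ[ Z ∈ Walk w b ]
    (∀ {r} → r ∈ˡ vertices X → r ∈ˡ vertices Z → r ≡ w) × (∀ c → Vanishing c → κ c X + κ c Z ≤ K c)

  pair-swap : ∀ {K x z} → Pair K x z → Pair K z x
  pair-swap {K} (a , b , s , X , Z , d , k) =
    b , a , sources-swap s , Z , X , (λ i j → d j i) , λ c v → subst (_≤ K c) (+-comm (κ c X) (κ c Z)) (k c v)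

  meet-step : ∀ {K x z e} → Joins e z x → Pair K x z → Meet (λ c → c e z x + K c) z
  meet-step {e = e} j (a , b , s , X , Z , d , k) =
    a , b , s , step e j X , Z , (λ { (here p) _ → p ; (there i) l → ⊥-elim (d i l) }) ,
    λ c v → ≤-trans (≤-reflexive (+-assoc _ (κ c X) (κ c Z))) (+-monoʳ-≤ _ (k c v))

  down : ∀ {y x a} → Anc y x → (A : Walk y a) → Σ[ B ∈ Walk x a ]
         (∀ {r} → r ∈ˡ vertices B → r ∈ˡ vertices A ⊎ (Anc y r × Anc r x)) × (∀ c → Vanishing c → κ c B ≤ κ c A)
  down here      A = A , inj₁ , λ _ _ → ≤-refl
  down (up ns p) A with down p A | tree′ ns
  ... | B , f , k | e , j , _ = step e j B ,
    (λ { (here refl) → inj₂ (up ns p , here)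
       ; (there i) → [ inj₁ , (λ (u , v) → inj₂ (u , up ns v)) ]′ (f i) }) ,
    λ c v → subst (λ t → t + κ c B ≤ κ c A) (sym (v ns j)) (k c v)

  -- A is prolonged along the tree path from the lowest ancestor y of t on A or B.
  Climb : ∀ {x z a b} → Walk x a → Walk z b → Fin n → Set
  Climb {a = a} A B t = ∃[ y ] y ∈ˡ vertices A × Anc y t
    × (∀ {r} → Anc r t → r ∈ˡ vertices A ⊎ r ∈ˡ vertices B → Anc r y)
    × Σ[ C ∈ Walk t a ]
        (∀ {r} → r ∈ˡ vertices C → r ∈ˡ vertices A ⊎ (Anc r t × ¬ r ∈ˡ vertices A × ¬ r ∈ˡ vertices B))
        × (∀ c → Vanishing c → κ c C ≤ κ c A)

  climb-up : ∀ {x z a b t} {A : Walk x a} {B : Walk z b} → ¬ Src t → ¬ t ∈ˡ vertices A → ¬ t ∈ˡ vertices B →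
             Climb A B (par t) → Climb A B t
  climb-up {A = A} ns ∉A ∉B (y , y∈ , p , low , C , f , k) with tree′ ns
  ... | e , j , _ = y , y∈ , up ns p ,
    (λ { here → [ ⊥-elim ∘ ∉A , ⊥-elim ∘ ∉B ]′ ; (up _ q) → low q }) ,
    step e j C ,
    (λ { (here refl) → inj₂ (here , ∉A , ∉B)
       ; (there i) → [ inj₁ , (λ (u , v) → inj₂ (up ns u , v)) ]′ (f i) }) ,
    λ c v → subst (λ t → t + κ c C ≤ κ c A) (sym (v ns j)) (k c v)

  -- The root path of `t` ends at a source, that is, at the end of `A` or of `B`, so some vertex of
  -- the two walks is met. The walk met first can be entered from `t` by vertices that lie on
  -- neither walk.
  climb : ∀ {x z a b} (A : Walk x a) (B : Walk z b) → Sources a b → ∀ t → Climb A B t ⊎ Climb B A t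
  climb {a = a} {b} A B s t = go t (<-wellFounded (rank t))
    where
    found : ∀ {x z a b t} (A : Walk x a) (B : Walk z b) → t ∈ˡ vertices A → Climb A B t
    found {t = t} A B i with suffix A i
    ... | C , sub , _ = t , i , here , (λ p _ → p) , C , inj₁ ∘ ≼-vertices sub , λ c _ → ≼-cost sub c
    go : ∀ t → Acc _<_ (rank t) → Climb A B t ⊎ Climb B A t
    go t (acc rs) with t ∈? vertices A | t ∈? vertices B
    ... | yes i | _     = inj₁ (found A B i)
    ... | no _  | yes i = inj₂ (found B A i)
    ... | no ∉A | no ∉B with src? t
    ... | yes σ = ⊥-elim ([ (λ { refl → ∉A (last∈ A) }) , (λ { refl → ∉B (last∈ B) }) ]′ (sources-cover s σ))
    ... | no ns with go (par t) (rs (proj₂ (proj₂ (tree′ ns))))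
    ... | inj₁ c = inj₁ (climb-up ns ∉A ∉B c)
    ... | inj₂ c = inj₂ (climb-up ns ∉B ∉A c)

  -- The last vertex of the walk in `R`, which is the first one seen from the source; from `next` on
  -- the walk avoids `R`. The end `a` is never the hit, hence there is an edge that leaves it.
  record Hit (R : Fin n → Set) {z a} (A : Walk z a) : Set where
    field
      {hit next} : Fin n
      edge    : Fin m
      joins   : Joins edge hit next
      rest    : Walk next a
      hit-R   : R hit
      avoids  : ∀ {r} → r ∈ˡ vertices rest → ¬ R r
      rest⊆   : ∀ {r} → r ∈ˡ vertices rest → r ∈ˡ vertices A
      hit∈    : hit ∈ˡ vertices A
      hit-κ   : ∀ c → κ c (step edge joins rest) ≤ κ c A
    whole : Walk hit a
    whole = step edge joins rest
  open Hit

  firstHit : ∀ {R : Fin n → Set} → (∀ r → Dec (R r)) → ∀ {z a} (A : Walk z a) → ¬ R a →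
             (∀ {r} → r ∈ˡ vertices A → ¬ R r) ⊎ Hit R A
  firstHit R? stop         na = inj₁ λ { (here refl) → na }
  firstHit R? (step {u} e j A) na with firstHit R? A na | R? u
  ... | inj₂ h  | _     = inj₂ (record
      { edge = edge h ; joins = joins h ; rest = rest h ; hit-R = hit-R h ; avoids = avoids h
      ; rest⊆ = there ∘ rest⊆ h ; hit∈ = there (hit∈ h) ; hit-κ = λ c → ≤-trans (hit-κ h c) (m≤n+m _ _) })
  ... | inj₁ av | yes r = inj₂ (record
      { edge = e ; joins = j ; rest = A ; hit-R = r ; avoids = av ; rest⊆ = there ; hit∈ = here refl ; hit-κ = λ c → ≤-refl })
  ... | inj₁ av | no nr = inj₁ λ { (here refl) → nr ; (there i) → av i }

  -- The source is an ancestor of one end only, so the two ends belong to different trees. Their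
  -- root paths are disjoint and free.
  tree-pair : ∀ {x z s} → Src s → Between x z s → Pair (λ _ → 0) x z
  tree-pair {x} {z} {s} σ (inj₁ (p , np)) with root z
  ... | s′ , σ′ , q with down p stop | down q stop
  ... | X , fX , kX | Z , fZ , kZ =
    s , s′ , src-pair σ σ′ (λ { refl → np q }) , X , Z ,
    (λ i l → np (anc-trans (anc-s fX i) (anc-z fZ l))) , λ c v → +-mono-≤ (kX c v) (kZ c v)
    where
    anc-s : ∀ {y x r} {B : List (Fin n)} → (∀ {r} → r ∈ˡ B → r ∈ˡ (y ∷ []) ⊎ (Anc y r × Anc r x)) → r ∈ˡ B → Anc y r
    anc-s f i with f i
    ... | inj₁ (here refl) = here
    ... | inj₂ (u , _)     = u
    anc-z : ∀ {r} {B : List (Fin n)} → (∀ {r} → r ∈ˡ B → r ∈ˡ (s′ ∷ []) ⊎ (Anc s′ r × Anc r z)) → r ∈ˡ B → Anc r z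
    anc-z f i with f i
    ... | inj₁ (here refl) = q
    ... | inj₂ (_ , u)     = u
  tree-pair {x} {z} σ (inj₂ b) = pair-swap {z = x} (tree-pair σ (inj₁ b))

  someSource? : ∀ x z → (∃[ s ] Src s × Between x z s) ⊎ (∀ {s} → Src s → ¬ Between x z s)
  someSource? x z with between? x z s₁ | between? x z s₂
  ... | yes p | _     = inj₁ (s₁ , inj₁ refl , p)
  ... | no _  | yes q = inj₁ (s₂ , inj₂ refl , q)
  ... | no p  | no q  = inj₂ λ { (inj₁ refl) → p ; (inj₂ refl) → q }

  module _ {x z a b p q : Fin n} {A : Walk p a} {B : Walk q b} where

    downHit : (h : Hit (Between x z) A) → Anc (hit h) x → ¬ Anc (hit h) z → Σ[ X ∈ Walk x a ]
              (∀ {r} → r ∈ˡ vertices X → r ∈ˡ vertices (rest h) ⊎ (Anc r x × ¬ Anc r z))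
              × (∀ c → Vanishing c → κ c X ≤ κ c A)
    downHit h p np with down p (whole h)
    ... | X , f , k = X , g , λ c v → ≤-trans (k c v) (hit-κ h c)
      where
      g : ∀ {r} → r ∈ˡ vertices X → r ∈ˡ vertices (rest h) ⊎ (Anc r x × ¬ Anc r z)
      g i with f i
      ... | inj₁ (here refl) = inj₂ (p , np)
      ... | inj₁ (there l)   = inj₁ l
      ... | inj₂ (u , v)     = inj₂ (v , λ w → np (anc-trans u w))

    opposite : (h : Hit (Between x z) A) (g : Hit (Between x z) B) → Sources a b → Disjoint (rest h) (rest g) →
               (Σ[ X ∈ Walk x a ] (∀ {r} → r ∈ˡ vertices X → r ∈ˡ vertices (rest h) ⊎ (Anc r x × ¬ Anc r z))
                 × (∀ c → Vanishing c → κ c X ≤ κ c A)) →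
               (Σ[ Z ∈ Walk z b ] (∀ {r} → r ∈ˡ vertices Z → r ∈ˡ vertices (rest g) ⊎ (Anc r z × ¬ Anc r x))
                 × (∀ c → Vanishing c → κ c Z ≤ κ c B)) → Pair (λ c → κ c A + κ c B) x z
    opposite h g s d (X , fX , kX) (Z , fZ , kZ) = a , b , s , X , Z , dis , λ c v → +-mono-≤ (kX c v) (kZ c v)
      where
      dis : Disjoint X Z
      dis i l with fX i | fZ l
      ... | inj₁ u       | inj₁ v       = d u v
      ... | inj₁ u       | inj₂ v       = avoids h u (inj₂ v)
      ... | inj₂ u       | inj₁ v       = avoids g v (inj₁ u)
      ... | inj₂ (u , _) | inj₂ (_ , v) = v u

    oneSide : ∀ {q′} (h : Hit (Between x z) A) (C : Walk q′ b) → (∀ {r} → r ∈ˡ vertices C → ¬ Between x z r) →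
              Sources a b → Disjoint (rest h) C → Anc (hit h) x → ¬ Anc (hit h) z →
              Climb C (rest h) z → (∀ c → κ c C ≤ κ c B) → Pair (λ c → κ c A + κ c B) x z
    oneSide h C av s d p np (_ , _ , _ , _ , Z , fZ , kZ) le with downHit h p np
    ... | X , fX , kX = a , b , s , X , Z , dis , λ c v → +-mono-≤ (kX c v) (≤-trans (kZ c v) (le c))
      where
      dis : Disjoint X Z
      dis i l with fX i | fZ l
      ... | inj₁ u       | inj₁ v           = d u v
      ... | inj₁ u       | inj₂ (_ , _ , v) = v u
      ... | inj₂ u       | inj₁ v           = av v (inj₁ u)
      ... | inj₂ (_ , u) | inj₂ (v , _)     = u v

  hit-swap : ∀ {x z p a} {A : Walk p a} → Hit (Between x z) A → Hit (Between z x) A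
  hit-swap {x} {z} h = record { edge = edge h ; joins = joins h ; rest = rest h ; hit-R = between-swap {x} {z} (hit-R h)
                      ; avoids = λ i b → avoids h i (between-swap {z} {x} b) ; rest⊆ = rest⊆ h ; hit∈ = hit∈ h ; hit-κ = hit-κ h }

  rest-κ : ∀ {R p a} {A : Walk p a} (h : Hit R A) → ∀ c → κ c (rest h) ≤ κ c A
  rest-κ h c = ≤-trans (m≤n+m _ _) (hit-κ h c)

  -- If the hits are on different sides of the tree path, `x` and `z` both climb to a hit. If both
  -- are on the same side, say that of `x`, a climb from `z` decides: the walk it meets first serves
  -- `z`, and `x` uses the hit of the other walk.
  hits-pair : ∀ {x z a b p q} {A : Walk p a} {B : Walk q b} (h : Hit (Between x z) A) (g : Hit (Between x z) B) →
              Sources a b → Disjoint (rest h) (rest g) → Pair (λ c → κ c A + κ c B) x z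
  hits-pair {x} {z} {a} {b} {A = A} {B} h g s d = go h g d (hit-R h) (hit-R g)
    where
    xside : ∀ {x z} (h : Hit (Between x z) A) (g : Hit (Between x z) B) → Disjoint (rest h) (rest g) →
            Anc (hit h) x × ¬ Anc (hit h) z → Between x z (hit g) → Pair (λ c → κ c A + κ c B) x z
    xside {x} {z} h g d (p , np) (inj₂ (q , nq)) = opposite h g s d (downHit {B = B} h p np) (downHit {B = B} (hit-swap {x} g) q nq)
    xside {x} {z} h g d (p , np) (inj₁ (q , nq)) with climb (rest g) (rest h) (sources-swap s) z
    ... | inj₁ c = widen (oneSide {B = step (edge g) (joins g) (rest g)} h (rest g) (avoids g) s d p np c (λ c → m≤n+m _ _))
      where
      widen : Pair (λ c → κ c A + κ c (whole g)) x z → Pair (λ c → κ c A + κ c B) x z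
      widen (a , b , s , X , Z , e , k) = a , b , s , X , Z , e , λ c v → ≤-trans (k c v) (+-monoʳ-≤ (κ c A) (hit-κ g c))
    ... | inj₂ c = widen (oneSide {B = whole h} g (rest h) (avoids h) (sources-swap s) (λ i l → d l i) q nq c (λ c → m≤n+m _ _))
      where
      widen : Pair (λ c → κ c B + κ c (whole h)) x z → Pair (λ c → κ c A + κ c B) x z
      widen (a , b , s , X , Z , e , k) = a , b , s , X , Z , e ,
        λ c v → ≤-trans (k c v) (≤-trans (+-monoʳ-≤ (κ c B) (hit-κ h c)) (≤-reflexive (+-comm (κ c B) (κ c A))))
    go : ∀ {x z} (h : Hit (Between x z) A) (g : Hit (Between x z) B) → Disjoint (rest h) (rest g) →
         Between x z (hit h) → Between x z (hit g) → Pair (λ c → κ c A + κ c B) x z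
    go h g d (inj₁ p) q = xside h g d p q
    go {x} {z} h g d (inj₂ p) q = pair-swap {x = z} (xside (hit-swap {x} h) (hit-swap {x} g) d p (between-swap {x} {z} q))

  -- This is why an edge is usable once a vertex between its ends is scanned. Both walks leave the
  -- tree path for the last time at a hit. Behind the hits they are disjoint, since they share only
  -- `w` and `w` itself is between.
  meet⇒pair : ∀ {K x z w} → Between x z w → Meet K w → Pair K x z
  meet⇒pair {K} {x} {z} {w} bw (a , b , s , A , B , only , k) with someSource? x z
  ... | inj₁ (_ , σ , bs) with tree-pair σ bs
  ... | a′ , b′ , s′ , X , Z , d , k′ = a′ , b′ , s′ , X , Z , d , λ c v → ≤-trans (k′ c v) z≤n
  meet⇒pair {K} {x} {z} {w} bw (a , b , s , A , B , only , k) | inj₂ ns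
    with firstHit (between? x z) A (ns (proj₁ (sources-src s))) | firstHit (between? x z) B (ns (proj₂ (sources-src s)))
  ... | inj₁ av | _       = ⊥-elim (av (first∈ A) bw)
  ... | inj₂ _  | inj₁ av = ⊥-elim (av (first∈ B) bw)
  ... | inj₂ h  | inj₂ g  with hits-pair h g s (λ i l → avoids h i (subst (Between x z) (sym (only (rest⊆ h i) (rest⊆ g l))) bw))
  ... | a′ , b′ , s′ , X , Z , d , k′ = a′ , b′ , s′ , X , Z , d , λ c v → ≤-trans (k′ c v) (k c v)

  climb-meet : ∀ {x z a b p q} {A : Walk p a} {B : Walk q b} {K} (h : Hit (Between x z) B) → Sources a b → Disjoint A (rest h) →
               (∀ c → Vanishing c → κ c A + κ c B ≤ K c) → Climb A (rest h) (hit h) → Meet K (hit h)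
  climb-meet {a = a} {b} h s d k (_ , _ , _ , _ , C , f , kC) = a , b , s , C , whole h , only ,
    λ c v → ≤-trans (+-mono-≤ (kC c v) (hit-κ h c)) (k c v)
    where
    only : ∀ {r} → r ∈ˡ vertices C → r ∈ˡ vertices (whole h) → r ≡ hit h
    only i (here eq) = eq
    only i (there l) = ⊥-elim ([ (λ u → d u l) , (λ (_ , _ , u) → u l) ]′ (f i))

  -- One of two disjoint walks avoids the tree path between x and z.
  oneHit : ∀ {K x z a b q} {A : Walk x a} {B : Walk q b} → Sources a b → (∀ {r} → r ∈ˡ vertices A → ¬ Between x z r) →
           (h : Hit (Between x z) B) → Disjoint A (rest h) → (∀ c → Vanishing c → κ c A + κ c B ≤ K c) → Meet K (hit h)
  oneHit {x = x} {z} {A = A} s av h d k with climb A (rest h) s (hit h)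
  ... | inj₁ c = climb-meet h s d k c
  ... | inj₂ (y , y∈ , anc , low , _) = ⊥-elim (d (first∈ A) (subst (_∈ˡ vertices (rest h)) (sym x≡y) y∈))
    where
    x∣z : Anc x z
    x∣z with anc? x z
    ... | yes p = p
    ... | no np = ⊥-elim (av (first∈ A) (inj₁ (here , np)))
    x≡y : x ≡ y
    x≡y = anc-antisym (low (below (hit-R h) here x∣z) (inj₂ (first∈ A))) (proj₁ (above (hit-R h) anc (avoids h y∈)))

  -- One walk is redirected along the tree to the hit of the other, which then starts both. Should
  -- the climbs from both hits fail, they would stop at common ancestors of `x` and `z`; these are
  -- equal and lie on both walks, against disjointness.
  pair⇒meet : ∀ {K x z} → (∀ {s} → Src s → ¬ Between x z s) → Pair K x z → ∃[ w ] Between x z w × Meet K w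
  pair⇒meet {K} {x} {z} ns (a , b , s , A , B , d , k)
    with firstHit (between? x z) A (ns (proj₁ (sources-src s))) | firstHit (between? x z) B (ns (proj₂ (sources-src s)))
  ... | inj₁ avA | inj₁ avB = ⊥-elim (d (first∈ A) (subst (_∈ˡ vertices B) (sym x≡z) (first∈ B)))
    where
    x≡z : x ≡ z
    x≡z with anc? x z | anc? z x
    ... | yes p | yes q = anc-antisym p q
    ... | no np | _     = ⊥-elim (avA (first∈ A) (inj₁ (here , np)))
    ... | yes _ | no nq = ⊥-elim (avB (first∈ B) (inj₂ (here , nq)))
  ... | inj₁ avA | inj₂ h = hit h , hit-R h , oneHit s avA h (λ i l → d i (rest⊆ h l)) k
  ... | inj₂ h | inj₁ avB = hit h , hit-R h ,
    oneHit (sources-swap s) (λ i t → avB i (between-swap {z} {x} t)) (hit-swap {x} h) (λ i l → d (rest⊆ h l) i)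
      (λ c v → subst (_≤ K c) (+-comm (κ c A) (κ c B)) (k c v))
  ... | inj₂ h | inj₂ g with climb (rest h) (rest g) s (hit g)
  ... | inj₁ c = hit g , hit-R g ,
    climb-meet g s (λ i l → d (rest⊆ h i) (rest⊆ g l)) (λ c v → ≤-trans (+-monoˡ-≤ _ (rest-κ h c)) (k c v)) c
  ... | inj₂ (y , y∈ , anc , low , _) with climb (rest g) (rest h) (sources-swap s) (hit h)
  ... | inj₁ c = hit h , hit-R h ,
    climb-meet h (sources-swap s) (λ i l → d (rest⊆ h l) (rest⊆ g i))
      (λ c v → ≤-trans (+-monoˡ-≤ _ (rest-κ g c)) (subst (_≤ K c) (+-comm (κ c A) (κ c B)) (k c v))) c
  ... | inj₂ (y′ , y′∈ , anc′ , low′ , _) = ⊥-elim (d (rest⊆ h y′∈) (rest⊆ g (subst (_∈ˡ vertices (rest g)) y≡y′ y∈)))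
    where
    c₁ = above (hit-R g) anc (avoids g y∈)
    c₂ = above (hit-R h) anc′ (avoids h y′∈)
    y≡y′ : y ≡ y′
    y≡y′ = anc-antisym (low′ (below (hit-R h) (proj₁ c₁) (proj₂ c₁)) (inj₂ y∈))
                       (low (below (hit-R g) (proj₁ c₂) (proj₂ c₂)) (inj₂ y′∈))

  LastArc : (Cost → ℕ) → Fin n → Set
  LastArc K w = ∃[ e ] ∃[ x ] Joins e w x × (Src w ⊎ x ≢ par w) ×
    Σ[ K′ ∈ (Cost → ℕ) ] Pair K′ x w × (∀ c → Vanishing c → K′ c + c e w x ≤ K c)

  -- Two walks that share only `w` cannot both begin with the step to its parent. So one of them
  -- begins with an arc off the tree, or `w` is a source; without this arc they form a pair for the
  -- ends of its edge.
  lastArc : ∀ {K w} → Meet K w → LastArc K w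
  lastArc {K} {w} (a , b , s , A₀ , B₀ , only₀ , k₀) with erase A₀ | erase B₀
  ... | A , sA , pA | B , sB , pB = go s A B pA pB (λ i l → only₀ (≼-vertices sA i) (≼-vertices sB l))
                                     (λ c v → ≤-trans (+-mono-≤ (≼-cost sA c) (≼-cost sB c)) (k₀ c v))
    where
    take : ∀ {a b e x} → Sources a b → (A : Walk w a) (j : Joins e w x) (B : Walk x b) → IsPath (step e j B) → (Src w ⊎ x ≢ par w) →
           (∀ {r} → r ∈ˡ vertices A → r ∈ˡ vertices (step e j B) → r ≡ w) →
           (∀ c → Vanishing c → κ c A + κ c (step e j B) ≤ K c) → LastArc K w
    take {a} {b} {e} {x} s A j B (p ∷ _) nt only k = e , x , j , nt , (λ c → κ c B + κ c A) ,
      (b , a , sources-swap s , B , A , (λ i l → All.lookup p i (sym (only l (there i)))) , λ c v → ≤-refl) ,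
      λ c v → subst (_≤ K c) (trans (cong (κ c A +_) (+-comm (c e w x) (κ c B))) (trans (sym (+-assoc (κ c A) (κ c B) (c e w x))) (cong (_+ c e w x) (+-comm (κ c A) (κ c B))))) (k c v)
    flip : ∀ {a b} (A : Walk w a) (B : Walk w b) → (∀ c → Vanishing c → κ c A + κ c B ≤ K c) → ∀ c → Vanishing c → κ c B + κ c A ≤ K c
    flip A B k c v = subst (_≤ K c) (+-comm (κ c A) (κ c B)) (k c v)
    go : ∀ {a b} → Sources a b → (A : Walk w a) (B : Walk w b) → IsPath A → IsPath B →
         (∀ {r} → r ∈ˡ vertices A → r ∈ˡ vertices B → r ≡ w) → (∀ c → Vanishing c → κ c A + κ c B ≤ K c) → LastArc K w
    go s stop stop _ _ _ _ = ⊥-elim (sources-≢ s refl)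
    go s stop B@(step e j B₁) _ pB only k = take s stop j B₁ pB (inj₁ (proj₁ (sources-src s))) only k
    go s A@(step e j A₁) stop pA _ only k =
      take (sources-swap s) stop j A₁ pA (inj₁ (proj₂ (sources-src s))) (λ i l → only l i) (flip A stop k)
    go s A@(step {v = x₁} e j A₁) B@(step {v = x₂} f i B₁) pA pB only k with x₁ Fin.≟ par w
    ... | no ne  = take (sources-swap s) B j A₁ pA (inj₂ ne) (λ i l → only l i) (flip A B k)
    ... | yes eq = take s A i B₁ pB (inj₂ λ eq′ → joins-≢ j (sym (only (there (first∈ A₁))
                     (there (subst (_∈ˡ vertices B₁) (trans eq′ (sym eq)) (first∈ B₁)))))) only k

  private
    -- Reduced lengths can be zero off the tree and are no measure for an induction. The number of
    -- arcs that do not lead to a parent is one, since `lastArc` removes such an arc.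
    nontree : Cost
    nontree e z x with src? z | x Fin.≟ par z
    ... | no _  | yes _ = 0
    ... | yes _ | _     = 1
    ... | no _  | no _  = 1

    nontree-vanishing : Vanishing nontree
    nontree-vanishing {e} {z} ns j with src? z | par z Fin.≟ par z
    ... | yes s | _     = ⊥-elim (ns s)
    ... | no _  | yes _ = refl
    ... | no _  | no np = ⊥-elim (np refl)

    nontree-1 : ∀ {e w x} → Src w ⊎ x ≢ par w → nontree e w x ≡ 1
    nontree-1 {e} {w} {x} h with src? w | x Fin.≟ par w
    ... | yes _ | _     = refl
    ... | no _  | no _  = refl
    ... | no ns | yes p = ⊥-elim ([ ns , (λ np → np p) ]′ h)

  module Closed (D : Fin n → ℕ) (c : Cost) (vc : Vanishing c)
    (D-src : ∀ {s} → Src s → D s ≡ 0)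
    (D-step : ∀ {e x z w} → Joins e z x → Between x z w → D z ≤ D w + c e z x) where

    private
      meet≤′ : ∀ {K w} → Acc _<_ (K nontree) → Meet K w → D w ≤ K c
      meet≤′ {K} {w} (acc rs) M with lastArc M
      ... | e , x , j , nt , K′ , P , k with someSource? x w
      ... | inj₁ (s , σ , bs) = ≤-trans (D-step j bs) (≤-trans (≤-reflexive (cong (_+ c e w x) (D-src σ))) (≤-trans (m≤n+m _ (K′ c)) (k c vc)))
      ... | inj₂ ns with pair⇒meet {K′} ns P
      ... | w′ , b , M′ = ≤-trans (D-step j b) (≤-trans (+-monoˡ-≤ _ (meet≤′ {K′} (rs lt) M′)) (k c vc))
        where
        lt : K′ nontree < K nontree
        lt = subst (_≤ K nontree) (trans (cong (K′ nontree +_) (nontree-1 {e} nt)) (+-comm (K′ nontree) 1)) (k nontree nontree-vanishing)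

    -- Labels that satisfy the closure inequalities are lower bounds for all pairs, by induction on
    -- the nontree arcs. Thus the final inequalities of the scan are all that its minimality needs;
    -- the order of scanning enters only in deriving them.
    pair≤ : ∀ {K x z} → Pair K x z → ∃[ w ] Between x z w × D w ≤ K c
    pair≤ {K} {x} {z} P with someSource? x z
    ... | inj₁ (s , σ , bs) = s , bs , ≤-trans (≤-reflexive (D-src σ)) z≤n
    ... | inj₂ ns with pair⇒meet {K} ns P
    ... | w , b , M = w , b , meet≤′ {K} (<-wellFounded (K nontree)) M

-- Arrays as functions

set : (ℕ → ℕ) → ℕ → ℕ → (ℕ → ℕ)
set f i v j = if i ≡ᵇ j then v else f j

set-same : ∀ f i v → set f i v i ≡ v
set-same f i v rewrite ≡ᵇ-refl i = refl

set-other : ∀ f {i j} v → i ≢ j → set f i v j ≡ f j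
set-other f {i} {j} v ne with i ≡ᵇ j in eq
... | false = refl
... | true  = ⊥-elim (ne (≡ᵇ⇒≡ i j (subst T (sym eq) tt)))

-- Since `P` speaks about an arbitrary value, a statement on all cells survives a write by one case
-- distinction on the index, without rewriting the array.
set-elim : ∀ {N} f (P : Fin N → ℕ → Set) i {v} → P i v → (∀ z → i ≢ z → P z (f (toℕ z))) → ∀ z → P z (set f (toℕ i) v (toℕ z))
set-elim f P i {v} pv pf z with i Fin.≟ z
... | yes refl = subst (P i) (sym (set-same f (toℕ i) v)) pv
... | no ne    = subst (P z) (sym (set-other f v (ne ∘ Fin.toℕ-injective))) (pf z ne)

Below : ∀ {N} → (Fin N → ℕ → Set) → ℕ → (ℕ → ℕ) → Set
Below P k f = ∀ z → toℕ z < k → P z (f (toℕ z))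

table-step : ∀ {N} f (P : Fin N → ℕ → Set) (k : Fin N) {v} → P k v → Below P (toℕ k) f → Below P (suc (toℕ k)) (set f (toℕ k) v)
table-step f P k pv pf = set-elim f (λ z d → toℕ z < suc (toℕ k) → P z d) k (λ _ → pv)
  (λ z ne lt → pf z (≤∧≢⇒< (≤-pred lt) (ne ∘ sym ∘ Fin.toℕ-injective)))

-- The value of `minE`. Written with truncated subtraction, a minimum passes the test `bounded` as
-- soon as its first operand does, whatever sum the second one is.
mn : ℕ → ℕ → ℕ
mn a b = a ∸ (a ∸ b)

mn-≤ˡ : ∀ a b → mn a b ≤ a
mn-≤ˡ a b = m∸n≤m a (a ∸ b)

mn-cases : ∀ a b → (mn a b ≡ a × a ≤ b) ⊎ (mn a b ≡ b × b ≤ a)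
mn-cases a b with ≤-total a b
... | inj₁ le = inj₁ (cong (a ∸_) (m≤n⇒m∸n≡0 le) , le)
... | inj₂ le = inj₂ (m∸[m∸n]≡n le , le)

mn-≤ʳ : ∀ a b → mn a b ≤ b
mn-≤ʳ a b with mn-cases a b
... | inj₁ (eq , le) = subst (_≤ b) (sym eq) le
... | inj₂ (eq , _)  = ≤-reflexive eq

mn-elim : ∀ {P : ℕ → Set} a b → P a → (b ≤ a → P b) → P (mn a b)
mn-elim {P} a b pa pb with mn-cases a b
... | inj₁ (eq , _)  = subst P (sym eq) pa
... | inj₂ (eq , le) = subst P (sym eq) (pb le)

-- Programs

-- Arrays: 0 input, 1 output, 2 constants, 3-7 counters, 8 and 9 sources, 10 distances, 11 mask of allowed edges,
-- 12 settling thresholds, 13 parents, 14 ancestor matrix, 15 walk to the root, 16 scanning order, 17 and 18 labels of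
-- vertices and edges, 19-21 scanned vertex, 22 settling paths (later bundles) as a matrix, 23 trivial edges,
-- 24 alternative path found, 25 critical pairs, 27 some bundle of a critical pair e contains more than e, 28 chosen edges,
-- 29 their weight, 30 their number, 31 solution found, 32 height of the stack with levels 33 and edges 34, 35 chosen
-- edges on the branch by level, 36 and 37 popped entry, 38 query and 39 reply of the APSP program, 40 unsettled edge.

n# m# CAP BIG : Exp
n#  = 0 ⟦ lit 1 ⟧
m#  = 0 ⟦ lit 2 ⟧
CAP = 2 ⟦ lit 0 ⟧
BIG = 2 ⟦ lit 1 ⟧

lo# hi# len# wt# : Exp → Exp
lo#  x = 0 ⟦ lit 7 ⊕ lit 4 ⊗ x ⟧
hi#  x = 0 ⟦ lit 8 ⊕ lit 4 ⊗ x ⟧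
len# x = 0 ⟦ lit 9 ⊕ lit 4 ⊗ x ⟧
wt#  x = 0 ⟦ lit 10 ⊕ lit 4 ⊗ x ⟧

minE leE : Exp → Exp → Exp
minE a b = a ⊖ (a ⊖ b)
leE a b  = lit 1 ⊖ (a ⊖ b)

isZeroE nonZeroE : Exp → Exp
isZeroE a  = lit 1 ⊖ a
nonZeroE a = lit 1 ⊖ (lit 1 ⊖ a)

-- Distances from two sources by the method of Bellman and Ford

relaxP bellmanFord : Prog
relaxP =
  -- A masked edge costs the cap in addition. Its offer is then at least the cap, and as labels
  -- never exceed the cap, the minimum ignores it.
  (10 [ hi# ($$ 5) ]:= minE (10 ⟦ hi# ($$ 5) ⟧) (10 ⟦ lo# ($$ 5) ⟧ ⊕ len# ($$ 5) ⊕ isZeroE (11 ⟦ $$ 5 ⟧) ⊗ CAP)) ⨟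
  (10 [ lo# ($$ 5) ]:= minE (10 ⟦ lo# ($$ 5) ⟧) (10 ⟦ hi# ($$ 5) ⟧ ⊕ len# ($$ 5) ⊕ isZeroE (11 ⟦ $$ 5 ⟧) ⊗ CAP))
bellmanFord =
  for 6 1 (10 [ $$ 6 ]:= CAP) ⨟
  (10 [ $$ 8 ]:= lit 0) ⨟
  (10 [ $$ 9 ]:= lit 0) ⨟
  for 4 1 (for 5 2 relaxP)

-- `inp` and `con` are the contents of arrays 0 and 2. The cap `con 0` acts as infinity and `con 1`
-- is the length of an unchosen edge; the inequalities are all that is used about these two numbers.
-- The offsets from 7 on skip the length and the six leading numbers.
record Input {n m} (I : Instance n m) : Set where
  open Instance I
  field
    inp con : ℕ → ℕ
    inp-n   : inp 1 ≡ n
    inp-m   : inp 2 ≡ m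
    inp-lo  : ∀ e → inp (7 + 4 * toℕ e) ≡ toℕ (lo e)
    inp-hi  : ∀ e → inp (8 + 4 * toℕ e) ≡ toℕ (hi e)
    inp-ℓ   : ∀ e → inp (9 + 4 * toℕ e) ≡ ℓ e
    inp-w   : ∀ e → inp (10 + 4 * toℕ e) ≡ w e
    inp-num : inp 3 ≡ ℤ.∣ ↥ α ∣
    inp-den : inp 4 ≡ ↧ₙ α
    inp-W   : inp 5 ≡ W
    inp-μ   : inp 6 ≡ μ
    path<V  : ∀ {u v} (p : Walk u v) → IsPath p → ℓ* p < con 0
    num*ℓ<B : ∀ e → ℤ.∣ ↥ α ∣ * ℓ e < con 1
    1≤B     : 1 ≤ con 1
    ℓ≤B     : ∀ e → ℓ e ≤ con 1
    B≤V     : con 1 ≤ con 0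
    n*n≤V   : n * n ≤ con 0
    n*B≤V   : n * con 1 ≤ con 0
    W<V     : W < con 0
    stack≤V : 3 + (m * m + 3 * m) ≤ con 0
    dist    : ∀ u v → ∃[ d ] Dist full u v d
  V : ℕ
  V = con 0

module BellmanFord {n m} (I : Instance n m) (In : Input I) where

  open Instance I using (graph; ℓ)
  open Input In
  open Walks graph
  open Lengths ℓ

  Env : Store → Set
  Env σ = σ 0 ≡ inp × σ 2 ≡ con

  Masked : (ℕ → ℕ) → ∀ {u v} → Walk u v → Set
  Masked msk p = All (λ e → msk (toℕ e) ≢ 0) (edges p)

  -- The value `V` means unreached. Minimality is claimed for walks with at most n edges, which is
  -- what n rounds guarantee; erasing loops lifts the restriction later.
  record Distances (msk : ℕ → ℕ) (s t : Fin n) (D : ℕ → ℕ) : Set where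
    field
      D≤V      : ∀ (z : Fin n) → D (toℕ z) ≤ V
      realised : ∀ z → D (toℕ z) ≡ V ⊎ (∃[ a ] (a ≡ s ⊎ a ≡ t) × Σ[ p ∈ Walk z a ] Masked msk p × len p ≡ D (toℕ z))
      minimal  : ∀ {z a} → a ≡ s ⊎ a ≡ t → (p : Walk z a) → Masked msk p → length (edges p) ≤ n → D (toℕ z) ≤ len p

  module _ (msk : ℕ → ℕ) (s t : Fin n) where

    private
      Sound₁ : Fin n → ℕ → Set
      Sound₁ z d = d ≤ V × (d ≡ V ⊎ (∃[ a ] (a ≡ s ⊎ a ≡ t) × Σ[ p ∈ Walk z a ] Masked msk p × len p ≡ d))

      Sound : (ℕ → ℕ) → Set
      Sound D = ∀ z → Sound₁ z (D (toℕ z))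

      relax : (ℕ → ℕ) → Fin m → Fin n → Fin n → ℕ → ℕ
      relax D e z x = set D (toℕ z) (mn (D (toℕ z)) (D (toℕ x) + ℓ e + (1 ∸ msk (toℕ e)) * V))

      relax-≤ : ∀ D e z x y → relax D e z x (toℕ y) ≤ D (toℕ y)
      relax-≤ D e z x = set-elim D (λ y d → d ≤ D (toℕ y)) z (mn-≤ˡ (D (toℕ z)) (D (toℕ x) + ℓ e + (1 ∸ msk (toℕ e)) * V)) (λ _ _ → ≤-refl)

      relax-edge : ∀ D e z x → msk (toℕ e) ≢ 0 → relax D e z x (toℕ z) ≤ D (toℕ x) + ℓ e
      relax-edge D e z x h rewrite set-same D (toℕ z) (mn (D (toℕ z)) (D (toℕ x) + ℓ e + (1 ∸ msk (toℕ e)) * V))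
        with msk (toℕ e)
      ... | zero  = ⊥-elim (h refl)
      ... | suc k = ≤-trans (mn-≤ʳ (D (toℕ z)) _) (≤-reflexive (trans (cong (λ j → D (toℕ x) + ℓ e + j * V) (0∸n≡0 k)) (+-identityʳ _)))

      relax-sound : ∀ D → Sound D → ∀ {e z x} → Joins e z x → Sound (relax D e z x)
      relax-sound D S {e} {z} {x} j = set-elim D Sound₁ z (mn-elim {Sound₁ z} (D (toℕ z)) (D (toℕ x) + ℓ e + (1 ∸ msk (toℕ e)) * V) (S z) new) (λ y _ → S y)
        where
        new : D (toℕ x) + ℓ e + (1 ∸ msk (toℕ e)) * V ≤ D (toℕ z) → Sound₁ z (D (toℕ x) + ℓ e + (1 ∸ msk (toℕ e)) * V)
        new le = d≤V , cases (msk (toℕ e)) refl (proj₂ (S x))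
          where
          d≤V = ≤-trans le (proj₁ (S z))
          tight : ∀ {d} → d ≡ V → d ≤ D (toℕ x) + ℓ e + (1 ∸ msk (toℕ e)) * V → D (toℕ x) + ℓ e + (1 ∸ msk (toℕ e)) * V ≡ V
          tight refl le′ = ≤-antisym d≤V le′
          cases : ∀ k → msk (toℕ e) ≡ k → D (toℕ x) ≡ V ⊎ (∃[ a ] (a ≡ s ⊎ a ≡ t) × Σ[ p ∈ Walk x a ] Masked msk p × len p ≡ D (toℕ x)) →
                  D (toℕ x) + ℓ e + (1 ∸ msk (toℕ e)) * V ≡ V ⊎
                  (∃[ a ] (a ≡ s ⊎ a ≡ t) × Σ[ p ∈ Walk z a ] Masked msk p × len p ≡ D (toℕ x) + ℓ e + (1 ∸ msk (toℕ e)) * V)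
          cases _ _ (inj₁ eq) = inj₁ (tight eq (≤-trans (m≤m+n _ (ℓ e)) (m≤m+n _ _)))
          cases zero eq (inj₂ _) = inj₁ (tight (trans (cong (λ k → (1 ∸ k) * V) eq) (+-identityʳ V)) (m≤n+m ((1 ∸ msk (toℕ e)) * V) _))
          cases (suc k) eq (inj₂ (a , σ , p , mp , lp)) = inj₂ (a , σ , step e j p , (λ z → case trans (sym eq) z of λ ()) ∷ mp ,
            trans (+-comm (ℓ e) (len p)) (trans (cong (_+ ℓ e) lp) (trans (sym (+-identityʳ _))
              (cong (λ q → D (toℕ x) + ℓ e + q * V) (trans (sym (0∸n≡0 k)) (cong (1 ∸_) (sym eq)))))))

      -- Labels are updated in place, so inside a round only upper bounds in terms of the labels
      -- `D₀` at its beginning are available. They suffice.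
      Round : (ℕ → ℕ) → ℕ → (ℕ → ℕ) → Set
      Round D₀ k D = Sound D × (∀ (z : Fin n) → D (toℕ z) ≤ D₀ (toℕ z)) ×
        (∀ e → toℕ e < k → msk (toℕ e) ≢ 0 → D (toℕ (hi e)) ≤ D₀ (toℕ (lo e)) + ℓ e × D (toℕ (lo e)) ≤ D₀ (toℕ (hi e)) + ℓ e)

      Rounds : ℕ → (ℕ → ℕ) → Set
      Rounds r D = Sound D ×
        (∀ {z a} → a ≡ s ⊎ a ≡ t → (p : Walk z a) → Masked msk p → length (edges p) ≤ r → D (toℕ z) ≤ len p)

      round-step : ∀ {D₀} e {D} → Round D₀ (toℕ e) D →
                   Round D₀ (suc (toℕ e)) (relax (relax D e (hi e) (lo e)) e (lo e) (hi e))
      round-step {D₀} e {D} (S , le , done) = relax-sound D₁ (relax-sound D S j) (joins-sym j) ,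
        (λ z → ≤-trans (le₂ z) (≤-trans (le₁ z) (le z))) , done′
        where
        j : Joins e (hi e) (lo e)
        j = inj₂ (refl , refl)
        D₁ = relax D e (hi e) (lo e)
        le₁ = relax-≤ D e (hi e) (lo e)
        le₂ = relax-≤ D₁ e (lo e) (hi e)
        done′ : ∀ f → toℕ f < suc (toℕ e) → msk (toℕ f) ≢ 0 → _ × _
        done′ f lt h with m<1+n⇒m<n∨m≡n lt
        ... | inj₁ lt′ = ≤-trans (le₂ (hi f)) (≤-trans (le₁ (hi f)) (proj₁ (done f lt′ h))) ,
                         ≤-trans (le₂ (lo f)) (≤-trans (le₁ (lo f)) (proj₂ (done f lt′ h)))
        ... | inj₂ eq with Fin.toℕ-injective eq
        ... | refl = ≤-trans (le₂ (hi e)) (≤-trans (relax-edge D e (hi e) (lo e) h) (+-monoˡ-≤ (ℓ e) (le (lo e)))) ,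
                     ≤-trans (relax-edge D₁ e (lo e) (hi e) h) (+-monoˡ-≤ (ℓ e) (≤-trans (le₁ (hi e)) (le (hi e))))

      rounds-step : ∀ {r D₀ D} → Rounds r D₀ → Round D₀ m D → Rounds (suc r) D
      rounds-step {r} {D₀} {D} (_ , old) (S , le , done) = S , new
        where
        new : ∀ {z a} → a ≡ s ⊎ a ≡ t → (p : Walk z a) → Masked msk p → length (edges p) ≤ suc r → D (toℕ z) ≤ len p
        new σ stop mp _ = ≤-trans (le _) (old σ stop mp z≤n)
        new {z} σ (step {v = x} e j p) (h ∷ mp) (s≤s l) = ≤-trans edge
            (≤-trans (+-monoˡ-≤ (ℓ e) (old σ p mp l)) (≤-reflexive (+-comm (len p) (ℓ e))))
          where
          edge : D (toℕ z) ≤ D₀ (toℕ x) + ℓ e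
          edge = oriented j (done e (Fin.toℕ<n e) h)
            where
            oriented : ∀ {z x} → Joins e z x → D (toℕ (hi e)) ≤ D₀ (toℕ (lo e)) + ℓ e × D (toℕ (lo e)) ≤ D₀ (toℕ (hi e)) + ℓ e →
                       D (toℕ z) ≤ D₀ (toℕ x) + ℓ e
            oriented (inj₁ (refl , refl)) (_ , b) = b
            oriented (inj₂ (refl , refl)) (b , _) = b

    bellmanFord-correct : ∀ σ → Env σ → σ 11 ≡ msk → σ 8 0 ≡ toℕ s → σ 9 0 ≡ toℕ t → Distances msk s t (sem bellmanFord σ 10)
    bellmanFord-correct σ (e₀ , e₂) em es et = record
      { D≤V = λ z → proj₁ (proj₁ final z) ; realised = λ z → proj₂ (proj₁ final z) ; minimal = proj₂ final }
      where
      σ₁ = sem (for 6 1 (10 [ $$ 6 ]:= CAP)) σ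
      σ₂ = sem ((10 [ $$ 8 ]:= lit 0) ⨟ (10 [ $$ 9 ]:= lit 0)) σ₁
      n-eq : ∀ (τ : Store) → τ 0 ≡ inp → τ 0 1 ≡ n
      n-eq τ q = trans (cong (λ f → f 1) q) inp-n
      m-eq : ∀ (τ : Store) → τ 0 ≡ inp → τ 0 2 ≡ m
      m-eq τ q = trans (cong (λ f → f 2) q) inp-m
      filled : ∀ (z : Fin n) → toℕ z < n → σ₁ 10 (toℕ z) ≡ V
      filled = for-ind 6 1 (10 [ $$ 6 ]:= CAP) σ (n-eq σ e₀) (λ k τ → ∀ (z : Fin n) → toℕ z < k → τ 10 (toℕ z) ≡ V)
        (λ _ ()) λ k τ ctr fr P → subst₂ (λ a b → Below (λ _ d → d ≡ V) (suc (toℕ k)) (set (τ 10) a b)) (sym ctr)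
          (sym (cong (λ f → f 0) (trans (fr 2 tt) e₂))) (table-step (τ 10) (λ _ d → d ≡ V) k refl P)
      D₂ : σ₂ 10 ≡ set (set (σ₁ 10) (toℕ s) 0) (toℕ t) 0
      D₂ = cong₂ (λ a b → set (set (σ₁ 10) a 0) b 0)
             (trans (cong (λ f → f 0) (frame (for 6 1 (10 [ $$ 6 ]:= CAP)) σ 8 tt)) es)
             (trans (cong (λ f → f 0) (frame (for 6 1 (10 [ $$ 6 ]:= CAP)) σ 9 tt)) et)
      start : Rounds 0 (σ₂ 10)
      start = subst (Rounds 0) (sym D₂) (S , B)
        where
        S : Sound (set (set (σ₁ 10) (toℕ s) 0) (toℕ t) 0)
        S = set-elim (set (σ₁ 10) (toℕ s) 0) Sound₁ t (z≤n , inj₂ (t , inj₂ refl , stop , [] , refl))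
              λ y _ → (set-elim (σ₁ 10) Sound₁ s (z≤n , inj₂ (s , inj₁ refl , stop , [] , refl))
                λ z _ → ≤-reflexive (filled z (Fin.toℕ<n z)) , inj₁ (filled z (Fin.toℕ<n z))) y
        B : ∀ {z a} → a ≡ s ⊎ a ≡ t → (p : Walk z a) → Masked msk p → length (edges p) ≤ 0 →
            set (set (σ₁ 10) (toℕ s) 0) (toℕ t) 0 (toℕ z) ≤ len p
        B (inj₁ refl) stop _ _ = set-elim (set (σ₁ 10) (toℕ s) 0) (λ z d → z ≡ s → d ≤ 0) t (λ _ → z≤n)
          (λ y _ → set-elim (σ₁ 10) (λ z d → z ≡ s → d ≤ 0) s (λ _ → z≤n) (λ z ne eq → ⊥-elim (ne (sym eq))) y) s refl
        B (inj₂ refl) stop _ _ = ≤-reflexive (set-same (set (σ₁ 10) (toℕ s) 0) (toℕ t) 0)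
      env₂ : σ₂ 0 ≡ inp × σ₂ 2 ≡ con × σ₂ 11 ≡ msk
      env₂ = trans (frame (for 6 1 (10 [ $$ 6 ]:= CAP)) σ 0 tt) e₀ , trans (frame (for 6 1 (10 [ $$ 6 ]:= CAP)) σ 2 tt) e₂ ,
             trans (frame (for 6 1 (10 [ $$ 6 ]:= CAP)) σ 11 tt) em
      final : Rounds n (sem (for 4 1 (for 5 2 relaxP)) σ₂ 10)
      final = for-ind 4 1 (for 5 2 relaxP) σ₂ (n-eq σ₂ (proj₁ env₂)) (λ r τ → Rounds r (τ 10)) start
        λ r τ ctr fr R → rounds-step {toℕ r} {τ 10} {sem (for 5 2 relaxP) τ 10} R
          (for-ind 5 2 relaxP τ (m-eq τ (trans (fr 0 tt) (proj₁ env₂))) (λ k ρ → Round (τ 10) k (ρ 10))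
            (proj₁ R , (λ _ → ≤-refl) , (λ _ ()))
            λ e ρ ctr′ fr′ Q → inner {τ 10} e ρ ctr′ (trans (fr′ 0 tt) (trans (fr 0 tt) (proj₁ env₂)))
              (trans (fr′ 2 tt) (trans (fr 2 tt) (proj₁ (proj₂ env₂)))) (trans (fr′ 11 tt) (trans (fr 11 tt) (proj₂ (proj₂ env₂)))) Q)
        where
        inner : ∀ {D₀} e (ρ : Store) → ρ 5 0 ≡ toℕ e → ρ 0 ≡ inp → ρ 2 ≡ con → ρ 11 ≡ msk → Round D₀ (toℕ e) (ρ 10) →
                Round D₀ (suc (toℕ e)) (sem relaxP ρ 10)
        inner {D₀} e ρ ctr q₀ q₂ q₁₁ Q rewrite ctr | q₀ | q₂ | q₁₁ | inp-lo e | inp-hi e | inp-ℓ e = round-step {D₀} e {ρ 10} Q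

caseZ-elim : {A : Set} (P : A → Set) (c : ℕ) {a b : A} → (c ≡ 0 → P a) → (c ≢ 0 → P b) → P (caseZ c a b)
caseZ-elim P zero    pa pb = pa refl
caseZ-elim P (suc c) pa pb = pb λ ()

-- The scan over reduced lengths

bestP swapP relaxPairsP dijkstra : Prog
bestP =
  (19 [ lit 0 ]:= $$ 4) ⨟
  -- Positions before `$$ 4` hold the scanned vertices. The product is nonzero exactly if position
  -- `$$ 7` is not before `$$ 4` and its label is smaller than the best one so far.
  for 7 1 (ifz (leE ($$ 4) ($$ 7) ⊗ (17 ⟦ 16 ⟦ $$ 19 ⟧ ⟧ ⊖ 17 ⟦ 16 ⟦ $$ 7 ⟧ ⟧)) nop (19 [ lit 0 ]:= $$ 7))
swapP =
  (21 [ lit 0 ]:= 16 ⟦ $$ 19 ⟧) ⨟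
  (16 [ $$ 19 ]:= 16 ⟦ $$ 4 ⟧) ⨟
  (16 [ $$ 4 ]:= $$ 21) ⨟
  (20 [ lit 0 ]:= 17 ⟦ $$ 21 ⟧)
relaxPairsP =
  -- The two entries of the ancestor matrix differ exactly if the scanned vertex is between the ends
  -- of the edge; otherwise the cap is added and its label has no effect on the edge.
  (18 [ $$ 5 ]:= minE (18 ⟦ $$ 5 ⟧) ($$ 20 ⊕ isZeroE (x ⊖ y ⊕ (y ⊖ x)) ⊗ CAP)) ⨟
  (17 [ h ]:= minE (17 ⟦ h ⟧) (18 ⟦ $$ 5 ⟧ ⊕ (10 ⟦ l ⟧ ⊕ len# ($$ 5) ⊖ 10 ⟦ h ⟧))) ⨟
  (17 [ l ]:= minE (17 ⟦ l ⟧) (18 ⟦ $$ 5 ⟧ ⊕ (10 ⟦ h ⟧ ⊕ len# ($$ 5) ⊖ 10 ⟦ l ⟧)))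
  where
  h = hi# ($$ 5)
  l = lo# ($$ 5)
  x = 14 ⟦ n# ⊗ l ⊕ $$ 21 ⟧
  y = 14 ⟦ n# ⊗ h ⊕ $$ 21 ⟧
dijkstra =
  for 6 1 ((17 [ $$ 6 ]:= CAP) ⨟ (16 [ $$ 6 ]:= $$ 6)) ⨟
  (17 [ $$ 8 ]:= lit 0) ⨟
  (17 [ $$ 9 ]:= lit 0) ⨟
  for 5 2 (18 [ $$ 5 ]:= CAP) ⨟
  for 4 1 (bestP ⨟ swapP ⨟ for 5 2 relaxPairsP)

module Dijkstra {n m} (I : Instance n m) (In : Input I) (Dv anc : ℕ → ℕ) (s t : Fin n)
  (Btw : Fin m → Fin n → Set) where

  open Instance I using (graph; ℓ)
  open Graph graph using (lo; hi)
  open Input In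

  differ : Fin m → Fin n → ℕ
  differ f w = (anc (n * toℕ (lo f) + toℕ w) ∸ anc (n * toℕ (hi f) + toℕ w)) +
               (anc (n * toℕ (hi f) + toℕ w) ∸ anc (n * toℕ (lo f) + toℕ w))

  cH cL : Fin m → ℕ
  cH f = Dv (toℕ (lo f)) + ℓ f ∸ Dv (toℕ (hi f))
  cL f = Dv (toℕ (hi f)) + ℓ f ∸ Dv (toℕ (lo f))

  -- `SD` and `SE` say which labels are witnessed by walks. Kept abstract, they separate the scan
  -- from the geometry of the forest, which enters only through the three closure rules.
  module _ (SD : Fin n → ℕ → Set) (SE : Fin m → ℕ → Set)
    (btw : ∀ f w → (Btw f w × differ f w ≢ 0) ⊎ (¬ Btw f w × differ f w ≡ 0))
    (SD-s : SD s 0) (SD-t : SD t 0)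
    (SD⇒SE : ∀ {f w d} → Btw f w → SD w d → SE f d)
    (SE⇒SH : ∀ {f d} → SE f d → SD (hi f) (d + cH f))
    (SE⇒SL : ∀ {f d} → SE f d → SD (lo f) (d + cL f)) where

    private
      SndA : (ℕ → ℕ) → Set
      SndA A = ∀ (z : Fin n) → A (toℕ z) ≤ V × (A (toℕ z) ≡ V ⊎ SD z (A (toℕ z)))

      SndE : (ℕ → ℕ) → Set
      SndE E = ∀ (f : Fin m) → E (toℕ f) ≤ V × (E (toℕ f) ≡ V ⊎ SE f (E (toℕ f)))

    -- True from the beginning, because the labels of edges start at the cap, which no label of a
    -- vertex exceeds. It is maintained for all edges, whether they are usable yet or not.
    Arcs : (ℕ → ℕ) → (ℕ → ℕ) → Set
    Arcs A E = ∀ f → A (toℕ (hi f)) ≤ E (toℕ f) + cH f × A (toℕ (lo f)) ≤ E (toℕ f) + cL f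

    record Labels (A E : ℕ → ℕ) : Set where
      field
        A-sound : SndA A
        E-sound : SndE E
        arcs    : Arcs A E
        A-s     : A (toℕ s) ≡ 0
        A-t     : A (toℕ t) ≡ 0
    open Labels

    private
      -- Compares the labels before the scan of `w` with those after its first `k` edges. `A-low`
      -- preserves the scanning order: a label that drops is still at least that of `w`.
      record Relaxed (A₀ E₀ : ℕ → ℕ) (w : Fin n) (k : ℕ) (A E : ℕ → ℕ) : Set where
        field
          labels : Labels A E
          A-mono : ∀ (z : Fin n) → A (toℕ z) ≤ A₀ (toℕ z)
          A-low  : ∀ (z : Fin n) → A₀ (toℕ z) ≤ A (toℕ z) ⊎ A₀ (toℕ w) ≤ A (toℕ z)
          E-mono : ∀ (f : Fin m) → E (toℕ f) ≤ E₀ (toℕ f)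
          E-done : ∀ f → toℕ f < k → Btw f w → E (toℕ f) ≤ A₀ (toℕ w)
      open Relaxed

      pen : Fin m → Fin n → ℕ
      pen f w = (1 ∸ differ f w) * V

      pen-cases : ∀ f w → (Btw f w × pen f w ≡ 0) ⊎ (¬ Btw f w × pen f w ≡ V)
      pen-cases f w with btw f w
      ... | inj₁ (b , ne) = inj₁ (b , lemma (differ f w) ne)
        where
        lemma : ∀ d → d ≢ 0 → (1 ∸ d) * V ≡ 0
        lemma zero    h = ⊥-elim (h refl)
        lemma (suc d) h = cong (_* V) (0∸n≡0 d)
      ... | inj₂ (nb , eq) = inj₂ (nb , trans (cong (λ d → (1 ∸ d) * V) eq) (+-identityʳ V))

      module RelaxStep (A₀ E₀ : ℕ → ℕ) (w : Fin n) (w-sound : A₀ (toℕ w) ≡ V ⊎ SD w (A₀ (toℕ w)))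
        (f : Fin m) (A E : ℕ → ℕ) (R : Relaxed A₀ E₀ w (toℕ f) A E) where
        dw = A₀ (toℕ w)
        L = labels R
        e₁ = mn (E (toℕ f)) (dw + pen f w)
        E₁ = set E (toℕ f) e₁
        h₁ = mn (A (toℕ (hi f))) (E₁ (toℕ f) + cH f)
        A₁ = set A (toℕ (hi f)) h₁
        l₁ = mn (A₁ (toℕ (lo f))) (E₁ (toℕ f) + cL f)
        A₂ = set A₁ (toℕ (lo f)) l₁

        E₁f : E₁ (toℕ f) ≡ e₁
        E₁f = set-same E (toℕ f) e₁

        e₁-sound : e₁ ≤ V × (e₁ ≡ V ⊎ SE f e₁)
        e₁-sound = mn-elim {λ e → e ≤ V × (e ≡ V ⊎ SE f e)} (E (toℕ f)) (dw + pen f w) (E-sound L f)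
          λ le → ≤-trans le (proj₁ (E-sound L f)) , new (≤-trans le (proj₁ (E-sound L f)))
          where
          new : dw + pen f w ≤ V → dw + pen f w ≡ V ⊎ SE f (dw + pen f w)
          new le with pen-cases f w
          ... | inj₂ (_ , eq) = inj₁ (≤-antisym le (subst (_≤ dw + pen f w) eq (m≤n+m (pen f w) dw)))
          ... | inj₁ (b , eq) =
            [ (λ dV → inj₁ (≤-antisym le (subst (_≤ dw + pen f w) dV (m≤m+n dw (pen f w)))))
            , (λ sd → inj₂ (subst (SE f) (sym (trans (cong (dw +_) eq) (+-identityʳ dw))) (SD⇒SE b sd))) ]′ w-sound

        E₁-sound : SndE E₁
        E₁-sound = set-elim E (λ f e → e ≤ V × (e ≡ V ⊎ SE f e)) f e₁-sound (λ g _ → E-sound L g)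

        E₁-mono : ∀ (g : Fin m) → E₁ (toℕ g) ≤ E (toℕ g)
        E₁-mono = set-elim E (λ g e → e ≤ E (toℕ g)) f (mn-≤ˡ (E (toℕ f)) (dw + pen f w)) (λ _ _ → ≤-refl)

        -- If the label of the edge is unchanged, the arc inequality held before and the vertex
        -- cannot drop. Otherwise the new label of the edge is at least that of `w`.
        lower : ∀ (B : ℕ → ℕ) (z : Fin n) c → B (toℕ z) ≤ E (toℕ f) + c →
                (A₀ (toℕ z) ≤ B (toℕ z) ⊎ dw ≤ B (toℕ z)) →
                let v = mn (B (toℕ z)) (E₁ (toℕ f) + c) in A₀ (toℕ z) ≤ v ⊎ dw ≤ v
        lower B z c arc low with mn-cases (B (toℕ z)) (E₁ (toℕ f) + c)
        ... | inj₁ (eq , _) = subst (λ v → A₀ (toℕ z) ≤ v ⊎ dw ≤ v) (sym eq) low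
        ... | inj₂ (eq , le) = subst (λ v → A₀ (toℕ z) ≤ v ⊎ dw ≤ v) (sym eq) below-new
          where
          below-new : A₀ (toℕ z) ≤ E₁ (toℕ f) + c ⊎ dw ≤ E₁ (toℕ f) + c
          below-new with mn-cases (E (toℕ f)) (dw + pen f w)
          ... | inj₁ (eq′ , _) = [ (λ p → inj₁ (≤-trans p arc′)) , (λ p → inj₂ (≤-trans p arc′)) ]′ low
            where
            arc′ : B (toℕ z) ≤ E₁ (toℕ f) + c
            arc′ = subst (λ e → B (toℕ z) ≤ e + c) (sym (trans E₁f eq′)) arc
          ... | inj₂ (eq′ , _) = inj₂ (≤-trans (m≤m+n dw (pen f w)) (≤-trans (≤-reflexive (sym (trans E₁f eq′))) (m≤m+n (E₁ (toℕ f)) c)))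

        new-sound : ∀ (z : Fin n) a c → a ≤ V × (a ≡ V ⊎ SD z a) → (∀ {d} → SE f d → SD z (d + c)) →
                    let v = mn a (E₁ (toℕ f) + c) in v ≤ V × (v ≡ V ⊎ SD z v)
        new-sound z a c old rule = mn-elim {λ v → v ≤ V × (v ≡ V ⊎ SD z v)} a (E₁ (toℕ f) + c) old
          λ le → ≤-trans le (proj₁ old) ,
            [ (λ eq → inj₁ (≤-antisym (≤-trans le (proj₁ old)) (subst (_≤ E₁ (toℕ f) + c) eq (m≤m+n (E₁ (toℕ f)) c))))
            , (λ se → inj₂ (rule se)) ]′ (proj₂ (E₁-sound f))

        A₁-mono : ∀ (z : Fin n) → A₁ (toℕ z) ≤ A (toℕ z)
        A₁-mono = set-elim A (λ z a → a ≤ A (toℕ z)) (hi f) (mn-≤ˡ (A (toℕ (hi f))) (E₁ (toℕ f) + cH f)) (λ _ _ → ≤-refl)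

        A₂-mono : ∀ (z : Fin n) → A₂ (toℕ z) ≤ A₁ (toℕ z)
        A₂-mono = set-elim A₁ (λ z a → a ≤ A₁ (toℕ z)) (lo f) (mn-≤ˡ (A₁ (toℕ (lo f))) (E₁ (toℕ f) + cL f)) (λ _ _ → ≤-refl)

        A₁-sound : SndA A₁
        A₁-sound = set-elim A (λ z a → a ≤ V × (a ≡ V ⊎ SD z a)) (hi f)
          (new-sound (hi f) (A (toℕ (hi f))) (cH f) (A-sound L (hi f)) SE⇒SH) (λ z _ → A-sound L z)

        A₂-sound : SndA A₂
        A₂-sound = set-elim A₁ (λ z a → a ≤ V × (a ≡ V ⊎ SD z a)) (lo f)
          (new-sound (lo f) (A₁ (toℕ (lo f))) (cL f) (A₁-sound (lo f)) SE⇒SL) (λ z _ → A₁-sound z)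

        A₁-low : ∀ (z : Fin n) → A₀ (toℕ z) ≤ A₁ (toℕ z) ⊎ dw ≤ A₁ (toℕ z)
        A₁-low = set-elim A (λ z a → A₀ (toℕ z) ≤ a ⊎ dw ≤ a) (hi f)
          (lower A (hi f) (cH f) (proj₁ (arcs L f)) (A-low R (hi f))) (λ z _ → A-low R z)

        A₂-low : ∀ (z : Fin n) → A₀ (toℕ z) ≤ A₂ (toℕ z) ⊎ dw ≤ A₂ (toℕ z)
        A₂-low = set-elim A₁ (λ z a → A₀ (toℕ z) ≤ a ⊎ dw ≤ a) (lo f)
          (lower A₁ (lo f) (cL f) (≤-trans (A₁-mono (lo f)) (proj₂ (arcs L f))) (A₁-low (lo f))) (λ z _ → A₁-low z)

        arcs₂ : Arcs A₂ E₁
        arcs₂ = set-elim E (λ g e → A₂ (toℕ (hi g)) ≤ e + cH g × A₂ (toℕ (lo g)) ≤ e + cL g) f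
          (≤-trans (A₂-mono (hi f)) (≤-trans (≤-reflexive (set-same A (toℕ (hi f)) h₁))
             (subst (λ e → h₁ ≤ e + cH f) E₁f (mn-≤ʳ (A (toℕ (hi f))) (E₁ (toℕ f) + cH f)))) ,
           ≤-trans (≤-reflexive (set-same A₁ (toℕ (lo f)) l₁))
             (subst (λ e → l₁ ≤ e + cL f) E₁f (mn-≤ʳ (A₁ (toℕ (lo f))) (E₁ (toℕ f) + cL f))))
          (λ g _ → ≤-trans (A₂-mono (hi g)) (≤-trans (A₁-mono (hi g)) (proj₁ (arcs L g))) ,
                   ≤-trans (A₂-mono (lo g)) (≤-trans (A₁-mono (lo g)) (proj₂ (arcs L g))))

        result : Relaxed A₀ E₀ w (suc (toℕ f)) A₂ E₁
        result = record
          { labels = record { A-sound = A₂-sound ; E-sound = E₁-sound ; arcs = arcs₂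
                            ; A-s = stays s (A-s L) ; A-t = stays t (A-t L) }
          ; A-mono = λ z → ≤-trans (A₂-mono z) (≤-trans (A₁-mono z) (A-mono R z))
          ; A-low = A₂-low
          ; E-mono = λ g → ≤-trans (E₁-mono g) (E-mono R g)
          ; E-done = set-elim E (λ g e → toℕ g < suc (toℕ f) → Btw g w → e ≤ dw) f
              (λ _ b → [ (λ (_ , eq) → ≤-trans (mn-≤ʳ (E (toℕ f)) (dw + pen f w)) (≤-reflexive (trans (cong (dw +_) eq) (+-identityʳ dw))))
                       , (λ (nb , _) → ⊥-elim (nb b)) ]′ (pen-cases f w))
              (λ g ne lt b → E-done R g (≤∧≢⇒< (≤-pred lt) (ne ∘ sym ∘ Fin.toℕ-injective)) b)
          }
          where
          stays : ∀ (z : Fin n) → A (toℕ z) ≡ 0 → A₂ (toℕ z) ≡ 0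
          stays z eq = n≤0⇒n≡0 (≤-trans (A₂-mono z) (≤-trans (A₁-mono z) (≤-reflexive eq)))

      -- The vertices π p with p < r have been scanned.
      record Scanned (r : ℕ) (π : Fin n → Fin n) (A E : ℕ → ℕ) : Set where
        field
          labels : Labels A E
          onto   : ∀ z → ∃[ p ] π p ≡ z
          order  : ∀ p q → toℕ p < r → r ≤ toℕ q → A (toℕ (π p)) ≤ A (toℕ (π q))
          done   : ∀ p f → toℕ p < r → Btw f (π p) → E (toℕ f) ≤ A (toℕ (π p))

      swap : (Fin n → Fin n) → Fin n → Fin n → Fin n → Fin n
      swap π r b p with p Fin.≟ r | p Fin.≟ b
      ... | yes _ | _     = π b
      ... | no _  | yes _ = π r
      ... | no _  | no _  = π p

      swap-r : ∀ π r b → swap π r b r ≡ π b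
      swap-r π r b with r Fin.≟ r
      ... | yes _ = refl
      ... | no ne = ⊥-elim (ne refl)

      swap-b : ∀ π r b → swap π r b b ≡ π r
      swap-b π r b with b Fin.≟ r | b Fin.≟ b
      ... | yes refl | _   = refl
      ... | no _ | yes _   = refl
      ... | no _ | no ne   = ⊥-elim (ne refl)

      swap-other : ∀ π {r b p} → p ≢ r → p ≢ b → swap π r b p ≡ π p
      swap-other π {r} {b} {p} nr nb with p Fin.≟ r | p Fin.≟ b
      ... | yes eq | _      = ⊥-elim (nr eq)
      ... | no _   | yes eq = ⊥-elim (nb eq)
      ... | no _   | no _   = refl

      swap-onto : ∀ π r b → (∀ z → ∃[ p ] π p ≡ z) → ∀ z → ∃[ p ] swap π r b p ≡ z
      swap-onto π r b onto z with onto z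
      ... | p , eq with p Fin.≟ r | p Fin.≟ b
      ... | yes refl | _        = b , trans (swap-b π r b) eq
      ... | no _     | yes refl = r , trans (swap-r π r b) eq
      ... | no nr    | no nb    = p , trans (swap-other π nr nb) eq

      swap-≥ : ∀ π r b q (P : Fin n → Set) → toℕ r ≤ toℕ b → (∀ q → toℕ r ≤ toℕ q → P (π q)) → toℕ r ≤ toℕ q → P (swap π r b q)
      swap-≥ π r b q P rb h rq with q Fin.≟ r | q Fin.≟ b
      ... | yes _ | _     = h b rb
      ... | no _  | yes _ = h r ≤-refl
      ... | no _  | no _  = h q rq

      scan-step : ∀ r b π A₀ E₀ A E → toℕ r ≤ toℕ b → (∀ q → toℕ r ≤ toℕ q → A₀ (toℕ (π b)) ≤ A₀ (toℕ (π q))) →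
                  Scanned (toℕ r) π A₀ E₀ → Relaxed A₀ E₀ (π b) m A E → Scanned (suc (toℕ r)) (swap π r b) A E
      scan-step r b π A₀ E₀ A E rb best S R = record
        { labels = Relaxed.labels R
        ; onto   = swap-onto π r b (Scanned.onto S)
        ; order  = order′
        ; done   = done′
        }
        where
        w  = π b
        dw = A₀ (toℕ w)
        old : ∀ p → toℕ p < toℕ r → swap π r b p ≡ π p
        old p lt = swap-other π (λ { refl → <-irrefl refl lt }) (λ { refl → <-irrefl refl (<-≤-trans lt rb) })
        old≤dw : ∀ p → toℕ p < toℕ r → A₀ (toℕ (π p)) ≤ dw
        old≤dw p lt = Scanned.order S p b lt rb
        -- Labels not above that of the scanned vertex are final: by `A-low`, even a drop would not
        -- take them below `dw`.
        kept : ∀ z → A₀ (toℕ z) ≤ dw → A₀ (toℕ z) ≤ A (toℕ z)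
        kept z le = [ id , ≤-trans le ]′ (A-low R z)
        later : ∀ q → suc (toℕ r) ≤ toℕ q → dw ≤ A (toℕ (swap π r b q))
        later q rq = swap-≥ π r b q (λ z → dw ≤ A (toℕ z)) rb
          (λ q′ h → [ ≤-trans (best q′ h) , id ]′ (A-low R (π q′))) (<⇒≤ rq)
        order′ : ∀ p q → toℕ p < suc (toℕ r) → suc (toℕ r) ≤ toℕ q → A (toℕ (swap π r b p)) ≤ A (toℕ (swap π r b q))
        order′ p q lt rq with m<1+n⇒m<n∨m≡n lt
        ... | inj₁ lt′ = subst (λ z → A (toℕ z) ≤ A (toℕ (swap π r b q))) (sym (old p lt′))
                           (≤-trans (A-mono R (π p)) (≤-trans (old≤dw p lt′) (later q rq)))
        ... | inj₂ eq with Fin.toℕ-injective eq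
        ... | refl = subst (λ z → A (toℕ z) ≤ A (toℕ (swap π r b q))) (sym (swap-r π r b)) (≤-trans (A-mono R w) (later q rq))
        done′ : ∀ p f → toℕ p < suc (toℕ r) → Btw f (swap π r b p) → E (toℕ f) ≤ A (toℕ (swap π r b p))
        done′ p f lt bt with m<1+n⇒m<n∨m≡n lt
        ... | inj₁ lt′ = subst (λ z → E (toℕ f) ≤ A (toℕ z)) (sym (old p lt′))
              (≤-trans (E-mono R f) (≤-trans (Scanned.done S p f lt′ (subst (Btw f) (old p lt′) bt)) (kept (π p) (old≤dw p lt′))))
        ... | inj₂ eq with Fin.toℕ-injective eq
        ... | refl = subst (λ z → E (toℕ f) ≤ A (toℕ z)) (sym (swap-r π r b))
              (≤-trans (E-done R f (Fin.toℕ<n f) (subst (Btw f) (swap-r π r b) bt)) (kept w ≤-refl))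

    Env : Store → Set
    Env τ = τ 0 ≡ inp × τ 2 ≡ con × τ 10 ≡ Dv × τ 14 ≡ anc

    private
      relaxPairs-correct : ∀ {A₀ E₀ w} (e : Fin m) (ρ : Store) → ρ 5 0 ≡ toℕ e → Env ρ → ρ 20 0 ≡ A₀ (toℕ w) → ρ 21 0 ≡ toℕ w →
        A₀ (toℕ w) ≡ V ⊎ SD w (A₀ (toℕ w)) →
        Relaxed A₀ E₀ w (toℕ e) (ρ 17) (ρ 18) → Relaxed A₀ E₀ w (suc (toℕ e)) (sem relaxPairsP ρ 17) (sem relaxPairsP ρ 18)
      relaxPairs-correct {A₀} {E₀} {w} e ρ ctr (q₀ , q₂ , q₁₀ , q₁₄) qd qw ws R
        rewrite ctr | q₀ | q₂ | q₁₀ | q₁₄ | qd | qw | inp-n | inp-lo e | inp-hi e | inp-ℓ e =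
        RelaxStep.result A₀ E₀ w ws e (ρ 17) (ρ 18) R

      Perm : (Fin n → Fin n) → (ℕ → ℕ) → Set
      Perm π f = ∀ (p : Fin n) → f (toℕ p) ≡ toℕ (π p)

      best-correct : ∀ (τ : Store) (r : Fin n) (π : Fin n → Fin n) → Env τ → τ 4 0 ≡ toℕ r → Perm π (τ 16) →
        ∃[ b ] sem bestP τ 19 0 ≡ toℕ b × toℕ r ≤ toℕ b × (∀ q → toℕ r ≤ toℕ q → τ 17 (toℕ (π b)) ≤ τ 17 (toℕ (π q)))
      best-correct τ r π (q₀ , _) qr pm with
        for-ind 7 1 pick τ₁ (trans (cong (λ f → f 1) q₀) inp-n)
          (λ k ρ → ∃[ b ] ρ 19 0 ≡ toℕ b × toℕ r ≤ toℕ b × (∀ q → toℕ q < k → toℕ r ≤ toℕ q → τ 17 (toℕ (π b)) ≤ τ 17 (toℕ (π q))))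
          (r , qr , ≤-refl , λ _ ()) step
        where
        τ₁ = sem (19 [ lit 0 ]:= $$ 4) τ
        pick = ifz (leE ($$ 4) ($$ 7) ⊗ (17 ⟦ 16 ⟦ $$ 19 ⟧ ⟧ ⊖ 17 ⟦ 16 ⟦ $$ 7 ⟧ ⟧)) nop (19 [ lit 0 ]:= $$ 7)
        Inv : ℕ → Store → Set
        Inv k ρ = ∃[ b ] ρ 19 0 ≡ toℕ b × toℕ r ≤ toℕ b × (∀ q → toℕ q < k → toℕ r ≤ toℕ q → τ 17 (toℕ (π b)) ≤ τ 17 (toℕ (π q)))
        step : ∀ (k : Fin n) (ρ : Store) → ρ 7 0 ≡ toℕ k → (∀ c → T (not ((7 ≡ᵇ c) ∨ writes pick c)) → ρ c ≡ τ₁ c) →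
               Inv (toℕ k) ρ → Inv (suc (toℕ k)) (setCell 7 0 (suc (toℕ k)) (sem pick ρ))
        step k ρ ctr fr (b , qb , rb , best) = caseZ-elim (λ ρ′ → Inv (suc (toℕ k)) (setCell 7 0 (suc (toℕ k)) ρ′)) (eval ρ test) keep change
          where
          test = leE ($$ 4) ($$ 7) ⊗ (17 ⟦ 16 ⟦ $$ 19 ⟧ ⟧ ⊖ 17 ⟦ 16 ⟦ $$ 7 ⟧ ⟧)
          val : eval ρ test ≡ (1 ∸ (toℕ r ∸ toℕ k)) * (τ 17 (toℕ (π b)) ∸ τ 17 (toℕ (π k)))
          val rewrite fr 4 tt | fr 16 tt | fr 17 tt | ctr | qb | qr | pm b | pm k = refl
          extend : ∀ {b} → (toℕ r ≤ toℕ k → τ 17 (toℕ (π b)) ≤ τ 17 (toℕ (π k))) →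
                   (∀ q → toℕ q < toℕ k → toℕ r ≤ toℕ q → τ 17 (toℕ (π b)) ≤ τ 17 (toℕ (π q))) →
                   ∀ q → toℕ q < suc (toℕ k) → toℕ r ≤ toℕ q → τ 17 (toℕ (π b)) ≤ τ 17 (toℕ (π q))
          extend h g q lt rq with m<1+n⇒m<n∨m≡n lt
          ... | inj₁ lt′ = g q lt′ rq
          ... | inj₂ eq with Fin.toℕ-injective eq
          ... | refl = h rq
          keep : eval ρ test ≡ 0 → Inv (suc (toℕ k)) (setCell 7 0 (suc (toℕ k)) ρ)
          keep z = b , qb , rb , extend {b} le best
            where
            le : toℕ r ≤ toℕ k → τ 17 (toℕ (π b)) ≤ τ 17 (toℕ (π k))
            le rk = m∸n≡0⇒m≤n (trans (sym (+-identityʳ (τ 17 (toℕ (π b)) ∸ τ 17 (toℕ (π k))))) (trans (cong (λ j → (1 ∸ j) * (τ 17 (toℕ (π b)) ∸ τ 17 (toℕ (π k)))) (sym (m≤n⇒m∸n≡0 rk))) (trans (sym val) z)))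
          change : eval ρ test ≢ 0 → Inv (suc (toℕ k)) (setCell 7 0 (suc (toℕ k)) (setCell 19 0 (ρ 7 0) ρ))
          change nz = k , ctr , rk , extend {k} (λ _ → ≤-refl) (λ q lt rq → ≤-trans (<⇒≤ kb) (best q lt rq))
            where
            split : ∀ x y → x * y ≢ 0 → x ≢ 0 × y ≢ 0
            split x y h = (λ { refl → h refl }) , (λ { refl → h (*-zeroʳ x) })
            nz′ = split (1 ∸ (toℕ r ∸ toℕ k)) (τ 17 (toℕ (π b)) ∸ τ 17 (toℕ (π k))) (subst (_≢ 0) val nz)
            rk : toℕ r ≤ toℕ k
            rk with toℕ r ∸ toℕ k in eq
            ... | zero  = m∸n≡0⇒m≤n eq
            ... | suc j = ⊥-elim (proj₁ nz′ (trans (cong (1 ∸_) eq) (0∸n≡0 j)))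
            kb : τ 17 (toℕ (π k)) < τ 17 (toℕ (π b))
            kb = m∸n≢0⇒n<m (proj₂ nz′)
      ... | b , qb , rb , best = b , qb , rb , λ q rq → best q (Fin.toℕ<n q) rq

      swap-correct : ∀ (τ : Store) (r b : Fin n) (π : Fin n → Fin n) → τ 4 0 ≡ toℕ r → τ 19 0 ≡ toℕ b → Perm π (τ 16) →
        Perm (swap π r b) (sem swapP τ 16) × sem swapP τ 21 0 ≡ toℕ (π b) × sem swapP τ 20 0 ≡ τ 17 (toℕ (π b))
      swap-correct τ r b π qr qb pm rewrite qr | qb | pm b | pm r =
        set-elim (set (τ 16) (toℕ b) (toℕ (π r))) (λ p v → v ≡ toℕ (swap π r b p)) r (cong toℕ (sym (swap-r π r b)))
          (λ p ne → set-elim (τ 16) (λ p v → r ≢ p → v ≡ toℕ (swap π r b p)) b (λ _ → cong toℕ (sym (swap-b π r b)))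
            (λ p nb nr → trans (pm p) (cong toℕ (sym (swap-other π (≢-sym nr) (≢-sym nb))))) p ne) ,
        refl , refl

    -- Together with `arcs`, `closed` gives the hypothesis of `Closed`: the label at one end of an
    -- edge is at most that of any vertex between its ends plus a reduced length.
    record Shortest (A E : ℕ → ℕ) : Set where
      field
        labelled : Labels A E
        closed   : ∀ f w → Btw f w → E (toℕ f) ≤ A (toℕ w)

    dijkstra-correct : ∀ (σ : Store) → Env σ → σ 8 0 ≡ toℕ s → σ 9 0 ≡ toℕ t →
                       Shortest (sem dijkstra σ 17) (sem dijkstra σ 18)
    dijkstra-correct σ env es et = conclude (sem dijkstra σ 17) (sem dijkstra σ 18) final
      where
      init₁ = for 6 1 ((17 [ $$ 6 ]:= CAP) ⨟ (16 [ $$ 6 ]:= $$ 6))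
      init₂ = for 5 2 (18 [ $$ 5 ]:= CAP)
      σ₁ = sem init₁ σ
      σ₂ = sem ((17 [ $$ 8 ]:= lit 0) ⨟ (17 [ $$ 9 ]:= lit 0)) σ₁
      σ₃ = sem init₂ σ₂
      n-eq : ∀ (τ : Store) → τ 0 ≡ inp → τ 0 1 ≡ n
      n-eq τ q = trans (cong (λ f → f 1) q) inp-n
      m-eq : ∀ (τ : Store) → τ 0 ≡ inp → τ 0 2 ≡ m
      m-eq τ q = trans (cong (λ f → f 2) q) inp-m
      env-frame : ∀ (τ ρ : Store) → Env ρ → τ 0 ≡ ρ 0 → τ 2 ≡ ρ 2 → τ 10 ≡ ρ 10 → τ 14 ≡ ρ 14 → Env τ
      env-frame τ ρ (a , b , c , d) p q r s = trans p a , trans q b , trans r c , trans s d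
      env₁ : Env σ₁
      env₁ = env-frame σ₁ σ env (frame init₁ σ 0 tt) (frame init₁ σ 2 tt) (frame init₁ σ 10 tt) (frame init₁ σ 14 tt)
      env₃ : Env σ₃
      env₃ = env-frame σ₃ σ₂ env₁ (frame init₂ σ₂ 0 tt) (frame init₂ σ₂ 2 tt) (frame init₂ σ₂ 10 tt) (frame init₂ σ₂ 14 tt)
      IsV : ∀ {N} → Fin N → ℕ → Set
      IsV _ v = v ≡ V
      filled : Below {n} IsV n (σ₁ 17) × Below (λ (z : Fin n) v → v ≡ toℕ z) n (σ₁ 16)
      filled = for-ind 6 1 ((17 [ $$ 6 ]:= CAP) ⨟ (16 [ $$ 6 ]:= $$ 6)) σ (n-eq σ (proj₁ env))
        (λ k τ → Below {n} IsV k (τ 17) × Below (λ (z : Fin n) v → v ≡ toℕ z) k (τ 16))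
        ((λ _ ()) , (λ _ ())) λ k τ ctr fr (P , Q) →
          subst₂ (λ a b → Below {n} IsV (suc (toℕ k)) (set (τ 17) a b)) (sym ctr)
            (sym (cong (λ f → f 0) (trans (fr 2 tt) (proj₁ (proj₂ env))))) (table-step (τ 17) IsV k refl P) ,
          subst (λ a → Below {n} (λ z v → v ≡ toℕ z) (suc (toℕ k)) (set (τ 16) a a)) (sym ctr)
            (table-step (τ 16) (λ z v → v ≡ toℕ z) k refl Q)
      filledE : Below {m} IsV m (σ₃ 18)
      filledE = for-ind 5 2 (18 [ $$ 5 ]:= CAP) σ₂ (m-eq σ₂ (proj₁ env₁)) (λ k τ → Below {m} IsV k (τ 18)) (λ _ ())
        λ k τ ctr fr P → subst₂ (λ a b → Below {m} IsV (suc (toℕ k)) (set (τ 18) a b)) (sym ctr)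
          (sym (cong (λ f → f 0) (trans (fr 2 tt) (proj₁ (proj₂ env₁))))) (table-step (τ 18) IsV k refl P)
      A₀ : σ₃ 17 ≡ set (set (σ₁ 17) (toℕ s) 0) (toℕ t) 0
      A₀ = trans (frame init₂ σ₂ 17 tt) (cong₂ (λ a b → set (set (σ₁ 17) a 0) b 0)
             (trans (cong (λ f → f 0) (frame init₁ σ 8 tt)) es) (trans (cong (λ f → f 0) (frame init₁ σ 9 tt)) et))
      start : ∀ A → A ≡ set (set (σ₁ 17) (toℕ s) 0) (toℕ t) 0 → Labels A (σ₃ 18)
      start A refl = record
        { A-sound = sound
        ; E-sound = λ f → ≤-reflexive (filledE f (Fin.toℕ<n f)) , inj₁ (filledE f (Fin.toℕ<n f))
        ; arcs = λ f → ≤-trans (≤-trans (proj₁ (sound (hi f))) (≤-reflexive (sym (filledE f (Fin.toℕ<n f))))) (m≤m+n _ (cH f)) ,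
                       ≤-trans (≤-trans (proj₁ (sound (lo f))) (≤-reflexive (sym (filledE f (Fin.toℕ<n f))))) (m≤m+n _ (cL f))
        ; A-s = set-elim (set (σ₁ 17) (toℕ s) 0) (λ z v → z ≡ s → v ≡ 0) t (λ _ → refl)
                  (λ y _ → set-elim (σ₁ 17) (λ z v → z ≡ s → v ≡ 0) s (λ _ → refl) (λ z ne eq → ⊥-elim (ne (sym eq))) y) s refl
        ; A-t = set-same (set (σ₁ 17) (toℕ s) 0) (toℕ t) 0 }
        where
        sound : SndA A
        sound = set-elim (set (σ₁ 17) (toℕ s) 0) (λ z a → a ≤ V × (a ≡ V ⊎ SD z a)) t (z≤n , inj₂ SD-t)
          (λ y _ → set-elim (σ₁ 17) (λ z a → a ≤ V × (a ≡ V ⊎ SD z a)) s (z≤n , inj₂ SD-s)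
            (λ z _ → ≤-reflexive (proj₁ filled z (Fin.toℕ<n z)) , inj₁ (proj₁ filled z (Fin.toℕ<n z))) y)
      Inv : ℕ → Store → Set
      Inv r τ = ∃[ π ] Perm π (τ 16) × Scanned r π (τ 17) (τ 18)
      body = bestP ⨟ swapP ⨟ for 5 2 relaxPairsP
      step : ∀ (r : Fin n) (τ : Store) → τ 4 0 ≡ toℕ r → Env τ → Inv (toℕ r) τ → Inv (suc (toℕ r)) (sem body τ)
      step r τ ctr envτ (π , pm , S) with best-correct τ r π envτ ctr pm
      ... | b , qb , rb , best = swap π r b ,
            subst (λ f → Perm (swap π r b) f) (sym (frame (for 5 2 relaxPairsP) τ₂ 16 tt)) (proj₁ sw) ,
            scan-step r b π (τ 17) (τ 18) (sem body τ 17) (sem body τ 18) rb best S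
              (for-ind 5 2 relaxPairsP τ₂ (m-eq τ₂ (proj₁ env₂)) (λ k ρ → Relaxed (τ 17) (τ 18) (π b) k (ρ 17) (ρ 18))
                (subst (λ A → Relaxed (τ 17) (τ 18) (π b) 0 A (τ₁ 18)) (sym (frame bestP τ 17 tt))
                  (subst (λ E → Relaxed (τ 17) (τ 18) (π b) 0 (τ 17) E) (sym (frame bestP τ 18 tt)) (record
                  { labels = Scanned.labels S ; A-mono = λ _ → ≤-refl ; A-low = λ _ → inj₁ ≤-refl
                  ; E-mono = λ _ → ≤-refl ; E-done = λ _ () })))
                λ e ρ ctr′ fr R → relaxPairs-correct {τ 17} {τ 18} {π b} e ρ ctr′
                  (env-frame ρ τ₂ env₂ (fr 0 tt) (fr 2 tt) (fr 10 tt) (fr 14 tt))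
                  (trans (cong (λ f → f 0) (fr 20 tt)) (trans (proj₂ (proj₂ sw)) (cong (λ f → f (toℕ (π b))) (frame bestP τ 17 tt))))
                  (trans (cong (λ f → f 0) (fr 21 tt)) (proj₁ (proj₂ sw)))
                  (proj₂ (A-sound (Scanned.labels S) (π b))) R)
        where
        τ₁ = sem bestP τ
        τ₂ = sem swapP τ₁
        env₂ : Env τ₂
        env₂ = env-frame τ₂ τ envτ (frame bestP τ 0 tt) (frame bestP τ 2 tt) (frame bestP τ 10 tt) (frame bestP τ 14 tt)
        sw = swap-correct τ₁ r b π (trans (cong (λ f → f 0) (frame bestP τ 4 tt)) ctr) qb
               (λ p → trans (cong (λ f → f (toℕ p)) (frame bestP τ 16 tt)) (pm p))
      final : Inv n (sem (for 4 1 body) σ₃)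
      final = for-ind 4 1 body σ₃ (n-eq σ₃ (proj₁ env₃)) Inv
        (id , (λ p → trans (cong (λ f → f (toℕ p)) (frame init₂ σ₂ 16 tt)) (proj₂ filled p (Fin.toℕ<n p))) ,
          record { labels = start (σ₃ 17) A₀ ; onto = λ z → z , refl ; order = λ _ _ () ; done = λ _ _ () })
        λ r τ ctr fr inv → step r τ ctr (env-frame τ σ₃ env₃ (fr 0 tt) (fr 2 tt) (fr 10 tt) (fr 14 tt)) inv
      conclude : ∀ (A E : ℕ → ℕ) → (∃[ π ] Perm π (sem (for 4 1 body) σ₃ 16) × Scanned n π A E) → Shortest A E
      conclude A E (π , _ , S) = record { labelled = Scanned.labels S ; closed = cl }
        where
        cl : ∀ f w → Btw f w → E (toℕ f) ≤ A (toℕ w)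
        cl f w b with Scanned.onto S w
        ... | p , refl = Scanned.done S p f (Fin.toℕ<n p) b

-- The shortest path forest and its ancestor matrix

index-injective : ∀ {N M} (y z : Fin N) (w c : Fin M) → M * toℕ y + toℕ w ≡ M * toℕ z + toℕ c → y ≡ z × w ≡ c
index-injective y z w c eq = Fin.combine-injective y w z c
  (Fin.toℕ-injective (trans (Fin.toℕ-combine y w) (trans eq (sym (Fin.toℕ-combine z c)))))

set-elim₂ : ∀ {N M} f (P : Fin N → Fin M → ℕ → Set) z c {v} → P z c v →
            (∀ y w → y ≢ z ⊎ w ≢ c → P y w (f (M * toℕ y + toℕ w))) →
            ∀ y w → P y w (set f (M * toℕ z + toℕ c) v (M * toℕ y + toℕ w))
set-elim₂ {M = M} f P z c {v} pv pf y w with y Fin.≟ z | w Fin.≟ c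
... | yes refl | yes refl = subst (P z c) (sym (set-same f (M * toℕ z + toℕ c) v)) pv
... | no ny    | _        = subst (P y w) (sym (set-other f v (λ eq → ny (sym (proj₁ (index-injective z y c w eq)))))) (pf y w (inj₁ ny))
... | yes _    | no nw    = subst (P y w) (sym (set-other f v (λ eq → nw (sym (proj₂ (index-injective z y c w eq)))))) (pf y w (inj₂ nw))

parentP parents ancestors : Prog
parentP =
  -- The two differences add up to zero exactly if the edge is tight. A source keeps itself as its
  -- parent, since its distance is 0 and edges have positive length.
  ifz (10 ⟦ l ⟧ ⊕ len# ($$ 5) ⊖ 10 ⟦ h ⟧ ⊕ (10 ⟦ h ⟧ ⊖ (10 ⟦ l ⟧ ⊕ len# ($$ 5)))) (13 [ h ]:= l) nop ⨟
  ifz (10 ⟦ h ⟧ ⊕ len# ($$ 5) ⊖ 10 ⟦ l ⟧ ⊕ (10 ⟦ l ⟧ ⊖ (10 ⟦ h ⟧ ⊕ len# ($$ 5)))) (13 [ l ]:= h) nop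
  where
  h = hi# ($$ 5)
  l = lo# ($$ 5)
parents =
  for 6 1 (13 [ $$ 6 ]:= $$ 6) ⨟
  for 5 2 parentP
ancestors = for 6 1 (
  (15 [ lit 0 ]:= $$ 6) ⨟
  for 5 1 (14 [ n# ⊗ $$ 6 ⊕ $$ 5 ]:= lit 0) ⨟
  -- A root path has fewer than n edges, so n marks reach every ancestor; at a source, which is its
  -- own parent, the walk simply stays.
  for 7 1 ((14 [ n# ⊗ $$ 6 ⊕ $$ 15 ]:= lit 1) ⨟ (15 [ lit 0 ]:= 13 ⟦ $$ 15 ⟧)))

module Parents {n m} (I : Instance n m) (In : Input I) (Dv : ℕ → ℕ) where

  open Instance I using (graph; ℓ)
  open Graph graph
  open Input In

  d : Fin n → ℕ
  d z = Dv (toℕ z)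

  Tight : Fin m → Fin n → Fin n → Set
  Tight e z x = Joins e z x × d z ≡ d x + ℓ e

  -- `Pr` tells which edges have been examined, and from which end. Once all are, a vertex that is
  -- still its own parent has no tight edge at all.
  ParentOf : (Fin m → Fin n → Set) → Fin n → ℕ → Set
  ParentOf Pr z v = (∃[ e ] ∃[ x ] Tight e z x × v ≡ toℕ x) ⊎ (v ≡ toℕ z × (∀ e x → Pr e z → ¬ Tight e z x))

  private
    PInv : (Fin m → Fin n → Set) → (ℕ → ℕ) → Set
    PInv Pr f = ∀ (z : Fin n) → ParentOf Pr z (f (toℕ z))

    gap : ℕ → ℕ → ℕ
    gap a b = (a ∸ b) + (b ∸ a)

    gap≡0 : ∀ a b → gap a b ≡ 0 → b ≡ a
    gap≡0 a b eq = ≤-antisym (m∸n≡0⇒m≤n (m+n≡0⇒n≡0 (a ∸ b) eq)) (m∸n≡0⇒m≤n (m+n≡0⇒m≡0 (a ∸ b) eq))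

    gap-refl : ∀ {a b} → b ≡ a → gap a b ≡ 0
    gap-refl {a} refl = cong₂ _+_ (n∸n≡0 a) (n∸n≡0 a)

    half : ∀ {Pr Pr′ : Fin m → Fin n → Set} {e z x} f → Joins e z x →
           (∀ {e′ z′ x′} → Joins e′ z′ x′ → Pr′ e′ z′ → Pr e′ z′ ⊎ (e′ ≡ e × z′ ≡ z)) →
           PInv Pr f → PInv Pr′ (caseZ (gap (d x + ℓ e) (d z)) (set f (toℕ z) (toℕ x)) f)
    half {Pr} {Pr′} {e} {z} {x} f j new inv = caseZ-elim (PInv Pr′) (gap (d x + ℓ e) (d z)) tight loose
      where
      tight : gap (d x + ℓ e) (d z) ≡ 0 → PInv Pr′ (set f (toℕ z) (toℕ x))
      tight c = set-elim f (ParentOf Pr′) z (inj₁ (e , x , (j , gap≡0 (d x + ℓ e) (d z) c) , refl)) other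
        where
        other : ∀ z′ → z ≢ z′ → ParentOf Pr′ z′ (f (toℕ z′))
        other z′ ne with inv z′
        ... | inj₁ h        = inj₁ h
        ... | inj₂ (eq , h) = inj₂ (eq , λ e′ x′ pr t → [ (λ p → h e′ x′ p t) , (λ (_ , q) → ne (sym q)) ]′ (new (proj₁ t) pr))
      loose : gap (d x + ℓ e) (d z) ≢ 0 → PInv Pr′ f
      loose c z′ with inv z′
      ... | inj₁ h        = inj₁ h
      ... | inj₂ (eq , h) = inj₂ (eq , λ e′ x′ pr t → [ (λ p → h e′ x′ p t) , (λ { (refl , refl) → c (gap-refl (same t)) }) ]′ (new (proj₁ t) pr))
        where
        same : ∀ {x′} → Tight e z x′ → d z ≡ d x + ℓ e
        same {x′} (j′ , eq) with Walks.joins-ends graph j j′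
        ... | inj₁ (_ , refl)    = eq
        ... | inj₂ (refl , refl) = ⊥-elim (Walks.joins-≢ graph j refl)

    caseZ-array : ∀ c (ρ τ : Store) a → caseZ c ρ τ a ≡ caseZ c (ρ a) (τ a)
    caseZ-array zero    ρ τ a = refl
    caseZ-array (suc c) ρ τ a = refl

  parents-correct : ∀ (σ : Store) → σ 0 ≡ inp → σ 10 ≡ Dv → ∀ (z : Fin n) → ParentOf (λ _ _ → Unit) z (sem parents σ 13 (toℕ z))
  parents-correct σ q₀ q₁₀ z with for-ind 5 2 parentP σ₁ m-eq
      (λ k τ → PInv (λ e _ → toℕ e < k) (τ 13)) start scan z
    where
    init = for 6 1 (13 [ $$ 6 ]:= $$ 6)
    σ₁ = sem init σ
    q₀′ : σ₁ 0 ≡ inp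
    q₀′ = trans (frame init σ 0 tt) q₀
    m-eq : σ₁ 0 2 ≡ m
    m-eq = trans (cong (λ f → f 2) q₀′) inp-m
    Self : Fin n → ℕ → Set
    Self z v = v ≡ toℕ z
    filled : Below Self n (σ₁ 13)
    filled = for-ind 6 1 (13 [ $$ 6 ]:= $$ 6) σ (trans (cong (λ f → f 1) q₀) inp-n) (λ k τ → Below Self k (τ 13)) (λ _ ())
      λ k τ ctr fr P → subst (λ a → Below Self (suc (toℕ k)) (set (τ 13) a a)) (sym ctr) (table-step (τ 13) Self k refl P)
    start : PInv (λ e _ → toℕ e < 0) (σ₁ 13)
    start z = inj₂ (filled z (Fin.toℕ<n z) , λ _ _ ())
    body : ∀ (e : Fin m) (τ : Store) → τ 5 0 ≡ toℕ e → τ 0 ≡ inp → τ 10 ≡ Dv →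
           PInv (λ e′ _ → toℕ e′ < toℕ e) (τ 13) → PInv (λ e′ _ → toℕ e′ < suc (toℕ e)) (sem parentP τ 13)
    body e τ ctr p₀ p₁₀ inv = subst (PInv (λ e′ _ → toℕ e′ < suc (toℕ e))) (sym shape)
      (half {λ e′ z′ → toℕ e′ < toℕ e ⊎ (e′ ≡ e × z′ ≡ hi e)} _ (inj₁ (refl , refl))
        (λ j lt → [ (λ l → inj₁ (inj₁ l)) , (λ eq → last j (Fin.toℕ-injective eq)) ]′ (m<1+n⇒m<n∨m≡n lt))
        (half {λ e′ _ → toℕ e′ < toℕ e} (τ 13) (inj₂ (refl , refl)) (λ _ → id) inv))
      where
      last : ∀ {e′ z′ x′} → Joins e′ z′ x′ → e′ ≡ e → (toℕ e′ < toℕ e ⊎ (e′ ≡ e × z′ ≡ hi e)) ⊎ (e′ ≡ e × z′ ≡ lo e)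
      last (inj₁ (refl , _)) refl = inj₂ (refl , refl)
      last (inj₂ (_ , refl)) refl = inj₁ (inj₂ (refl , refl))
      F₁ : ℕ → ℕ
      F₁ = caseZ (gap (d (lo e) + ℓ e) (d (hi e))) (set (τ 13) (toℕ (hi e)) (toℕ (lo e))) (τ 13)
      τ₁ : Store
      τ₁ = caseZ (gap (d (lo e) + ℓ e) (d (hi e))) (setCell 13 (toℕ (hi e)) (toℕ (lo e)) τ) τ
      first : sem (ifz (10 ⟦ lo# ($$ 5) ⟧ ⊕ len# ($$ 5) ⊖ 10 ⟦ hi# ($$ 5) ⟧ ⊕ (10 ⟦ hi# ($$ 5) ⟧ ⊖ (10 ⟦ lo# ($$ 5) ⟧ ⊕ len# ($$ 5)))) (13 [ hi# ($$ 5) ]:= lo# ($$ 5)) nop) τ ≡ τ₁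
      first rewrite ctr | p₀ | p₁₀ | inp-lo e | inp-hi e | inp-ℓ e = refl
      at : ∀ b → T (not (13 ≡ᵇ b)) → τ₁ b ≡ τ b
      at b h = caseZ-elim {Store} (λ ρ → ρ b ≡ τ b) (gap (d (lo e) + ℓ e) (d (hi e)))
                 (λ _ → setCell-other 13 (toℕ (hi e)) (toℕ (lo e)) τ h) (λ _ → refl)
      shape : sem parentP τ 13 ≡ caseZ (gap (d (hi e) + ℓ e) (d (lo e))) (set F₁ (toℕ (lo e)) (toℕ (hi e))) F₁
      shape rewrite first | at 5 tt | at 0 tt | at 10 tt | ctr | p₀ | p₁₀ | inp-lo e | inp-hi e | inp-ℓ e =
        trans (caseZ-array (gap (d (hi e) + ℓ e) (d (lo e))) (setCell 13 (toℕ (lo e)) (toℕ (hi e)) τ₁) τ₁ 13)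
          (cong (λ f → caseZ (gap (d (hi e) + ℓ e) (d (lo e))) (set f (toℕ (lo e)) (toℕ (hi e))) f)
            (caseZ-array (gap (d (lo e) + ℓ e) (d (hi e))) (setCell 13 (toℕ (hi e)) (toℕ (lo e)) τ) τ 13))
    scan : ∀ (e : Fin m) (τ : Store) → τ 5 0 ≡ toℕ e → (∀ b → T (not ((5 ≡ᵇ b) ∨ writes parentP b)) → τ b ≡ σ₁ b) →
           PInv (λ e′ _ → toℕ e′ < toℕ e) (τ 13) → PInv (λ e′ _ → toℕ e′ < suc (toℕ e)) (sem parentP τ 13)
    scan e τ ctr fr inv = body e τ ctr (trans (fr 0 tt) q₀′) (trans (fr 10 tt) (trans (frame init σ 10 tt) q₁₀)) inv
  ... | inj₁ h = inj₁ h
  ... | inj₂ (eq , h) = inj₂ (eq , λ e x _ → h e x (Fin.toℕ<n e))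

module Ancestors {n m} (I : Instance n m) (In : Input I) (par : Fin n → Fin n) where

  open Input In

  iter : ℕ → Fin n → Fin n
  iter zero    z = z
  iter (suc j) z = par (iter j z)

  Row : ℕ → Fin n → (ℕ → ℕ) → Set
  Row k y f = ∀ (w : Fin n) → ((∃[ j ] j < k × iter j y ≡ w) × f (n * toℕ y + toℕ w) ≡ 1)
                            ⊎ ((∀ j → j < k → iter j y ≢ w) × f (n * toℕ y + toℕ w) ≡ 0)

  private
    Rows : ℕ → (ℕ → ℕ) → Set
    Rows k f = ∀ (y : Fin n) → toℕ y < k → Row n y f

    rows-set : ∀ f (z c : Fin n) v → Rows (toℕ z) f → Rows (toℕ z) (set f (n * toℕ z + toℕ c) v)
    rows-set f z c v R y lt w = subst
      (λ u → ((∃[ j ] j < n × iter j y ≡ w) × u ≡ 1) ⊎ ((∀ j → j < n → iter j y ≢ w) × u ≡ 0))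
      (sym (set-other f v (λ eq → <-irrefl (cong toℕ (sym (proj₁ (index-injective z y c w eq)))) lt))) (R y lt w)

    mark : ∀ f (z : Fin n) k → Row k z f → Row (suc k) z (set f (n * toℕ z + toℕ (iter k z)) 1)
    mark f z k R = λ w → set-elim₂ f
        (λ y w v → y ≡ z → ((∃[ j ] j < suc k × iter j z ≡ w) × v ≡ 1) ⊎ ((∀ j → j < suc k → iter j z ≢ w) × v ≡ 0))
        z (iter k z) (λ _ → inj₁ ((k , ≤-refl , refl) , refl)) old z w refl
      where
      old : ∀ y w → y ≢ z ⊎ w ≢ iter k z → y ≡ z →
            ((∃[ j ] j < suc k × iter j z ≡ w) × f (n * toℕ y + toℕ w) ≡ 1) ⊎ ((∀ j → j < suc k → iter j z ≢ w) × f (n * toℕ y + toℕ w) ≡ 0)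
      old y w (inj₁ ne) eq = ⊥-elim (ne eq)
      old y w (inj₂ ne) refl with R w
      ... | inj₁ ((j , lt , h) , v) = inj₁ ((j , m<n⇒m<1+n lt , h) , v)
      ... | inj₂ (h , v) = inj₂ ((λ j lt eq → [ (λ l → h j l eq) , (λ { refl → ne (sym eq) }) ]′ (m<1+n⇒m<n∨m≡n lt)) , v)

  ancestors-correct : ∀ (σ : Store) → σ 0 ≡ inp → (∀ z → σ 13 (toℕ z) ≡ toℕ (par z)) → ∀ z → Row n z (sem ancestors σ 14)
  ancestors-correct σ q₀ qp z = for-ind 6 1 body σ (n-eq σ q₀) (λ k τ → Rows k (τ 14)) (λ _ ()) step z (Fin.toℕ<n z)
    where
    clear mk body : Prog
    clear = 14 [ n# ⊗ $$ 6 ⊕ $$ 5 ]:= lit 0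
    mk    = (14 [ n# ⊗ $$ 6 ⊕ $$ 15 ]:= lit 1) ⨟ (15 [ lit 0 ]:= 13 ⟦ $$ 15 ⟧)
    body  = (15 [ lit 0 ]:= $$ 6) ⨟ for 5 1 clear ⨟ for 7 1 mk
    n-eq : ∀ (τ : Store) → τ 0 ≡ inp → τ 0 1 ≡ n
    n-eq τ q = trans (cong (λ f → f 1) q) inp-n
    step : ∀ (z : Fin n) (τ : Store) → τ 6 0 ≡ toℕ z → (∀ b → T (not ((6 ≡ᵇ b) ∨ writes body b)) → τ b ≡ σ b) →
           Rows (toℕ z) (τ 14) → Rows (suc (toℕ z)) (sem body τ 14)
    step z τ ctr fr R y lt = [ proj₁ final y , (λ eq → subst (λ y → Row n y (sem body τ 14)) (sym (Fin.toℕ-injective eq)) (proj₁ (proj₂ final))) ]′ (m<1+n⇒m<n∨m≡n lt)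
      where
      τ₁ = sem (15 [ lit 0 ]:= $$ 6) τ
      τ₂ = sem (for 5 1 clear) τ₁
      qτ : τ 0 ≡ inp
      qτ = trans (fr 0 tt) q₀
      cleared : Rows (toℕ z) (τ₂ 14) × (∀ (w : Fin n) → toℕ w < n → τ₂ 14 (n * toℕ z + toℕ w) ≡ 0)
      cleared = for-ind 5 1 clear τ₁ (n-eq τ₁ qτ)
        (λ k ρ → Rows (toℕ z) (ρ 14) × (∀ (w : Fin n) → toℕ w < k → ρ 14 (n * toℕ z + toℕ w) ≡ 0)) (R , λ _ ()) go
        where
        go : ∀ (c : Fin n) (ρ : Store) → ρ 5 0 ≡ toℕ c → (∀ b → T (not ((5 ≡ᵇ b) ∨ writes clear b)) → ρ b ≡ τ₁ b) →
             Rows (toℕ z) (ρ 14) × (∀ (w : Fin n) → toℕ w < toℕ c → ρ 14 (n * toℕ z + toℕ w) ≡ 0) →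
             Rows (toℕ z) (sem clear ρ 14) × (∀ (w : Fin n) → toℕ w < suc (toℕ c) → sem clear ρ 14 (n * toℕ z + toℕ w) ≡ 0)
        go c ρ ctr′ fr′ (R′ , zs) rewrite fr′ 0 tt | fr′ 6 tt | qτ | inp-n | ctr | ctr′ =
          rows-set (ρ 14) z c 0 R′ ,
          λ w lt′ → set-elim₂ (ρ 14) (λ y w v → y ≡ z → toℕ w < suc (toℕ c) → v ≡ 0) z c (λ _ _ → refl)
            (λ { y w (inj₁ ne) eq _ → ⊥-elim (ne eq)
               ; y w (inj₂ ne) refl l → zs w (≤∧≢⇒< (≤-pred l) (ne ∘ Fin.toℕ-injective)) }) z w refl lt′
      Inv : ℕ → Store → Set
      Inv k ρ = Rows (toℕ z) (ρ 14) × Row k z (ρ 14) × ρ 15 0 ≡ toℕ (iter k z)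
      final : Inv n (sem (for 7 1 mk) τ₂)
      final = for-ind 7 1 mk τ₂ (n-eq τ₂ (trans (frame (for 5 1 clear) τ₁ 0 tt) qτ)) Inv
        (proj₁ cleared , (λ w → inj₂ ((λ _ ()) , proj₂ cleared w (Fin.toℕ<n w))) ,
          trans (cong (λ f → f 0) (frame (for 5 1 clear) τ₁ 15 tt)) ctr) go
        where
        go : ∀ (k : Fin n) (ρ : Store) → ρ 7 0 ≡ toℕ k → (∀ b → T (not ((7 ≡ᵇ b) ∨ writes mk b)) → ρ b ≡ τ₂ b) →
             Inv (toℕ k) ρ → Inv (suc (toℕ k)) (setCell 7 0 (suc (toℕ k)) (sem mk ρ))
        go k ρ _ fr′ (R′ , row , cur) = go′ (ρ 0) (ρ 6 0) (ρ 13) (ρ 14) (ρ 15 0)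
            (trans (fr′ 0 tt) (trans (frame (for 5 1 clear) τ₁ 0 tt) qτ))
            (trans (cong (λ f → f 0) (trans (fr′ 6 tt) (frame (for 5 1 clear) τ₁ 6 tt))) ctr)
            (λ y → trans (cong (λ f → f (toℕ y)) (trans (fr′ 13 tt) (trans (frame (for 5 1 clear) τ₁ 13 tt) (fr 13 tt)))) (qp y)) cur R′ row
          where
          go′ : ∀ (i₀ : ℕ → ℕ) (c₆ : ℕ) (p a : ℕ → ℕ) (c : ℕ) → i₀ ≡ inp → c₆ ≡ toℕ z → (∀ y → p (toℕ y) ≡ toℕ (par y)) → c ≡ toℕ (iter (toℕ k) z) →
                Rows (toℕ z) a → Row (toℕ k) z a →
                Rows (toℕ z) (set a (i₀ 1 * c₆ + c) 1) × Row (suc (toℕ k)) z (set a (i₀ 1 * c₆ + c) 1) × p c ≡ toℕ (iter (suc (toℕ k)) z)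
          go′ _ _ p a _ refl refl hp refl R row rewrite inp-n =
            rows-set a z (iter (toℕ k) z) 1 R , mark a z (toℕ k) row , hp (iter (toℕ k) z)

-- Settling paths through an edge

stretch : ℚᵘ → ℕ → ℕ
stretch α d = apply div (ℤ.∣ ↥ α ∣ * d) (↧ₙ α)

-- A length is an integer, so it may be compared with the stretched distance rounded down, and the
-- program does without rationals. The encoding holds the absolute value of the numerator; α ≥ 1
-- excludes a negative one.
stretch-correct : ∀ {α} → 1ℚᵘ ℚ.≤ α → ∀ x d → (fromℕ x ℚ.≤ α ℚ.* fromℕ d → x ≤ stretch α d) × (x ≤ stretch α d → fromℕ x ℚ.≤ α ℚ.* fromℕ d)
stretch-correct {mkℚᵘ (ℤ.+ a) b-1} _ x d = to , from
  where
  b = suc b-1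
  to : fromℕ x ℚ.≤ mkℚᵘ (ℤ.+ a) b-1 ℚ.* fromℕ d → x ≤ (a * d) / b
  to (ℚ.*≤* h) = subst (_≤ (a * d) / b) (m*n/n≡m x b) (/-monoˡ-≤ b (ℤ.drop‿+≤+ (subst₂ ℤ._≤_ e₁ e₂ h)))
    where
    e₁ : ℤ.+ x ℤ.* ℤ.+ (b * 1) ≡ ℤ.+ (x * b)
    e₁ = trans (sym (ℤ.pos-* x (b * 1))) (cong (λ k → ℤ.+ (x * k)) (*-identityʳ b))
    e₂ : (ℤ.+ a ℤ.* ℤ.+ d) ℤ.* ℤ.+ 1 ≡ ℤ.+ (a * d)
    e₂ = trans (ℤ.*-identityʳ _) (sym (ℤ.pos-* a d))
  from : x ≤ (a * d) / b → fromℕ x ℚ.≤ mkℚᵘ (ℤ.+ a) b-1 ℚ.* fromℕ d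
  from h = ℚ.*≤* (subst₂ ℤ._≤_ e₁ e₂ (ℤ.+≤+ (≤-trans (*-monoˡ-≤ b h) (m/n*n≤m (a * d) b))))
    where
    e₁ : ℤ.+ (x * b) ≡ ℤ.+ x ℤ.* ℤ.+ (b * 1)
    e₁ = sym (trans (sym (ℤ.pos-* x (b * 1))) (cong (λ k → ℤ.+ (x * k)) (*-identityʳ b)))
    e₂ : ℤ.+ (a * d) ≡ (ℤ.+ a ℤ.* ℤ.+ d) ℤ.* ℤ.+ 1
    e₂ = sym (trans (ℤ.*-identityʳ _) (sym (ℤ.pos-* a d)))
stretch-correct {mkℚᵘ ℤ.-[1+ a ] b-1} (ℚ.*≤* h) x d = ⊥-elim (impossible h)
  where
  impossible : ¬ (ℤ.+ 1 ℤ.* ℤ.+ suc b-1 ℤ.≤ ℤ.-[1+ a ] ℤ.* ℤ.+ 1)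
  impossible ()

stretch-≤ : ∀ α d → stretch α d ≤ ℤ.∣ ↥ α ∣ * d
stretch-≤ (mkℚᵘ a b-1) d = m/n≤m (ℤ.∣ a ∣ * d) (suc b-1)

module Settling {n m} (I : Instance n m) (In : Input I) where

  open Instance I using (graph; ℓ; ℓ-pos; connected; α; 1≤α; Dist; SettlingLength; 𝒫)
  open Input In
  open Walks graph
  open Lengths ℓ
  open BellmanFord I In

  dist-unique : ∀ {F u v c d} → Dist F u v c → Dist F u v d → c ≡ d
  dist-unique ((p , pp , pF , refl) , pm) ((q , qp , qF , refl) , qm) = ≤-antisym (pm q qp qF) (qm p pp pF)

  δ : Fin n → Fin n → ℕ
  δ u v = proj₁ (dist u v)

  th : Fin m → ℕ
  th e = stretch α (δ (lo e) (hi e))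

  settling⇒≤ : ∀ e {x} → SettlingLength (lo e) (hi e) x → x ≤ th e
  settling⇒≤ e {x} (d , D , h) = subst (λ c → x ≤ stretch α c) (dist-unique D (proj₂ (dist (lo e) (hi e))))
    (proj₁ (stretch-correct 1≤α x d) h)

  ≤⇒settling : ∀ e {x} → x ≤ th e → SettlingLength (lo e) (hi e) x
  ≤⇒settling e {x} h = δ (lo e) (hi e) , proj₂ (dist (lo e) (hi e)) , proj₂ (stretch-correct 1≤α x _) h

  ⊑-full : ∀ {u v} (p : Walk u v) → p ⊑ full
  ⊑-full p = All.tabulate λ _ → Subset.∈⊤

  edge-path : ∀ e → IsPath (step e (inj₁ (refl , refl)) stop)
  edge-path e = (joins-≢ {e} (inj₁ (refl , refl)) ∷ []) ∷ [] ∷ []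

  δ≤ℓ : ∀ e → δ (lo e) (hi e) ≤ ℓ e
  δ≤ℓ e = ≤-trans (proj₂ (proj₂ (dist (lo e) (hi e))) (step e (inj₁ (refl , refl)) stop) (edge-path e) (⊑-full (step e (inj₁ (refl , refl)) stop)))
                  (≤-reflexive (+-identityʳ (ℓ e)))

  th<B : ∀ e → th e < con 1
  th<B e = ≤-<-trans (≤-trans (stretch-≤ α _) (*-monoʳ-≤ ℤ.∣ ↥ α ∣ (δ≤ℓ e))) (num*ℓ<B e)

  th<V : ∀ e → th e < V
  th<V e = <-≤-trans (th<B e) B≤V

  distances-path : ∀ {msk s t D z a} → Distances msk s t D → a ≡ s ⊎ a ≡ t → (p : Walk z a) → Masked msk p → D (toℕ z) ≤ len p
  distances-path Ds σ p mp with erase p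
  ... | q , sub , path = ≤-trans (Distances.minimal Ds σ q (All.tabulate (λ i → All.lookup mp (≼-edges sub i))) (<⇒≤ (path-length q path))) (len-≼ sub)

  distances-real : ∀ {msk s t D z a} → Distances msk s t D → a ≡ s ⊎ a ≡ t → (p : Walk z a) → Masked msk p →
                   ∃[ b ] (b ≡ s ⊎ b ≡ t) × Σ[ q ∈ Walk z b ] Masked msk q × len q ≡ D (toℕ z)
  distances-real {z = z} Ds σ p mp with Distances.realised Ds z
  ... | inj₂ h = h
  ... | inj₁ eq with erase p
  ... | q , sub , path = ⊥-elim (<-irrefl eq (≤-<-trans (≤-trans (distances-path Ds σ q (All.tabulate (λ i → All.lookup mp (≼-edges sub i)))) ≤-refl) (path<V q path)))

  Ones : (ℕ → ℕ) → Set
  Ones msk = ∀ (f : Fin m) → msk (toℕ f) ≡ 1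

  ones-masked : ∀ msk → Ones msk → ∀ {u v} (p : Walk u v) → Masked msk p
  ones-masked msk h p = All.tabulate λ {f} _ eq → case trans (sym (h f)) eq of λ ()

  δ-correct : ∀ {msk s D} → Ones msk → Distances msk s s D → ∀ z → D (toℕ z) ≡ δ z s
  δ-correct {msk} {s} {D} ones Ds z = ≤-antisym upper (lower (distances-real Ds (inj₁ refl) (connected z s) (ones-masked msk ones _)))
    where
    upper : D (toℕ z) ≤ δ z s
    upper with proj₁ (proj₂ (dist z s))
    ... | p , _ , _ , eq = subst (D (toℕ z) ≤_) eq (distances-path Ds (inj₁ refl) p (ones-masked msk ones p))
    lower : (∃[ b ] (b ≡ s ⊎ b ≡ s) × Σ[ q ∈ Walk z b ] Masked msk q × len q ≡ D (toℕ z)) → δ z s ≤ D (toℕ z)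
    lower (b , σ , q , _ , eq) with [ id , id ]′ σ
    ... | refl with erase q
    ... | r , sub , path = ≤-trans (proj₂ (proj₂ (dist z s)) r path (⊑-full r)) (≤-trans (len-≼ sub) (≤-reflexive eq))

  OnSettling : Fin m → Fin m → Set
  OnSettling e f = ∃[ p ] 𝒫 e p × f ∈ˡ edges p

  Decided : Set → ℕ → Set
  Decided P v = (P × v ≡ 1) ⊎ (¬ P × v ≡ 0)

  module ForEdge (e : Fin m) {msk Dv} (ones : Ones msk) (Ds : Distances msk (lo e) (hi e) Dv)
    (par : Fin n → Fin n)
    (par-tight : ∀ z → (∃[ f ] Joins f z (par z) × Dv (toℕ z) ≡ Dv (toℕ (par z)) + ℓ f)
                     ⊎ (par z ≡ z × (∀ f x → Joins f z x → Dv (toℕ z) ≢ Dv (toℕ x) + ℓ f))) where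

    d : Fin n → ℕ
    d z = Dv (toℕ z)

    lo≢hi : lo e ≢ hi e
    lo≢hi = joins-≢ {e} (inj₁ (refl , refl))

    d-min : ∀ {z a} → a ≡ lo e ⊎ a ≡ hi e → (p : Walk z a) → d z ≤ len p
    d-min σ p = distances-path Ds σ p (ones-masked msk ones p)

    d-src : ∀ {z} → z ≡ lo e ⊎ z ≡ hi e → d z ≡ 0
    d-src {z} σ = n≤0⇒n≡0 (d-min σ (stop {u = z}))

    real : ∀ z → ∃[ b ] (b ≡ lo e ⊎ b ≡ hi e) × Σ[ q ∈ Walk z b ] Masked msk q × len q ≡ d z
    real z = distances-real Ds (inj₁ refl) (connected z (lo e)) (ones-masked msk ones _)

    d-edge : ∀ {f z x} → Joins f z x → d z ≤ d x + ℓ f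
    d-edge {f} {z} {x} j with real x
    ... | b , σ , q , _ , eq = ≤-trans (d-min σ (step f j q)) (≤-reflexive (trans (+-comm (ℓ f) (len q)) (cong (_+ ℓ f) eq)))

    tight-exists : ∀ {z} → z ≢ lo e → z ≢ hi e → ∃[ f ] ∃[ x ] Joins f z x × d z ≡ d x + ℓ f
    tight-exists {z} nl nh with real z
    ... | b , σ , stop , _ , _ = ⊥-elim ([ nl , nh ]′ σ)
    ... | b , σ , step {v = x} f j q , _ , eq = f , x , j ,
      ≤-antisym (d-edge j) (≤-trans (+-monoˡ-≤ (ℓ f) (d-min σ q)) (≤-trans (≤-reflexive (+-comm (len q) (ℓ f))) (≤-reflexive eq)))

    par-edge : ∀ {z} → z ≢ lo e → z ≢ hi e → ∃[ f ] Joins f z (par z) × d z ≡ d (par z) + ℓ f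
    par-edge {z} nl nh with par-tight z
    ... | inj₁ h = h
    ... | inj₂ (_ , none) with tight-exists nl nh
    ... | f , x , j , eq = ⊥-elim (none f x j eq)

    par-src : ∀ {z} → z ≡ lo e ⊎ z ≡ hi e → par z ≡ z
    par-src {z} σ with par-tight z
    ... | inj₂ (eq , _) = eq
    ... | inj₁ (f , j , eq) = ⊥-elim (<-irrefl (trans (sym (d-src σ)) eq) (<-≤-trans (ℓ-pos f) (m≤n+m (ℓ f) (d (par z)))))

    tree : ∀ z → z ≢ lo e → z ≢ hi e → ∃[ f ] Joins f z (par z) × d (par z) < d z
    tree z nl nh with par-edge nl nh
    ... | f , j , eq = f , j , subst (suc (d (par z)) ≤_) (sym eq) (≤-trans (≤-reflexive (+-comm 1 (d (par z)))) (+-monoʳ-≤ (d (par z)) (ℓ-pos f)))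

    open Forest graph (lo e) (hi e) lo≢hi par d tree public
    open Ancestors I In par using (iter; Row)

    iter-shift : ∀ j z → iter (suc j) z ≡ iter j (par z)
    iter-shift zero    z = refl
    iter-shift (suc j) z = cong par (iter-shift j z)

    iter⇒anc : ∀ j z → Anc (iter j z) z
    iter⇒anc zero    z = here
    iter⇒anc (suc j) z = subst (λ w → Anc w z) (sym (iter-shift j z)) (lift (iter⇒anc j (par z)))
      where
      lift : ∀ {w} → Anc w (par z) → Anc w z
      lift a with src? z
      ... | yes σ = subst (Anc _) (par-src σ) a
      ... | no ns = up ns a

    -- Distances decrease towards the root, so the way to an ancestor is a simple path and has fewer
    -- than n edges. Hence n steps from child to parent find every ancestor.
    anc-path : ∀ {w z} → Anc w z → Σ[ p ∈ Walk z w ] IsPath p × (∀ {r} → r ∈ˡ vertices p → Anc r z) × iter (length (edges p)) z ≡ w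
    anc-path here = stop , [] ∷ [] , (λ { (here refl) → here }) , refl
    anc-path {z = z} (up ns a) with anc-path a | tree′ ns
    ... | p , path , on , it | f , j , lt = step f j p ,
      All.tabulate (λ i eq → [ (λ q → <-irrefl (cong d (trans (sym q) (sym eq))) lt)
                             , (λ q → <-asym lt (subst (λ x → d x < d (par z)) (sym eq) q)) ]′ (anc-rank (on i))) ∷ path ,
      (λ { (here refl) → here ; (there i) → up ns (on i) }) , trans (iter-shift (length (edges p)) z) it

    anc⇒iter : ∀ {w z} → Anc w z → ∃[ j ] j < n × iter j z ≡ w
    anc⇒iter a with anc-path a
    ... | p , path , _ , it = length (edges p) , path-length p path , it

    -- The reduced length of an edge that is traversed towards the sources, from `z` to `x`. By
    -- `d-edge` the subtraction never truncates.
    arc : Cost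
    arc f z x = d x + ℓ f ∸ d z

    arc-vanishing : Vanishing arc
    arc-vanishing {f} {z} ns j with par-edge (ns ∘ inj₁) (ns ∘ inj₂)
    ... | g , i , eq rewrite joins-unique j i = m≤n⇒m∸n≡0 (≤-reflexive (sym eq))

    -- The distances telescope and a source has distance 0. So for a fixed start the length and the
    -- reduced length of a walk to a source differ by a constant.
    len-excess : ∀ {z a} → a ≡ lo e ⊎ a ≡ hi e → (A : Walk z a) → len A ≡ d z + κ arc A
    len-excess σ stop = sym (trans (+-identityʳ _) (d-src σ))
    len-excess σ (step {z} {x} f j A) = begin
      ℓ f + len A                                ≡⟨ cong (ℓ f +_) (len-excess σ A) ⟩
      ℓ f + (d x + κ arc A)                      ≡⟨ sym (+-assoc (ℓ f) (d x) _) ⟩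
      ℓ f + d x + κ arc A                        ≡⟨ cong (_+ κ arc A) (trans (+-comm (ℓ f) (d x)) (sym (m+[n∸m]≡n (d-edge j)))) ⟩
      d z + (d x + ℓ f ∸ d z) + κ arc A          ≡⟨ +-assoc (d z) _ _ ⟩
      d z + (arc f z x + κ arc A)                ∎
      where open ≡-Reasoning

    Btw : Fin m → Fin n → Set
    Btw f w = Between (lo f) (hi f) w

    module _ {anc : ℕ → ℕ} (rows : ∀ z → Row n z anc) where

      open Dijkstra I In Dv anc (lo e) (hi e) Btw

      anc-entry : ∀ w z → Decided (Anc w z) (anc (n * toℕ z + toℕ w))
      anc-entry w z with rows z w
      ... | inj₁ ((j , _ , it) , v) = inj₁ (subst (λ x → Anc x z) it (iter⇒anc j z) , v)
      ... | inj₂ (none , v) = inj₂ ((λ a → none _ (proj₁ (proj₂ (anc⇒iter a))) (proj₂ (proj₂ (anc⇒iter a)))) , v)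

      btw : ∀ f w → (Btw f w × differ f w ≢ 0) ⊎ (¬ Btw f w × differ f w ≡ 0)
      btw f w with anc-entry w (lo f) | anc-entry w (hi f)
      ... | inj₁ (p , u) | inj₁ (q , v) = inj₂ ((λ { (inj₁ (_ , r)) → r q ; (inj₂ (_ , r)) → r p }) , cong₂ (λ a b → (a ∸ b) + (b ∸ a)) u v)
      ... | inj₂ (p , u) | inj₂ (q , v) = inj₂ ((λ { (inj₁ (r , _)) → p r ; (inj₂ (r , _)) → q r }) , cong₂ (λ a b → (a ∸ b) + (b ∸ a)) u v)
      ... | inj₁ (p , u) | inj₂ (q , v) = inj₁ (inj₁ (p , q) , λ z → case trans (sym (cong₂ (λ a b → (a ∸ b) + (b ∸ a)) u v)) z of λ ())
      ... | inj₂ (p , u) | inj₁ (q , v) = inj₁ (inj₂ (q , p) , λ z → case trans (sym (cong₂ (λ a b → (a ∸ b) + (b ∸ a)) u v)) z of λ ())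

      SE : Fin m → ℕ → Set
      SE f b = Σ[ K ∈ (Cost → ℕ) ] Pair K (lo f) (hi f) × K arc ≤ b

      -- A source has label 0 without two walks of cost 0: it stands for the edges whose ends have
      -- root paths in different trees, which are free by `tree-pair`.
      SD : Fin n → ℕ → Set
      SD w b = Src w ⊎ (Σ[ K ∈ (Cost → ℕ) ] Meet K w × K arc ≤ b)

      SD⇒SE : ∀ {f w b} → Btw f w → SD w b → SE f b
      SD⇒SE {f} bt (inj₁ σ)           = (λ _ → 0) , tree-pair σ bt , z≤n
      SD⇒SE {f} bt (inj₂ (K , M , k)) = K , meet⇒pair {K} bt M , k

      SE⇒SH : ∀ {f b} → SE f b → SD (hi f) (b + cH f)
      SE⇒SH {f} {b} (K , P , k) = inj₂ (_ , meet-step {K} {lo f} {hi f} {f} (inj₂ (refl , refl)) P ,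
        ≤-trans (+-monoʳ-≤ (cH f) k) (≤-reflexive (+-comm (cH f) b)))

      SE⇒SL : ∀ {f b} → SE f b → SD (lo f) (b + cL f)
      SE⇒SL {f} {b} (K , P , k) = inj₂ (_ , meet-step {K} {hi f} {lo f} {f} (inj₁ (refl , refl)) (pair-swap {K} {lo f} P) ,
        ≤-trans (+-monoʳ-≤ (cL f) k) (≤-reflexive (+-comm (cL f) b)))

      dijkstra-shortest = dijkstra-correct SD SE btw (inj₁ (inj₁ refl)) (inj₁ (inj₂ refl)) SD⇒SE SE⇒SH SE⇒SL

      module _ {A E : ℕ → ℕ} (S : Shortest SD SE btw (inj₁ (inj₁ refl)) (inj₁ (inj₂ refl)) SD⇒SE SE⇒SH SE⇒SL A E) where

        open Shortest S
        open Labels labelled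

        private
          A-src : ∀ {s} → Src s → A (toℕ s) ≡ 0
          A-src (inj₁ refl) = A-s
          A-src (inj₂ refl) = A-t

          A-step : ∀ {f x z w} → Joins f z x → Between x z w → A (toℕ z) ≤ A (toℕ w) + arc f z x
          A-step {f} {w = w} (inj₁ (refl , refl)) b = ≤-trans (proj₂ (arcs f)) (+-monoˡ-≤ (cL f) (closed f w (between-swap {hi f} {lo f} b)))
          A-step {f} {w = w} (inj₂ (refl , refl)) b = ≤-trans (proj₁ (arcs f)) (+-monoˡ-≤ (cH f) (closed f w b))

          open Closed (λ z → A (toℕ z)) arc arc-vanishing A-src A-step

          -- Undoes the reduction. Unless the label is the cap, this is the least length of two
          -- disjoint walks from the ends of `f` to the two ends of `e`, including `f` itself.
          total : Fin m → ℕ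
          total f = E (toℕ f) + d (lo f) + d (hi f) + ℓ f

          rearrange : ∀ a b x y l → a + b + x + y + l ≡ (x + a) + l + (y + b)
          rearrange = solve 5 (λ a b x y l → a :+ b :+ x :+ y :+ l := (x :+ a) :+ l :+ (y :+ b)) refl
            where open +-*-Solver

          E≤ : ∀ {f K} → Pair K (lo f) (hi f) → E (toℕ f) ≤ K arc
          E≤ {f} {K} P with pair≤ {K} P
          ... | w , b , le = ≤-trans (closed f w b) le

          -- A settling path through `f` falls apart into two disjoint walks, and the label of `f`
          -- is a lower bound for their total reduced length.
          complete : ∀ f → OnSettling e f → total f ≤ th e
          complete f (p , (path , σ) , i) with split stop p path (λ { (here eq) _ → eq }) i
          ... | x , z , j , X , Z , dis , eq = ≤-trans (bound j) (settling⇒≤ e σ)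
            where
            K : Cost → ℕ
            K c = κ c X + κ c Z
            P : Pair K x z
            P = lo e , hi e , inj₁ (refl , refl) , X , Z , dis , λ _ _ → ≤-refl
            lenp : K arc + d x + d z + ℓ f ≡ len p
            lenp = trans (rearrange (κ arc X) (κ arc Z) (d x) (d z) (ℓ f))
              (trans (cong₂ (λ a b → a + ℓ f + b) (sym (len-excess (inj₁ refl) X)) (sym (len-excess (inj₂ refl) Z))) eq)
            bound : Joins f x z → total f ≤ len p
            bound (inj₁ (refl , refl)) = ≤-trans (+-monoˡ-≤ (ℓ f) (+-monoˡ-≤ (d z) (+-monoˡ-≤ (d x) (E≤ {f} {K} P)))) (≤-reflexive lenp)
            bound (inj₂ (refl , refl)) = ≤-trans (+-monoˡ-≤ (ℓ f) (+-monoˡ-≤ (d x) (+-monoˡ-≤ (d z) (E≤ {f} {K} (pair-swap {K} {x} P)))))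
              (≤-reflexive (trans (cong (_+ ℓ f) (trans (+-assoc (K arc) (d z) (d x)) (trans (cong (K arc +_) (+-comm (d z) (d x))) (sym (+-assoc (K arc) (d x) (d z)))))) lenp))

          -- The walks that witness the label are made simple, which keeps them disjoint and no
          -- longer than before, and are joined by `f`. A label equal to the cap cannot occur, since
          -- it exceeds the threshold.
          sound : ∀ f → total f ≤ th e → OnSettling e f
          sound f le with proj₂ (E-sound f)
          ... | inj₁ eq = ⊥-elim (<⇒≱ (th<V e) (≤-trans (≤-trans (≤-reflexive (sym eq)) (≤-trans (m≤m+n _ (d (lo f))) (≤-trans (m≤m+n _ (d (hi f))) (m≤m+n _ (ℓ f))))) le))
          ... | inj₂ (K , (a , b , s , X , Z , dis , k) , kE) with erase X | erase Z
          ... | X′ , sX , pX | Z′ , sZ , pZ = build s X′ Z′ sX sZ pX pZ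
            where
            short : ∀ {a b} {X : Walk (lo f) a} {Z : Walk (hi f) b} → (a ≡ lo e ⊎ a ≡ hi e) → (b ≡ lo e ⊎ b ≡ hi e) → κ arc X + κ arc Z ≤ E (toℕ f) →
                    (X′ : Walk (lo f) a) (Z′ : Walk (hi f) b) → X′ ≼ X → Z′ ≼ Z → len X′ + ℓ f + len Z′ ≤ th e
            short {X = X} {Z} σa σb kk X′ Z′ sX sZ = ≤-trans (+-mono-≤ (+-monoˡ-≤ (ℓ f) (len-≼ sX)) (len-≼ sZ))
              (≤-trans (≤-reflexive (trans (cong₂ (λ a b → a + ℓ f + b) (len-excess σa X) (len-excess σb Z)) (sym (rearrange (κ arc X) (κ arc Z) (d (lo f)) (d (hi f)) (ℓ f)))))
                (≤-trans (+-monoˡ-≤ (ℓ f) (+-monoˡ-≤ (d (hi f)) (+-monoˡ-≤ (d (lo f)) kk))) le))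
            build : Sources a b → (X′ : Walk (lo f) a) (Z′ : Walk (hi f) b) → X′ ≼ X → Z′ ≼ Z → IsPath X′ → IsPath Z′ → OnSettling e f
            build s@(inj₁ (refl , refl)) X′ Z′ sX sZ pX pZ = revOnto X′ Y ,
                (revOnto-path X′ Y pX (All.tabulate (λ i eq → d′ (first∈ X′) (subst (_∈ˡ vertices Z′) (sym eq) i)) ∷ pZ)
                   (λ { _ (here eq) → eq ; i (there l) → ⊥-elim (d′ i l) }) ,
                 ≤⇒settling e (≤-trans (≤-reflexive (trans (revOnto-len X′ Y) (sym (+-assoc (len X′) (ℓ f) (len Z′)))))
                   (short (inj₁ refl) (inj₂ refl) (≤-trans (k arc arc-vanishing) kE) X′ Z′ sX sZ))) ,
                revOnto-edges X′ Y (here refl)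
              where
              Y = step f (inj₁ (refl , refl)) Z′
              d′ : Disjoint X′ Z′
              d′ i l = dis (≼-vertices sX i) (≼-vertices sZ l)
            build s@(inj₂ (refl , refl)) X′ Z′ sX sZ pX pZ = revOnto Z′ Y ,
                (revOnto-path Z′ Y pZ (All.tabulate (λ i eq → d′ i (subst (_∈ˡ vertices Z′) eq (first∈ Z′))) ∷ pX)
                   (λ { _ (here eq) → eq ; i (there l) → ⊥-elim (d′ l i) }) ,
                 ≤⇒settling e (≤-trans (≤-reflexive (trans (revOnto-len Z′ Y) (trans (+-comm (len Z′) _) (cong (_+ len Z′) (+-comm (ℓ f) (len X′))))))
                   (short (inj₂ refl) (inj₁ refl) (≤-trans (k arc arc-vanishing) kE) X′ Z′ sX sZ))) ,
                revOnto-edges Z′ Y (here refl)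
              where
              Y = step f (inj₂ (refl , refl)) X′
              d′ : Disjoint X′ Z′
              d′ i l = dis (≼-vertices sX i) (≼-vertices sZ l)

        entry : ∀ f → Decided (OnSettling e f) (1 ∸ (total f ∸ th e))
        entry f with total f ≤? th e
        ... | yes le = inj₁ (sound f le , cong (1 ∸_) (m≤n⇒m∸n≡0 le))
        ... | no nle with total f ∸ th e in eq
        ... | zero  = ⊥-elim (nle (m∸n≡0⇒m≤n eq))
        ... | suc k = inj₂ ((λ h → nle (complete f h)) , 0∸n≡0 k)

      decided : ∀ (σ : Store) → σ 0 ≡ inp × σ 2 ≡ con × σ 10 ≡ Dv × σ 14 ≡ anc → σ 8 0 ≡ toℕ (lo e) → σ 9 0 ≡ toℕ (hi e) →
                ∀ f → Decided (OnSettling e f) (1 ∸ (run dijkstra σ 18 (toℕ f) + d (lo f) + d (hi f) + ℓ f ∸ th e))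
      decided σ en es et = entry {run dijkstra σ 17} {run dijkstra σ 18}
        (subst (λ ρ → Shortest SD SE btw (inj₁ (inj₁ refl)) (inj₁ (inj₂ refl)) SD⇒SE SE⇒SH SE⇒SL (ρ 17) (ρ 18)) (sym (run-sem dijkstra σ)) (dijkstra-shortest σ en es et))

-- Tables filled by loops

Frame : ℕ → Prog → Store → Store → Set
Frame x p τ σ = ∀ b → T (not ((x ≡ᵇ b) ∨ writes p b)) → τ b ≡ σ b

setCell-array : ∀ x A v (τ : Store) → T (not (x ≡ᵇ A)) → setCell x 0 v τ A ≡ τ A
setCell-array x A v τ t = setCell-other x 0 v τ t

for-table : ∀ x c p σ A {N} → T (not (x ≡ᵇ A)) → σ 0 c ≡ N → (P : Fin N → ℕ → Set) →
            (∀ k (τ : Store) → τ x 0 ≡ toℕ k → Frame x p τ σ → ∃[ v ] run p τ A ≡ set (τ A) (toℕ k) v × P k v) →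
            ∀ k → P k (run (for x c p) σ A (toℕ k))
for-table x c p σ A {N} xA eN P body k = for-run x c p σ eN (λ j τ → Below P j (τ A)) (λ _ ()) go k (Fin.toℕ<n k)
  where
  go : ∀ (k : Fin N) τ → τ x 0 ≡ toℕ k → Frame x p τ σ → Below P (toℕ k) (τ A) →
       Below P (suc (toℕ k)) (setCell x 0 (suc (toℕ k)) (run p τ) A)
  go k τ ctr fr h with body k τ ctr fr
  ... | v , eq , pv = subst (Below P (suc (toℕ k))) (sym (trans (setCell-array x A _ (run p τ) xA) eq)) (table-step (τ A) P k pv h)

RowSet : ∀ {N M} → (ℕ → ℕ) → (ℕ → ℕ) → Fin N → (Fin M → ℕ → Set) → Set
RowSet {N} {M} f g e P = (∀ (y : Fin N) (w : Fin M) → y ≢ e → f (M * toℕ y + toℕ w) ≡ g (M * toℕ y + toℕ w))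
                       × (∀ (w : Fin M) → P w (f (M * toℕ e + toℕ w)))

-- The body may assume that its own cell still has the value from before the loop, so a row can be
-- updated in place, as is done when trivial edges are removed from the bundles.
for-row : ∀ x c p σ A {N M} (e : Fin N) → T (not (x ≡ᵇ A)) → σ 0 c ≡ M → (P : Fin M → ℕ → Set) →
          (∀ f (τ : Store) → τ x 0 ≡ toℕ f → Frame x p τ σ → τ A (M * toℕ e + toℕ f) ≡ σ A (M * toℕ e + toℕ f) →
             ∃[ v ] run p τ A ≡ set (τ A) (M * toℕ e + toℕ f) v × P f v) →
          RowSet (run (for x c p) σ A) (σ A) e P
for-row x c p σ A {N} {M} e xA eM P body =
  let (u , v , _) = for-run x c p σ eM Inv start go in u , λ w → v w (Fin.toℕ<n w)
  where
  Inv : ℕ → Store → Set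
  Inv k τ = (∀ (y : Fin N) (w : Fin M) → y ≢ e → τ A (M * toℕ y + toℕ w) ≡ σ A (M * toℕ y + toℕ w))
          × (∀ (w : Fin M) → toℕ w < k → P w (τ A (M * toℕ e + toℕ w)))
          × (∀ (w : Fin M) → k ≤ toℕ w → τ A (M * toℕ e + toℕ w) ≡ σ A (M * toℕ e + toℕ w))
  start : Inv 0 (setCell x 0 0 σ)
  start rewrite setCell-array x A 0 σ xA = (λ _ _ _ → refl) , (λ _ ()) , λ _ _ → refl
  go : ∀ (k : Fin M) τ → τ x 0 ≡ toℕ k → Frame x p τ σ → Inv (toℕ k) τ → Inv (suc (toℕ k)) (setCell x 0 (suc (toℕ k)) (run p τ))
  go k τ ctr fr (others , done , todo) with body k τ ctr fr (todo k ≤-refl)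
  ... | v , eq , pv rewrite setCell-array x A (suc (toℕ k)) (run p τ) xA | eq =
    (λ y w ne → set-elim₂ (τ A) (λ y w u → y ≢ e → u ≡ σ A (M * toℕ y + toℕ w)) e k (λ h → ⊥-elim (h refl)) (λ y w _ → others y w) y w ne) ,
    (λ w lt → set-elim₂ (τ A) (λ y w u → y ≡ e → toℕ w < suc (toℕ k) → P w u) e k (λ _ _ → pv)
       (λ { y w (inj₁ ne) eq _ → ⊥-elim (ne eq)
          ; y w (inj₂ ne) refl l → done w (≤∧≢⇒< (≤-pred l) (ne ∘ Fin.toℕ-injective)) }) e w refl lt) ,
    (λ w lt → set-elim₂ (τ A) (λ y w u → y ≡ e → suc (toℕ k) ≤ toℕ w → u ≡ σ A (M * toℕ y + toℕ w)) e k (λ _ l → ⊥-elim (<-irrefl refl l))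
       (λ { y w (inj₁ ne) eq _ → ⊥-elim (ne eq)
          ; y w (inj₂ ne) refl l → todo w (<⇒≤ l) }) e w refl lt)

for-matrix : ∀ x c p σ A {N M} → T (not (x ≡ᵇ A)) → σ 0 c ≡ N → (P : Fin N → Fin M → ℕ → Set) →
             (∀ e (τ : Store) → τ x 0 ≡ toℕ e → Frame x p τ σ →
                (∀ (w : Fin M) → τ A (M * toℕ e + toℕ w) ≡ σ A (M * toℕ e + toℕ w)) → RowSet (run p τ A) (τ A) e (P e)) →
             ∀ (y : Fin N) (w : Fin M) → P y w (run (for x c p) σ A (M * toℕ y + toℕ w))
for-matrix x c p σ A {N} {M} xA eN P body y w = proj₁ (for-run x c p σ eN Inv start go) y w (Fin.toℕ<n y)
  where
  Inv : ℕ → Store → Set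
  Inv k τ = (∀ (y : Fin N) (w : Fin M) → toℕ y < k → P y w (τ A (M * toℕ y + toℕ w)))
          × (∀ (y : Fin N) (w : Fin M) → k ≤ toℕ y → τ A (M * toℕ y + toℕ w) ≡ σ A (M * toℕ y + toℕ w))
  start : Inv 0 (setCell x 0 0 σ)
  start rewrite setCell-array x A 0 σ xA = (λ _ _ ()) , λ _ _ _ → refl
  go : ∀ (k : Fin N) τ → τ x 0 ≡ toℕ k → Frame x p τ σ → Inv (toℕ k) τ → Inv (suc (toℕ k)) (setCell x 0 (suc (toℕ k)) (run p τ))
  go k τ ctr fr (done , todo) with body k τ ctr fr (λ w → todo k w ≤-refl)
  ... | others , row rewrite setCell-array x A (suc (toℕ k)) (run p τ) xA = done′ ,
    λ y w lt → trans (others y w (λ { refl → <-irrefl refl lt })) (todo y w (<⇒≤ lt))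
    where
    done′ : ∀ (y : Fin N) (w : Fin M) → toℕ y < suc (toℕ k) → P y w (run p τ A (M * toℕ y + toℕ w))
    done′ y w lt with m<1+n⇒m<n∨m≡n lt
    ... | inj₁ l = subst (P y w) (sym (others y w (λ { refl → <-irrefl refl l }))) (done y w l)
    ... | inj₂ eq with Fin.toℕ-injective eq
    ... | refl = row w

-- The thresholds and the table of settling paths

edge₁ edge₂ edge₃ edge₄ edge₅ edge₆ edge₇ edge₈ : Prog
-- With both sources at `hi e`, the first pass measures the distance between the ends and sets the
-- threshold; for the second pass only array 8 changes, to `lo e`. The prefixes are named so that
-- every intermediate store and its frame conditions can be stated.
edge₁ = (8 [ lit 0 ]:= hi# ($$ 3)) ⨟ (9 [ lit 0 ]:= hi# ($$ 3))
edge₂ = edge₁ ⨟ bellmanFord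
edge₃ = edge₂ ⨟ (12 [ $$ 3 ]:= minE CAP (op div (0 ⟦ lit 3 ⟧ ⊗ 10 ⟦ lo# ($$ 3) ⟧) (0 ⟦ lit 4 ⟧)))
edge₄ = edge₃ ⨟ (8 [ lit 0 ]:= lo# ($$ 3))
edge₅ = edge₄ ⨟ bellmanFord
edge₆ = edge₅ ⨟ parents
edge₇ = edge₆ ⨟ ancestors
edge₈ = edge₇ ⨟ dijkstra

settlingP edgeP tables : Prog
settlingP = 22 [ m# ⊗ $$ 3 ⊕ $$ 5 ]:= leE (18 ⟦ $$ 5 ⟧ ⊕ 10 ⟦ lo# ($$ 5) ⟧ ⊕ 10 ⟦ hi# ($$ 5) ⟧ ⊕ len# ($$ 5)) (12 ⟦ $$ 3 ⟧)
edgeP = edge₈ ⨟ for 5 2 settlingP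
tables = for 5 2 (11 [ $$ 5 ]:= lit 1) ⨟ for 3 2 edgeP

module TablesCorrect {n m} (I : Instance n m) (In : Input I) where

  open Instance I using (graph; ℓ; α)
  open Input In
  open Graph graph using (lo; hi; Joins)
  open BellmanFord I In
  open Settling I In

  n-eq : ∀ (τ : Store) → τ 0 ≡ inp → τ 0 1 ≡ n
  n-eq τ q = trans (cong (λ f → f 1) q) inp-n

  m-eq : ∀ (τ : Store) → τ 0 ≡ inp → τ 0 2 ≡ m
  m-eq τ q = trans (cong (λ f → f 2) q) inp-m

  bellmanFord-run : ∀ msk s t σ → Env σ → σ 11 ≡ msk → σ 8 0 ≡ toℕ s → σ 9 0 ≡ toℕ t → Distances msk s t (run bellmanFord σ 10)
  bellmanFord-run msk s t σ en em es et =
    subst (λ τ → Distances msk s t (τ 10)) (sym (run-sem bellmanFord σ)) (bellmanFord-correct msk s t σ en em es et)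

  settling-cell : ∀ {ρ : Store} (e f : Fin m) {s d : ℕ → ℕ} {t} → ρ 0 ≡ inp → ρ 3 0 ≡ toℕ e → ρ 5 0 ≡ toℕ f → ρ 18 ≡ s → ρ 10 ≡ d → ρ 12 (toℕ e) ≡ t →
    sem settlingP ρ 22 ≡ set (ρ 22) (m * toℕ e + toℕ f) (1 ∸ (s (toℕ f) + d (toℕ (lo f)) + d (toℕ (hi f)) + ℓ f ∸ t))
  settling-cell {ρ} e f q c₃ c₅ refl refl t rewrite q | c₃ | c₅ | t | inp-m | inp-lo f | inp-hi f | inp-ℓ f = refl

  private
    module EdgeStep (τ : Store) (e : Fin m) (ctr : τ 3 0 ≡ toℕ e) (q₀ : τ 0 ≡ inp) (q₂ : τ 2 ≡ con) (ones : Ones (τ 11)) where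

      thP loP : Prog
      thP = 12 [ $$ 3 ]:= minE CAP (op div (0 ⟦ lit 3 ⟧ ⊗ 10 ⟦ lo# ($$ 3) ⟧) (0 ⟦ lit 4 ⟧))
      loP = 8 [ lit 0 ]:= lo# ($$ 3)

      τ₁ τ₂ τ₃ τ₄ τ₅ τ₆ τ₇ τ₈ : Store
      τ₁ = sem edge₁ τ
      τ₂ = run bellmanFord τ₁
      τ₃ = sem thP τ₂
      τ₄ = sem loP τ₃
      τ₅ = run bellmanFord τ₄
      τ₆ = run parents τ₅
      τ₇ = run ancestors τ₆
      τ₈ = run dijkstra τ₇

      eq₂ : run edge₂ τ ≡ τ₂
      eq₂ = run-seq₂ (run-sem edge₁ τ)
      eq₃ : run edge₃ τ ≡ τ₃
      eq₃ = trans (run-seq₂ eq₂) (run-sem thP τ₂)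
      eq₄ : run edge₄ τ ≡ τ₄
      eq₄ = trans (run-seq₂ eq₃) (run-sem loP τ₃)
      eq₅ : run edge₅ τ ≡ τ₅
      eq₅ = run-seq₂ eq₄
      eq₆ : run edge₆ τ ≡ τ₆
      eq₆ = run-seq₂ eq₅
      eq₇ : run edge₇ τ ≡ τ₇
      eq₇ = run-seq₂ eq₆
      eq₈ : run edge₈ τ ≡ τ₈
      eq₈ = run-seq₂ eq₇

      keep : ∀ p {ρ} → run p τ ≡ ρ → ∀ b → T (not (writes p b)) → ρ b ≡ τ b
      keep p refl b t = run-frame p τ b t

      keep₂ = keep edge₂ eq₂
      keep₃ = keep edge₃ eq₃
      keep₄ = keep edge₄ eq₄
      keep₅ = keep edge₅ eq₅
      keep₆ = keep edge₆ eq₆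
      keep₇ = keep edge₇ eq₇
      keep₈ = keep edge₈ eq₈

      src₁ : τ₁ 8 0 ≡ toℕ (hi e) × τ₁ 9 0 ≡ toℕ (hi e)
      src₁ rewrite ctr | q₀ | inp-hi e = refl , refl

      Ds₁ : Distances (τ 11) (hi e) (hi e) (τ₂ 10)
      Ds₁ = bellmanFord-run (τ 11) (hi e) (hi e) τ₁ (q₀ , q₂) refl (proj₁ src₁) (proj₂ src₁)

      th-set : τ₃ 12 ≡ set (τ 12) (toℕ e) (th e)
      th-set = trans (value (τ₂ 3 0) (τ₂ 2) (τ₂ 0) (trans (cong (λ f → f 0) (keep₂ 3 tt)) ctr)
                 (trans (keep₂ 2 tt) q₂) (trans (keep₂ 0 tt) q₀))
                 (cong (λ f → set f (toℕ e) (th e)) (keep₂ 12 tt))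
        where
        value : ∀ (c : ℕ) (k i : ℕ → ℕ) → c ≡ toℕ e → k ≡ con → i ≡ inp →
                set (τ₂ 12) c (k 0 ∸ (k 0 ∸ apply div (i 3 * τ₂ 10 (i (7 + 4 * c))) (i 4))) ≡ set (τ₂ 12) (toℕ e) (th e)
        value _ _ _ refl refl refl = cong (set (τ₂ 12) (toℕ e))
          (trans (cong (λ v → V ∸ (V ∸ v)) (trans (cong₂ (λ a b → apply div (a * τ₂ 10 b) (inp 4)) inp-num (inp-lo e))
                    (cong₂ (λ a b → apply div (ℤ.∣ ↥ α ∣ * a) b) (δ-correct ones Ds₁ (lo e)) inp-den)))
                 (m∸[m∸n]≡n (<⇒≤ (th<V e))))

      src₄ : τ₄ 8 0 ≡ toℕ (lo e) × τ₄ 9 0 ≡ toℕ (hi e)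
      src₄ = trans (cong₂ (λ i c → i (7 + 4 * c)) (trans (keep₃ 0 tt) q₀) (trans (cong (λ f → f 0) (keep₃ 3 tt)) ctr)) (inp-lo e) ,
             trans (cong (λ f → f 0) (run-frame bellmanFord τ₁ 9 tt)) (proj₂ src₁)

      Ds : Distances (τ 11) (lo e) (hi e) (τ₅ 10)
      Ds = bellmanFord-run (τ 11) (lo e) (hi e) τ₄ (trans (keep₄ 0 tt) q₀ , trans (keep₄ 2 tt) q₂)
             (keep₄ 11 tt) (proj₁ src₄) (proj₂ src₄)

      open Parents I In (τ₅ 10) using (ParentOf; parents-correct)

      parent : ∀ z → ParentOf (λ _ _ → Unit) z (τ₆ 13 (toℕ z))
      parent z = subst (λ ρ → ParentOf (λ _ _ → Unit) z (ρ 13 (toℕ z))) (sym (run-sem parents τ₅)) (parents-correct τ₅ (trans (keep₅ 0 tt) q₀) refl z)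

      parOf : ∀ z {v} → ParentOf (λ _ _ → Unit) z v → Fin n
      parOf z (inj₁ (_ , x , _)) = x
      parOf z (inj₂ _)           = z

      parOf-eq : ∀ z {v} (h : ParentOf (λ _ _ → Unit) z v) → v ≡ toℕ (parOf z h)
      parOf-eq z (inj₁ (_ , _ , _ , eq)) = eq
      parOf-eq z (inj₂ (eq , _))         = eq

      parOf-tight : ∀ z {v} (h : ParentOf (λ _ _ → Unit) z v) →
        (∃[ f ] Joins f z (parOf z h) × τ₅ 10 (toℕ z) ≡ τ₅ 10 (toℕ (parOf z h)) + ℓ f)
        ⊎ (parOf z h ≡ z × (∀ f x → Joins f z x → τ₅ 10 (toℕ z) ≢ τ₅ 10 (toℕ x) + ℓ f))
      parOf-tight z (inj₁ (f , x , t , _)) = inj₁ (f , t)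
      parOf-tight z (inj₂ (_ , none))      = inj₂ (refl , λ f x j eq → none f x tt (j , eq))

      par : Fin n → Fin n
      par z = parOf z (parent z)

      par-tight : ∀ z → (∃[ f ] Joins f z (par z) × τ₅ 10 (toℕ z) ≡ τ₅ 10 (toℕ (par z)) + ℓ f)
                      ⊎ (par z ≡ z × (∀ f x → Joins f z x → τ₅ 10 (toℕ z) ≢ τ₅ 10 (toℕ x) + ℓ f))
      par-tight z = parOf-tight z (parent z)

      rows : ∀ z → Ancestors.Row I In par n z (τ₇ 14)
      rows z = subst (λ ρ → Ancestors.Row I In par n z (ρ 14)) (sym (run-sem ancestors τ₆))
        (Ancestors.ancestors-correct I In par τ₆ (trans (keep₆ 0 tt) q₀) (λ z → parOf-eq z (parent z)) z)

      decided : ∀ f → Decided (OnSettling e f) (1 ∸ (τ₈ 18 (toℕ f) + τ₅ 10 (toℕ (lo f)) + τ₅ 10 (toℕ (hi f)) + ℓ f ∸ th e))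
      decided = ForEdge.decided e ones Ds par par-tight {τ₇ 14} rows τ₇
        (trans (keep₇ 0 tt) q₀ , trans (keep₇ 2 tt) q₂ , trans (run-frame ancestors τ₆ 10 tt) (run-frame parents τ₅ 10 tt) , refl)
        (trans (cong (λ f → f 0) (trans (run-frame ancestors τ₆ 8 tt) (trans (run-frame parents τ₅ 8 tt) (run-frame bellmanFord τ₄ 8 tt)))) (proj₁ src₄))
        (trans (cong (λ f → f 0) (trans (run-frame ancestors τ₆ 9 tt) (trans (run-frame parents τ₅ 9 tt) (run-frame bellmanFord τ₄ 9 tt)))) (proj₂ src₄))

      d₈ : τ₈ 10 ≡ τ₅ 10
      d₈ = trans (run-frame dijkstra τ₇ 10 tt) (trans (run-frame ancestors τ₆ 10 tt) (run-frame parents τ₅ 10 tt))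

      th₈ : τ₈ 12 ≡ set (τ 12) (toℕ e) (th e)
      th₈ = trans (run-frame dijkstra τ₇ 12 tt) (trans (run-frame ancestors τ₆ 12 tt) (trans (run-frame parents τ₅ 12 tt)
              (trans (run-frame bellmanFord τ₄ 12 tt) th-set)))

      eq₉ : run edgeP τ ≡ run (for 5 2 settlingP) τ₈
      eq₉ = run-seq₂ eq₈

      th₉ : run edgeP τ 12 ≡ set (τ 12) (toℕ e) (th e)
      th₉ = trans (cong (λ ρ → ρ 12) eq₉) (trans (run-frame (for 5 2 settlingP) τ₈ 12 tt) th₈)

      row : RowSet (run edgeP τ 22) (τ 22) e (λ f → Decided (OnSettling e f))
      row = subst₂ (λ ρ g → RowSet (ρ 22) g e (λ f → Decided (OnSettling e f))) (sym eq₉) (keep₈ 22 tt)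
        (for-row 5 2 settlingP τ₈ 22 e tt (m-eq τ₈ (trans (keep₈ 0 tt) q₀)) (λ f → Decided (OnSettling e f)) body)
        where
        body : ∀ f (ρ : Store) → ρ 5 0 ≡ toℕ f → Frame 5 settlingP ρ τ₈ → ρ 22 (m * toℕ e + toℕ f) ≡ τ₈ 22 (m * toℕ e + toℕ f) →
               ∃[ v ] run settlingP ρ 22 ≡ set (ρ 22) (m * toℕ e + toℕ f) v × Decided (OnSettling e f) v
        body f ρ c fr _ = _ , leaf settlingP ρ 22
          (settling-cell {ρ} e f (trans (fr 0 tt) (trans (keep₈ 0 tt) q₀)) (trans (cong (λ g → g 0) (trans (fr 3 tt) (keep₈ 3 tt))) ctr) c (fr 18 tt) (trans (fr 10 tt) d₈)
            (trans (cong (λ g → g (toℕ e)) (trans (fr 12 tt) th₈)) (set-same (τ 12) (toℕ e) (th e)))) , decided f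

  tables-correct : ∀ (σ : Store) → σ 0 ≡ inp → σ 2 ≡ con →
                   (∀ e → run tables σ 12 (toℕ e) ≡ th e) × (∀ e f → Decided (OnSettling e f) (run tables σ 22 (m * toℕ e + toℕ f)))
  tables-correct σ q₀ q₂ =
    (λ e → trans (cong (λ τ → τ 12 (toℕ e)) eqT) (for-table 3 2 edgeP σ₁ 12 tt (m-eq σ₁ p₀) (λ e v → v ≡ th e)
      (λ e τ ctr fr → th e , EdgeStep.th₉ τ e ctr (e₀ τ fr) (e₂ τ fr) (eₘ τ fr) , refl) e)) ,
    λ e f → subst (λ τ → Decided (OnSettling e f) (τ 22 (m * toℕ e + toℕ f))) (sym eqT)
      (for-matrix 3 2 edgeP σ₁ 22 {m} {m} tt (m-eq σ₁ p₀) (λ e f → Decided (OnSettling e f)) (λ e τ ctr fr _ → EdgeStep.row τ e ctr (e₀ τ fr) (e₂ τ fr) (eₘ τ fr)) e f)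
    where
    fillP = 11 [ $$ 5 ]:= lit 1
    fill = for 5 2 fillP
    σ₁ = run fill σ
    eqT : run tables σ ≡ run (for 3 2 edgeP) σ₁
    eqT = run-seq fill (for 3 2 edgeP) σ
    p₀ : σ₁ 0 ≡ inp
    p₀ = trans (run-frame fill σ 0 tt) q₀
    ones : Ones (σ₁ 11)
    ones = for-table 5 2 fillP σ 11 tt (m-eq σ q₀) (λ _ v → v ≡ 1) λ k τ ctr _ → 1 , leaf fillP τ 11 (cong (λ c → set (τ 11) c 1) ctr) , refl
    e₀ : ∀ (τ : Store) → Frame 3 edgeP τ σ₁ → τ 0 ≡ inp
    e₀ τ fr = trans (fr 0 tt) p₀
    e₂ : ∀ (τ : Store) → Frame 3 edgeP τ σ₁ → τ 2 ≡ con
    e₂ τ fr = trans (fr 2 tt) (trans (run-frame fill σ 2 tt) q₂)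
    eₘ : ∀ (τ : Store) → Frame 3 edgeP τ σ₁ → Ones (τ 11)
    eₘ τ fr = subst Ones (sym (fr 11 tt)) ones

-- Trivial edges, bundles and critical pairs

gapE : Exp → Exp → Exp
gapE a b = a ⊖ b ⊕ (b ⊖ a)

altP trivialP trivialEdges bundleP bundles criticalP criticalPairs flagP flag preprocess : Prog
-- A path between the ends of `e` that contains `e` has no other edge. So `e` has an alternative
-- path exactly if some edge other than `e` lies on a settling path of `e`, which the matrix tells.
altP = 24 [ lit 0 ]:= nonZeroE ($$ 24 ⊕ 22 ⟦ m# ⊗ $$ 3 ⊕ $$ 5 ⟧ ⊗ gapE ($$ 3) ($$ 5))
trivialP = 23 [ $$ 3 ]:= nonZeroE (isZeroE ($$ 24) ⊕ isZeroE (wt# ($$ 3)))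
trivialEdges = for 3 2 (((24 [ lit 0 ]:= lit 0) ⨟ for 5 2 altP) ⨟ trivialP)
bundleP = 22 [ m# ⊗ $$ 3 ⊕ $$ 5 ]:= 22 ⟦ m# ⊗ $$ 3 ⊕ $$ 5 ⟧ ⊖ 23 ⟦ $$ 5 ⟧
bundles = for 3 2 (for 5 2 bundleP)
-- Array 11 holds the trivial edges at this point, so the distances are those in the subgraph of
-- trivial edges; the pair is critical exactly if its distance there exceeds the threshold.
criticalP = (edge₁ ⨟ bellmanFord) ⨟
  (25 [ $$ 3 ]:= nonZeroE (10 ⟦ lo# ($$ 3) ⟧ ⊖ 12 ⟦ $$ 3 ⟧))
criticalPairs = for 5 2 (11 [ $$ 5 ]:= 23 ⟦ $$ 5 ⟧) ⨟ for 3 2 criticalP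
flagP = 27 [ lit 0 ]:= nonZeroE ($$ 27 ⊕ 25 ⟦ $$ 3 ⟧ ⊗ (22 ⟦ m# ⊗ $$ 3 ⊕ $$ 5 ⟧ ⊗ gapE ($$ 3) ($$ 5)))
flag = (27 [ lit 0 ]:= lit 0) ⨟ for 3 2 (for 5 2 flagP)
preprocess = (((tables ⨟ trivialEdges) ⨟ bundles) ⨟ criticalPairs) ⨟ flag

gap-zero : ∀ {N} (e f : Fin N) → (e ≢ f × (toℕ e ∸ toℕ f) + (toℕ f ∸ toℕ e) ≢ 0) ⊎ (e ≡ f × (toℕ e ∸ toℕ f) + (toℕ f ∸ toℕ e) ≡ 0)
gap-zero e f with e Fin.≟ f
... | yes refl = inj₂ (refl , cong₂ _+_ (n∸n≡0 (toℕ e)) (n∸n≡0 (toℕ e)))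
... | no ne = inj₁ (ne , λ z → ne (Fin.toℕ-injective (≤-antisym (m∸n≡0⇒m≤n (m+n≡0⇒m≡0 (toℕ e ∸ toℕ f) z)) (m∸n≡0⇒m≤n (m+n≡0⇒n≡0 (toℕ e ∸ toℕ f) z)))))

-- A weaker form of Decided, for numbers that are not normalised.
Tested : Set → ℕ → Set
Tested P v = (P × v ≢ 0) ⊎ (¬ P × v ≡ 0)

nonzero-1 : ∀ {v} → v ≢ 0 → 1 ∸ (1 ∸ v) ≡ 1
nonzero-1 {zero}  h = ⊥-elim (h refl)
nonzero-1 {suc v} h = cong (1 ∸_) (0∸n≡0 v)

module Preprocessing {n m} (I : Instance n m) (In : Input I) where

  open Instance I using (graph; ℓ; w; Mandatory; Trivial; Critical; Bundle)
  open Input In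
  open Walks graph
  open Lengths ℓ
  open BellmanFord I In
  open Settling I In
  open TablesCorrect I In

  decided⇒tested : ∀ {P v} → Decided P v → Tested P v
  decided⇒tested (inj₁ (p , refl)) = inj₁ (p , λ ())
  decided⇒tested (inj₂ h)          = inj₂ h

  tested⇒decided : ∀ {P v} → Tested P v → Decided P (1 ∸ (1 ∸ v))
  tested⇒decided (inj₁ (p , h))    = inj₁ (p , nonzero-1 h)
  tested⇒decided (inj₂ (p , refl)) = inj₂ (p , refl)

  tested-map : ∀ {P Q v} → (P → Q) → (Q → P) → Tested P v → Tested Q v
  tested-map f g (inj₁ (p , h)) = inj₁ (f p , h)
  tested-map f g (inj₂ (p , h)) = inj₂ (p ∘ g , h)

  decided-map : ∀ {P Q v} → (P → Q) → (Q → P) → Decided P v → Decided Q v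
  decided-map f g (inj₁ (p , h)) = inj₁ (f p , h)
  decided-map f g (inj₂ (p , h)) = inj₂ (p ∘ g , h)

  tested-+ : ∀ {P Q u v} → Tested P u → Tested Q v → Tested (P ⊎ Q) (u + v)
  tested-+ {u = u} (inj₁ (p , h)) _ = inj₁ (inj₁ p , λ z → h (m+n≡0⇒m≡0 u z))
  tested-+ {u = u} (inj₂ _) (inj₁ (q , h)) = inj₁ (inj₂ q , λ z → h (m+n≡0⇒n≡0 u z))
  tested-+ (inj₂ (p , refl)) (inj₂ (q , refl)) = inj₂ ([ p , q ]′ , refl)

  tested-* : ∀ {P Q u v} → Tested P u → Tested Q v → Tested (P × Q) (u * v)
  tested-* {u = u} {v} (inj₁ (p , h)) (inj₁ (q , k)) = inj₁ ((p , q) , λ z → [ h , k ]′ (m*n≡0⇒m≡0∨n≡0 u z))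
  tested-* (inj₂ (p , refl)) _ = inj₂ (p ∘ proj₁ , refl)
  tested-* {u = u} (inj₁ _) (inj₂ (q , refl)) = inj₂ (q ∘ proj₂ , *-zeroʳ u)

  tested-¬ : ∀ {P v} → Decided P v → Tested (¬ P) (1 ∸ v)
  tested-¬ (inj₁ (p , refl)) = inj₂ ((λ h → h p) , refl)
  tested-¬ (inj₂ (p , refl)) = inj₁ (p , λ ())

  tested-gap : ∀ {N} (e f : Fin N) → Tested (e ≢ f) ((toℕ e ∸ toℕ f) + (toℕ f ∸ toℕ e))
  tested-gap e f with gap-zero e f
  ... | inj₁ h          = inj₁ h
  ... | inj₂ (refl , z) = inj₂ ((λ h → h refl) , z)

  -- `Q` is what the cell decides before the loop. As the body is described for every `Q`, the rule
  -- applies to nested loops as well.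
  for-or : ∀ x c p σ a {N} → T (not (x ≡ᵇ a)) → σ 0 c ≡ N → (P : Fin N → Set) →
           (∀ k (τ : Store) → τ x 0 ≡ toℕ k → Frame x p τ σ → ∀ {Q} → Decided Q (τ a 0) → Decided (Q ⊎ P k) (run p τ a 0)) →
           ∀ {Q} → Decided Q (σ a 0) → Decided (Q ⊎ (∃[ k ] P k)) (run (for x c p) σ a 0)
  for-or x c p σ a {N} xa eN P body {Q} q =
    decided-map [ inj₁ , (λ (k , _ , h) → inj₂ (k , h)) ]′ [ inj₁ , (λ (k , h) → inj₂ (k , Fin.toℕ<n k , h)) ]′
      (for-run x c p σ eN (λ j τ → Decided (Upto j) (τ a 0)) start go)
    where
    Upto : ℕ → Set
    Upto j = Q ⊎ (∃[ k ] toℕ k < j × P k)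
    start : Decided (Upto 0) (setCell x 0 0 σ a 0)
    start rewrite setCell-array x a 0 σ xa = decided-map inj₁ [ id , (λ ()) ]′ q
    go : ∀ (k : Fin N) τ → τ x 0 ≡ toℕ k → Frame x p τ σ → Decided (Upto (toℕ k)) (τ a 0) →
         Decided (Upto (suc (toℕ k))) (setCell x 0 (suc (toℕ k)) (run p τ) a 0)
    go k τ ctr fr d rewrite setCell-array x a (suc (toℕ k)) (run p τ) xa = decided-map to from (body k τ ctr fr d)
      where
      to : Upto (toℕ k) ⊎ P k → Upto (suc (toℕ k))
      to (inj₁ (inj₁ q)) = inj₁ q
      to (inj₁ (inj₂ (j , lt , h))) = inj₂ (j , m<n⇒m<1+n lt , h)
      to (inj₂ h) = inj₂ (k , ≤-refl , h)
      from : Upto (suc (toℕ k)) → Upto (toℕ k) ⊎ P k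
      from (inj₁ q) = inj₁ (inj₁ q)
      from (inj₂ (j , lt , h)) with m<1+n⇒m<n∨m≡n lt
      ... | inj₁ l  = inj₁ (inj₂ (j , l , h))
      ... | inj₂ eq = inj₂ (subst P (Fin.toℕ-injective eq) h)

  edge-end : ∀ {u v e x y} (p : Walk u v) → e ∈ˡ edges p → Joins e x y → x ∈ˡ vertices p
  edge-end (step e j p) (here refl) i with joins-ends i j
  ... | inj₁ (refl , _) = here refl
  ... | inj₂ (refl , _) = there (first∈ p)
  edge-end (step e j p) (there l) i = there (edge-end p l i)

  closed-path : ∀ {v} (p : Walk v v) → IsPath p → edges p ≡ []
  closed-path stop         _       = refl
  closed-path (step e j p) (a ∷ _) = ⊥-elim (All.lookup a (last∈ p) refl)

  -- If `e` came later, the path would return to its first vertex. If it comes first, the path has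
  -- already arrived, and a closed simple rest is empty.
  direct-path : ∀ {u v e f} (p : Walk u v) → IsPath p → Joins e u v → e ∈ˡ edges p → f ∈ˡ edges p → f ≡ e
  direct-path (step e j p) (a ∷ _) i (there l) _ = ⊥-elim (All.lookup a (edge-end p l i) refl)
  direct-path {u} {v} {f = f} (step {v = x} e j p) (a ∷ u′) i (here refl) l with joins-ends i j
  ... | inj₂ (refl , _) = ⊥-elim (joins-≢ j refl)
  ... | inj₁ (_ , refl) with l
  ... | here eq = eq
  ... | there k with edges p | closed-path p u′
  ... | _ | refl = case k of λ ()

  alternative⇒¬mandatory : ∀ {e f} → OnSettling e f → e ≢ f → ¬ Mandatory e
  alternative⇒¬mandatory {e} (p , (path , σ) , i) ne man =
    man (p , (path , σ) , λ k → ne (sym (direct-path p path (inj₁ (refl , refl)) k i)))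

  no-alternative : ∀ {e} → ¬ (∃[ f ] OnSettling e f × e ≢ f) → Mandatory e
  no-alternative {e} none (p , P , ∉p) with someEdge p
    where
    someEdge : ∀ {u v} (p : Walk u v) → u ≡ v ⊎ (∃[ f ] f ∈ˡ edges p)
    someEdge stop         = inj₁ refl
    someEdge (step f _ _) = inj₂ (f , here refl)
  ... | inj₁ eq      = joins-≢ {e} (inj₁ (refl , refl)) eq
  ... | inj₂ (f , i) = none (f , (p , P , i) , λ { refl → ∉p i })

  record Prepared (τ : Store) : Set where
    field
      thresholds : ∀ e → τ 12 (toℕ e) ≡ th e
      trivial    : ∀ e → Decided (Trivial e) (τ 23 (toℕ e))
      bundle     : ∀ e f → Decided (Bundle e f) (τ 22 (m * toℕ e + toℕ f))
      critical   : ∀ e → Decided (Critical e) (τ 25 (toℕ e))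
      flagged    : Decided (∃[ e ] ∃[ f ] Critical e × Bundle e f × e ≢ f) (τ 27 0)

  private
    trivialEdges-correct : ∀ (σ : Store) → σ 0 ≡ inp → (∀ e f → Decided (OnSettling e f) (σ 22 (m * toℕ e + toℕ f))) →
                           ∀ e → Decided (Trivial e) (run trivialEdges σ 23 (toℕ e))
    trivialEdges-correct σ q₀ sb = for-table 3 2 body σ 23 tt (m-eq σ q₀) (λ e v → Decided (Trivial e) v) go
      where
      body = ((24 [ lit 0 ]:= lit 0) ⨟ for 5 2 altP) ⨟ trivialP
      go : ∀ e (τ : Store) → τ 3 0 ≡ toℕ e → Frame 3 body τ σ → ∃[ v ] run body τ 23 ≡ set (τ 23) (toℕ e) v × Decided (Trivial e) v
      go e τ ctr fr = _ , eq , tested⇒decided (tested-map to from (tested-+ (tested-¬ alt) weight))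
        where
        τ₁ = sem (24 [ lit 0 ]:= lit 0) τ
        τ₂ = run (for 5 2 altP) τ₁
        p₀ : τ 0 ≡ inp
        p₀ = trans (fr 0 tt) q₀
        alt : Decided (∃[ f ] OnSettling e f × e ≢ f) (τ₂ 24 0)
        alt = decided-map [ (λ ()) , id ]′ inj₂ (for-or 5 2 altP τ₁ 24 tt (m-eq τ₁ p₀) (λ f → OnSettling e f × e ≢ f) acc′ {⊥} (inj₂ ((λ ()) , refl)))
          where
          acc′ : ∀ f (ρ : Store) → ρ 5 0 ≡ toℕ f → Frame 5 altP ρ τ₁ → ∀ {Q} → Decided Q (ρ 24 0) →
                 Decided (Q ⊎ (OnSettling e f × e ≢ f)) (run altP ρ 24 0)
          acc′ f ρ c fr′ q rewrite run-sem altP ρ | c | fr′ 0 tt | p₀ | inp-m | fr′ 3 tt | ctr | fr′ 22 tt | fr 22 tt =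
            tested⇒decided (tested-+ (decided⇒tested q) (tested-* (decided⇒tested (sb e f)) (tested-gap e f)))
        weight : Tested (w e ≡ 0) (1 ∸ w e)
        weight with w e
        ... | zero  = inj₁ (refl , λ ())
        ... | suc k = inj₂ ((λ ()) , 0∸n≡0 k)
        eq : run body τ 23 ≡ set (τ 23) (toℕ e) (1 ∸ (1 ∸ ((1 ∸ τ₂ 24 0) + (1 ∸ w e))))
        eq = trans (cong (λ ρ → ρ 23) (trans (run-seq₂ (run-seq₂ (run-sem (24 [ lit 0 ]:= lit 0) τ))) (run-sem trivialP τ₂)))
          (trans (value (τ₂ 3 0) (τ₂ 0) (trans (cong (λ f → f 0) (run-frame (for 5 2 altP) τ₁ 3 tt)) ctr) (trans (run-frame (for 5 2 altP) τ₁ 0 tt) p₀))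
               (cong (λ f → set f (toℕ e) (1 ∸ (1 ∸ ((1 ∸ τ₂ 24 0) + (1 ∸ w e))))) (run-frame (for 5 2 altP) τ₁ 23 tt)))
          where
          value : ∀ (c : ℕ) (i : ℕ → ℕ) → c ≡ toℕ e → i ≡ inp → set (τ₂ 23) c (1 ∸ (1 ∸ ((1 ∸ τ₂ 24 0) + (1 ∸ i (10 + 4 * c))))) ≡
                  set (τ₂ 23) (toℕ e) (1 ∸ (1 ∸ ((1 ∸ τ₂ 24 0) + (1 ∸ w e))))
          value _ _ refl refl = cong (λ v → set (τ₂ 23) (toℕ e) (1 ∸ (1 ∸ ((1 ∸ τ₂ 24 0) + (1 ∸ v))))) (inp-w e)
        to : ¬ (∃[ f ] OnSettling e f × e ≢ f) ⊎ w e ≡ 0 → Trivial e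
        to = [ inj₁ ∘ no-alternative , inj₂ ]′
        from : Trivial e → ¬ (∃[ f ] OnSettling e f × e ≢ f) ⊎ w e ≡ 0
        from = [ (λ man → inj₁ λ (f , on , ne) → alternative⇒¬mandatory on ne man) , inj₂ ]′

    bundles-correct : ∀ (σ : Store) → σ 0 ≡ inp → (∀ e f → Decided (OnSettling e f) (σ 22 (m * toℕ e + toℕ f))) →
                      (∀ e → Decided (Trivial e) (σ 23 (toℕ e))) → ∀ e f → Decided (Bundle e f) (run bundles σ 22 (m * toℕ e + toℕ f))
    bundles-correct σ q₀ sb tr = for-matrix 3 2 (for 5 2 bundleP) σ 22 {m} {m} tt (m-eq σ q₀) (λ e f → Decided (Bundle e f)) row
      where
      row : ∀ e (τ : Store) → τ 3 0 ≡ toℕ e → Frame 3 (for 5 2 bundleP) τ σ →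
            (∀ (f : Fin m) → τ 22 (m * toℕ e + toℕ f) ≡ σ 22 (m * toℕ e + toℕ f)) →
            RowSet (run (for 5 2 bundleP) τ 22) (τ 22) e (λ f → Decided (Bundle e f))
      row e τ ctr fr same = for-row 5 2 bundleP τ 22 e tt (m-eq τ (trans (fr 0 tt) q₀)) (λ f → Decided (Bundle e f)) body
        where
        body : ∀ f (ρ : Store) → ρ 5 0 ≡ toℕ f → Frame 5 bundleP ρ τ → ρ 22 (m * toℕ e + toℕ f) ≡ τ 22 (m * toℕ e + toℕ f) →
               ∃[ v ] run bundleP ρ 22 ≡ set (ρ 22) (m * toℕ e + toℕ f) v × Decided (Bundle e f) v
        body f ρ c fr′ same′ = _ , leaf bundleP ρ 22 eq , value
          where
          eq : sem bundleP ρ 22 ≡ set (ρ 22) (m * toℕ e + toℕ f) (σ 22 (m * toℕ e + toℕ f) ∸ σ 23 (toℕ f))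
          eq rewrite c | trans (fr′ 0 tt) (trans (fr 0 tt) q₀) | inp-m | fr′ 3 tt | ctr | trans (fr′ 23 tt) (fr 23 tt) | trans same′ (same f) = refl
          value : Decided (Bundle e f) (σ 22 (m * toℕ e + toℕ f) ∸ σ 23 (toℕ f))
          value with sb e f | tr f
          ... | inj₁ (p , u) | inj₁ (q , v) = inj₂ ((λ b → proj₂ b q) , cong₂ _∸_ u v)
          ... | inj₁ (p , u) | inj₂ (q , v) = inj₁ ((p , q) , cong₂ _∸_ u v)
          ... | inj₂ (p , u) | _            = inj₂ ((λ b → p (proj₁ b)) , trans (cong (_∸ σ 23 (toℕ f)) u) (0∸n≡0 (σ 23 (toℕ f))))

    critical-value : ∀ {msk D} e → (∀ f → Decided (Trivial f) (msk (toℕ f))) → Distances msk (hi e) (hi e) D →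
                     Decided (Critical e) (1 ∸ (1 ∸ (D (toℕ (lo e)) ∸ th e)))
    critical-value {msk} {D} e tr Ds with D (toℕ (lo e)) ≤? th e
    ... | yes le = inj₂ (not-critical (Distances.realised Ds (lo e)) , cong (λ v → 1 ∸ (1 ∸ v)) (m≤n⇒m∸n≡0 le))
      where
      not-critical : D (toℕ (lo e)) ≡ V ⊎ (∃[ a ] (a ≡ hi e ⊎ a ≡ hi e) × Σ[ p ∈ Walk (lo e) a ] Masked msk p × len p ≡ D (toℕ (lo e))) → ¬ Critical e
      not-critical (inj₁ eq) _ = <⇒≱ (th<V e) (subst (_≤ th e) eq le)
      not-critical (inj₂ (a , σ , p , mp , eq)) cr with [ id , id ]′ σ
      ... | refl with erase p
      ... | q , sub , path = cr (q , (path , ≤⇒settling e (≤-trans (len-≼ sub) (≤-trans (≤-reflexive eq) le))) ,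
              All.tabulate (λ {f} i → [ proj₁ , (λ (_ , z) → ⊥-elim (All.lookup mp (≼-edges sub i) z)) ]′ (tr f)))
    ... | no nle = inj₁ (crit , nonzero-1 (λ z → nle (m∸n≡0⇒m≤n z)))
      where
      crit : Critical e
      crit (p , (path , σ) , allT) = nle (≤-trans (distances-path Ds (inj₁ refl) p
        (All.map (λ {f} t → [ (λ (_ , v) z → case trans (sym v) z of λ ()) , (λ (nt , _) → ⊥-elim (nt t)) ]′ (tr f)) allT)) (settling⇒≤ e σ))

    criticalPairs-correct : ∀ (σ : Store) → σ 0 ≡ inp → σ 2 ≡ con → (∀ e → σ 12 (toℕ e) ≡ th e) →
                            (∀ e → Decided (Trivial e) (σ 23 (toℕ e))) → ∀ e → Decided (Critical e) (run criticalPairs σ 25 (toℕ e))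
    criticalPairs-correct σ q₀ q₂ hth tr e₀ = subst (λ τ → Decided (Critical e₀) (τ 25 (toℕ e₀))) (sym eqC)
      (for-table 3 2 criticalP σ₁ 25 tt (m-eq σ₁ p₀) (λ e v → Decided (Critical e) v) go e₀)
      where
      copyP = 11 [ $$ 5 ]:= 23 ⟦ $$ 5 ⟧
      copy = for 5 2 copyP
      σ₁ = run copy σ
      eqC : run criticalPairs σ ≡ run (for 3 2 criticalP) σ₁
      eqC = run-seq copy (for 3 2 criticalP) σ
      p₀ : σ₁ 0 ≡ inp
      p₀ = trans (run-frame copy σ 0 tt) q₀
      mask : ∀ e → Decided (Trivial e) (σ₁ 11 (toℕ e))
      mask = for-table 5 2 copyP σ 11 tt (m-eq σ q₀) (λ e v → Decided (Trivial e) v)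
        λ k τ ctr fr → σ 23 (toℕ k) , leaf copyP τ 11 (cong₂ (λ c f → set (τ 11) c (f c)) ctr (fr 23 tt)) , tr k
      go : ∀ e (τ : Store) → τ 3 0 ≡ toℕ e → Frame 3 criticalP τ σ₁ →
           ∃[ v ] run criticalP τ 25 ≡ set (τ 25) (toℕ e) v × Decided (Critical e) v
      go e τ ctr fr = _ , eq , critical-value e (λ f → subst (Decided (Trivial f)) (sym (cong (λ g → g (toℕ f)) (fr 11 tt))) (mask f)) Ds
        where
        setP : Prog
        setP = 25 [ $$ 3 ]:= nonZeroE (10 ⟦ lo# ($$ 3) ⟧ ⊖ 12 ⟦ $$ 3 ⟧)
        τ₁ = sem edge₁ τ
        τ₂ = run bellmanFord τ₁
        t₀ : τ 0 ≡ inp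
        t₀ = trans (fr 0 tt) p₀
        src : τ₁ 8 0 ≡ toℕ (hi e) × τ₁ 9 0 ≡ toℕ (hi e)
        src rewrite ctr | t₀ | inp-hi e = refl , refl
        Ds : Distances (τ 11) (hi e) (hi e) (τ₂ 10)
        Ds = bellmanFord-run (τ 11) (hi e) (hi e) τ₁ (t₀ , trans (fr 2 tt) (trans (run-frame copy σ 2 tt) q₂)) refl (proj₁ src) (proj₂ src)
        th₂ : τ₂ 12 (toℕ e) ≡ th e
        th₂ = trans (cong (λ f → f (toℕ e)) (trans (run-frame bellmanFord τ₁ 12 tt) (trans (fr 12 tt) (run-frame copy σ 12 tt)))) (hth e)
        eq : run criticalP τ 25 ≡ set (τ 25) (toℕ e) (1 ∸ (1 ∸ (τ₂ 10 (toℕ (lo e)) ∸ th e)))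
        eq = trans (cong (λ ρ → ρ 25) (trans (run-seq₂ (run-seq₂ (run-sem edge₁ τ))) (run-sem setP τ₂)))
          (trans (value (τ₂ 3 0) (τ₂ 0) (trans (cong (λ f → f 0) (run-frame bellmanFord τ₁ 3 tt)) ctr) (trans (run-frame bellmanFord τ₁ 0 tt) t₀))
               (cong (λ f → set f (toℕ e) (1 ∸ (1 ∸ (τ₂ 10 (toℕ (lo e)) ∸ th e)))) (run-frame bellmanFord τ₁ 25 tt)))
          where
          value : ∀ (c : ℕ) (i : ℕ → ℕ) → c ≡ toℕ e → i ≡ inp → set (τ₂ 25) c (1 ∸ (1 ∸ (τ₂ 10 (i (7 + 4 * c)) ∸ τ₂ 12 c))) ≡
                  set (τ₂ 25) (toℕ e) (1 ∸ (1 ∸ (τ₂ 10 (toℕ (lo e)) ∸ th e)))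
          value _ _ refl refl = cong₂ (λ a b → set (τ₂ 25) (toℕ e) (1 ∸ (1 ∸ (τ₂ 10 a ∸ b)))) (inp-lo e) th₂

    flag-correct : ∀ (σ : Store) → σ 0 ≡ inp → (∀ e f → Decided (Bundle e f) (σ 22 (m * toℕ e + toℕ f))) →
                   (∀ e → Decided (Critical e) (σ 25 (toℕ e))) → Decided (∃[ e ] ∃[ f ] Critical e × Bundle e f × e ≢ f) (run flag σ 27 0)
    flag-correct σ q₀ bd cr = subst (λ τ → Decided (∃[ e ] ∃[ f ] Critical e × Bundle e f × e ≢ f) (τ 27 0)) (sym (run-seq₂ (run-sem (27 [ lit 0 ]:= lit 0) σ))) $ decided-map [ (λ ()) , id ]′ inj₂
        (for-or 3 2 (for 5 2 flagP) σ₁ 27 tt (m-eq σ₁ q₀) (λ e → ∃[ f ] Critical e × Bundle e f × e ≢ f) outer {⊥} (inj₂ ((λ ()) , refl)))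
      where
      σ₁ = sem (27 [ lit 0 ]:= lit 0) σ
      outer : ∀ e (τ : Store) → τ 3 0 ≡ toℕ e → Frame 3 (for 5 2 flagP) τ σ₁ → ∀ {Q} → Decided Q (τ 27 0) →
              Decided (Q ⊎ (∃[ f ] Critical e × Bundle e f × e ≢ f)) (run (for 5 2 flagP) τ 27 0)
      outer e τ ctr fr = for-or 5 2 flagP τ 27 tt (m-eq τ (trans (fr 0 tt) q₀)) (λ f → Critical e × Bundle e f × e ≢ f) inner
        where
        inner : ∀ f (ρ : Store) → ρ 5 0 ≡ toℕ f → Frame 5 flagP ρ τ → ∀ {Q} → Decided Q (ρ 27 0) →
                Decided (Q ⊎ (Critical e × Bundle e f × e ≢ f)) (run flagP ρ 27 0)
        inner f ρ c fr′ q rewrite run-sem flagP ρ | c | trans (fr′ 0 tt) (trans (fr 0 tt) q₀) | inp-m | fr′ 3 tt | ctr | trans (fr′ 22 tt) (fr 22 tt) | trans (fr′ 25 tt) (fr 25 tt) =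
          tested⇒decided (tested-+ (decided⇒tested q) (tested-* (decided⇒tested (cr e)) (tested-* (decided⇒tested (bd e f)) (tested-gap e f))))

  preprocess-correct : ∀ (σ : Store) → σ 0 ≡ inp → σ 2 ≡ con → Prepared (run preprocess σ)
  preprocess-correct σ q₀ q₂ = subst Prepared (sym eq₅) (record
    { thresholds = λ e → trans (cong (λ f → f (toℕ e)) (trans (run-frame flag σ₄ 12 tt) (trans (run-frame criticalPairs σ₃ 12 tt) (trans (run-frame bundles σ₂ 12 tt) (run-frame trivialEdges σ₁ 12 tt))))) (proj₁ T₁ e)
    ; trivial = λ e → subst (Decided (Trivial e)) (sym (cong (λ f → f (toℕ e)) (trans (run-frame flag σ₄ 23 tt) (trans (run-frame criticalPairs σ₃ 23 tt) (run-frame bundles σ₂ 23 tt))))) (tr e)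
    ; bundle = λ e f → subst (Decided (Bundle e f)) (sym (cong (λ g → g (m * toℕ e + toℕ f)) (trans (run-frame flag σ₄ 22 tt) (run-frame criticalPairs σ₃ 22 tt)))) (bd e f)
    ; critical = λ e → subst (Decided (Critical e)) (sym (cong (λ f → f (toℕ e)) (run-frame flag σ₄ 25 tt))) (cr e)
    ; flagged = flag-correct σ₄ i₄
        (λ e f → subst (Decided (Bundle e f)) (sym (cong (λ g → g (m * toℕ e + toℕ f)) (run-frame criticalPairs σ₃ 22 tt))) (bd e f)) cr })
    where
    σ₁ σ₂ σ₃ σ₄ : Store
    σ₁ = run tables σ
    σ₂ = run trivialEdges σ₁
    σ₃ = run bundles σ₂
    σ₄ = run criticalPairs σ₃
    eq₅ : run preprocess σ ≡ run flag σ₄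
    eq₅ = run-seq₂ (run-seq₂ (run-seq₂ (run-seq tables trivialEdges σ)))
    i₁ : σ₁ 0 ≡ inp
    i₁ = trans (run-frame tables σ 0 tt) q₀
    i₂ : σ₂ 0 ≡ inp
    i₂ = trans (run-frame trivialEdges σ₁ 0 tt) i₁
    i₃ : σ₃ 0 ≡ inp
    i₃ = trans (run-frame bundles σ₂ 0 tt) i₂
    i₄ : σ₄ 0 ≡ inp
    i₄ = trans (run-frame criticalPairs σ₃ 0 tt) i₃
    T₁ = tables-correct σ q₀ q₂
    tr : ∀ e → Decided (Trivial e) (σ₂ 23 (toℕ e))
    tr = trivialEdges-correct σ₁ i₁ (proj₂ T₁)
    bd : ∀ e f → Decided (Bundle e f) (σ₃ 22 (m * toℕ e + toℕ f))
    bd = bundles-correct σ₂ i₂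
      (λ e f → subst (Decided (OnSettling e f)) (sym (cong (λ g → g (m * toℕ e + toℕ f)) (run-frame trivialEdges σ₁ 22 tt))) (proj₂ T₁ e f)) tr
    cr : ∀ e → Decided (Critical e) (σ₄ 25 (toℕ e))
    cr = criticalPairs-correct σ₃ i₃ (trans (run-frame bundles σ₂ 2 tt) (trans (run-frame trivialEdges σ₁ 2 tt) (trans (run-frame tables σ 2 tt) q₂)))
      (λ e → trans (cong (λ f → f (toℕ e)) (trans (run-frame bundles σ₂ 12 tt) (run-frame trivialEdges σ₁ 12 tt))) (proj₁ T₁ e))
      (λ e → subst (Decided (Trivial e)) (sym (cong (λ f → f (toℕ e)) (run-frame bundles σ₂ 23 tt))) (tr e))

-- Sums and sizes

nz : ℕ → ℕ
nz v = 1 ∸ (1 ∸ v)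

isNZ : ℕ → Bool
isNZ zero    = false
isNZ (suc _) = true

nz-if : ∀ v a → (if isNZ v then a else 0) ≡ nz v * a
nz-if zero    a = refl
nz-if (suc v) a = sym (trans (cong (λ k → (1 ∸ k) * a) (0∸n≡0 v)) (+-identityʳ a))

Σ< : ℕ → (ℕ → ℕ) → ℕ
Σ< zero    a = 0
Σ< (suc k) a = Σ< k a + a k

Σ<-front : ∀ k a → Σ< (suc k) a ≡ a 0 + Σ< k (a ∘ suc)
Σ<-front zero    a = sym (+-identityʳ (a 0))
Σ<-front (suc k) a = trans (cong (_+ a (suc k)) (Σ<-front k a)) (+-assoc (a 0) _ _)

Σ<-cong : ∀ k {a b : ℕ → ℕ} → (∀ i → i < k → a i ≡ b i) → Σ< k a ≡ Σ< k b
Σ<-cong zero    h = refl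
Σ<-cong (suc k) h = cong₂ _+_ (Σ<-cong k (λ i lt → h i (m<n⇒m<1+n lt))) (h k ≤-refl)

Σ<-bump : ∀ k f {a b : ℕ → ℕ} → f < k → (∀ i → i < k → i ≢ f → b i ≡ a i) → b f ≡ suc (a f) → Σ< k b ≡ suc (Σ< k a)
Σ<-bump (suc k) f {a} {b} lt h hf with m<1+n⇒m<n∨m≡n lt
... | inj₁ l    = cong₂ _+_ (Σ<-bump k f l (λ i lt → h i (m<n⇒m<1+n lt)) hf) (h k ≤-refl (λ { refl → <-irrefl refl l }))
... | inj₂ refl = trans (cong₂ _+_ (Σ<-cong k (λ i l → h i (m<n⇒m<1+n l) (λ { refl → <-irrefl refl l }))) hf) (+-suc (Σ< k a) (a k))

sum-tabulate : ∀ k (a : ℕ → ℕ) → Vec.sum (Vec.tabulate {n = k} (a ∘ toℕ)) ≡ Σ< k a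
sum-tabulate zero    a = refl
sum-tabulate (suc k) a = trans (cong (a 0 +_) (sum-tabulate k (a ∘ suc))) (sym (Σ<-front k a))

sum-tabulate-≤ : ∀ {k} {a b : Fin k → ℕ} → (∀ i → a i ≤ b i) → Vec.sum (Vec.tabulate a) ≤ Vec.sum (Vec.tabulate b)
sum-tabulate-≤ {zero}  h = z≤n
sum-tabulate-≤ {suc k} h = +-mono-≤ (h Fin.zero) (sum-tabulate-≤ (h ∘ Fin.suc))

toSet : ∀ {m} → (ℕ → ℕ) → Subset m
toSet g = Vec.tabulate (λ i → isNZ (g (toℕ i)))

∈-toSet : ∀ {m} g {i : Fin m} → g (toℕ i) ≢ 0 → i ∈ˢ toSet g
∈-toSet g {i} h = Vec.lookup⇒[]= i (toSet g) (trans (Vec.lookup∘tabulate _ i) (nonzero (g (toℕ i)) h))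
  where
  nonzero : ∀ v → v ≢ 0 → isNZ v ≡ true
  nonzero zero    h = ⊥-elim (h refl)
  nonzero (suc v) h = refl

toSet-∈ : ∀ {m} g {i : Fin m} → i ∈ˢ toSet g → g (toℕ i) ≢ 0
toSet-∈ g {i} h eq = case trans (sym (Vec.[]=⇒lookup h)) (trans (Vec.lookup∘tabulate _ i) (cong isNZ eq)) of λ ()

card-toSet : ∀ m g → card (toSet {m} g) ≡ Σ< m (nz ∘ g)
card-toSet zero    g = refl
card-toSet (suc m) g with g 0 in eq
... | zero  = trans (card-toSet m (g ∘ suc)) (trans (cong (λ v → nz v + Σ< m (nz ∘ g ∘ suc)) (sym eq)) (sym (Σ<-front m (nz ∘ g))))
... | suc v = trans (cong suc (card-toSet m (g ∘ suc)))
                (trans (cong (_+ Σ< m (nz ∘ g ∘ suc)) (trans (sym (nonzero-1 {suc v} λ ())) (cong nz (sym eq)))) (sym (Σ<-front m (nz ∘ g))))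

card-two : ∀ {m} {S : Subset m} {e f} → e ∈ˢ S → f ∈ˢ S → e ≢ f → 2 ≤ card S
card-two {S = S} {e} {f} p q ne = go S p q ne
  where
  one : ∀ {m} (S : Subset m) {e} → e ∈ˢ S → 1 ≤ card S
  one (true ∷ᵛ S)  Vec.here      = s≤s z≤n
  one (true ∷ᵛ S)  (Vec.there p) = s≤s z≤n
  one (false ∷ᵛ S) (Vec.there p) = one S p
  go : ∀ {m} (S : Subset m) {e f} → e ∈ˢ S → f ∈ˢ S → e ≢ f → 2 ≤ card S
  go (true ∷ᵛ S)  Vec.here      Vec.here      ne = ⊥-elim (ne refl)
  go (true ∷ᵛ S)  Vec.here      (Vec.there q) ne = s≤s (one S q)
  go (true ∷ᵛ S)  (Vec.there p) Vec.here      ne = s≤s (one S p)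
  go (true ∷ᵛ S)  (Vec.there p) (Vec.there q) ne = m≤n⇒m≤1+n (go S p q (ne ∘ cong Fin.suc))
  go (false ∷ᵛ S) (Vec.there p) (Vec.there q) ne = go S p q (ne ∘ cong Fin.suc)

stretch-mul : ∀ α {x d} → x ≤ stretch α d → x * ↧ₙ α ≤ ℤ.∣ ↥ α ∣ * d
stretch-mul (mkℚᵘ a b-1) {x} {d} h = ≤-trans (*-monoˡ-≤ (suc b-1) h) (m/n*n≤m (ℤ.∣ a ∣ * d) (suc b-1))

mul-stretch : ∀ α {x d} → x * ↧ₙ α ≤ ℤ.∣ ↥ α ∣ * d → x ≤ stretch α d
mul-stretch (mkℚᵘ a b-1) {x} {d} h = subst (_≤ (ℤ.∣ a ∣ * d) / suc b-1) (m*n/n≡m x (suc b-1)) (/-monoˡ-≤ (suc b-1) h)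

-- Spanners

module Theory {n m} (I : Instance n m) (In : Input I)
  (distances : (N : Network n m) → Σ[ D ∈ (Fin n → Fin n → ℕ) ] (∀ (u v : Fin n) → Network.Dist N full u v (D u v)))
  (preprocessed : Instance.Preprocessed I) where

  open Instance I using (graph; network; ℓ; ℓ-pos; connected; w; W; μ; α; 1≤α; Dist; SettlingLength; 𝒫; weight; IsSpanner; IsSolution;
                         Mandatory; Trivial; Nontrivial; Critical; Bundle; HasSize)
  open Input In
  open Walks graph
  open Lengths ℓ
  open Settling I In
  open Preprocessing I In

  -- The stack height 0 in `NoSolution` and the flag 1 in `Found` are what makes the guard of the
  -- search loop fail.
  Found NoSolution : Store → Set
  Found σ = σ 31 0 ≡ 1 × IsSolution (toSet (σ 28))
  NoSolution σ = σ 31 0 ≡ 0 × σ 32 0 ≡ 0 × (∀ F → ¬ IsSolution F)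

  module Modified (g : ℕ → ℕ) (B : ℕ) (1≤B : 1 ≤ B) where

    ℓ′ : Fin m → ℕ
    ℓ′ e = if isNZ (g (toℕ e)) then ℓ e else B

    -- Deleting the unchosen edges could disconnect the graph and leave no network to ask about.
    -- With length `B` they are merely kept off all walks shorter than `B`.
    modified : Network n m
    modified = record { graph = graph ; connected = connected ; ℓ = ℓ′ ; ℓ-pos = pos }
      where
      pos : ∀ e → 1 ≤ ℓ′ e
      pos e with isNZ (g (toℕ e))
      ... | true  = ℓ-pos e
      ... | false = 1≤B

    inside-length : ∀ {u v} (p : Walk u v) → p ⊑ toSet g → Network.ℓ* modified p ≡ len p
    inside-length stop         []       = refl
    inside-length (step e j p) (i ∷ is) = cong₂ _+_ (here-length (g (toℕ e)) (toSet-∈ g i)) (inside-length p is)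
      where
      here-length : ∀ v → v ≢ 0 → (if isNZ v then ℓ e else B) ≡ ℓ e
      here-length zero    h = ⊥-elim (h refl)
      here-length (suc v) h = refl

    short-inside : ∀ {u v} (p : Walk u v) → Network.ℓ* modified p < B → p ⊑ toSet g
    short-inside stop         _  = []
    short-inside (step e j p) lt = here-in (g (toℕ e)) refl ∷ short-inside p (≤-<-trans (m≤n+m _ (ℓ′ e)) lt)
      where
      here-in : ∀ v → g (toℕ e) ≡ v → e ∈ˢ toSet g
      here-in zero    eq = ⊥-elim (<⇒≱ (≤-<-trans (m≤m+n (ℓ′ e) (Network.ℓ* modified p)) lt) (≤-reflexive (cong (λ v → if isNZ v then ℓ e else B) (sym eq))))
      here-in (suc v) eq = ∈-toSet g λ z → case trans (sym eq) z of λ ()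

    modified-path : ∀ {u v d} → Network.Dist modified full u v d → d < B → ∃[ p ] IsPath {u} {v} p × p ⊑ toSet g × len p ≡ d
    modified-path ((p , path , _ , eq) , _) lt = p , path , ins , trans (sym (inside-length p ins)) eq
      where ins = short-inside p (subst (_< B) (sym eq) lt)

    modified-≤ : ∀ {u v d} → Network.Dist modified full u v d → (p : Walk u v) → IsPath p → p ⊑ toSet g → d ≤ len p
    modified-≤ (_ , least) p path ins = ≤-trans (least p path (⊑-full p)) (≤-reflexive (inside-length p ins))

  Settled : (ℕ → ℕ) → Fin m → Set
  Settled g e = ∃[ p ] IsPath {lo e} {hi e} p × p ⊑ toSet g × len p ≤ th e

  -- Read off from a distance, whose existence the APSP program guarantees. Giving unchosen edges
  -- the length `suc (th e)` puts them just above every length that settles.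
  settled? : ∀ g e → Dec (Settled g e)
  settled? g e with distances (Modified.modified g (suc (th e)) (s≤s z≤n))
  ... | D , h with D (lo e) (hi e) ≤? th e
  ... | yes le = let (p , path , ins , eq) = Modified.modified-path g (suc (th e)) (s≤s z≤n) (h (lo e) (hi e)) (s≤s le)
                 in  yes (p , path , ins , subst (_≤ th e) (sym eq) le)
  ... | no nle = no λ (p , path , ins , le) → nle (≤-trans (Modified.modified-≤ g (suc (th e)) (s≤s z≤n) (h (lo e) (hi e)) p path ins) le)

  -- Distances are known to exist in whole networks only. Unchosen edges longer than the given path
  -- do not matter for its ends, so the distance in the modified network is one in the subgraph.
  dist-in : ∀ g {u v} (p : Walk u v) → IsPath p → p ⊑ toSet g → ∃[ d ] Dist (toSet g) u v d × d ≤ len p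
  dist-in g {u} {v} p path ins with distances (Modified.modified g (suc (len p)) (s≤s z≤n))
  ... | D , h = D u v , (modified-path (h u v) (s≤s le) , λ q pq iq → modified-≤ (h u v) q pq iq) , le
    where
    open Modified g (suc (len p)) (s≤s z≤n)
    le : D u v ≤ len p
    le = modified-≤ (h u v) p path ins

  revOnto-⊑ : ∀ {x a c F} (A : Walk x a) (B : Walk x c) → A ⊑ F → B ⊑ F → revOnto A B ⊑ F
  revOnto-⊑ stop         B _        b = b
  revOnto-⊑ (step e j A) B (a ∷ as) b = revOnto-⊑ A _ as (a ∷ b)

  concat : ∀ {u v x F} (A : Walk u v) (B : Walk v x) → A ⊑ F → B ⊑ F → Σ[ C ∈ Walk u x ] C ⊑ F × len C ≡ len A + len B
  concat stop         B _        b = B , b , refl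
  concat (step e j A) B (a ∷ as) b with concat A B as b
  ... | C , c , eq = step e j C , a ∷ c , trans (cong (ℓ e +_) eq) (sym (+-assoc (ℓ e) _ _))

  -- Each edge of a shortest path is replaced by its settling path. The bounds are kept multiplied
  -- by the denominator of α, because thresholds rounded down would not add up to the required one.
  settled⇒spanner : ∀ g → (∀ e → Settled g e) → IsSpanner (toSet g)
  settled⇒spanner g st u v d ((p , path , _ , refl) , _) with detour p
    where
    across : ∀ e {u v} → Joins e u v → Σ[ q ∈ Walk u v ] q ⊑ toSet g × len q * ↧ₙ α ≤ ℤ.∣ ↥ α ∣ * ℓ e
    across e j with st e
    ... | q , _ , ins , le with ≤-trans (stretch-mul α le) (*-monoʳ-≤ ℤ.∣ ↥ α ∣ (δ≤ℓ e))
    ... | bound with j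
    ... | inj₁ (refl , refl) = q , ins , bound
    ... | inj₂ (refl , refl) = revOnto q stop , revOnto-⊑ q stop ins [] ,
            subst (λ k → k * ↧ₙ α ≤ ℤ.∣ ↥ α ∣ * ℓ e) (sym (trans (revOnto-len q stop) (+-identityʳ (len q)))) bound
    detour : ∀ {u v} (p : Walk u v) → Σ[ q ∈ Walk u v ] q ⊑ toSet g × len q * ↧ₙ α ≤ ℤ.∣ ↥ α ∣ * len p
    detour stop = stop , [] , z≤n
    detour (step e j p) with across e j | detour p
    ... | q , qi , qb | r , ri , rb with concat q r qi ri
    ... | c , ci , eq = c , ci , (begin
      len c * ↧ₙ α                         ≡⟨ cong (_* ↧ₙ α) eq ⟩
      (len q + len r) * ↧ₙ α               ≡⟨ *-distribʳ-+ (↧ₙ α) (len q) (len r) ⟩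
      len q * ↧ₙ α + len r * ↧ₙ α          ≤⟨ +-mono-≤ qb rb ⟩
      ℤ.∣ ↥ α ∣ * ℓ e + ℤ.∣ ↥ α ∣ * len p  ≡⟨ sym (*-distribˡ-+ ℤ.∣ ↥ α ∣ (ℓ e) (len p)) ⟩
      ℤ.∣ ↥ α ∣ * (ℓ e + len p)            ∎)
      where open ≤-Reasoning
  ... | q , ins , bound with erase q
  ... | r , sub , rpath with dist-in g r rpath (⊑-≼ sub ins)
  ... | d′ , D , le = d′ , D , proj₂ (stretch-correct 1≤α d′ _)
          (≤-trans le (≤-trans (len-≼ sub) (mul-stretch α bound)))

  spanner⇒settling : ∀ {F} → IsSpanner F → ∀ e → ∃[ p ] 𝒫 e p × p ⊑ F
  spanner⇒settling sp e with sp (lo e) (hi e) (δ (lo e) (hi e)) (proj₂ (dist (lo e) (hi e)))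
  ... | d , ((p , path , ins , eq) , _) , le = p , (path , δ (lo e) (hi e) , proj₂ (dist (lo e) (hi e)) , subst (λ x → fromℕ x ℚ.≤ _) (sym eq) le) , ins

  mandatory∈ : ∀ {F e} → IsSpanner F → Mandatory e → e ∈ˢ F
  mandatory∈ {F} {e} sp man with e Subset.∈? F
  ... | yes i = i
  ... | no ∉F with spanner⇒settling sp e
  ... | p , P , ins = ⊥-elim (man (p , P , λ i → ∉F (All.lookup ins i)))

  edge-settles : ∀ e → 𝒫 e (step e (inj₁ (refl , refl)) stop)
  edge-settles e = edge-path e , subst (SettlingLength (lo e) (hi e)) (sym (+-identityʳ (ℓ e))) (preprocessed e)

  critical⇒nontrivial : ∀ {e} → Critical e → Nontrivial e
  critical⇒nontrivial {e} cr t = cr (step e (inj₁ (refl , refl)) stop , edge-settles e , t ∷ [])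

  critical⇒bundle : ∀ {e} → Critical e → Bundle e e
  critical⇒bundle {e} cr = (step e (inj₁ (refl , refl)) stop , edge-settles e , here refl) , critical⇒nontrivial cr

  module _ (TR : ℕ → ℕ) (tr : ∀ e → Decided (Trivial e) (TR (toℕ e))) where

    trivial? : ∀ e → Dec (Trivial e)
    trivial? e with tr e
    ... | inj₁ (p , _) = yes p
    ... | inj₂ (p , _) = no p

    Good : (ℕ → ℕ) → Set
    Good g = ∀ e → Trivial e → g (toℕ e) ≢ 0

    -- Trivial edges are exempt: the choice contains all of them, while a solution may lack edges of
    -- weight 0.
    Consistent : (ℕ → ℕ) → Subset m → Set
    Consistent g F = ∀ e → g (toℕ e) ≢ 0 → Nontrivial e → e ∈ˢ F

    chosen : (ℕ → ℕ) → ℕ → ℕ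
    chosen g i = g i * (1 ∸ TR i)

    size : (ℕ → ℕ) → ℕ
    size g = card (toSet {m} (chosen g))

    chosen-≢0 : ∀ g e → (chosen g (toℕ e) ≢ 0 → g (toℕ e) ≢ 0 × Nontrivial e) × (g (toℕ e) ≢ 0 → Nontrivial e → chosen g (toℕ e) ≢ 0)
    chosen-≢0 g e with tr e
    ... | inj₁ (t , eq) rewrite eq = (λ h → ⊥-elim (h (*-zeroʳ (g (toℕ e))))) , λ _ nt _ → nt t
    ... | inj₂ (nt , eq) rewrite eq | *-identityʳ (g (toℕ e)) = (λ h → h , nt) , λ h _ → h

    size-correct : ∀ g → HasSize (λ e → e ∈ˢ toSet g × Nontrivial e) (size g)
    size-correct g = toSet (chosen g) ,
      (λ e → mk⇔ (λ i → let (a , b) = proj₁ (chosen-≢0 g e) (toSet-∈ (chosen g) i) in ∈-toSet g a , b)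
                 (λ (i , nt) → ∈-toSet (chosen g) (proj₂ (chosen-≢0 g e) (toSet-∈ g i) nt))) , refl

    size-≤ : ∀ {g F k} → Consistent g F → HasSize (λ e → e ∈ˢ F × Nontrivial e) k → size g ≤ k
    size-≤ {g} con (S , iff , refl) = Subset.p⊆q⇒∣p∣≤∣q∣ λ {e} i →
      let (a , b) = proj₁ (chosen-≢0 g e) (toSet-∈ (chosen g) i) in Equivalence.from (iff e) (con e a b , b)

    size-trivial : ∀ {g} → (∀ e → g (toℕ e) ≢ 0 → Trivial e) → size g ≡ 0
    size-trivial {g} h = n≤0⇒n≡0 (≤-trans (Subset.p⊆q⇒∣p∣≤∣q∣ {p = toSet (chosen g)} {q = Data.Fin.Subset.⊥} λ {e} i →
        let (a , b) = proj₁ (chosen-≢0 g e) (toSet-∈ (chosen g) i) in ⊥-elim (b (h e a))) (≤-reflexive (Subset.∣⊥∣≡0 m)))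
      where import Data.Fin.Subset

    size-add : ∀ {g g′ : ℕ → ℕ} {f : Fin m} → (∀ (e : Fin m) → e ≢ f → nz (g′ (toℕ e)) ≡ nz (g (toℕ e))) → g (toℕ f) ≡ 0 → g′ (toℕ f) ≢ 0 →
               Nontrivial f → size g′ ≡ suc (size g)
    size-add {g} {g′} {f} same g0 g1 nt = trans (card-toSet m (chosen g′)) (trans
        (Σ<-bump m (toℕ f) (Fin.toℕ<n f) others
          (trans (nonzero-1 (proj₂ (chosen-≢0 g′ f) g1 nt)) (cong (λ v → suc (nz (v * (1 ∸ TR (toℕ f))))) (sym g0))))
        (cong suc (sym (card-toSet m (chosen g)))))
      where
      nz-* : ∀ a b → nz (a * b) ≡ nz a * nz b
      nz-* zero    b       = refl
      nz-* (suc a) zero    = trans (cong nz (*-zeroʳ a)) (sym (*-zeroʳ (nz (suc a))))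
      nz-* (suc a) (suc b) = trans (cong (1 ∸_) (0∸n≡0 (b + a * suc b))) (sym (cong₂ (λ x y → (1 ∸ x) * (1 ∸ y)) (0∸n≡0 a) (0∸n≡0 b)))
      others : ∀ i → i < m → i ≢ toℕ f → nz (chosen g′ i) ≡ nz (chosen g i)
      others i lt ne = trans (nz-* (g′ i) (1 ∸ TR i)) (trans (cong (_* nz (1 ∸ TR i)) at) (sym (nz-* (g i) (1 ∸ TR i))))
        where
        at : nz (g′ i) ≡ nz (g i)
        at = subst (λ j → nz (g′ j) ≡ nz (g j)) (Fin.toℕ-fromℕ< lt)
               (same (fromℕ< lt) (λ eq → ne (trans (sym (Fin.toℕ-fromℕ< lt)) (cong toℕ eq))))

    wt : ℕ → ℕ
    wt i = inp (10 + 4 * i)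

    weight-toSet : ∀ g → weight (toSet g) ≡ Σ< m (λ i → nz (g i) * wt i)
    weight-toSet g = trans (cong Vec.sum (Vec.tabulate-cong λ e → trans (cong (λ b → if b then w e else 0) (Vec.lookup∘tabulate _ e))
        (trans (nz-if (g (toℕ e)) (w e)) (cong (nz (g (toℕ e)) *_) (sym (inp-w e))))))
      (sum-tabulate m (λ i → nz (g i) * wt i))

    -- The trivial edges of the choice cost nothing extra: mandatory ones lie in every spanner, and
    -- the others weigh 0.
    weight-≤ : ∀ {g F} → Consistent g F → IsSpanner F → weight (toSet g) ≤ weight F
    weight-≤ {g} {F} con sp = sum-tabulate-≤ each
      where
      in-F : ∀ {e} → e ∈ˢ F → w e ≤ (if Vec.lookup F e then w e else 0)
      in-F {e} i rewrite Vec.[]=⇒lookup i = ≤-refl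
      each : ∀ e → (if Vec.lookup (toSet g) e then w e else 0) ≤ (if Vec.lookup F e then w e else 0)
      each e with Vec.lookup (toSet g) e in eq
      ... | false = z≤n
      ... | true with trivial? e
      ... | yes (inj₁ man)  = in-F (mandatory∈ sp man)
      ... | yes (inj₂ w≡0) = ≤-trans (≤-reflexive w≡0) z≤n
      ... | no nt = in-F (con e (toSet-∈ g (Vec.lookup⇒[]= e (toSet g) eq)) nt)

    outside : ∀ g {u v} (p : Walk u v) → ¬ p ⊑ toSet g → ∃[ f ] f ∈ˡ edges p × g (toℕ f) ≡ 0
    outside g p h with ¬All⇒Any¬ (Subset._∈? toSet g) (edges p) h
    ... | a = find a
      where
      find : ∀ {xs : List (Fin m)} → Any.Any (λ e → ¬ e ∈ˢ toSet g) xs → ∃[ f ] f ∈ˡ xs × g (toℕ f) ≡ 0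
      find (here {x} h) with g (toℕ x) in eq
      ... | zero  = x , here refl , eq
      ... | suc v = ⊥-elim (h (∈-toSet g λ z → case trans (sym eq) z of λ ()))
      find (there a) with find a
      ... | f , i , z = f , there i , z

    unsettled⇒critical : ∀ {g e} → Good g → ¬ Settled g e → Critical e
    unsettled⇒critical {g} {e} good ns (p , (path , σ) , allT) =
      ns (p , path , All.map (λ {f} t → ∈-toSet g (good f t)) allT , settling⇒≤ e σ)

    -- The spanner contains a settling path of `e`, and it cannot lie inside the choice. An edge of
    -- it outside is nontrivial because the choice has all trivial edges.
    branch : ∀ {g e F} → Good g → ¬ Settled g e → IsSpanner F → ∃[ f ] f ∈ˢ F × Bundle e f × g (toℕ f) ≡ 0
    branch {g} {e} good ns sp with spanner⇒settling sp e
    ... | p , (path , σ) , ins with outside g p (λ all → ns (p , path , all , settling⇒≤ e σ))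
    ... | f , i , z = f , All.lookup ins i , ((p , (path , σ) , i) , λ t → good f t z) , z

    -- A settling path inside `F` has a nontrivial edge, which then belongs to the bundle of `e` and
    -- can only be `e` itself.
    critical∈ : ∀ {e F} → (∀ f → Bundle e f → e ≡ f) → Critical e → IsSpanner F → e ∈ˢ F
    critical∈ {e} only cr sp with spanner⇒settling sp e
    ... | p , P , ins with ¬All⇒Any¬ trivial? (edges p) (λ all → cr (p , P , all))
    ... | a with find a
      where
      find : ∀ {xs : List (Fin m)} → Any.Any (λ f → ¬ Trivial f) xs → ∃[ f ] f ∈ˡ xs × Nontrivial f
      find (here {x} h) = x , here refl , h
      find (there a) with find a
      ... | f , i , z = f , there i , z
    ... | f , i , nt with only f ((p , P , i) , nt)
    ... | refl = All.lookup ins i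

    -- `Critical` is a negation, so its failure provides a settling path only up to double negation;
    -- `settled?` removes it.
    not-critical⇒settled : ∀ {g e} → Good g → ¬ Critical e → Settled g e
    not-critical⇒settled {g} {e} good nc with settled? g e
    ... | yes s = s
    ... | no ns = ⊥-elim (nc (unsettled⇒critical {g} good ns))

    self-settled : ∀ {g e} → g (toℕ e) ≢ 0 → Settled g e
    self-settled {g} {e} h = step e (inj₁ (refl , refl)) stop , edge-path e , ∈-toSet g h ∷ [] , settling⇒≤ e (proj₂ (edge-settles e))

    solution : ∀ {g} → (∀ e → Settled g e) → weight (toSet g) ≤ W → size g ≤ μ → IsSolution (toSet g)
    solution {g} st wW sμ = settled⇒spanner g st , wW , size g , size-correct g , sμ

    bundle-size : ∀ {s} (BND : ℕ → ℕ) e → (∀ f → Decided (Bundle e f) (BND (m * toℕ e + toℕ f))) → Instance.IsBundleSize I s → Critical e →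
                  card (toSet {m} (λ i → BND (m * toℕ e + i))) ≤ s
    bundle-size BND e bd (upper , _) cr = upper e cr _ (toSet row , (λ f → mk⇔
        (λ i → [ proj₁ , (λ (_ , z) → ⊥-elim (toSet-∈ row i z)) ]′ (bd f))
        (λ b → ∈-toSet row ([ (λ (_ , z) z′ → case trans (sym z) z′ of λ ()) , (λ (nb , _) → ⊥-elim (nb b)) ]′ (bd f)))) , refl)
      where
      row : ℕ → ℕ
      row i = BND (m * toℕ e + i)

-- Lists stored in arrays

applyUpTo-cong : ∀ {f g : ℕ → ℕ} k → (∀ i → i < k → f i ≡ g i) → applyUpTo f k ≡ applyUpTo g k
applyUpTo-cong zero    h = refl
applyUpTo-cong (suc k) h = cong₂ _∷_ (h 0 (s≤s z≤n)) (applyUpTo-cong k (λ i lt → h (suc i) (s≤s lt)))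

applyUpTo-++ : ∀ (f : ℕ → ℕ) a b → applyUpTo f (a + b) ≡ applyUpTo f a ++ applyUpTo (λ i → f (a + i)) b
applyUpTo-++ f zero    b = refl
applyUpTo-++ f (suc a) b = cong (f 0 ∷_) (applyUpTo-++ (f ∘ suc) a b)

applyUpTo-blocks : ∀ (f : ℕ → ℕ) b k {A : Set} (h : A → List ℕ) (g : Fin k → A) →
  (∀ e → applyUpTo (λ r → f (b * toℕ e + r)) b ≡ h (g e)) → applyUpTo f (k * b) ≡ concatMap h (tabulate g)
applyUpTo-blocks f b zero    h g eq = refl
applyUpTo-blocks f b (suc k) h g eq = trans (applyUpTo-++ f b (k * b))
  (cong₂ _++_ (trans (applyUpTo-cong b (λ i _ → cong (λ z → f (z + i)) (sym (*-zeroʳ b)))) (eq Fin.zero))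
    (applyUpTo-blocks (λ i → f (b + i)) b k h (g ∘ Fin.suc) λ e →
      trans (applyUpTo-cong b (λ i _ → cong f (trans (sym (+-assoc b (b * toℕ e) i)) (cong (_+ i) (sym (*-suc b (toℕ e))))))) (eq (Fin.suc e))))

-- Depth-first search over sets of chosen edges

popHead rowP popP scanP pushP checkHead checkP : Prog
popHead = (32 [ lit 0 ]:= $$ 32 ⊖ lit 1) ⨟ (36 [ lit 0 ]:= 33 ⟦ $$ 32 ⟧) ⨟ (37 [ lit 0 ]:= 34 ⟦ $$ 32 ⟧) ⨟
  -- Cell 0 receives the length of the query: n, m and three numbers for each edge.
  (38 [ lit 0 ]:= minE CAP (lit 2 ⊕ m# ⊗ lit 3)) ⨟ (38 [ lit 1 ]:= n#) ⨟ (38 [ lit 2 ]:= m#)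
rowP =
  -- Row `j` is the choice of the parent node, found in the preceding row, plus the edge of the
  -- popped entry. The root entry carries the number m, which is no edge, and so adds nothing.
  (35 [ m# ⊗ $$ 36 ⊕ $$ 5 ]:= nonZeroE (35 ⟦ m# ⊗ ($$ 36 ⊖ lit 1) ⊕ $$ 5 ⟧ ⊕ isZeroE (gapE ($$ 37) ($$ 5)))) ⨟
  (28 [ $$ 5 ]:= 35 ⟦ m# ⊗ $$ 36 ⊕ $$ 5 ⟧) ⨟
  (38 [ lit 3 ⊕ lit 3 ⊗ $$ 5 ]:= lo# ($$ 5)) ⨟
  (38 [ lit 4 ⊕ lit 3 ⊗ $$ 5 ]:= hi# ($$ 5)) ⨟
  (38 [ lit 5 ⊕ lit 3 ⊗ $$ 5 ]:= minE BIG (len# ($$ 5) ⊕ isZeroE (28 ⟦ $$ 5 ⟧) ⊗ BIG))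
popP = popHead ⨟ for 5 2 rowP
scanP =
  -- Any unsettled edge will do; the last one is kept. The value m stored beforehand means that
  -- there is none. The index starts from 1 because cell 0 holds the length of the reply.
  ifz (39 ⟦ lit 1 ⊕ (n# ⊗ lo# ($$ 5) ⊕ hi# ($$ 5)) ⟧ ⊖ 12 ⟦ $$ 5 ⟧) nop (40 [ lit 0 ]:= $$ 5) ⨟
  (29 [ lit 0 ]:= minE CAP ($$ 29 ⊕ nonZeroE (28 ⟦ $$ 5 ⟧) ⊗ wt# ($$ 5)))
pushP =
  -- The entry is written in any case, above the top of the stack. The height grows only if the edge
  -- is in the bundle and not chosen; otherwise the entry stays outside the stack.
  (33 [ $$ 32 ]:= minE CAP ($$ 36 ⊕ lit 1)) ⨟ (34 [ $$ 32 ]:= $$ 5) ⨟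
  (32 [ lit 0 ]:= minE CAP ($$ 32 ⊕ 22 ⟦ m# ⊗ $$ 40 ⊕ $$ 5 ⟧ ⊗ isZeroE (28 ⟦ $$ 5 ⟧)))
checkHead = ((40 [ lit 0 ]:= m#) ⨟ (29 [ lit 0 ]:= lit 0)) ⨟ for 5 2 scanP
checkP = checkHead ⨟
  -- A node of level `j` has `j - 1` chosen nontrivial edges and its children have `j`, so they are
  -- admissible exactly if `j` is at most μ.
  ifz (m# ⊖ $$ 40) (31 [ lit 0 ]:= leE ($$ 29) (0 ⟦ lit 5 ⟧)) (ifz ($$ 36 ⊖ 0 ⟦ lit 6 ⟧) (for 5 2 pushP) nop)

-- An entry consists of a level and an edge, with the top of the stack at the head. The set it
-- stands for is not stored but recovered from array 35, which holds the current branch only.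
Stack : Set
Stack = List (ℕ × ℕ)

Rep : (ℕ → ℕ) → (ℕ → ℕ) → Stack → Set
Rep sj sf []            = Unit
Rep sj sf ((j , f) ∷ L) = sj (length L) ≡ j × sf (length L) ≡ f × Rep sj sf L

rep-set : ∀ {sj sf p v v′} L → length L ≤ p → Rep sj sf L → Rep (set sj p v) (set sf p v′) L
rep-set                   []      _  _           = tt
rep-set {sj} {sf} {p} {v} {v′} (x ∷ L) lt (a , b , r) =
  trans (set-other sj {p} {length L} v (λ { refl → <-irrefl refl lt })) a , trans (set-other sf {p} {length L} v′ (λ { refl → <-irrefl refl lt })) b ,
  rep-set L (<⇒≤ lt) r

gapN : ℕ → ℕ → ℕ
gapN a b = (a ∸ b) + (b ∸ a)

gapN-≢ : ∀ {a b} → a ≢ b → gapN a b ≢ 0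
gapN-≢ {a} {b} ne z = ne (≤-antisym (m∸n≡0⇒m≤n (m+n≡0⇒m≡0 (a ∸ b) z)) (m∸n≡0⇒m≤n (m+n≡0⇒n≡0 (a ∸ b) z)))

gapN-refl : ∀ a → gapN a a ≡ 0
gapN-refl a = cong₂ _+_ (n∸n≡0 a) (n∸n≡0 a)

1∸-≢ : ∀ {v} → v ≢ 0 → 1 ∸ v ≡ 0
1∸-≢ {zero}  h = ⊥-elim (h refl)
1∸-≢ {suc v} h = 0∸n≡0 v

-- Sums are capped after every addition; by this law the outcome is the capped total. As W is below
-- the cap, comparing with W is not affected.
mn-cap : ∀ v x y → mn v (mn v x + y) ≡ mn v (x + y)
mn-cap v x y with mn-cases v x
... | inj₂ (eq , _)  = cong (λ z → mn v (z + y)) eq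
... | inj₁ (eq , le) = trans (cong (λ z → mn v (z + y)) eq)
        (trans (cong (v ∸_) (m≤n⇒m∸n≡0 (m≤m+n v y))) (sym (cong (v ∸_) (m≤n⇒m∸n≡0 (≤-trans le (m≤m+n x y))))))

module Search {n m} (I : Instance n m) (In : Input I)
  (distances : (N : Network n m) → Σ[ D ∈ (Fin n → Fin n → ℕ) ] (∀ (u v : Fin n) → Network.Dist N full u v (D u v)))
  (preprocessed : Instance.Preprocessed I)
  (TH BND TR : ℕ → ℕ)
  (th-eq : ∀ e → TH (toℕ e) ≡ Settling.th I In e)
  (tr : ∀ e → Settling.Decided I In (Instance.Trivial I e) (TR (toℕ e)))
  (bd : ∀ e f → Settling.Decided I In (Instance.Bundle I e f) (BND (m * toℕ e + toℕ f))) where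

  open Instance I using (graph; ℓ)
  open Input In
  open Graph graph using (lo; hi)
  open Theory I In distances preprocessed
  open TablesCorrect I In using (m-eq)

  record Fixed (σ : Store) : Set where
    constructor fixed
    field
      f₀  : σ 0 ≡ inp
      f₂  : σ 2 ≡ con
      f₁₂ : σ 12 ≡ TH
      f₂₂ : σ 22 ≡ BND
      f₂₃ : σ 23 ≡ TR
  open Fixed

  fixed-frame : ∀ τ σ → τ 0 ≡ σ 0 → τ 2 ≡ σ 2 → τ 12 ≡ σ 12 → τ 22 ≡ σ 22 → τ 23 ≡ σ 23 → Fixed σ → Fixed τ
  fixed-frame τ σ a b c d e F = fixed (trans a (f₀ F)) (trans b (f₂ F)) (trans c (f₁₂ F)) (trans d (f₂₂ F)) (trans e (f₂₃ F))

  entry : (ℕ → ℕ) → ℕ × ℕ → ℕ → ℕ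
  entry blk (j , f) i = nz (blk (m * (j ∸ 1) + i) + (1 ∸ gapN f i))

  record Popped (σ : Store) (j f : ℕ) (L : Stack) (τ : Store) : Set where
    field
      top    : τ 32 0 ≡ length L
      level  : τ 36 0 ≡ j
      rows   : ∀ r (i : Fin m) → r < j → τ 35 (m * r + toℕ i) ≡ σ 35 (m * r + toℕ i)
      row    : ∀ (i : Fin m) → τ 35 (m * j + toℕ i) ≡ entry (σ 35) (j , f) (toℕ i)
      result : ∀ (i : Fin m) → τ 28 (toℕ i) ≡ entry (σ 35) (j , f) (toℕ i)
      query  : getList (τ 38) ≡ encodeNetwork (Modified.modified (entry (σ 35) (j , f)) (con 1) 1≤B)

  private
    module Pop (σ : Store) (j-1 f : ℕ) (L : Stack) (F : Fixed σ) (sp : σ 32 0 ≡ suc (length L))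
               (sj : σ 33 (length L) ≡ suc j-1) (sf : σ 34 (length L) ≡ f) where

      j = suc j-1
      g = entry (σ 35) (j , f)
      σ₁ = sem popHead σ

      length-eq : V ∸ (V ∸ (2 + m * 3)) ≡ 2 + m * 3
      length-eq = m∸[m∸n]≡n (≤-trans (≤-trans (≤-reflexive (cong (2 +_) (*-comm m 3))) (+-mono-≤ (n≤1+n 2) (m≤n+m (3 * m) (m * m)))) stack≤V)

      head : σ₁ 32 0 ≡ length L × σ₁ 36 0 ≡ j × σ₁ 37 0 ≡ f × σ₁ 38 0 ≡ 2 + m * 3 × σ₁ 38 1 ≡ n × σ₁ 38 2 ≡ m
      head rewrite sp | sj | sf | f₀ F | f₂ F | inp-n | inp-m | length-eq = refl , refl , refl , refl , refl , refl

      length′ : Fin m → ℕ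
      length′ = Modified.ℓ′ g (con 1) 1≤B

      record Inv (k : ℕ) (τ : Store) : Set where
        field
          rows   : ∀ r (i : Fin m) → r < j → τ 35 (m * r + toℕ i) ≡ σ 35 (m * r + toℕ i)
          row    : ∀ (i : Fin m) → toℕ i < k → τ 35 (m * j + toℕ i) ≡ g (toℕ i)
          result : ∀ (i : Fin m) → toℕ i < k → τ 28 (toℕ i) ≡ g (toℕ i)
          q₀     : τ 38 0 ≡ 2 + m * 3
          q₁     : τ 38 1 ≡ n
          q₂     : τ 38 2 ≡ m
          qs     : ∀ (i : Fin m) → toℕ i < k → τ 38 (3 + 3 * toℕ i) ≡ toℕ (lo i) × τ 38 (4 + 3 * toℕ i) ≡ toℕ (hi i) × τ 38 (5 + 3 * toℕ i) ≡ length′ i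

      row-< : ∀ r (i : Fin m) x → r < j → m * r + toℕ i < m * j + x
      row-< r i x lt = ≤-trans (+-monoʳ-< (m * r) (Fin.toℕ<n i))
        (≤-trans (≤-reflexive (trans (+-comm (m * r) m) (sym (*-suc m r)))) (≤-trans (*-monoʳ-≤ m lt) (m≤m+n (m * j) x)))

      length-value : ∀ k → con 1 ∸ (con 1 ∸ (ℓ k + (1 ∸ g (toℕ k)) * con 1)) ≡ length′ k
      length-value k with g (toℕ k)
      ... | zero  = trans (cong (con 1 ∸_) (m≤n⇒m∸n≡0 (≤-trans (≤-reflexive (sym (+-identityʳ (con 1)))) (m≤n+m (con 1 + 0) (ℓ k))))) refl
      ... | suc v = trans (cong (λ u → con 1 ∸ (con 1 ∸ (ℓ k + u * con 1))) (0∸n≡0 v))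
                      (trans (cong (λ u → con 1 ∸ (con 1 ∸ u)) (+-identityʳ (ℓ k))) (m∸[m∸n]≡n (ℓ≤B k)))

      module Step (k : Fin m) (B₃₅ R₂₈ Q : ℕ → ℕ)
        (rows : ∀ r (i : Fin m) → r < j → B₃₅ (m * r + toℕ i) ≡ σ 35 (m * r + toℕ i)) where
        c = toℕ k
        v = nz (B₃₅ (m * j-1 + c) + (1 ∸ gapN f c))
        B′ = set B₃₅ (m * j + c) v
        R′ = set R₂₈ c (B′ (m * j + c))
        Q₁ = set Q (3 + 3 * c) (toℕ (lo k))
        Q₂ = set Q₁ (4 + 3 * c) (toℕ (hi k))
        Q₃ = set Q₂ (5 + 3 * c) (con 1 ∸ (con 1 ∸ (ℓ k + (1 ∸ R′ c) * con 1)))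

        v-eq : v ≡ g c
        v-eq = cong (λ u → nz (u + (1 ∸ gapN f c))) (rows j-1 k ≤-refl)

        B-same : B′ (m * j + c) ≡ g c
        B-same = trans (set-same B₃₅ (m * j + c) v) v-eq

        R-same : R′ c ≡ g c
        R-same = trans (set-same R₂₈ c (B′ (m * j + c))) B-same

        x₅ = con 1 ∸ (con 1 ∸ (ℓ k + (1 ∸ R′ c) * con 1))

        Q-low : ∀ i → i < 3 + 3 * c → Q₃ i ≡ Q i
        Q-low i lt = trans (set-other Q₂ {5 + 3 * c} {i} x₅ (λ eq → <-irrefl (sym eq) (<-trans lt (m<n⇒m<1+n ≤-refl))))
          (trans (set-other Q₁ {4 + 3 * c} {i} (toℕ (hi k)) (λ eq → <-irrefl (sym eq) (<-trans lt ≤-refl)))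
            (set-other Q {3 + 3 * c} {i} (toℕ (lo k)) (λ eq → <-irrefl (sym eq) lt)))

        Q-here : Q₃ (3 + 3 * c) ≡ toℕ (lo k) × Q₃ (4 + 3 * c) ≡ toℕ (hi k) × Q₃ (5 + 3 * c) ≡ length′ k
        Q-here = trans (set-other Q₂ {5 + 3 * c} {3 + 3 * c} x₅ (λ eq → <-irrefl (sym eq) (m<n⇒m<1+n ≤-refl)))
                   (trans (set-other Q₁ {4 + 3 * c} {3 + 3 * c} (toℕ (hi k)) (λ eq → <-irrefl (sym eq) ≤-refl)) (set-same Q (3 + 3 * c) (toℕ (lo k)))) ,
                 trans (set-other Q₂ {5 + 3 * c} {4 + 3 * c} x₅ (λ eq → <-irrefl (sym eq) ≤-refl)) (set-same Q₁ (4 + 3 * c) (toℕ (hi k))) ,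
                 trans (set-same Q₂ (5 + 3 * c) x₅) (trans (cong (λ u → con 1 ∸ (con 1 ∸ (ℓ k + (1 ∸ u) * con 1))) R-same) (length-value k))

      step : ∀ (k : Fin m) (τ : Store) → τ 5 0 ≡ toℕ k → Frame 5 rowP τ σ₁ → Inv (toℕ k) τ → Inv (suc (toℕ k)) (setCell 5 0 (suc (toℕ k)) (run rowP τ))
      step k τ ctr fr inv = subst (λ ρ → Inv (suc (toℕ k)) (setCell 5 0 (suc (toℕ k)) ρ)) (sym (run-sem rowP τ)) new
        where
        open Step k (τ 35) (τ 28) (τ 38) (Inv.rows inv)
        ρ = sem rowP τ
        h₃₆ : τ 36 0 ≡ j
        h₃₆ = trans (cong (λ a → a 0) (fr 36 tt)) (proj₁ (proj₂ head))
        h₃₇ : τ 37 0 ≡ f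
        h₃₇ = trans (cong (λ a → a 0) (fr 37 tt)) (proj₁ (proj₂ (proj₂ head)))
        e₃₅ : ρ 35 ≡ B′
        e₃₅ rewrite ctr | trans (fr 0 tt) (f₀ F) | inp-m | h₃₆ | h₃₇ = refl
        e₂₈ : ρ 28 ≡ R′
        e₂₈ rewrite ctr | trans (fr 0 tt) (f₀ F) | inp-m | h₃₆ | h₃₇ = refl
        e₃₈ : ρ 38 ≡ Q₃
        e₃₈ rewrite ctr | trans (fr 0 tt) (f₀ F) | trans (fr 2 tt) (f₂ F) | inp-m | h₃₆ | h₃₇ | inp-lo k | inp-hi k | inp-ℓ k = refl
        old : ∀ (i : Fin m) → toℕ i < toℕ k → ∀ d → d < 3 → (3 + d) + 3 * toℕ i < 3 + 3 * toℕ k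
        old i lt d ld = +-monoʳ-< 3 (≤-trans (+-monoˡ-< (3 * toℕ i) ld) (≤-trans (≤-reflexive (sym (*-suc 3 (toℕ i)))) (*-monoʳ-≤ 3 lt)))
        new : Inv (suc (toℕ k)) (setCell 5 0 (suc (toℕ k)) ρ)
        new = record
          { rows = λ r i lt → trans (cong (λ a → a (m * r + toℕ i)) e₃₅)
              (trans (set-other (τ 35) {m * j + c} {m * r + toℕ i} v (λ eq → <-irrefl (sym eq) (row-< r i c lt))) (Inv.rows inv r i lt))
          ; row = λ i lt → trans (cong (λ a → a (m * j + toℕ i)) e₃₅) (at-row i lt)
          ; result = λ i lt → trans (cong (λ a → a (toℕ i)) e₂₈) (at-res i lt)
          ; q₀ = trans (cong (λ a → a 0) e₃₈) (trans (Q-low 0 (s≤s z≤n)) (Inv.q₀ inv))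
          ; q₁ = trans (cong (λ a → a 1) e₃₈) (trans (Q-low 1 (s≤s (s≤s z≤n))) (Inv.q₁ inv))
          ; q₂ = trans (cong (λ a → a 2) e₃₈) (trans (Q-low 2 (s≤s (s≤s (s≤s z≤n)))) (Inv.q₂ inv))
          ; qs = λ i lt → subst (λ a → a (3 + 3 * toℕ i) ≡ toℕ (lo i) × a (4 + 3 * toℕ i) ≡ toℕ (hi i) × a (5 + 3 * toℕ i) ≡ length′ i) (sym e₃₈) (at-q i lt)
          }
          where
          at-row : ∀ i → toℕ i < suc (toℕ k) → B′ (m * j + toℕ i) ≡ g (toℕ i)
          at-row i lt with i Fin.≟ k
          ... | yes refl = B-same
          ... | no ne = trans (set-other (τ 35) {m * j + c} {m * j + toℕ i} v (λ eq → ne (Fin.toℕ-injective (sym (+-cancelˡ-≡ (m * j) (toℕ k) (toℕ i) eq)))))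
                          (Inv.row inv i (≤∧≢⇒< (≤-pred lt) (ne ∘ Fin.toℕ-injective)))
          at-res : ∀ i → toℕ i < suc (toℕ k) → R′ (toℕ i) ≡ g (toℕ i)
          at-res i lt with i Fin.≟ k
          ... | yes refl = R-same
          ... | no ne = trans (set-other (τ 28) {toℕ k} {toℕ i} (B′ (m * j + c)) (λ eq → ne (Fin.toℕ-injective (sym eq)))) (Inv.result inv i (≤∧≢⇒< (≤-pred lt) (ne ∘ Fin.toℕ-injective)))
          at-q : ∀ i → toℕ i < suc (toℕ k) → Q₃ (3 + 3 * toℕ i) ≡ toℕ (lo i) × Q₃ (4 + 3 * toℕ i) ≡ toℕ (hi i) × Q₃ (5 + 3 * toℕ i) ≡ length′ i
          at-q i lt with m<1+n⇒m<n∨m≡n lt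
          ... | inj₁ l = let (a , b , d) = Inv.qs inv i l in
                trans (Q-low (3 + 3 * toℕ i) (old i l 0 (s≤s z≤n))) a , trans (Q-low (4 + 3 * toℕ i) (old i l 1 (s≤s (s≤s z≤n)))) b , trans (Q-low (5 + 3 * toℕ i) (old i l 2 (s≤s (s≤s (s≤s z≤n))))) d
          ... | inj₂ eq with Fin.toℕ-injective eq
          ... | refl = Q-here

      σ₂ = run (for 5 2 rowP) σ₁

      final : Inv m σ₂
      final = for-run 5 2 rowP σ₁ (m-eq σ₁ (f₀ F)) Inv (record
        { rows = λ _ _ _ → refl ; row = λ _ () ; result = λ _ ()
        ; q₀ = proj₁ (proj₂ (proj₂ (proj₂ head))) ; q₁ = proj₁ (proj₂ (proj₂ (proj₂ (proj₂ head))))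
        ; q₂ = proj₂ (proj₂ (proj₂ (proj₂ (proj₂ head)))) ; qs = λ _ () }) step

      query : getList (σ₂ 38) ≡ encodeNetwork (Modified.modified g (con 1) 1≤B)
      query = trans (cong (applyUpTo (λ i → σ₂ 38 (suc i))) (Inv.q₀ final))
        (cong₂ _∷_ (Inv.q₁ final) (cong₂ _∷_ (Inv.q₂ final) (applyUpTo-blocks (λ i → σ₂ 38 (3 + i)) 3 m
          (λ e → toℕ (lo e) ∷ toℕ (hi e) ∷ length′ e ∷ []) id block)))
        where
        block : ∀ e → applyUpTo (λ r → σ₂ 38 (3 + (3 * toℕ e + r))) 3 ≡ toℕ (lo e) ∷ toℕ (hi e) ∷ length′ e ∷ []
        block e with Inv.qs final e (Fin.toℕ<n e)
        ... | a , b , c = cong₂ _∷_ (trans (cong (λ i → σ₂ 38 (3 + i)) (+-identityʳ (3 * toℕ e))) a)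
              (cong₂ _∷_ (trans (cong (λ i → σ₂ 38 (3 + i)) (+-comm (3 * toℕ e) 1)) b)
                (cong₂ _∷_ (trans (cong (λ i → σ₂ 38 (3 + i)) (+-comm (3 * toℕ e) 2)) c) refl))

      popped : Popped σ j f L σ₂
      popped = record
        { top = trans (cong (λ a → a 0) (run-frame (for 5 2 rowP) σ₁ 32 tt)) (proj₁ head)
        ; level = trans (cong (λ a → a 0) (run-frame (for 5 2 rowP) σ₁ 36 tt)) (proj₁ (proj₂ head))
        ; rows = Inv.rows final
        ; row = λ i → Inv.row final i (Fin.toℕ<n i)
        ; result = λ i → Inv.result final i (Fin.toℕ<n i)
        ; query = query }

  pop-correct : ∀ (σ : Store) j f L → Fixed σ → 1 ≤ j → σ 32 0 ≡ suc (length L) → Rep (σ 33) (σ 34) ((j , f) ∷ L) → Popped σ j f L (run popP σ)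
  pop-correct σ (suc j-1) f L F _ sp (sj , sf , _) = subst (Popped σ (suc j-1) f L) (sym (run-seq₂ (run-sem popHead σ))) (Pop.popped σ j-1 f L F sp sj sf)

-- The potential of a stack and one node of the search

G : ℕ → ℕ → ℕ
G s zero    = 1
G s (suc k) = 1 + s * G s k

G-pos : ∀ s k → 1 ≤ G s k
G-pos s zero    = ≤-refl
G-pos s (suc k) = s≤s z≤n

-- The additional 1 on the left makes the induction work: with the 1 of the recursion it becomes 2,
-- which `2 ≤ s` turns into another `s`.
G-bound : ∀ {s} → 2 ≤ s → ∀ k → G s k + 1 ≤ 2 * s ^ k
G-bound h zero = ≤-refl
G-bound {s} h (suc k) = begin
  1 + s * G s k + 1       ≡⟨ trans (+-comm (1 + s * G s k) 1) (cong (2 +_) refl) ⟩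
  2 + s * G s k           ≤⟨ +-monoˡ-≤ (s * G s k) h ⟩
  s + s * G s k           ≡⟨ trans (+-comm s (s * G s k)) (sym (trans (*-distribˡ-+ s (G s k) 1) (cong (s * G s k +_) (*-identityʳ s)))) ⟩
  s * (G s k + 1)         ≤⟨ *-monoʳ-≤ s (G-bound h k) ⟩
  s * (2 * s ^ k)         ≡⟨ trans (sym (*-assoc s 2 _)) (trans (cong (_* s ^ k) (*-comm s 2)) (*-assoc 2 s _)) ⟩
  2 * (s * s ^ k)         ∎
  where open ≤-Reasoning

Σ<-mono : ∀ k {a b : ℕ → ℕ} → (∀ i → a i ≤ b i) → Σ< k a ≤ Σ< k b
Σ<-mono zero    h = z≤n
Σ<-mono (suc k) h = +-mono-≤ (Σ<-mono k h) (h k)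

nz-≤1 : ∀ v → nz v ≤ 1
nz-≤1 v = m∸n≤m 1 (1 ∸ v)

nz-*-≤ : ∀ a b → nz (a * b) ≤ nz a
nz-*-≤ zero    b = z≤n
nz-*-≤ (suc a) b = ≤-trans (nz-≤1 (suc a * b)) (≤-reflexive (sym (nonzero-1 {suc a} λ ())))

toSet-cong : ∀ {m} {g h : ℕ → ℕ} → (∀ (i : Fin m) → g (toℕ i) ≡ h (toℕ i)) → toSet {m} g ≡ toSet h
toSet-cong eq = Vec.tabulate-cong (λ i → cong isNZ (eq i))

Σ<-congF : ∀ {m} {a b : ℕ → ℕ} → (∀ (i : Fin m) → a (toℕ i) ≡ b (toℕ i)) → Σ< m a ≡ Σ< m b
Σ<-congF {m} {a} {b} h = Σ<-cong m λ i lt → subst (λ j → a j ≡ b j) (Fin.toℕ-fromℕ< lt) (h (fromℕ< lt))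

extend-below : ∀ {m} {P : Fin m → Set} {k : Fin m} → (∀ e → toℕ e < toℕ k → P e) → P k → ∀ e → toℕ e < suc (toℕ k) → P e
extend-below {P = P} {k} h pk e lt with m<1+n⇒m<n∨m≡n lt
... | inj₁ l  = h e l
... | inj₂ eq = subst P (sym (Fin.toℕ-injective eq)) pk

module Node {n m} (I : Instance n m) (In : Input I)
  (distances : (N : Network n m) → Σ[ D ∈ (Fin n → Fin n → ℕ) ] (∀ (u v : Fin n) → Network.Dist N full u v (D u v)))
  (preprocessed : Instance.Preprocessed I)
  (TH BND TR : ℕ → ℕ)
  (th-eq : ∀ e → TH (toℕ e) ≡ Settling.th I In e)
  (tr : ∀ e → Settling.Decided I In (Instance.Trivial I e) (TR (toℕ e)))
  (bd : ∀ e f → Settling.Decided I In (Instance.Bundle I e f) (BND (m * toℕ e + toℕ f))) where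

  open Instance I using (graph; W; μ; weight; IsSolution; IsBundleSize; Nontrivial; Bundle)
  open Input In
  open Graph graph using (lo; hi)
  open Settling I In using (th; th<B)
  open Theory I In distances preprocessed hiding (Good; Consistent; size; size-trivial; size-add; size-≤; weight-≤; weight-toSet; unsettled⇒critical; branch; solution; wt; chosen)
  open TablesCorrect I In using (m-eq)
  open Search I In distances preprocessed TH BND TR th-eq tr bd

  Good : (ℕ → ℕ) → Set
  Good = Theory.Good I In distances preprocessed TR tr

  Consistent : (ℕ → ℕ) → Subset m → Set
  Consistent = Theory.Consistent I In distances preprocessed TR tr

  size : (ℕ → ℕ) → ℕ
  size = Theory.size I In distances preprocessed TR tr

  wt : ℕ → ℕ
  wt = Theory.wt I In distances preprocessed TR tr

  Same : (ℕ → ℕ) → (ℕ → ℕ) → Set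
  Same g h = ∀ (i : Fin m) → g (toℕ i) ≡ h (toℕ i)

  size-cong : ∀ (g h : ℕ → ℕ) → Same g h → size g ≡ size h
  size-cong g h eq = cong card (toSet-cong {m} {Theory.chosen I In distances preprocessed TR tr g} {Theory.chosen I In distances preprocessed TR tr h} λ i → cong (_* (1 ∸ TR (toℕ i))) (eq i))

  size≤m : ∀ g → size g ≤ m
  size≤m g = Subset.∣p∣≤n (toSet (Theory.chosen I In distances preprocessed TR tr g))

  good-cong : ∀ (g h : ℕ → ℕ) → Same g h → Good g → Good h
  good-cong g h eq gd e t z = gd e t (trans (eq e) z)

  consistent-cong : ∀ (g h : ℕ → ℕ) {F} → Same g h → Consistent g F → Consistent h F
  consistent-cong g h eq c e hz nt = c e (λ z → hz (trans (sym (eq e)) z)) nt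

  module _ (s : ℕ) where

    -- A node of level `j` has used `j - 1` of its μ choices.
    Φ : Stack → ℕ
    Φ []            = 0
    Φ ((j , _) ∷ L) = G s (μ ∸ (j ∸ 1)) + Φ L

  -- `sorted` protects the rows: popping level `j` overwrites row `j`, while the entries below, of
  -- level at most `j`, read rows before `j`. `index` bounds the height, as each level adds at most
  -- m entries; it keeps stack positions below the cap.
  record EntryOK (blk : ℕ → ℕ) (L : Stack) (x : ℕ × ℕ) : Set where
    constructor entryOK
    field
      level≥1 : 1 ≤ proj₁ x
      level≤μ : proj₁ x ∸ 1 ≤ μ
      good    : Good (entry blk x)
      sized   : size (entry blk x) ≡ proj₁ x ∸ 1
      index   : length L ≤ m * (proj₁ x ∸ 1)
      sorted  : All (λ y → proj₁ y ≤ proj₁ x) L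
  open EntryOK

  StackOK : (ℕ → ℕ) → Stack → Set
  StackOK blk []      = Unit
  StackOK blk (x ∷ L) = EntryOK blk L x × StackOK blk L

  SameRows : ℕ → (ℕ → ℕ) → (ℕ → ℕ) → Set
  SameRows J blk blk′ = ∀ r (i : Fin m) → r < J → blk′ (m * r + toℕ i) ≡ blk (m * r + toℕ i)

  entry-cong : ∀ {J blk blk′} x → SameRows J blk blk′ → 1 ≤ proj₁ x → proj₁ x ≤ J → Same (entry blk x) (entry blk′ x)
  entry-cong (suc j , f) same _ le i = cong (λ v → nz (v + (1 ∸ gapN f (toℕ i)))) (sym (same j i le))

  stack-cong : ∀ {J blk blk′} L → SameRows J blk blk′ → All (λ y → proj₁ y ≤ J) L → StackOK blk L → StackOK blk′ L
  stack-cong []      same _        _ = tt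
  stack-cong {J} {blk} {blk′} (x ∷ L) same (le ∷ les) (ok , oks) =
    entryOK (level≥1 ok) (level≤μ ok) (good-cong (entry blk x) (entry blk′ x) eq (good ok)) (trans (sym (size-cong (entry blk x) (entry blk′ x) eq)) (sized ok)) (index ok) (sorted ok) ,
    stack-cong {J} {blk} {blk′} L same les oks
    where
    eq : Same (entry blk x) (entry blk′ x)
    eq = entry-cong {J} {blk} {blk′} x same (level≥1 ok) le

  any-cong : ∀ {J blk blk′ F} L → SameRows J blk blk′ → All (λ y → proj₁ y ≤ J) L → StackOK blk L →
             Any.Any (λ x → Consistent (entry blk x) F) L → Any.Any (λ x → Consistent (entry blk′ x) F) L
  any-cong {J} {blk} {blk′} (x ∷ L) same (le ∷ _) (ok , _) (here c) = here (consistent-cong (entry blk x) (entry blk′ x) (entry-cong {J} {blk} {blk′} x same (level≥1 ok) le) c)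
  any-cong {J} {blk} {blk′} {F} (x ∷ L) same (_ ∷ les) (_ , oks) (there a) = there (any-cong {J} {blk} {blk′} {F} L same les oks a)

  -- This carries the negative answer: once the stack is empty no solution is left, and nothing
  -- about discarded nodes has to be remembered.
  Covers : (ℕ → ℕ) → Stack → Set
  Covers blk L = ∀ F → IsSolution F → Any.Any (λ x → Consistent (entry blk x) F) L

  record Searching (σ : Store) (L : Stack) : Set where
    field
      fx     : Fixed σ
      sp     : σ 32 0 ≡ length L
      rep    : Rep (σ 33) (σ 34) L
      stack  : StackOK (σ 35) L
      covers : Covers (σ 35) L
      live   : σ 31 0 ≡ 0

  accP : Prog
  accP = 29 [ lit 0 ]:= minE CAP ($$ 29 ⊕ nonZeroE (28 ⟦ $$ 5 ⟧) ⊗ wt# ($$ 5))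

  scanTest : Exp
  scanTest = 39 ⟦ lit 1 ⊕ (n# ⊗ lo# ($$ 5) ⊕ hi# ($$ 5)) ⟧ ⊖ 12 ⟦ $$ 5 ⟧

  scan-value : ∀ {ρ : Store} {d h} (k : Fin m) → ρ 0 ≡ inp → ρ 5 0 ≡ toℕ k → ρ 39 (1 + (n * toℕ (lo k) + toℕ (hi k))) ≡ d → ρ 12 (toℕ k) ≡ h →
               eval ρ scanTest ≡ d ∸ h
  scan-value k q c a b rewrite q | c | inp-n | inp-lo k | inp-hi k | a | b = refl

  acc-value : ∀ {ρ : Store} {a} {r : ℕ → ℕ} (k : Fin m) → ρ 0 ≡ inp → ρ 2 ≡ con → ρ 5 0 ≡ toℕ k → ρ 28 ≡ r → ρ 29 0 ≡ mn V a →
              sem accP ρ 29 0 ≡ mn V (a + nz (r (toℕ k)) * wt (toℕ k))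
  acc-value {a = a} {r} k q p c s h rewrite q | p | c | s | h = mn-cap V a (nz (r (toℕ k)) * wt (toℕ k))

  push-top : ∀ {ρ : Store} {p} {r : ℕ → ℕ} (e k : Fin m) → ρ 0 ≡ inp → ρ 2 ≡ con → ρ 5 0 ≡ toℕ k → ρ 40 0 ≡ toℕ e → ρ 22 ≡ BND → ρ 28 ≡ r → ρ 32 0 ≡ p →
             sem pushP ρ 32 0 ≡ mn V (p + BND (m * toℕ e + toℕ k) * (1 ∸ r (toℕ k)))
  push-top e k q p c u b r h rewrite c | h | q | p | inp-m | u | b | r = refl

  push-level : ∀ {ρ : Store} {p j} → ρ 2 ≡ con → ρ 32 0 ≡ p → ρ 36 0 ≡ j → sem pushP ρ 33 ≡ set (ρ 33) p (V ∸ (V ∸ (j + 1)))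
  push-level q h l rewrite h | q | l = refl

  push-index : ∀ {ρ : Store} {p k} → ρ 32 0 ≡ p → ρ 5 0 ≡ k → sem pushP ρ 34 ≡ set (ρ 34) p k
  push-index h c rewrite h | c = refl

  -- The second half of a node, when the reply has arrived. `mat` and `dst` are all that is known
  -- about the reply: it lists the distances in the network modified by `g`.
  module Checking (τ : Store) (j f : ℕ) (L : Stack) (g : ℕ → ℕ) (D : Fin n → Fin n → ℕ)
    (fx : Fixed τ) (top : τ 32 0 ≡ length L) (level : τ 36 0 ≡ j) (rep : Rep (τ 33) (τ 34) L) (live : τ 31 0 ≡ 0)
    (res : Same (τ 28) g) (row : ∀ (i : Fin m) → τ 35 (m * j + toℕ i) ≡ g (toℕ i))
    (j≥1 : 1 ≤ j) (j≤μ : j ∸ 1 ≤ μ) (g-good : Good g) (g-size : size g ≡ j ∸ 1) (idx : length L ≤ m * (j ∸ 1))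
    (srt : All (λ y → proj₁ y ≤ j) L) (oks : StackOK (τ 35) L)
    (cov : ∀ F → IsSolution F → Consistent g F ⊎ Any.Any (λ x → Consistent (entry (τ 35) x) F) L)
    (mat : ∀ u v → τ 39 (1 + (n * toℕ u + toℕ v)) ≡ D u v)
    (dst : ∀ u v → Network.Dist (Modified.modified g (con 1) 1≤B) full u v (D u v)) where

    open Fixed fx

    total : ℕ → ℕ
    total i = nz (τ 28 i) * wt i

    Scan : ℕ → Store → Set
    Scan k ρ = ((ρ 40 0 ≡ m × (∀ e → toℕ e < k → D (lo e) (hi e) ≤ th e)) ⊎ (∃[ e ] ρ 40 0 ≡ toℕ e × th e < D (lo e) (hi e)))
             × ρ 29 0 ≡ mn V (Σ< k total)

    setupP : Prog
    setupP = (40 [ lit 0 ]:= m#) ⨟ (29 [ lit 0 ]:= lit 0)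

    τ₀ τ₁ : Store
    τ₀ = sem setupP τ
    τ₁ = run checkHead τ

    eq₁ : τ₁ ≡ run (for 5 2 scanP) τ₀
    eq₁ = run-seq₂ (run-sem setupP τ)

    scan-step : ∀ (k : Fin m) (ρ : Store) → ρ 5 0 ≡ toℕ k → Frame 5 scanP ρ τ₀ → Scan (toℕ k) ρ → Scan (suc (toℕ k)) (setCell 5 0 (suc (toℕ k)) (run scanP ρ))
    scan-step k ρ ctr fr (st , sm) rewrite run-sem scanP ρ =
      caseZ-elim (λ ρ′ → Scan (suc (toℕ k)) (setCell 5 0 (suc (toℕ k)) (sem accP ρ′))) (eval ρ scanTest) settled unsettled
      where
      val : eval ρ scanTest ≡ D (lo k) (hi k) ∸ th k
      val = scan-value {ρ} k (trans (fr 0 tt) f₀) ctr (trans (cong (λ a → a (1 + (n * toℕ (lo k) + toℕ (hi k)))) (fr 39 tt)) (mat (lo k) (hi k)))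
        (trans (cong (λ a → a (toℕ k)) (trans (fr 12 tt) f₁₂)) (th-eq k))
      settled : eval ρ scanTest ≡ 0 → Scan (suc (toℕ k)) (setCell 5 0 (suc (toℕ k)) (sem accP ρ))
      settled z = [ (λ (u , h) → inj₁ (u , extend-below {P = λ e → D (lo e) (hi e) ≤ th e} {k} h (m∸n≡0⇒m≤n (trans (sym val) z)))) , inj₂ ]′ st , acc-value {ρ} {Σ< (toℕ k) total} {τ 28} k (trans (fr 0 tt) f₀) (trans (fr 2 tt) f₂) ctr (fr 28 tt) sm
      unsettled : eval ρ scanTest ≢ 0 → Scan (suc (toℕ k)) (setCell 5 0 (suc (toℕ k)) (sem accP (setCell 40 0 (ρ 5 0) ρ)))
      unsettled nzr = inj₂ (k , ctr , m∸n≢0⇒n<m (λ z → nzr (trans val z))) ,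
        acc-value {setCell 40 0 (ρ 5 0) ρ} {Σ< (toℕ k) total} {τ 28} k (trans (fr 0 tt) f₀) (trans (fr 2 tt) f₂) ctr (fr 28 tt) sm

    scanned : Scan m τ₁
    scanned = subst (Scan m) (sym eq₁) (for-run 5 2 scanP τ₀ (m-eq τ₀ f₀) Scan
      (inj₁ (cong (λ a → a 2) f₀ ⟨≡⟩ inp-m , λ _ ()) , sym (n∸n≡0 V)) scan-step)
      where
      _⟨≡⟩_ : ∀ {a b c : ℕ} → a ≡ b → b ≡ c → a ≡ c
      _⟨≡⟩_ = trans

    keep : ∀ b → T (not (writes checkHead b)) → τ₁ b ≡ τ b
    keep b t = run-frame checkHead τ b t

    fx₁ : Fixed τ₁
    fx₁ = fixed-frame τ₁ τ (keep 0 tt) (keep 2 tt) (keep 12 tt) (keep 22 tt) (keep 23 tt) fx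

    is-settled : ∀ e → D (lo e) (hi e) ≤ th e → Settled g e
    is-settled e le with Modified.modified-path g (con 1) 1≤B (dst (lo e) (hi e)) (≤-<-trans le (th<B e))
    ... | p , path , ins , eq = p , path , ins , subst (_≤ th e) (sym eq) le

    not-settled : ∀ e → th e < D (lo e) (hi e) → ¬ Settled g e
    not-settled e lt (p , path , ins , le) = <⇒≱ lt (≤-trans (Modified.modified-≤ g (con 1) 1≤B (dst (lo e) (hi e)) p path ins) le)

    weight-eq : Σ< m total ≡ weight (toSet g)
    weight-eq = trans (Σ<-congF {m} {total} {λ i → nz (g i) * wt i} (λ i → cong (λ v → nz v * wt (toℕ i)) (res i))) (sym (Theory.weight-toSet I In distances preprocessed TR tr g))

    checkTail decideP branchP : Prog
    decideP = 31 [ lit 0 ]:= leE ($$ 29) (0 ⟦ lit 5 ⟧)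
    branchP = ifz ($$ 36 ⊖ 0 ⟦ lit 6 ⟧) (for 5 2 pushP) nop
    checkTail = ifz (m# ⊖ $$ 40) decideP branchP

    Done : ℕ → Store → Set
    Done s ρ = Found ρ ⊎ (∃[ L′ ] Searching ρ L′ × suc (Φ s L′) ≤ Φ s ((j , f) ∷ L))

    discard : ∀ s (ρ : Store) → ρ 31 0 ≡ 0 → Fixed ρ → ρ 32 ≡ τ 32 → ρ 33 ≡ τ 33 → ρ 34 ≡ τ 34 → ρ 35 ≡ τ 35 →
              (∀ F → IsSolution F → ¬ Consistent g F) → Done s ρ
    discard s ρ z fxρ e₃₂ e₃₃ e₃₄ e₃₅ none = inj₂ (L , record
      { fx = fxρ ; sp = trans (cong (λ a → a 0) e₃₂) top
      ; rep = subst₂ (λ a b → Rep a b L) (sym e₃₃) (sym e₃₄) rep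
      ; stack = subst (λ b → StackOK b L) (sym e₃₅) oks
      ; covers = λ F sol → subst (λ b → Any.Any (λ x → Consistent (entry b x) F) L) (sym e₃₅) ([ (λ c → ⊥-elim (none F sol c)) , id ]′ (cov F sol))
      ; live = z } , +-monoˡ-≤ (Φ s L) (G-pos s (μ ∸ (j ∸ 1))))

    decide : ∀ s → (∀ e → D (lo e) (hi e) ≤ th e) → Done s (run decideP τ₁)
    decide s all with weight (toSet g) ≤? W
    ... | yes le = inj₁ (trans out (cong (1 ∸_) (m≤n⇒m∸n≡0 (≤-trans (mn-≤ʳ V (weight (toSet g))) le))) ,
            subst (λ S → IsSolution S) (sym (trans (cong toSet (trans (run-frame decideP τ₁ 28 tt) (keep 28 tt))) (toSet-cong {m} {τ 28} {g} res)))
              (Theory.solution I In distances preprocessed TR tr {g} (λ e → is-settled e (all e)) le (≤-trans (≤-reflexive g-size) j≤μ)))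
      where
      out : run decideP τ₁ 31 0 ≡ 1 ∸ (mn V (weight (toSet g)) ∸ W)
      out = trans (cong (λ ρ → ρ 31 0) (run-sem decideP τ₁))
        (cong₂ (λ a b → 1 ∸ (a ∸ b)) (trans (proj₂ scanned) (cong (mn V) weight-eq)) (trans (cong (λ a → a 5) (Fixed.f₀ fx₁)) inp-W))
    ... | no nle = discard s (run decideP τ₁) zero-out
          (fixed-frame (run decideP τ₁) τ₁ (run-frame decideP τ₁ 0 tt) (run-frame decideP τ₁ 2 tt) (run-frame decideP τ₁ 12 tt) (run-frame decideP τ₁ 22 tt) (run-frame decideP τ₁ 23 tt) fx₁)
          (trans (run-frame decideP τ₁ 32 tt) (keep 32 tt)) (trans (run-frame decideP τ₁ 33 tt) (keep 33 tt))
          (trans (run-frame decideP τ₁ 34 tt) (keep 34 tt)) (trans (run-frame decideP τ₁ 35 tt) (keep 35 tt))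
          λ F sol c → nle (≤-trans (Theory.weight-≤ I In distances preprocessed TR tr {g} c (proj₁ sol)) (proj₁ (proj₂ sol)))
      where
      -- Capping cannot hide an excess, because W itself is below the cap.
      big : W < mn V (weight (toSet g))
      big = mn-elim {λ v → W < v} V (weight (toSet g)) W<V (λ _ → ≰⇒> nle)
      zero-out : run decideP τ₁ 31 0 ≡ 0
      zero-out = trans (cong (λ ρ → ρ 31 0) (run-sem decideP τ₁))
        (trans (cong₂ (λ a b → 1 ∸ (a ∸ b)) (trans (proj₂ scanned) (cong (mn V) weight-eq)) (trans (cong (λ a → a 5) (Fixed.f₀ fx₁)) inp-W))
          (1∸-≢ (λ z → <⇒≱ big (m∸n≡0⇒m≤n z))))

    module Unsettled (e : Fin m) (u : τ₁ 40 0 ≡ toℕ e) (ns : ¬ Settled g e) where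

      cond : ℕ → ℕ
      cond i = BND (m * toℕ e + i) * (1 ∸ τ 28 i)

      cond-cases : ∀ f′ → (cond (toℕ f′) ≡ 1 × Bundle e f′ × g (toℕ f′) ≡ 0) ⊎ (cond (toℕ f′) ≡ 0 × ¬ (Bundle e f′ × g (toℕ f′) ≡ 0))
      cond-cases f′ with bd e f′ | g (toℕ f′) in eq
      ... | inj₁ (b , v) | zero  = inj₁ (cong₂ (λ a c → a * (1 ∸ c)) v (trans (res f′) eq) , b , refl)
      ... | inj₂ (nb , v) | _    = inj₂ (cong (_* (1 ∸ τ 28 (toℕ f′))) v , λ (b , _) → nb b)
      ... | inj₁ (b , v) | suc k = inj₂ (trans (cong₂ (λ a c → a * (1 ∸ c)) v (trans (res f′) eq)) (cong (1 *_) (0∸n≡0 k)) , λ { (_ , ()) })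

      -- The stack after the first `k` edges have been offered. All new entries extend the same
      -- choice, the one in row `j`.
      pushed : ℕ → Stack
      pushed zero    = L
      pushed (suc k) = caseZ (cond k) (pushed k) ((suc j , k) ∷ pushed k)

      pushed-length : ∀ k → length (pushed k) ≤ length L + k
      pushed-length zero    = m≤m+n (length L) 0
      pushed-length (suc k) = caseZ-elim (λ S → length S ≤ length L + suc k) (cond k)
        (λ _ → ≤-trans (pushed-length k) (+-monoʳ-≤ (length L) (n≤1+n k)))
        (λ _ → ≤-trans (s≤s (pushed-length k)) (≤-reflexive (sym (+-suc (length L) k))))

      pushed-Φ : ∀ s k → Φ s (pushed k) ≤ Φ s L + Σ< k (nz ∘ cond) * G s (μ ∸ j)
      pushed-Φ s zero    = m≤m+n (Φ s L) 0
      pushed-Φ s (suc k) = caseZ-elim (λ S → Φ s S ≤ Φ s L + (Σ< k (nz ∘ cond) + nz (cond k)) * G s (μ ∸ j)) (cond k)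
        (λ _ → ≤-trans (pushed-Φ s k) (+-monoʳ-≤ (Φ s L) (*-monoˡ-≤ (G s (μ ∸ j)) (m≤m+n (Σ< k (nz ∘ cond)) (nz (cond k))))))
        (λ h → ≤-trans (+-monoʳ-≤ (G s (μ ∸ j)) (pushed-Φ s k)) (≤-reflexive (rearr (G s (μ ∸ j)) (Φ s L) (Σ< k (nz ∘ cond)) (nz (cond k)) (nonzero-1 h))))
        where
        rearr : ∀ a b c v → v ≡ 1 → a + (b + c * a) ≡ b + (c + v) * a
        rearr a b c _ refl = trans (solve 3 (λ a b c → a :+ (b :+ c :* a) := b :+ (c :* a :+ a)) refl a b c)
          (cong (b +_) (trans (cong (c * a +_) (sym (*-identityˡ a))) (sym (*-distribʳ-+ a c 1))))
          where open +-*-Solver using (solve; _:+_; _:*_; _:=_)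

      pushed-sorted : ∀ k → All (λ y → proj₁ y ≤ suc j) (pushed k)
      pushed-sorted zero    = All.map m≤n⇒m≤1+n srt
      pushed-sorted (suc k) = caseZ-elim (All (λ y → proj₁ y ≤ suc j)) (cond k) (λ _ → pushed-sorted k) (λ _ → ≤-refl ∷ pushed-sorted k)

      pushed-keeps : ∀ {P : ℕ × ℕ → Set} k → Any.Any P L → Any.Any P (pushed k)
      pushed-keeps         zero    a = a
      pushed-keeps {P} (suc k) a = caseZ-elim (Any.Any P) (cond k) (λ _ → pushed-keeps k a) (λ _ → there (pushed-keeps k a))

      pushed-has : ∀ {P : ℕ × ℕ → Set} k i → i < k → cond i ≢ 0 → P (suc j , i) → Any.Any P (pushed k)
      pushed-has {P} (suc k) i lt ci p with m<1+n⇒m<n∨m≡n lt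
      ... | inj₁ l    = caseZ-elim (Any.Any P) (cond k) (λ _ → pushed-has k i l ci p) (λ _ → there (pushed-has k i l ci p))
      ... | inj₂ refl = caseZ-elim (Any.Any P) (cond k) (λ z → ⊥-elim (ci z)) (λ _ → here p)

      child : Fin m → ℕ → ℕ
      child f′ = entry (τ 35) (suc j , toℕ f′)

      child-other : ∀ f′ (i : Fin m) → i ≢ f′ → child f′ (toℕ i) ≡ nz (g (toℕ i))
      child-other f′ i ne = cong nz (trans (cong₂ _+_ (row i) (1∸-≢ (gapN-≢ (λ eq → ne (sym (Fin.toℕ-injective eq)))))) (+-identityʳ (g (toℕ i))))

      child-self : ∀ f′ → child f′ (toℕ f′) ≢ 0
      child-self f′ z = case trans (sym (nonzero-1 (λ z′ → case trans (sym (cong (1 ∸_) (gapN-refl (toℕ f′)))) (m+n≡0⇒n≡0 (τ 35 (m * j + toℕ f′)) z′) of λ ()))) z of λ ()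

      nz≢0 : ∀ {v} → v ≢ 0 → nz v ≢ 0
      nz≢0 h z = case trans (sym (nonzero-1 h)) z of λ ()

      child-good : ∀ f′ → Good (child f′)
      child-good f′ i t z with i Fin.≟ f′
      ... | yes refl = child-self f′ z
      ... | no ne    = nz≢0 (g-good i t) (trans (sym (child-other f′ i ne)) z)

      nz-idem : ∀ v → nz (nz v) ≡ nz v
      nz-idem zero    = refl
      nz-idem (suc v) = trans (cong nz (nonzero-1 {suc v} λ ())) (sym (nonzero-1 {suc v} λ ()))

      child-size : ∀ f′ → g (toℕ f′) ≡ 0 → Nontrivial f′ → size (child f′) ≡ j
      child-size f′ z nt = trans (Theory.size-add I In distances preprocessed TR tr {g} {child f′} {f′} (λ i ne → trans (cong nz (child-other f′ i ne)) (nz-idem (g (toℕ i)))) z (child-self f′) nt)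
        (trans (cong suc g-size) (m+[n∸m]≡n j≥1))

      child-consistent : ∀ f′ {F} → Consistent g F → f′ ∈ˢ F → Consistent (child f′) F
      child-consistent f′ c f′∈ i h nt with i Fin.≟ f′
      ... | yes refl = f′∈
      ... | no ne    = c i (λ z → h (trans (child-other f′ i ne) (cong nz z))) nt

      pushed-ok : ∀ k → k ≤ m → j ≤ μ → StackOK (τ 35) (pushed k)
      pushed-ok zero    _  _   = oks
      pushed-ok (suc k) lt jμ with cond k in eq
      ... | zero  = pushed-ok k (<⇒≤ lt) jμ
      ... | suc _ = entryOK (s≤s z≤n) jμ (subst (λ i → Good (entry (τ 35) (suc j , i))) k-eq (child-good k′))
                      (subst (λ i → size (entry (τ 35) (suc j , i)) ≡ j) k-eq (child-size k′ (proj₂ info) (proj₂ (proj₁ info))))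
                      len (pushed-sorted k) , pushed-ok k (<⇒≤ lt) jμ
        where
        k′ = fromℕ< lt
        k-eq : toℕ k′ ≡ k
        k-eq = Fin.toℕ-fromℕ< lt
        info : Bundle e k′ × g (toℕ k′) ≡ 0
        info with cond-cases k′
        ... | inj₁ (_ , b , z) = b , z
        ... | inj₂ (z , _) = case trans (sym eq) (trans (cong cond (sym k-eq)) z) of λ ()
        len : length (pushed k) ≤ m * j
        len = ≤-trans (pushed-length k) (≤-trans (+-mono-≤ idx (<⇒≤ lt))
                (≤-reflexive (trans (+-comm (m * (j ∸ 1)) m) (trans (sym (*-suc m (j ∸ 1))) (cong (m *_) (m+[n∸m]≡n j≥1))))))

      -- μ can be far larger than m, so levels are bounded through the choice: `j - 1` is its number
      -- of nontrivial edges and hence at most m.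
      mm : length L ≤ m * m
      mm = ≤-trans idx (*-monoʳ-≤ m (subst (_≤ m) g-size (size≤m g)))

      PushInv : ℕ → Store → Set
      PushInv k ρ = ρ 32 0 ≡ length (pushed k) × Rep (ρ 33) (ρ 34) (pushed k)

      push-step : ∀ (k : Fin m) (ρ : Store) → ρ 5 0 ≡ toℕ k → Frame 5 pushP ρ τ₁ → PushInv (toℕ k) ρ →
                  PushInv (suc (toℕ k)) (setCell 5 0 (suc (toℕ k)) (run pushP ρ))
      push-step k ρ ctr fr (spρ , repρ) = subst (λ ρ′ → PushInv (suc (toℕ k)) (setCell 5 0 (suc (toℕ k)) ρ′)) (sym (run-sem pushP ρ)) new
        where
        p = length (pushed (toℕ k))
        p≤ : p ≤ m * m + m
        p≤ = ≤-trans (pushed-length (toℕ k)) (+-mono-≤ mm (<⇒≤ (Fin.toℕ<n k)))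
        room : suc p ≤ V
        room = ≤-trans (s≤s p≤) (≤-trans (+-mono-≤ (s≤s (z≤n {2})) (+-monoʳ-≤ (m * m) (m≤m+n m (m + (m + 0))))) stack≤V)
        j≤V : suc j ≤ V
        j≤V = ≤-trans (s≤s (subst (_≤ suc m) (m+[n∸m]≡n j≥1) (s≤s (subst (_≤ m) g-size (size≤m g)))))
                (≤-trans (+-mono-≤ (s≤s (s≤s (z≤n {1}))) (≤-trans (m≤m+n m (m + (m + 0))) (m≤n+m (3 * m) (m * m)))) stack≤V)
        c = cond (toℕ k)
        e₃₂ : sem pushP ρ 32 0 ≡ mn V (p + c)
        e₃₂ = push-top {ρ} e k (trans (fr 0 tt) (Fixed.f₀ fx₁)) (trans (fr 2 tt) (Fixed.f₂ fx₁)) ctr (trans (cong (λ a → a 0) (fr 40 tt)) u)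
          (trans (fr 22 tt) (Fixed.f₂₂ fx₁)) (trans (fr 28 tt) (keep 28 tt)) spρ
        e₃₃ : sem pushP ρ 33 ≡ set (ρ 33) p (suc j)
        e₃₃ = trans (push-level {ρ} (trans (fr 2 tt) (Fixed.f₂ fx₁)) spρ (trans (cong (λ a → a 0) (trans (fr 36 tt) (keep 36 tt))) level))
          (cong (set (ρ 33) p) (trans (cong (λ v → V ∸ (V ∸ v)) (+-comm j 1)) (m∸[m∸n]≡n j≤V)))
        e₃₄ : sem pushP ρ 34 ≡ set (ρ 34) p (toℕ k)
        e₃₄ = push-index {ρ} spρ ctr
        repOld : Rep (set (ρ 33) p (suc j)) (set (ρ 34) p (toℕ k)) (pushed (toℕ k))
        repOld = rep-set (pushed (toℕ k)) ≤-refl repρ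
        new : PushInv (suc (toℕ k)) (setCell 5 0 (suc (toℕ k)) (sem pushP ρ))
        new = subst₂ _×_ (cong (_≡ length (pushed (suc (toℕ k)))) (sym e₃₂))
                (cong₂ (λ a b → Rep a b (pushed (suc (toℕ k)))) (sym e₃₃) (sym e₃₄)) (go (cond-cases k))
          where
          go : (c ≡ 1 × Bundle e k × g (toℕ k) ≡ 0) ⊎ (c ≡ 0 × ¬ (Bundle e k × g (toℕ k) ≡ 0)) →
               mn V (p + c) ≡ length (pushed (suc (toℕ k))) × Rep (set (ρ 33) p (suc j)) (set (ρ 34) p (toℕ k)) (pushed (suc (toℕ k)))
          go (inj₁ (eq , _)) rewrite eq = trans (cong (λ v → V ∸ (V ∸ v)) (+-comm p 1)) (m∸[m∸n]≡n room) ,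
            set-same (ρ 33) p (suc j) , set-same (ρ 34) p (toℕ k) , repOld
          go (inj₂ (eq , _)) rewrite eq = trans (cong (λ v → V ∸ (V ∸ v)) (+-identityʳ p)) (m∸[m∸n]≡n (<⇒≤ room)) , repOld

      push : ∀ {s} → IsBundleSize s → j ≤ μ → Done s (run (for 5 2 pushP) τ₁)
      push {s} bs jμ = inj₂ (pushed m , record
          { fx = fixed-frame ρ τ₁ (kp 0 tt) (kp 2 tt) (kp 12 tt) (kp 22 tt) (kp 23 tt) fx₁
          ; sp = proj₁ inv ; rep = proj₂ inv
          ; stack = subst (λ b → StackOK b (pushed m)) (sym e₃₅) (pushed-ok m ≤-refl jμ)
          ; covers = λ F sol → subst (λ b → Any.Any (λ x → Consistent (entry b x) F) (pushed m)) (sym e₃₅) (cover F sol)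
          ; live = trans (cong (λ a → a 0) (trans (kp 31 tt) (keep 31 tt))) live } , smaller)
        where
        ρ = run (for 5 2 pushP) τ₁
        kp : ∀ b → T (not (writes (for 5 2 pushP) b)) → ρ b ≡ τ₁ b
        kp b t = run-frame (for 5 2 pushP) τ₁ b t
        e₃₅ : ρ 35 ≡ τ 35
        e₃₅ = trans (kp 35 tt) (keep 35 tt)
        inv : PushInv m ρ
        inv = for-run 5 2 pushP τ₁ (m-eq τ₁ (Fixed.f₀ fx₁)) PushInv
          (trans (cong (λ a → a 0) (keep 32 tt)) top , subst₂ (λ a b → Rep a b L) (sym (keep 33 tt)) (sym (keep 34 tt)) rep) push-step
        cover : ∀ F → IsSolution F → Any.Any (λ x → Consistent (entry (τ 35) x) F) (pushed m)
        cover F sol = [ (λ c → branched c (Theory.branch I In distances preprocessed TR tr {g} g-good ns (proj₁ sol))) , (λ a → pushed-keeps m a) ]′ (cov F sol)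
          where
          branched : Consistent g F → ∃[ f′ ] f′ ∈ˢ F × Bundle e f′ × g (toℕ f′) ≡ 0 → Any.Any (λ x → Consistent (entry (τ 35) x) F) (pushed m)
          branched c (f′ , i , b , z) = pushed-has m (toℕ f′) (Fin.toℕ<n f′)
            ([ (λ (eq , _) z′ → case trans (sym eq) z′ of λ ()) , (λ (_ , h) → ⊥-elim (h (b , z))) ]′ (cond-cases f′))
            (child-consistent f′ c i)
        count≤s : Σ< m (nz ∘ cond) ≤ s
        count≤s = ≤-trans (Σ<-mono m (λ i → nz-*-≤ (BND (m * toℕ e + i)) (1 ∸ τ 28 i)))
          (≤-trans (≤-reflexive (sym (card-toSet m (λ i → BND (m * toℕ e + i)))))
            (Theory.bundle-size I In distances preprocessed TR tr BND e (bd e) bs (Theory.unsettled⇒critical I In distances preprocessed TR tr {g} g-good ns)))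
        smaller : suc (Φ s (pushed m)) ≤ Φ s ((j , f) ∷ L)
        smaller = begin
          suc (Φ s (pushed m))                                    ≤⟨ s≤s (pushed-Φ s m) ⟩
          suc (Φ s L + Σ< m (nz ∘ cond) * G s (μ ∸ j))            ≤⟨ s≤s (+-monoʳ-≤ (Φ s L) (*-monoˡ-≤ (G s (μ ∸ j)) count≤s)) ⟩
          suc (Φ s L + s * G s (μ ∸ j))                           ≡⟨ trans (cong suc (+-comm (Φ s L) _)) refl ⟩
          G s (suc (μ ∸ j)) + Φ s L                               ≡⟨ cong (λ k → G s k + Φ s L) shift ⟩
          G s (μ ∸ (j ∸ 1)) + Φ s L                               ∎
          where
          open ≤-Reasoning
          shift : suc (μ ∸ j) ≡ μ ∸ (j ∸ 1)
          shift = trans (sym (+-∸-assoc 1 jμ)) (cong (suc μ ∸_) (sym (m+[n∸m]≡n j≥1)))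

      -- A solution extending the choice contains a further edge of the bundle, hence at least `j`
      -- nontrivial edges, which is more than μ.
      stop-here : ∀ s → ¬ j ≤ μ → Done s (run nop τ₁)
      stop-here s nj = subst (Done s) (sym (run-sem nop τ₁)) (discard s τ₁ (trans (cong (λ a → a 0) (keep 31 tt)) live) fx₁ (keep 32 tt) (keep 33 tt) (keep 34 tt) (keep 35 tt) none)
        where
        none : ∀ F → IsSolution F → ¬ Consistent g F
        none F (sp , _ , k , hs , kμ) c with Theory.branch I In distances preprocessed TR tr {g} g-good ns sp
        ... | f′ , i , b , z = nj (≤-trans (≤-trans (≤-reflexive (sym (child-size f′ z (proj₂ b))))
                (Theory.size-≤ I In distances preprocessed TR tr {child f′} (child-consistent f′ c i) hs)) kμ)

    check-correct : ∀ {s} → IsBundleSize s → Done s (run checkP τ)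
    check-correct {s} bs = subst (Done s) (sym (run-seq checkHead checkTail τ))
      (subst (Done s) (sym (run-ifz (m# ⊖ $$ 40) decideP branchP τ₁)) (top-case (proj₁ scanned)))
      where
      m₁ : τ₁ 0 2 ≡ m
      m₁ = m-eq τ₁ (Fixed.f₀ fx₁)
      μ₁ : τ₁ 36 0 ∸ τ₁ 0 6 ≡ j ∸ μ
      μ₁ = cong₂ _∸_ (trans (cong (λ a → a 0) (keep 36 tt)) level) (trans (cong (λ a → a 6) (Fixed.f₀ fx₁)) inp-μ)
      top-case : (τ₁ 40 0 ≡ m × (∀ e → toℕ e < m → D (lo e) (hi e) ≤ th e)) ⊎ (∃[ e ] τ₁ 40 0 ≡ toℕ e × th e < D (lo e) (hi e)) →
                 Done s (caseZ (τ₁ 0 2 ∸ τ₁ 40 0) (run decideP τ₁) (run branchP τ₁))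
      top-case (inj₁ (u , all)) = subst (λ v → Done s (caseZ v (run decideP τ₁) (run branchP τ₁))) (sym (trans (cong₂ _∸_ m₁ u) (n∸n≡0 m)))
        (decide s λ e → all e (Fin.toℕ<n e))
      top-case (inj₂ (e , u , lt)) = caseZ-elim (Done s) (τ₁ 0 2 ∸ τ₁ 40 0)
        (λ z → ⊥-elim (<⇒≱ (Fin.toℕ<n e) (m∸n≡0⇒m≤n (trans (sym (cong₂ _∸_ m₁ u)) z))))
        (λ _ → subst (Done s) (sym (run-ifz ($$ 36 ⊖ 0 ⟦ lit 6 ⟧) (for 5 2 pushP) nop τ₁))
          (caseZ-elim (Done s) (τ₁ 36 0 ∸ τ₁ 0 6) (λ z → Unsettled.push e u (not-settled e lt) bs (m∸n≡0⇒m≤n (trans (sym μ₁) z)))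
            (λ nzr → Unsettled.stop-here e u (not-settled e lt) s (λ le → nzr (trans μ₁ (m≤n⇒m∸n≡0 le))))))

  receive : List ℕ → Store → Store
  receive ys τ = setArray 39 (putList ys (τ 39)) τ

  node-correct : ∀ {s} → IsBundleSize s → ∀ σ j f L → Searching σ ((j , f) ∷ L) → ∀ ys (D : Fin n → Fin n → ℕ) →
    (∀ u v → Network.Dist (Modified.modified (entry (σ 35) (j , f)) (con 1) 1≤B) full u v (D u v)) →
    (∀ u v → putList ys (run popP σ 39) (1 + (n * toℕ u + toℕ v)) ≡ D u v) →
    Found (run checkP (receive ys (run popP σ))) ⊎
    (∃[ L′ ] Searching (run checkP (receive ys (run popP σ))) L′ × suc (Φ s L′) ≤ Φ s ((j , f) ∷ L))
  node-correct bs σ j f L S ys D dst mat =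
    Checking.check-correct (receive ys (run popP σ)) j f L (entry (σ 35) (j , f)) D (fixed-frame (receive ys (run popP σ)) σ (kp 0 tt) (kp 2 tt) (kp 12 tt) (kp 22 tt) (kp 23 tt) fx) top level (subst₂ (λ a b → Rep a b L) (sym (kp 33 tt)) (sym (kp 34 tt)) (proj₂ (proj₂ rep))) (trans (cong (λ a → a 0) (kp 31 tt)) live) result row (level≥1 top-ok) (level≤μ top-ok) (good top-ok) (sized top-ok) (index top-ok) (sorted top-ok) oks′ cov′ mat dst bs
    where
    open Searching S
    top-ok = proj₁ stack
    P = pop-correct σ j f L fx (level≥1 top-ok) sp rep
    open Popped P
    kp : ∀ b → T (not (writes popP b)) → run popP σ b ≡ σ b
    kp b t = run-frame popP σ b t
    oks′ : StackOK (run popP σ 35) L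
    oks′ = stack-cong {j} {σ 35} {run popP σ 35} L rows (sorted top-ok) (proj₂ stack)
    cov′ : ∀ F → IsSolution F → Consistent (entry (σ 35) (j , f)) F ⊎ Any.Any (λ x → Consistent (entry (run popP σ 35) x) F) L
    cov′ F sol with covers F sol
    ... | here c  = inj₁ c
    ... | there a = inj₂ (any-cong {j} {σ 35} {run popP σ 35} {F} L rows (sorted top-ok) (proj₂ stack) a)

-- The start of the search, the case without search and the output

resultP totalP totalsHead totalsP rootP directP branchInitP chooseP startP answerHead answerP outputP : Prog
-- Trivial and critical edges together settle all pairs. If each bundle of a critical pair is a
-- single edge, this set is consistent with every solution, so checking its weight and size decides
-- the instance.
resultP = 28 [ $$ 5 ]:= nonZeroE (23 ⟦ $$ 5 ⟧ ⊕ 25 ⟦ $$ 5 ⟧)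
totalP =
  (29 [ lit 0 ]:= minE CAP ($$ 29 ⊕ nonZeroE (28 ⟦ $$ 5 ⟧) ⊗ wt# ($$ 5))) ⨟
  (30 [ lit 0 ]:= minE CAP ($$ 30 ⊕ nonZeroE (28 ⟦ $$ 5 ⟧ ⊗ isZeroE (23 ⟦ $$ 5 ⟧))))
totalsHead = (29 [ lit 0 ]:= lit 0) ⨟ (30 [ lit 0 ]:= lit 0)
totalsP = totalsHead ⨟ for 5 2 totalP
rootP = 35 [ m# ⊗ lit 0 ⊕ $$ 5 ]:= 23 ⟦ $$ 5 ⟧
directP = (31 [ lit 0 ]:= nonZeroE (leE ($$ 29) (0 ⟦ lit 5 ⟧) ⊗ leE ($$ 30) (0 ⟦ lit 6 ⟧))) ⨟ (32 [ lit 0 ]:= lit 0)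
branchInitP = (31 [ lit 0 ]:= lit 0) ⨟ (32 [ lit 0 ]:= lit 1) ⨟ (33 [ lit 0 ]:= lit 1) ⨟ (34 [ lit 0 ]:= m#)
chooseP = ifz ($$ 27) directP branchInitP
startP = ((for 5 2 resultP ⨟ totalsP) ⨟ for 5 2 rootP) ⨟ chooseP
answerHead = (1 [ lit 0 ]:= minE CAP (lit 1 ⊕ m#)) ⨟ (1 [ lit 1 ]:= lit 1)
answerP = 1 [ lit 2 ⊕ $$ 5 ]:= nonZeroE (28 ⟦ $$ 5 ⟧)
outputP = ifz ($$ 31) ((1 [ lit 0 ]:= lit 1) ⨟ (1 [ lit 1 ]:= lit 0)) (answerHead ⨟ for 5 2 answerP)

module Start {n m} (I : Instance n m) (In : Input I)
  (distances : (N : Network n m) → Σ[ D ∈ (Fin n → Fin n → ℕ) ] (∀ (u v : Fin n) → Network.Dist N full u v (D u v)))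
  (preprocessed : Instance.Preprocessed I) where

  open Instance I using (W; μ; weight; IsSolution; Trivial; Nontrivial; Critical; Bundle)
  open Input In
  open Theory I In distances preprocessed
  open Preprocessing I In using (Prepared)
  open TablesCorrect I In using (m-eq)

  module _ (σ : Store) (P : Prepared σ) (q₀ : σ 0 ≡ inp) (q₂ : σ 2 ≡ con) where

    open Prepared P
    TR = σ 23
    Searching : Store → Stack → Set
    Searching = Node.Searching I In distances preprocessed (σ 12) (σ 22) (σ 23) thresholds trivial bundle

    private
      entry : (ℕ → ℕ) → ℕ × ℕ → ℕ → ℕ
      entry = Search.entry I In distances preprocessed (σ 12) (σ 22) (σ 23) thresholds trivial bundle

    private
      σ₁ σ₂ σ₃ τ₂ : Store
      σ₁ = run (for 5 2 resultP) σ
      τ₂ = sem totalsHead σ₁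
      σ₂ = run (for 5 2 totalP) τ₂
      σ₃ = run (for 5 2 rootP) σ₂

      eq-start : run startP σ ≡ run chooseP σ₃
      eq-start = run-seq₂ (run-seq₂ (trans (run-seq (for 5 2 resultP) totalsP σ) (run-seq₂ (run-sem totalsHead σ₁))))

      g : ℕ → ℕ
      g = σ₁ 28

      g-eq : ∀ (i : Fin m) → g (toℕ i) ≡ nz (TR (toℕ i) + σ 25 (toℕ i))
      g-eq = for-table 5 2 resultP σ 28 tt (m-eq σ q₀) (λ i v → v ≡ nz (TR (toℕ i) + σ 25 (toℕ i)))
        λ k τ ctr fr → _ , leaf resultP τ 28 (body k τ ctr (fr 23 tt) (fr 25 tt)) , refl
        where
        body : ∀ k (τ : Store) → τ 5 0 ≡ toℕ k → τ 23 ≡ σ 23 → τ 25 ≡ σ 25 → sem resultP τ 28 ≡ set (τ 28) (toℕ k) (nz (TR (toℕ k) + σ 25 (toℕ k)))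
        body k τ ctr a b rewrite ctr | a | b = refl

      q₁ : σ₁ 0 ≡ inp
      q₁ = trans (run-frame (for 5 2 resultP) σ 0 tt) q₀

      wsum csum : ℕ → ℕ
      wsum i = nz (g i) * wt TR trivial i
      csum i = nz (chosen TR trivial g i)

      totals : σ₂ 29 0 ≡ mn V (Σ< m wsum) × σ₂ 30 0 ≡ mn V (Σ< m csum)
      totals = for-run 5 2 totalP τ₂ (m-eq τ₂ q₁) (λ k ρ → ρ 29 0 ≡ mn V (Σ< k wsum) × ρ 30 0 ≡ mn V (Σ< k csum))
        (sym (n∸n≡0 V) , sym (n∸n≡0 V)) body
        where
        body : ∀ (k : Fin m) (ρ : Store) → ρ 5 0 ≡ toℕ k → Frame 5 totalP ρ τ₂ → ρ 29 0 ≡ mn V (Σ< (toℕ k) wsum) × ρ 30 0 ≡ mn V (Σ< (toℕ k) csum) →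
               run totalP ρ 29 0 ≡ mn V (Σ< (suc (toℕ k)) wsum) × run totalP ρ 30 0 ≡ mn V (Σ< (suc (toℕ k)) csum)
        body k ρ ctr fr (a , b) rewrite run-sem totalP ρ | ctr | trans (fr 0 tt) q₁ | trans (fr 2 tt) (trans (run-frame (for 5 2 resultP) σ 2 tt) q₂)
            | fr 28 tt | trans (fr 23 tt) (run-frame (for 5 2 resultP) σ 23 tt) | a | b =
          mn-cap V (Σ< (toℕ k) wsum) (wsum (toℕ k)) , mn-cap V (Σ< (toℕ k) csum) (csum (toℕ k))

      keep : ∀ b → T (not (writes (for 5 2 rootP) b)) → T (not (writes (for 5 2 totalP) b)) → T (not (writes totalsHead b)) →
             T (not (writes (for 5 2 resultP) b)) → σ₃ b ≡ σ b
      keep b t₁ t₂ t₃ t₄ = trans (run-frame (for 5 2 rootP) σ₂ b t₁) (trans (run-frame (for 5 2 totalP) τ₂ b t₂)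
        (trans (frame totalsHead σ₁ b t₃) (run-frame (for 5 2 resultP) σ b t₄)))

      r₀ : σ₃ 0 ≡ inp
      r₀ = trans (keep 0 tt tt tt tt) q₀

      root : ∀ (i : Fin m) → σ₃ 35 (m * 0 + toℕ i) ≡ TR (toℕ i)
      root = proj₂ (for-row 5 2 rootP σ₂ 35 {1} {m} Fin.zero tt (m-eq σ₂ q₂′) (λ i v → v ≡ TR (toℕ i)) λ i τ ctr fr _ →
          _ , leaf rootP τ 35 (body i τ ctr (trans (fr 0 tt) q₂′) (trans (fr 23 tt) (trans (run-frame (for 5 2 totalP) τ₂ 23 tt) (run-frame (for 5 2 resultP) σ 23 tt)))) , refl)
        where
        q₂′ : σ₂ 0 ≡ inp
        q₂′ = trans (run-frame (for 5 2 totalP) τ₂ 0 tt) q₁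
        body : ∀ i (τ : Store) → τ 5 0 ≡ toℕ i → τ 0 ≡ inp → τ 23 ≡ σ 23 → sem rootP τ 35 ≡ set (τ 35) (m * 0 + toℕ i) (TR (toℕ i))
        body i τ ctr a b rewrite ctr | a | b | inp-m = refl

      g-trivial : ∀ e → Trivial e → g (toℕ e) ≢ 0
      g-trivial e t z with trivial e
      ... | inj₂ (nt , _) = nt t
      ... | inj₁ (_ , v) = case trans (sym (nonzero-1 (λ z′ → case trans (sym v) (m+n≡0⇒m≡0 (TR (toℕ e)) z′) of λ ()))) (trans (sym (g-eq e)) z) of λ ()

      g-critical : ∀ e → Critical e → g (toℕ e) ≢ 0
      g-critical e cr z with critical e
      ... | inj₂ (nc , _) = nc cr
      ... | inj₁ (_ , v) = case trans (sym (nonzero-1 (λ z′ → case trans (sym v) (m+n≡0⇒n≡0 (TR (toℕ e)) z′) of λ ()))) (trans (sym (g-eq e)) z) of λ ()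

      g-only : ∀ e → g (toℕ e) ≢ 0 → Nontrivial e → Critical e
      g-only e h nt with trivial e | critical e
      ... | inj₁ (t , _) | _            = ⊥-elim (nt t)
      ... | inj₂ _       | inj₁ (c , _) = c
      ... | inj₂ (_ , v) | inj₂ (_ , u) = ⊥-elim (h (trans (g-eq e) (cong₂ (λ a b → nz (a + b)) v u)))

      -- A critical edge is chosen and settles itself by the preprocessing convention; any other
      -- pair is settled because all trivial edges are chosen.
      all-settled : ∀ e → Settled g e
      all-settled e with critical e
      ... | inj₁ (c , _)  = self-settled TR trivial {g} (g-critical e c)
      ... | inj₂ (nc , _) = not-critical⇒settled TR trivial {g} g-trivial nc

      weight-eq : Σ< m wsum ≡ weight (toSet g)
      weight-eq = sym (weight-toSet TR trivial g)

      size-eq : Σ< m csum ≡ size TR trivial g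
      size-eq = sym (card-toSet m (chosen TR trivial g))

      m≤V : m ≤ V
      m≤V = ≤-trans (≤-trans (m≤m+n m (m + (m + 0))) (m≤n+m (3 * m) (3 + m * m))) (≤-trans (≤-reflexive (+-assoc 3 (m * m) (3 * m))) stack≤V)

      cap-size : mn V (size TR trivial g) ≡ size TR trivial g
      cap-size = m∸[m∸n]≡n (≤-trans (Subset.∣p∣≤n (toSet (chosen TR trivial g))) m≤V)

      consistent : ¬ (∃[ e ] ∃[ f ] Critical e × Bundle e f × e ≢ f) → ∀ {F} → IsSolution F → Consistent TR trivial g F
      consistent nf {F} sol e h nt = critical∈ TR trivial {e} only (g-only e h nt) (proj₁ sol)
        where
        only : ∀ f → Bundle e f → e ≡ f
        only f b with e Fin.≟ f
        ... | yes eq = eq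
        ... | no ne = ⊥-elim (nf (e , f , g-only e h nt , b , ne))

      direct : ¬ (∃[ e ] ∃[ f ] Critical e × Bundle e f × e ≢ f) → Found (run directP σ₃) ⊎ NoSolution (run directP σ₃)
      direct nf with weight (toSet g) ≤? W | size TR trivial g ≤? μ
      ... | yes wW | yes sμ = inj₁ (trans out (cong₂ (λ a b → nz ((1 ∸ a) * (1 ∸ b))) (m≤n⇒m∸n≡0 (≤-trans (mn-≤ʳ V (weight (toSet g))) wW)) (m≤n⇒m∸n≡0 sμ)) ,
              subst (λ S → IsSolution S) (sym (cong toSet r₂₈)) (solution TR trivial {g} all-settled wW sμ))
        where
        r₂₈ : run directP σ₃ 28 ≡ g
        r₂₈ = trans (run-frame directP σ₃ 28 tt) (trans (run-frame (for 5 2 rootP) σ₂ 28 tt) (run-frame (for 5 2 totalP) τ₂ 28 tt))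
        out : run directP σ₃ 31 0 ≡ nz ((1 ∸ (mn V (weight (toSet g)) ∸ W)) * (1 ∸ (size TR trivial g ∸ μ)))
        out = trans (cong (λ ρ → ρ 31 0) (run-sem directP σ₃)) (cong₂ (λ a b → nz ((1 ∸ a) * (1 ∸ b)))
          (cong₂ _∸_ (trans (cong (λ a → a 0) (run-frame (for 5 2 rootP) σ₂ 29 tt)) (trans (proj₁ totals) (cong (mn V) weight-eq))) (trans (cong (λ a → a 5) r₀) inp-W))
          (cong₂ _∸_ (trans (cong (λ a → a 0) (run-frame (for 5 2 rootP) σ₂ 30 tt)) (trans (proj₂ totals) (trans (cong (mn V) size-eq) cap-size))) (trans (cong (λ a → a 6) r₀) inp-μ)))
      ... | no nw | _ = inj₂ (trans (cong (λ ρ → ρ 31 0) (run-sem directP σ₃))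
              (cong (λ a → nz (a * (1 ∸ (σ₃ 30 0 ∸ σ₃ 0 6)))) zero₁) , cong (λ ρ → ρ 32 0) (run-sem directP σ₃) ,
              λ F sol → nw (≤-trans (weight-≤ TR trivial {g} (consistent nf sol) (proj₁ sol)) (proj₁ (proj₂ sol))))
        where
        zero₁ : 1 ∸ (σ₃ 29 0 ∸ σ₃ 0 5) ≡ 0
        zero₁ = 1∸-≢ (λ z → <⇒≱ (mn-elim {λ v → W < v} V (weight (toSet g)) W<V (λ _ → ≰⇒> nw))
          (m∸n≡0⇒m≤n (trans (sym (cong₂ _∸_ (trans (cong (λ a → a 0) (run-frame (for 5 2 rootP) σ₂ 29 tt)) (trans (proj₁ totals) (cong (mn V) weight-eq))) (trans (cong (λ a → a 5) r₀) inp-W))) z)))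
      ... | yes _ | no ns = inj₂ (trans (cong (λ ρ → ρ 31 0) (run-sem directP σ₃))
              (trans (cong (λ a → nz ((1 ∸ (σ₃ 29 0 ∸ σ₃ 0 5)) * a)) zero₂) (cong nz (*-zeroʳ (1 ∸ (σ₃ 29 0 ∸ σ₃ 0 5))))) , cong (λ ρ → ρ 32 0) (run-sem directP σ₃) ,
              λ F sol → ns (≤-trans (size-≤ TR trivial {g} (consistent nf sol) (proj₁ (proj₂ (proj₂ (proj₂ sol))))) (proj₂ (proj₂ (proj₂ (proj₂ sol))))))
        where
        zero₂ : 1 ∸ (σ₃ 30 0 ∸ σ₃ 0 6) ≡ 0
        zero₂ = 1∸-≢ (λ z → ns (m∸n≡0⇒m≤n (trans (sym (cong₂ _∸_ (trans (cong (λ a → a 0) (run-frame (for 5 2 rootP) σ₂ 30 tt)) (trans (proj₂ totals) (trans (cong (mn V) size-eq) cap-size))) (trans (cong (λ a → a 6) r₀) inp-μ))) z)))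

      branching : Searching (run branchInitP σ₃) ((1 , m) ∷ [])
      branching = subst (λ ρ → Searching ρ ((1 , m) ∷ [])) (sym (run-sem branchInitP σ₃)) (record
        { fx = Search.fixed r₀ (trans (keep 2 tt tt tt tt) q₂) (keep 12 tt tt tt tt) (keep 22 tt tt tt tt) (keep 23 tt tt tt tt)
        ; sp = refl
        ; rep = refl , trans (cong (λ a → a 2) r₀) inp-m , tt
        ; stack = Node.entryOK (s≤s z≤n) z≤n (λ e t z → top-trivial e t z)
            (size-trivial TR trivial {entry (σ₃ 35) (1 , m)} top-only) z≤n [] , tt
        ; covers = λ F sol → here (λ e h nt → ⊥-elim (nt (top-only e h)))
        ; live = refl })
        where
        top-eq : ∀ (i : Fin m) → entry (σ₃ 35) (1 , m) (toℕ i) ≡ nz (TR (toℕ i))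
        top-eq i = cong nz (trans (cong₂ _+_ (root i) (1∸-≢ (gapN-≢ (λ eq → <-irrefl (sym eq) (Fin.toℕ<n i))))) (+-identityʳ (TR (toℕ i))))
        top-trivial : ∀ e → Trivial e → entry (σ₃ 35) (1 , m) (toℕ e) ≢ 0
        top-trivial e t z with trivial e
        ... | inj₂ (nt , _) = nt t
        ... | inj₁ (_ , v) = case trans (sym (cong nz v)) (trans (sym (top-eq e)) z) of λ ()
        top-only : ∀ e → entry (σ₃ 35) (1 , m) (toℕ e) ≢ 0 → Trivial e
        top-only e h with trivial e
        ... | inj₁ (t , _) = t
        ... | inj₂ (_ , v) = ⊥-elim (h (trans (top-eq e) (cong nz v)))

      -- A critical edge settles itself and is nontrivial, so it lies in its own bundle; the flagged
      -- edge is a second member.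
      two : ∀ {s} → Instance.IsBundleSize I s → (∃[ e ] ∃[ f ] Critical e × Bundle e f × e ≢ f) → 2 ≤ s
      two bs (e , f , c , b , ne) = ≤-trans
        (card-two (∈-toSet row (in-row e (critical⇒bundle c))) (∈-toSet row (in-row f b)) ne)
        (bundle-size TR trivial (σ 22) e (bundle e) bs c)
        where
        row : ℕ → ℕ
        row i = σ 22 (m * toℕ e + i)
        in-row : ∀ f → Bundle e f → row (toℕ f) ≢ 0
        in-row f b z with bundle e f
        ... | inj₁ (_ , v)  = case trans (sym v) z of λ ()
        ... | inj₂ (nb , _) = nb b

    start-correct : ∀ {s} → Instance.IsBundleSize I s →
      (Found (run startP σ) ⊎ NoSolution (run startP σ)) ⊎ (2 ≤ s × Searching (run startP σ) ((1 , m) ∷ []))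
    start-correct {s} bs = subst Goal (sym (trans eq-start (run-ifz ($$ 27) directP branchInitP σ₃)))
      (caseZ-elim Goal (σ₃ 27 0) (λ z → inj₁ (direct (unflagged (trans (sym k₂₇) z)))) (λ nzr → inj₂ (two bs (isflagged (λ z → nzr (trans k₂₇ z))) , branching)))
      where
      Goal : Store → Set
      Goal ρ = (Found ρ ⊎ NoSolution ρ) ⊎ (2 ≤ s × Searching ρ ((1 , m) ∷ []))
      k₂₇ : σ₃ 27 0 ≡ σ 27 0
      k₂₇ = cong (λ a → a 0) (keep 27 tt tt tt tt)
      unflagged : σ 27 0 ≡ 0 → ¬ (∃[ e ] ∃[ f ] Critical e × Bundle e f × e ≢ f)
      unflagged z fl with flagged
      ... | inj₁ (_ , v)  = case trans (sym v) z of λ ()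
      ... | inj₂ (nf , _) = nf fl
      isflagged : σ 27 0 ≢ 0 → ∃[ e ] ∃[ f ] Critical e × Bundle e f × e ≢ f
      isflagged h with flagged
      ... | inj₁ (fl , _) = fl
      ... | inj₂ (_ , v)  = ⊥-elim (h v)

  indicator-list : ∀ k (a b : ℕ → ℕ) → (∀ i → i < k → a i ≡ nz (b i)) → applyUpTo a k ≡ indicator (toSet {k} b)
  indicator-list zero    a b h = refl
  indicator-list (suc k) a b h = cong₂ _∷_ (trans (h 0 (s≤s z≤n)) (bit (b 0))) (indicator-list k (a ∘ suc) (b ∘ suc) (λ i lt → h (suc i) (s≤s lt)))
    where
    bit : ∀ v → nz v ≡ (if isNZ v then 1 else 0)
    bit zero    = refl
    bit (suc v) = nonzero-1 {suc v} λ ()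

  output-none : ∀ (ρ : Store) → ρ 31 0 ≡ 0 → output (run outputP ρ) ≡ 0 ∷ []
  output-none ρ z = cong output (trans (run-ifz ($$ 31) none found ρ) (trans (cong (λ v → caseZ v (run none ρ) (run found ρ)) z) (run-sem none ρ)))
    where
    none found : Prog
    none = (1 [ lit 0 ]:= lit 1) ⨟ (1 [ lit 1 ]:= lit 0)
    found = answerHead ⨟ for 5 2 answerP

  output-found : ∀ (ρ : Store) → ρ 0 ≡ inp → ρ 2 ≡ con → ρ 31 0 ≡ 1 → output (run outputP ρ) ≡ 1 ∷ indicator (toSet {m} (ρ 28))
  output-found ρ q₀ q₂ o = trans (cong output (trans (run-ifz ($$ 31) none found ρ) (trans (cong (λ v → caseZ v (run none ρ) (run found ρ)) o) (run-seq₂ (run-sem answerHead ρ)))))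
      (trans (cong (applyUpTo (λ i → ρ₂ 1 (suc i))) (proj₁ (proj₂ final))) (cong₂ _∷_ (proj₂ (proj₂ final))
        (indicator-list m (λ i → ρ₂ 1 (2 + i)) (ρ 28) λ i lt → subst (λ j → ρ₂ 1 (2 + j) ≡ nz (ρ 28 j)) (Fin.toℕ-fromℕ< lt)
          (proj₁ final (fromℕ< lt) (≤-trans (≤-reflexive (cong suc (Fin.toℕ-fromℕ< lt))) lt)))))
    where
    none found : Prog
    none = (1 [ lit 0 ]:= lit 1) ⨟ (1 [ lit 1 ]:= lit 0)
    found = answerHead ⨟ for 5 2 answerP
    ρ₁ ρ₂ : Store
    ρ₁ = sem answerHead ρ
    ρ₂ = run (for 5 2 answerP) ρ₁
    Inv : ℕ → Store → Set
    Inv k τ = (∀ (i : Fin m) → toℕ i < k → τ 1 (2 + toℕ i) ≡ nz (ρ 28 (toℕ i))) × τ 1 0 ≡ suc m × τ 1 1 ≡ 1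
    size₀ : ρ₁ 1 0 ≡ suc m
    size₀ rewrite q₀ | q₂ | inp-m = m∸[m∸n]≡n (≤-trans (+-mono-≤ (s≤s (z≤n {2})) (≤-trans (m≤m+n m (m + (m + 0))) (m≤n+m (3 * m) (m * m)))) stack≤V)
    body : ∀ (k : Fin m) (τ : Store) → τ 5 0 ≡ toℕ k → Frame 5 answerP τ ρ₁ → Inv (toℕ k) τ → Inv (suc (toℕ k)) (setCell 5 0 (suc (toℕ k)) (run answerP τ))
    body k τ ctr fr (a , b , c) = subst (λ ρ′ → Inv (suc (toℕ k)) (setCell 5 0 (suc (toℕ k)) ρ′)) (sym (run-sem answerP τ)) (a′ , b , c)
      where
      v = nz (ρ 28 (toℕ k))
      e₁ : sem answerP τ 1 ≡ set (τ 1) (2 + toℕ k) v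
      e₁ rewrite ctr | fr 28 tt = refl
      a′ : ∀ (i : Fin m) → toℕ i < suc (toℕ k) → sem answerP τ 1 (2 + toℕ i) ≡ nz (ρ 28 (toℕ i))
      a′ i lt = trans (cong (λ h → h (2 + toℕ i)) e₁) (at (i Fin.≟ k))
        where
        at : Dec (i ≡ k) → set (τ 1) (2 + toℕ k) v (2 + toℕ i) ≡ nz (ρ 28 (toℕ i))
        at (yes refl) = set-same (τ 1) (2 + toℕ k) v
        at (no ne) = trans (set-other (τ 1) {2 + toℕ k} {2 + toℕ i} v (λ eq → ne (Fin.toℕ-injective (sym (suc-injective (suc-injective eq))))))
          (a i (≤∧≢⇒< (≤-pred lt) (ne ∘ Fin.toℕ-injective)))
    final : Inv m ρ₂
    final = for-run 5 2 answerP ρ₁ (m-eq ρ₁ q₀) Inv ((λ _ ()) , size₀ , refl) body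

-- Reading encoded lists and enlarging word bounds

overwrite-++ˡ : ∀ (xs ys : List ℕ) (f f′ : ℕ → ℕ) r → r < length xs → overwrite (xs ++ ys) f r ≡ overwrite xs f′ r
overwrite-++ˡ (x ∷ xs) ys f f′ zero    _        = refl
overwrite-++ˡ (x ∷ xs) ys f f′ (suc r) (s≤s lt) = overwrite-++ˡ xs ys (f ∘ suc) (f′ ∘ suc) r lt

overwrite-++ʳ : ∀ (xs ys : List ℕ) (f : ℕ → ℕ) r → overwrite (xs ++ ys) f (length xs + r) ≡ overwrite ys (λ j → f (length xs + j)) r
overwrite-++ʳ []       ys f r = refl
overwrite-++ʳ (x ∷ xs) ys f r = overwrite-++ʳ xs ys (f ∘ suc) r

overwrite-blocks : ∀ {A : Set} b (h : A → List ℕ) → (∀ a → length (h a) ≡ b) → ∀ k (g : Fin k → A) (f f′ : ℕ → ℕ) (i : Fin k) r → r < b →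
                   overwrite (concatMap h (tabulate g)) f (b * toℕ i + r) ≡ overwrite (h (g i)) f′ r
overwrite-blocks b h len (suc k) g f f′ Fin.zero r lt =
  trans (cong (overwrite (h (g Fin.zero) ++ concatMap h (tabulate (g ∘ Fin.suc))) f) (cong (_+ r) (*-zeroʳ b)))
    (overwrite-++ˡ (h (g Fin.zero)) _ f f′ r (≤-trans lt (≤-reflexive (sym (len (g Fin.zero))))))
overwrite-blocks b h len (suc k) g f f′ (Fin.suc i) r lt =
  trans (cong (overwrite (h (g Fin.zero) ++ concatMap h (tabulate (g ∘ Fin.suc))) f)
          (trans (cong (_+ r) (*-suc b (toℕ i))) (trans (+-assoc b _ r) (cong (_+ (b * toℕ i + r)) (sym (len (g Fin.zero)))))))
    (trans (overwrite-++ʳ (h (g Fin.zero)) _ f (b * toℕ i + r))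
      (overwrite-blocks b h len k (g ∘ Fin.suc) (λ j → f (length (h (g Fin.zero)) + j)) f′ i r lt))

overwrite-map : ∀ {A : Set} (d : A → ℕ) k (g : Fin k → A) (f : ℕ → ℕ) (v : Fin k) → overwrite (map d (tabulate g)) f (toℕ v) ≡ d (g v)
overwrite-map d (suc k) g f Fin.zero    = refl
overwrite-map d (suc k) g f (Fin.suc v) = overwrite-map d k (g ∘ Fin.suc) (f ∘ suc) v

overwrite-≤ : ∀ {Z} xs {f : ℕ → ℕ} → All (_≤ Z) xs → (∀ i → f i ≤ Z) → ∀ i → overwrite xs f i ≤ Z
overwrite-≤ []       _        h i       = h i
overwrite-≤ (x ∷ xs) (p ∷ ps) h zero    = p
overwrite-≤ (x ∷ xs) (p ∷ ps) h (suc i) = overwrite-≤ xs ps (h ∘ suc) i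

length-blocks : ∀ {A : Set} b (h : A → List ℕ) → (∀ a → length (h a) ≡ b) → ∀ k (g : Fin k → A) → length (concatMap h (tabulate g)) ≡ k * b
length-blocks b h len zero    g = refl
length-blocks b h len (suc k) g = trans (List.length-++ (h (g Fin.zero))) (cong₂ _+_ (len (g Fin.zero)) (length-blocks b h len k (g ∘ Fin.suc)))

all-blocks : ∀ {A : Set} {P : ℕ → Set} (h : A → List ℕ) k (g : Fin k → A) → (∀ a → All P (h a)) → All P (concatMap h (tabulate g))
all-blocks h zero    g p = []
all-blocks h (suc k) g p = AllP.++⁺ (p (g Fin.zero)) (all-blocks h k (g ∘ Fin.suc) p)

setArray-≤ : ∀ {Z} a (f : ℕ → ℕ) (σ : Store) → (∀ i → f i ≤ Z) → (∀ b i → σ b i ≤ Z) → ∀ b i → setArray a f σ b i ≤ Z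
setArray-≤ a f σ hf hσ b i with a ≡ᵇ b
... | true  = hf i
... | false = hσ b i

fits-mono : ∀ {B B′ σ} e → B ≤ B′ → Fits B σ e → Fits B′ σ e
fits-mono (lit k)      le h           = ≤-trans h le
fits-mono (a ⟦ i ⟧)    le (h , k)     = fits-mono i le h , ≤-trans k le
fits-mono (op o e₁ e₂) le (h , k , l) = fits-mono e₁ le h , fits-mono e₂ le k , ≤-trans l le

-- The APSP program is known to respect the word bound of its own input only, and this input differs
-- from node to node.
exec-mono : ∀ {B B′ c σ τ t} → B ≤ B′ → Exec B c σ τ t → Exec B′ c σ τ t
exec-mono le skip                     = skip
exec-mono le (assign {i = i} {e} p q) = assign (fits-mono i le p) (fits-mono e le q)
exec-mono le (seq p q)                = seq (exec-mono le p) (exec-mono le q)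
exec-mono le (if-true {e} p z q)      = if-true (fits-mono e le p) z (exec-mono le q)
exec-mono le (if-false {e} p z q)     = if-false (fits-mono e le p) z (exec-mono le q)
exec-mono le (while-true {e} p z q r) = while-true (fits-mono e le p) z (exec-mono le q) (exec-mono le r)
exec-mono le (while-false {e} p z)    = while-false (fits-mono e le p) z
exec-mono le (call p)                 = call (exec-mono le p)

run-within : ∀ {B Z X} → 8 ≤ Z → ∀ p → T (ok p) → Z ^ span p ≤ B → ∀ {σ} → Small Z X σ →
             ∃[ t ] Exec B (compile p) σ (run p σ) t × t ≤ time X p × Small Z X (run p σ)
run-within {B} {Z} {X} 8≤Z p o h {σ} s with Execution.exec {B} {Z} {X} 8≤Z p o h s
... | t , r , b , s′ = t , subst (λ τ → Exec B (compile p) σ τ t) (sym (run-sem p σ)) r , b , subst (Small Z X) (sym (run-sem p σ)) s′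

-- The search loop with its calls of the APSP program

guardE : Exp
guardE = $$ 32 ⊗ isZeroE ($$ 31)

-- The exponent 5 is `width guardE`.
guard-fits : ∀ {B Z X σ} → 8 ≤ Z → Z ^ 5 ≤ B → Small Z X σ → Fits B σ guardE
guard-fits {B} {Z} {X} 8≤Z h s = Execution.fits {B} {Z} {X} 8≤Z (Small.cells s) guardE h

live-stops : ∀ {τ : Store} → τ 31 0 ≡ 1 → eval τ guardE ≡ 0
live-stops {τ} o = trans (cong (λ v → τ 32 0 * (1 ∸ v)) o) (*-zeroʳ (τ 32 0))

empty-stops : ∀ {τ : Store} → τ 32 0 ≡ 0 → eval τ guardE ≡ 0
empty-stops {τ} z = cong (_* (1 ∸ τ 31 0)) z

searchBody : Cmd → Cmd
searchBody apsp = compile popP ⨾ (call apsp 38 39 ⨾ compile checkP)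

nodeTime : ℕ → ℕ → ℕ
nodeTime X A = time X popP + ((1 + A) + time X checkP)

module Loop (apsp : Cmd) (APSP : ℕ → ℕ → ℕ) (k : ℕ)
  (solves : ∀ {n m} (N : Network n m) → ∃[ ys ] RunsWithin k apsp (encodeNetwork N) ys (APSP n m) × IsDistanceMatrix N ys) where

  distances : ∀ {n m} (N : Network n m) → Σ[ D ∈ (Fin n → Fin n → ℕ) ] (∀ (u v : Fin n) → Network.Dist N full u v (D u v))
  distances N = proj₁ (proj₂ (proj₂ (solves N))) , proj₁ (proj₂ (proj₂ (proj₂ (solves N))))

  module Run {n m} (I : Instance n m) (In : Input I) (preprocessed : Instance.Preprocessed I)
    {B X K : ℕ} (8≤V : 8 ≤ Input.V In) (span≤ : Input.V In ^ K ≤ B) (5≤K : 5 ≤ K) (pop≤K : span popP ≤ K) (check≤K : span checkP ≤ K)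
    (word≤ : (Input.V In * Input.V In) ^ k ≤ B) where

    open Instance I using (graph; μ; IsBundleSize)
    open Input In

    Found NoSolution : Store → Set
    Found      = Theory.Found I In distances preprocessed
    NoSolution = Theory.NoSolution I In distances preprocessed

    1≤V : 1 ≤ V
    1≤V = ≤-trans (s≤s z≤n) 8≤V

    span-part : ∀ j → j ≤ K → V ^ j ≤ B
    span-part j h = ≤-trans (^-mono 1≤V h) span≤

    module Searching-loop (σ₀ : Store) (P : Preprocessing.Prepared I In σ₀) {s} (bs : IsBundleSize s) where

      open Preprocessing.Prepared P using (thresholds; trivial; bundle)

      Searching : Store → Stack → Set
      Searching = Node.Searching I In distances preprocessed (σ₀ 12) (σ₀ 22) (σ₀ 23) thresholds trivial bundle

      Φ : ℕ → Stack → ℕ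
      Φ = Node.Φ I In distances preprocessed (σ₀ 12) (σ₀ 22) (σ₀ 23) thresholds trivial bundle

      entry : (ℕ → ℕ) → ℕ × ℕ → ℕ → ℕ
      entry = Search.entry I In distances preprocessed (σ₀ 12) (σ₀ 22) (σ₀ 23) thresholds trivial bundle

      Outcome : Store → Set
      Outcome τ = (Found τ ⊎ NoSolution τ) × Small V X τ × τ 0 ≡ inp × τ 2 ≡ con

      guard-cost : ℕ
      guard-cost = 1 + cost guardE

      node : ∀ σ j f L → Searching σ ((j , f) ∷ L) → Small V X σ →
             ∃[ ρ ] ∃[ t ] Exec B (searchBody apsp) σ ρ t × t ≤ nodeTime X (APSP n m) × Small V X ρ × ρ 0 ≡ inp × ρ 2 ≡ con
               × (Found ρ ⊎ (∃[ L′ ] Searching ρ L′ × suc (Φ s L′) ≤ Φ s ((j , f) ∷ L)))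
      node σ j f L S sm = continue (run-within 8≤V popP tt (span-part (span popP) pop≤K) sm) (solves N′)
        where
        N′ : Network n m
        N′ = Theory.Modified.modified I In distances preprocessed (entry (σ 35) (j , f)) (con 1) 1≤B
        fx = Node.Searching.fx S
        Pp = Search.pop-correct I In distances preprocessed (σ₀ 12) (σ₀ 22) (σ₀ 23) thresholds trivial bundle σ j f L fx
          (Node.EntryOK.level≥1 (proj₁ (Node.Searching.stack S))) (Node.Searching.sp S) (Node.Searching.rep S)
        τ : Store
        τ = run popP σ
        query : getList (τ 38) ≡ encodeNetwork N′
        query = Search.Popped.query Pp
        q₀ : τ 0 ≡ inp
        q₀ = trans (run-frame popP σ 0 tt) (Search.Fixed.f₀ fx)
        q₂ : τ 2 ≡ con
        q₂ = trans (run-frame popP σ 2 tt) (Search.Fixed.f₂ fx)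
        ℓ′≤ : ∀ e → Network.ℓ N′ e ≤ con 1
        ℓ′≤ e with isNZ (entry (σ 35) (j , f) (toℕ e))
        ... | true  = ℓ≤B e
        ... | false = ≤-refl
        Node-result : Set
        Node-result = ∃[ ρ ] ∃[ t ] Exec B (searchBody apsp) σ ρ t × t ≤ nodeTime X (APSP n m) × Small V X ρ × ρ 0 ≡ inp × ρ 2 ≡ con
                   × (Found ρ ⊎ (∃[ L′ ] Searching ρ L′ × suc (Φ s L′) ≤ Φ s ((j , f) ∷ L)))
        path≤ : ∀ {u v} (p : Graph.Walk graph u v) → Network.ℓ* N′ p ≤ length (Graph.edges graph p) * con 1
        path≤ Graph.stop         = z≤n
        path≤ (Graph.step e _ p) = +-mono-≤ (ℓ′≤ e) (path≤ p)
        module Received (s₁ : Small V X τ) (ys : List ℕ) (ρₐ : Store) (tₐ : ℕ) (rₐ : Exec (wordBound k (encodeNetwork N′)) apsp (initial (encodeNetwork N′)) ρₐ tₐ)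
          (out : output ρₐ ≡ ys) (time≤ : length (encodeNetwork N′) + tₐ + length ys ≤ APSP n m)
          (D : Fin n → Fin n → ℕ) (dst : ∀ u v → Network.Dist N′ full u v (D u v))
          (ys-eq : ys ≡ concatMap (λ u → map (D u) (allFin n)) (allFin n)) where
          n≤V : n ≤ V
          n≤V = subst (_≤ V) (trans (cong (λ a → a 1) q₀) inp-n) (Small.cells s₁ 0 1)
          m≤V : m ≤ V
          m≤V = subst (_≤ V) (trans (cong (λ a → a 2) q₀) inp-m) (Small.cells s₁ 0 2)
          open Graph graph using (lo; hi)
          block : Fin m → List ℕ
          block e = toℕ (lo e) ∷ toℕ (hi e) ∷ Network.ℓ N′ e ∷ []
          small-word : All (_≤ V) (encodeNetwork N′)
          small-word = n≤V ∷ m≤V ∷ all-blocks block m id λ e →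
            <⇒≤ (<-≤-trans (Fin.toℕ<n (lo e)) n≤V) ∷ <⇒≤ (<-≤-trans (Fin.toℕ<n (hi e)) n≤V) ∷ ≤-trans (ℓ′≤ e) B≤V ∷ []
          word-bound : wordBound k (encodeNetwork N′) ≤ B
          -- The constant 2, the length of the query and its largest number are each at most `V`,
          -- and `V` is at least 3, so their sum is at most `V * V`.
          word-bound = ≤-trans (^-monoˡ-≤ k (≤-trans (+-mono-≤ (+-mono-≤ (≤-trans (s≤s (s≤s z≤n)) 8≤V) len≤) (max≤v⁺ z≤n small-word))
              (≤-trans (≤-reflexive (trans (+-assoc V V V) (cong (λ v → V + (V + v)) (sym (+-identityʳ V))))) (*-monoˡ-≤ V (≤-trans (s≤s (s≤s (s≤s z≤n))) 8≤V))))) word≤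
            where
            len≤ : length (encodeNetwork N′) ≤ V
            len≤ = ≤-trans (≤-reflexive (cong (2 +_) (trans (length-blocks 3 block (λ _ → refl) m id) (*-comm m 3))))
                     (≤-trans (+-mono-≤ (n≤1+n 2) (m≤n+m (3 * m) (m * m))) stack≤V)
          ys-len : length ys ≡ n * n
          ys-len = trans (cong length ys-eq) (length-blocks n (λ u → map (D u) (allFin n)) (λ u → trans (List.length-map (D u) (allFin n)) (List.length-tabulate id)) n id)
          -- The reply is the only data that no syntactic test controls. It stays within the cap
          -- since a path has fewer than n edges, each of length at most `con 1`.
          D≤V : ∀ u v → D u v ≤ V
          D≤V u v = bound (proj₁ (dst u v))
            where
            bound : (∃[ p ] Graph.IsPath graph {u} {v} p × Graph._⊑_ graph p full × Network.ℓ* N′ p ≡ D u v) → D u v ≤ V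
            bound (p , path , _ , eq) = subst (_≤ V) eq (≤-trans (path≤ p) (≤-trans (*-monoˡ-≤ (con 1) (<⇒≤ (Walks.path-length graph p path))) n*B≤V))
          ys≤ : All (_≤ V) ys
          ys≤ = subst (All (_≤ V)) (sym ys-eq) (all-blocks (λ u → map (D u) (allFin n)) n id (λ u → AllP.map⁺ (All.tabulate λ {v} _ → D≤V u v)))
          τ′ : Store
          τ′ = Node.receive I In distances preprocessed (σ₀ 12) (σ₀ 22) (σ₀ 23) thresholds trivial bundle ys τ
          s₂ : Small V X τ′
          s₂ = small cells′ (Small.size₁ s₁) (Small.size₂ s₁)
            where
            new : ∀ i → putList ys (τ 39) i ≤ V
            new = overwrite-≤ (length ys ∷ ys) (subst (_≤ V) (sym ys-len) n*n≤V ∷ ys≤) (Small.cells s₁ 39)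
            cells′ : ∀ b i → τ′ b i ≤ V
            cells′ = setArray-≤ 39 (putList ys (τ 39)) τ new (Small.cells s₁)
          mat : ∀ u v → putList ys (τ 39) (1 + (n * toℕ u + toℕ v)) ≡ D u v
          mat u v = trans (cong (λ l → overwrite l (τ 39 ∘ suc) (n * toℕ u + toℕ v)) ys-eq)
            (trans (overwrite-blocks n (λ u → map (D u) (allFin n)) (λ u → trans (List.length-map (D u) (allFin n)) (List.length-tabulate id)) n id (τ 39 ∘ suc) (λ _ → 0) u (toℕ v) (Fin.toℕ<n v))
              (overwrite-map (D u) n id (λ _ → 0) v))
          call-exec : Exec B (call apsp 38 39) τ τ′ (1 + length (getList (τ 38)) + tₐ + length (output ρₐ))
          call-exec = subst (λ zs → Exec B (call apsp 38 39) τ (setArray 39 (putList zs (τ 39)) τ) (1 + length (getList (τ 38)) + tₐ + length (output ρₐ))) out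
            (call (subst (λ xs → Exec B apsp (initial xs) ρₐ tₐ) (sym query) (exec-mono word-bound rₐ)))
          call-time : 1 + length (getList (τ 38)) + tₐ + length (output ρₐ) ≤ 1 + APSP n m
          call-time = s≤s (subst₂ (λ xs zs → length xs + tₐ + length zs ≤ APSP n m) (sym query) (sym out) time≤)
          finish : (∃[ t ] Exec B (compile checkP) τ′ (run checkP τ′) t × t ≤ time X checkP × Small V X (run checkP τ′)) →
                   ∀ {t₁} → Exec B (compile popP) σ τ t₁ → t₁ ≤ time X popP → Node-result
          finish (t₃ , r₃ , b₃ , s₃) r₁ b₁ = run checkP τ′ , _ , seq r₁ (seq call-exec r₃) , +-mono-≤ b₁ (+-mono-≤ call-time b₃) , s₃ ,
            trans (run-frame checkP τ′ 0 tt) q₀ , trans (run-frame checkP τ′ 2 tt) q₂ , Node.node-correct I In distances preprocessed (σ₀ 12) (σ₀ 22) (σ₀ 23) thresholds trivial bundle bs σ j f L S ys D dst mat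
        continue : (∃[ t ] Exec B (compile popP) σ τ t × t ≤ time X popP × Small V X τ) →
                   (∃[ ys ] RunsWithin k apsp (encodeNetwork N′) ys (APSP n m) × IsDistanceMatrix N′ ys) → Node-result
        continue (t₁ , r₁ , b₁ , s₁) (ys , (ρₐ , tₐ , rₐ , out , time≤) , D , dst , ys-eq) =
          finish (run-within 8≤V checkP tt (span-part (span checkP) check≤K) s₂) r₁ b₁
          where open Received s₁ ys ρₐ tₐ rₐ out time≤ D dst ys-eq

      -- `b` is fuel that covers the potential. Each entry contributes at least 1, so without fuel
      -- the stack is empty.
      loop : ∀ b σ L → Searching σ L → Small V X σ → Φ s L ≤ b →
             ∃[ τ ] ∃[ t ] Exec B (while guardE (searchBody apsp)) σ τ t × t ≤ b * (guard-cost + nodeTime X (APSP n m)) + guard-cost × Outcome τ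
      loop b σ [] S sm _ = σ , _ , while-false (guard-fits 8≤V (span-part 5 5≤K) sm) (empty-stops {σ} (Node.Searching.sp S)) , m≤n+m guard-cost _ ,
        inj₂ (Node.Searching.live S , Node.Searching.sp S , λ F sol → case Node.Searching.covers S F sol of λ ()) , sm , Search.Fixed.f₀ (Node.Searching.fx S) , Search.Fixed.f₂ (Node.Searching.fx S)
      loop zero σ ((j , f) ∷ L) S sm le = ⊥-elim (<⇒≱ (≤-trans (G-pos s (μ ∸ (j ∸ 1))) (m≤m+n _ (Φ s L))) le)
      loop (suc b) σ ((j , f) ∷ L) S sm le = go (node σ j f L S sm)
        where
        T′ = nodeTime X (APSP n m)
        Result : Set
        Result = ∃[ τ ] ∃[ t ] Exec B (while guardE (searchBody apsp)) σ τ t × t ≤ suc b * (guard-cost + T′) + guard-cost × Outcome τ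
        busy : eval σ guardE ≢ 0
        busy z = case trans (sym (cong₂ (λ a c → a * (1 ∸ c)) (Node.Searching.sp S) (Node.Searching.live S))) z of λ ()
        more : ∀ {ρ t} → Exec B (searchBody apsp) σ ρ t → t ≤ T′ →
               (∃[ τ ] ∃[ t′ ] Exec B (while guardE (searchBody apsp)) ρ τ t′ × t′ ≤ b * (guard-cost + T′) + guard-cost × Outcome τ) → Result
        more r t≤ (τ , t′ , r′ , t′≤ , o) = τ , _ , while-true (guard-fits 8≤V (span-part 5 5≤K) sm) busy r r′ ,
              ≤-trans (+-mono-≤ (+-monoʳ-≤ guard-cost t≤) t′≤) (≤-reflexive (sym (+-assoc (guard-cost + T′) (b * (guard-cost + T′)) guard-cost))) , o
        go : (∃[ ρ ] ∃[ t ] Exec B (searchBody apsp) σ ρ t × t ≤ T′ × Small V X ρ × ρ 0 ≡ inp × ρ 2 ≡ con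
               × (Found ρ ⊎ (∃[ L′ ] Searching ρ L′ × suc (Φ s L′) ≤ Φ s ((j , f) ∷ L)))) → Result
        go (ρ , t , r , t≤ , sρ , ρ₀ , ρ₂ , inj₁ fd) = ρ , _ , while-true (guard-fits 8≤V (span-part 5 5≤K) sm) busy r (while-false (guard-fits 8≤V (span-part 5 5≤K) sρ) (live-stops {ρ} (proj₁ fd))) ,
          ≤-trans (+-monoˡ-≤ guard-cost (+-monoʳ-≤ guard-cost t≤)) (+-monoˡ-≤ guard-cost (m≤m+n (guard-cost + T′) (b * (guard-cost + T′)))) ,
          inj₁ fd , sρ , ρ₀ , ρ₂
        go (ρ , t , r , t≤ , sρ , ρ₀ , ρ₂ , inj₂ (L′ , S′ , lt)) = more r t≤ (loop b ρ L′ S′ sρ (≤-pred (≤-trans lt le)))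

-- Constants computed from the input

sumE : Exp
sumE = 2 ⟦ lit 2 ⟧

-- A plain command, as it has to create values above all those stored. `S`, which is 2 plus the
-- length and the sum of the input, exceeds every number of the input. Its square bounds the
-- numerator of α times a length and becomes the length of unchosen edges; its cube, the cap, leaves
-- room for n times that.
sumBody preludeP : Cmd
sumBody = (2 ⟦ lit 2 ⟧≔ sumE ⊕ 0 ⟦ $$ 3 ⊕ lit 1 ⟧) ⨾ (3 ⟦ lit 0 ⟧≔ $$ 3 ⊕ lit 1)
preludeP =
  (2 ⟦ lit 2 ⟧≔ lit 2 ⊕ 0 ⟦ lit 0 ⟧) ⨾ (3 ⟦ lit 0 ⟧≔ lit 0) ⨾
  while (0 ⟦ lit 0 ⟧ ⊖ $$ 3) sumBody ⨾
  (2 ⟦ lit 0 ⟧≔ sumE ⊗ sumE ⊗ sumE) ⨾ (2 ⟦ lit 1 ⟧≔ sumE ⊗ sumE)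

Σ<-≤ : ∀ k {a : ℕ → ℕ} {M} → (∀ i → a i ≤ M) → Σ< k a ≤ k * M
Σ<-≤ zero    h = z≤n
Σ<-≤ (suc k) {a} {M} h = ≤-trans (+-mono-≤ (Σ<-≤ k h) (h k)) (≤-reflexive (+-comm (k * M) M))

Σ<-member : ∀ k {a : ℕ → ℕ} i → i < k → a i ≤ Σ< k a
Σ<-member (suc k) {a} i lt with m<1+n⇒m<n∨m≡n lt
... | inj₁ l    = ≤-trans (Σ<-member k i l) (m≤m+n (Σ< k a) (a k))
... | inj₂ refl = m≤n+m (a k) (Σ< k a)

Σ<-mono-k : ∀ {j k} (a : ℕ → ℕ) → j ≤ k → Σ< j a ≤ Σ< k a
Σ<-mono-k {zero}  a _ = z≤n
Σ<-mono-k {suc j} {suc k} a (s≤s le) with m≤n⇒m<n∨m≡n le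
... | inj₁ lt   = ≤-trans (Σ<-mono-k {suc j} {k} a lt) (m≤m+n (Σ< k a) (a k))
... | inj₂ refl = ≤-refl

setCell-≤ : ∀ {Z} a i v (σ : Store) → v ≤ Z → (∀ b j → σ b j ≤ Z) → ∀ b j → setCell a i v σ b j ≤ Z
setCell-≤ {Z} a i v σ hv h = setArray-≤ a (λ j → if i ≡ᵇ j then v else σ a j) σ cell h
  where
  cell : ∀ j → (if i ≡ᵇ j then v else σ a j) ≤ Z
  cell j with i ≡ᵇ j
  ... | true  = hv
  ... | false = h a j

power-bound : ∀ S N K → S ≤ N ^ 2 → (S * S * S) ^ K ≤ N ^ (6 * K)
power-bound S N K h = ≤-trans (^-monoˡ-≤ K (≤-trans (*-mono-≤ (*-mono-≤ h h) h)
  (≤-reflexive (trans (cong (_* N ^ 2) (sym (^-distribˡ-+-* N 2 2))) (sym (^-distribˡ-+-* N 4 2)))))) (≤-reflexive (^-*-assoc N 6 K))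

module Prelude (xs : List ℕ) where

  private
    inp₀ : ℕ → ℕ
    inp₀ = initial xs 0
    a : ℕ → ℕ
    a i = inp₀ (suc i)

  S : ℕ
  S = 2 + (length xs) + Σ< (length xs) a

  cell<S : ∀ i → i < (length xs) → inp₀ (suc i) < S
  cell<S i lt = s≤s (≤-trans (Σ<-member (length xs) {a} i lt) (m≤n+m (Σ< (length xs) a) (1 + (length xs))))

  S≥ : 2 + (length xs) ≤ S
  S≥ = m≤m+n (2 + (length xs)) (Σ< (length xs) a)

  private
    a≤max : ∀ i → a i ≤ max 0 xs
    a≤max = overwrite-≤ xs {λ _ → 0} (xs≤max 0 xs) (λ _ → z≤n)

  -- A sum is at most the length times the maximum, which costs a square. With the cube in the cap
  -- this is the 6 in the exponent of the word bound.
  S≤N² : S ≤ (2 + (length xs) + max 0 xs) ^ 2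
  S≤N² = begin
    2 + (length xs) + Σ< (length xs) a     ≤⟨ +-mono-≤ (m≤m+n (2 + (length xs)) M) (Σ<-≤ (length xs) a≤max) ⟩
    N + (length xs) * M             ≤⟨ +-monoʳ-≤ N (*-monoˡ-≤ M (≤-trans (m≤n+m (length xs) 2) (m≤m+n (2 + (length xs)) M))) ⟩
    N + N * M                ≡⟨ sym (*-suc N M) ⟩
    N * suc M                ≤⟨ *-monoʳ-≤ N (+-monoˡ-≤ M (s≤s (z≤n {1 + (length xs)}))) ⟩
    N * N                    ≡⟨ cong (N *_) (sym (*-identityʳ N)) ⟩
    N ^ 2                    ∎
    where
    open ≤-Reasoning
    M = max 0 xs
    N = 2 + (length xs) + M

  Z : ℕ
  Z = S * S * S

  private
    1≤S : 1 ≤ S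
    1≤S = ≤-trans (s≤s z≤n) S≥

    S≤S² : S ≤ S * S
    S≤S² = ≤-trans (≤-reflexive (sym (*-identityʳ S))) (*-monoʳ-≤ S 1≤S)

  S²≤Z : S * S ≤ Z
  S²≤Z = ≤-trans (≤-reflexive (sym (*-identityʳ (S * S)))) (*-monoʳ-≤ (S * S) 1≤S)

  S≤Z : S ≤ Z
  S≤Z = ≤-trans S≤S² S²≤Z

  private
    sumTo : ℕ → ℕ
    sumTo k = 2 + (length xs) + Σ< k a

    state : ℕ → Store
    state zero    = setCell 3 0 0 (setCell 2 2 (2 + (length xs)) (initial xs))
    state (suc k) = setCell 3 0 (state k 3 0 + 1) (setCell 2 2 (state k 2 2 + state k 0 (state k 3 0 + 1)) (state k))

    state-input : ∀ k → state k 0 ≡ inp₀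
    state-input zero    = refl
    state-input (suc k) = state-input k

    state-counter : ∀ k → state k 3 0 ≡ k
    state-counter zero    = refl
    state-counter (suc k) = trans (cong (_+ 1) (state-counter k)) (+-comm k 1)

    state-sum : ∀ k → state k 2 2 ≡ sumTo k
    state-sum zero    = sym (+-identityʳ (2 + (length xs)))
    state-sum (suc k) = trans (cong₂ _+_ (state-sum k) (cong₂ (λ f i → f i) (state-input k) (trans (cong (_+ 1) (state-counter k)) (+-comm k 1))))
                          (+-assoc (2 + (length xs)) (Σ< k a) (a k))

    state-≤ : ∀ k → k ≤ (length xs) → ∀ b j → state k b j ≤ Z
    state-≤ zero    _  = setCell-≤ 3 0 0 _ z≤n (setCell-≤ 2 2 (2 + (length xs)) (initial xs) (≤-trans S≥ S≤Z) start)
      where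
      below-S : ∀ i → inp₀ i ≤ S
      below-S zero    = ≤-trans (m≤n+m (length xs) 2) S≥
      below-S (suc i) = overwrite-≤ xs {λ _ → 0} (members xs (λ i lt → <⇒≤ (cell<S i lt))) (λ _ → z≤n) i
        where
        members : ∀ ys → (∀ i → i < length ys → overwrite ys (λ _ → 0) i ≤ S) → All (_≤ S) ys
        members []       h = []
        members (y ∷ ys) h = h 0 (s≤s z≤n) ∷ members ys (λ i lt → h (suc i) (s≤s lt))
      start : ∀ b j → initial xs b j ≤ Z
      start zero    j = ≤-trans (below-S j) S≤Z
      start (suc b) j = z≤n
    state-≤ (suc k) lt = setCell-≤ 3 0 _ _ (≤-trans (≤-reflexive (state-counter (suc k))) (≤-trans lt (≤-trans (m≤n+m (length xs) 2) (≤-trans S≥ S≤Z))))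
      (setCell-≤ 2 2 _ (state k) (≤-trans (≤-reflexive (state-sum (suc k))) (≤-trans (+-monoʳ-≤ (2 + (length xs)) (Σ<-mono-k a lt)) S≤Z)) (state-≤ k (<⇒≤ lt)))

  cap-power : ∀ K → Z ^ K ≤ wordBound (6 * K) xs
  cap-power K = power-bound S (2 + length xs + max 0 xs) K S≤N²

  final : Store
  final = setCell 2 1 (state (length xs) 2 2 * state (length xs) 2 2) (setCell 2 0 (state (length xs) 2 2 * state (length xs) 2 2 * state (length xs) 2 2) (state (length xs)))

  final-input : final 0 ≡ inp₀
  final-input = state-input (length xs)

  final-cap : final 2 0 ≡ Z
  final-cap = cong (λ s → s * s * s) (state-sum (length xs))

  final-big : final 2 1 ≡ S * S
  final-big = cong (λ s → s * s) (state-sum (length xs))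

  final-≤ : ∀ b j → final b j ≤ Z
  final-≤ = setCell-≤ 2 1 _ _ (≤-trans (≤-reflexive final-big) S²≤Z) (setCell-≤ 2 0 _ (state (length xs)) (≤-reflexive final-cap) (state-≤ (length xs) ≤-refl))

  -- Each number of the input costs 22, namely 16 for the body of the loop and 6 for its test.
  prelude-exec : ∀ {B} K → 8 ≤ Z → 16 ≤ K → Z ^ K ≤ B → ∃[ t ] Exec B preludeP (initial xs) final t × t ≤ 22 * (length xs) + 32
  prelude-exec {B} K 8≤Z 16≤K ZB = _ ,
      seq (assign (two (initial xs)) (two (initial xs) , (z≤n , ≤-trans (≤-trans (m≤n+m (length xs) 2) (≤-trans S≥ S≤Z)) Z≤B) , ≤-trans (≤-trans S≥ S≤Z) Z≤B))
        (seq (assign z≤n z≤n)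
          (seq (proj₁ (proj₂ summed)) (seq (assign z≤n (fits′ (length xs) ≤-refl (sumE ⊗ sumE ⊗ sumE) (pow 11))) (assign one (proj₁ cubes , proj₂ cubes , sq≤))))) ,
      (begin
        6 + (3 + (proj₁ summed + (10 + 7)))            ≡⟨ solve 1 (λ t → con 6 :+ (con 3 :+ (t :+ con 17)) := t :+ con 26) refl (proj₁ summed) ⟩
        proj₁ summed + 26                              ≤⟨ +-monoˡ-≤ 26 (proj₂ (proj₂ summed)) ⟩
        (length xs) * 22 + 6 + 26                             ≡⟨ solve 1 (λ l → l :* con 22 :+ con 6 :+ con 26 := con 22 :* l :+ con 32) refl (length xs) ⟩
        22 * (length xs) + 32                                 ∎)
    where
    open ≤-Reasoning
    open +-*-Solver using (solve; con; _:+_; _:*_; _:=_)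
    open Execution {B} {Z} {0} 8≤Z using (fits)
    1≤Z : 1 ≤ Z
    1≤Z = ≤-trans (s≤s z≤n) 8≤Z
    -- The widths of the expressions evaluated here reach 11; the bound 16 leaves room and is
    -- checked by computation.
    pow : ∀ j → {T (j ≤ᵇ 16)} → Z ^ j ≤ B
    pow j {t} = ≤-trans (^-mono 1≤Z (≤-trans (≤ᵇ⇒≤ j 16 t) 16≤K)) ZB
    Z≤B : Z ≤ B
    Z≤B = ≤-trans (≤-reflexive (sym (*-identityʳ Z))) (pow 1)
    two : ∀ (σ : Store) → Fits B σ (lit 2)
    two σ = ≤-trans (≤-trans (s≤s (s≤s z≤n)) 8≤Z) Z≤B
    one : 1 ≤ B
    one = ≤-trans 1≤Z Z≤B
    fits′ : ∀ k → k ≤ (length xs) → ∀ e → Z ^ width e ≤ B → Fits B (state k) e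
    fits′ k le e h = fits (state-≤ k le) e h
    summed : ∃[ t ] Exec B (while (0 ⟦ lit 0 ⟧ ⊖ $$ 3) sumBody) (state 0) (state (length xs)) t × t ≤ (length xs) * 22 + 6
    summed = whileFor state (length xs) 16 (λ k le → fits′ k le (0 ⟦ lit 0 ⟧ ⊖ $$ 3) (pow 3))
      (λ k le → cong₂ _∸_ (cong (λ f → f 0) (state-input k)) (state-counter k))
      (λ k lt → 16 , seq (assign (two (state k)) (fits′ k (<⇒≤ lt) (sumE ⊕ 0 ⟦ $$ 3 ⊕ lit 1 ⟧) (pow 8)))
        (assign z≤n (fits (setCell-≤ 2 2 _ (state k) (≤-trans (≤-reflexive (state-sum (suc k))) (≤-trans (+-monoʳ-≤ (2 + (length xs)) (Σ<-mono-k a lt)) S≤Z)) (state-≤ k (<⇒≤ lt))) ($$ 3 ⊕ lit 1) (pow 3))) , ≤-refl)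
      (length xs) 0 (+-identityʳ (length xs))
    S-cell : ∀ {s} → s ≡ S → s ≤ B
    S-cell refl = ≤-trans S≤Z Z≤B
    cubes : Fits B (setCell 2 0 (state (length xs) 2 2 * state (length xs) 2 2 * state (length xs) 2 2) (state (length xs))) sumE ×
            Fits B (setCell 2 0 (state (length xs) 2 2 * state (length xs) 2 2 * state (length xs) 2 2) (state (length xs))) sumE
    cubes = (two (state (length xs)) , S-cell (state-sum (length xs))) , (two (state (length xs)) , S-cell (state-sum (length xs)))
    sq≤ : state (length xs) 2 2 * state (length xs) 2 2 ≤ B
    sq≤ = ≤-trans (≤-reflexive final-big) (≤-trans S²≤Z Z≤B)

-- Connected graphs and encoded instances

connected⇒n≤1+m : ∀ {n m} (N : Network n m) (D : Fin n → Fin n → ℕ) → (∀ u v → Network.Dist N full u v (D u v)) → n ≤ suc m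
connected⇒n≤1+m {zero}  N D h = z≤n
-- Every vertex but the first is mapped to the first edge of a shortest path to that vertex. Two
-- vertices with the same edge would be its two ends, each closer to the target than the other.
connected⇒n≤1+m {suc n} {m} N D h = s≤s (Fin.injective⇒≤ {f = λ i → proj₁ (towards i)} (λ {i} {k} → injective {i} {k}))
  where
  open Network N using (graph; ℓ; ℓ-pos)
  open Walks graph
  open Lengths ℓ
  rank : Fin (suc n) → ℕ
  rank z = D z Fin.zero
  first : ∀ {z} (p : Walk z Fin.zero) → z ≢ Fin.zero → IsPath p → len p ≡ rank z → ∃[ e ] ∃[ x ] Joins e z x × rank x < rank z
  first stop         ne _       _  = ⊥-elim (ne refl)
  first (step {v = x} e j p) ne (_ ∷ path) eq = e , x , j ,
    subst (rank x <_) eq (≤-trans (s≤s (proj₂ (h x Fin.zero) p path (All.tabulate λ _ → Subset.∈⊤))) (+-monoˡ-≤ (len p) (ℓ-pos e)))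
  towards : ∀ (i : Fin n) → ∃[ e ] ∃[ x ] Joins e (Fin.suc i) x × rank x < rank (Fin.suc i)
  towards i = first (proj₁ (proj₁ (h (Fin.suc i) Fin.zero))) (λ ()) (proj₁ (proj₂ (proj₁ (h (Fin.suc i) Fin.zero))))
                (proj₂ (proj₂ (proj₂ (proj₁ (h (Fin.suc i) Fin.zero)))))
  injective : ∀ {i k} → proj₁ (towards i) ≡ proj₁ (towards k) → i ≡ k
  injective {i} {k} eq = same (proj₁ (proj₂ (proj₂ (towards i)))) (proj₂ (proj₂ (proj₂ (towards i))))
                              (proj₁ (proj₂ (proj₂ (towards k)))) (proj₂ (proj₂ (proj₂ (towards k)))) eq
    where
    same : ∀ {e f x y} → Joins e (Fin.suc i) x → rank x < rank (Fin.suc i) → Joins f (Fin.suc k) y → rank y < rank (Fin.suc k) → e ≡ f → i ≡ k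
    same je lx jf ly refl with joins-ends je jf
    ... | inj₁ (q , _)       = Fin.suc-injective q
    ... | inj₂ (refl , refl) = ⊥-elim (<-asym lx ly)

module Encoded {n m} (I : Instance n m) (dist : ∀ u v → ∃[ d ] Instance.Dist I full u v d) where

  open Instance I using (graph; lo; hi; ℓ; w; α; W; Walk; ℓ*; edges)
  open Prelude (encode I)

  private
    block : Fin m → List ℕ
    block e = toℕ (lo e) ∷ toℕ (hi e) ∷ ℓ e ∷ w e ∷ []

    xs : List ℕ
    xs = encode I

    inp₀ : ℕ → ℕ
    inp₀ = initial xs 0

  length-encode : length xs ≡ 6 + m * 4
  length-encode = cong (6 +_) (length-blocks 4 block (λ _ → refl) m id)

  private
    at : ∀ e r → r < 4 → inp₀ (7 + (4 * toℕ e + r)) ≡ overwrite (block e) (λ _ → 0) r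
    at e r lt = overwrite-blocks 4 block (λ _ → refl) m id (λ _ → 0) (λ _ → 0) e r lt

    shift : ∀ k r → inp₀ (7 + (k + r)) ≡ inp₀ (7 + (r + k))
    shift k r = cong (λ j → inp₀ (7 + j)) (+-comm k r)

    lo-eq : ∀ e → inp₀ (7 + 4 * toℕ e) ≡ toℕ (lo e)
    lo-eq e = trans (sym (shift (4 * toℕ e) 0)) (at e 0 (s≤s z≤n))

    hi-eq : ∀ e → inp₀ (8 + 4 * toℕ e) ≡ toℕ (hi e)
    hi-eq e = trans (sym (shift (4 * toℕ e) 1)) (at e 1 (s≤s (s≤s z≤n)))

    ℓ-eq : ∀ e → inp₀ (9 + 4 * toℕ e) ≡ ℓ e
    ℓ-eq e = trans (sym (shift (4 * toℕ e) 2)) (at e 2 (s≤s (s≤s (s≤s z≤n))))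

    w-eq : ∀ e → inp₀ (10 + 4 * toℕ e) ≡ w e
    w-eq e = trans (sym (shift (4 * toℕ e) 3)) (at e 3 (s≤s (s≤s (s≤s (s≤s z≤n)))))

    len≥6 : 6 ≤ length xs
    len≥6 = ≤-trans (m≤m+n 6 (m * 4)) (≤-reflexive (sym length-encode))

    -- Six numbers precede the edges, and `S` has a summand 2. This guaranteed 8 is the reason why
    -- `bounded` admits literals up to 8.
    8≤S : 8 ≤ S
    8≤S = ≤-trans (+-monoʳ-≤ 2 len≥6) S≥

    n<S : n < S
    n<S = cell<S 0 (≤-trans (s≤s z≤n) len≥6)

    num<S : ℤ.∣ ↥ α ∣ < S
    num<S = cell<S 2 (≤-trans (s≤s (s≤s (s≤s z≤n))) len≥6)

    W<S : W < S
    W<S = cell<S 4 (≤-trans (s≤s (s≤s (s≤s (s≤s (s≤s z≤n))))) len≥6)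

    ℓ<S : ∀ e → ℓ e < S
    ℓ<S e = subst (_< S) (ℓ-eq e) (cell<S (8 + 4 * toℕ e) (≤-trans bound (≤-reflexive (sym length-encode))))
      where
      bound : 9 + 4 * toℕ e ≤ 6 + m * 4
      bound = +-monoʳ-≤ 6 (≤-trans (+-monoˡ-≤ (4 * toℕ e) (n≤1+n 3)) (≤-trans (≤-reflexive (sym (*-suc 4 (toℕ e)))) (≤-trans (*-monoʳ-≤ 4 (Fin.toℕ<n e)) (≤-reflexive (*-comm 4 m)))))

    m+3≤S : m + 3 ≤ S
    m+3≤S = ≤-trans (≤-trans (≤-reflexive (+-comm m 3)) (+-mono-≤ (m≤m+n 3 5) (≤-trans (≤-reflexive (sym (*-identityʳ m))) (*-monoʳ-≤ m (s≤s z≤n)))))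
              (≤-trans (+-monoʳ-≤ 2 (≤-reflexive (sym length-encode))) S≥)

    1≤S : 1 ≤ S
    1≤S = ≤-trans (s≤s z≤n) 8≤S

  8≤Z : 8 ≤ Z
  8≤Z = ≤-trans 8≤S S≤Z

  input : Input I
  input = record
    { inp = inp₀ ; con = final 2
    ; inp-n = refl ; inp-m = refl ; inp-lo = lo-eq ; inp-hi = hi-eq ; inp-ℓ = ℓ-eq ; inp-w = w-eq
    ; inp-num = refl ; inp-den = refl ; inp-W = refl ; inp-μ = refl
    ; path<V = λ p path → subst (ℓ* p <_) (sym final-cap) (<-≤-trans (≤-<-trans (≤-trans (path≤ p) (*-monoˡ-≤ S (<⇒≤ (Walks.path-length graph p path)))) (*-monoˡ-< S {{>-nonZero 1≤S}} n<S)) S²≤Z)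
    ; num*ℓ<B = λ e → subst (ℤ.∣ ↥ α ∣ * ℓ e <_) (sym final-big) (≤-<-trans (*-monoʳ-≤ ℤ.∣ ↥ α ∣ (<⇒≤ (ℓ<S e))) (*-monoˡ-< S {{>-nonZero 1≤S}} num<S))
    ; 1≤B = subst (1 ≤_) (sym final-big) (*-mono-≤ 1≤S 1≤S)
    ; ℓ≤B = λ e → subst (ℓ e ≤_) (sym final-big) (≤-trans (<⇒≤ (ℓ<S e)) (≤-trans (≤-reflexive (sym (*-identityʳ S))) (*-monoʳ-≤ S 1≤S)))
    ; B≤V = subst₂ _≤_ (sym final-big) (sym final-cap) S²≤Z
    ; n*n≤V = subst (n * n ≤_) (sym final-cap) (≤-trans (*-mono-≤ (<⇒≤ n<S) (<⇒≤ n<S)) S²≤Z)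
    ; n*B≤V = subst₂ (λ b v → n * b ≤ v) (sym final-big) (sym final-cap) (≤-trans (*-monoˡ-≤ (S * S) (<⇒≤ n<S)) (≤-reflexive (sym (*-assoc S S S))))
    ; W<V = subst (W <_) (sym final-cap) (<-≤-trans W<S S≤Z)
    ; stack≤V = subst (3 + (m * m + 3 * m) ≤_) (sym final-cap) (≤-trans stack (≤-trans (*-mono-≤ m+3≤S m+3≤S) S²≤Z))
    ; dist = dist
    }
    where
    path≤ : ∀ {u v} (p : Walk u v) → ℓ* p ≤ length (edges p) * S
    path≤ Graph.stop         = z≤n
    path≤ (Graph.step e _ p) = +-mono-≤ (<⇒≤ (ℓ<S e)) (path≤ p)
    stack : 3 + (m * m + 3 * m) ≤ (m + 3) * (m + 3)
    stack = ≤-trans (m≤m+n _ (6 + 3 * m)) (≤-reflexive (solve 1 (λ m → con 3 :+ (m :* m :+ con 3 :* m) :+ (con 6 :+ con 3 :* m) := (m :+ con 3) :* (m :+ con 3)) refl m))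
      where open +-*-Solver using (solve; con; _:+_; _:*_; _:=_)


-- The whole program and its running time

spannerP : Cmd → Cmd
spannerP apsp =
  preludeP ⨾ (compile preprocess ⨾ (compile startP ⨾ (while guardE (searchBody apsp) ⨾ compile outputP)))

-- For `m` at least 1 this is doubling, and the summand 1 covers the graph without edges.
cube-suc : ∀ m → suc m ^ 3 ≤ 8 * (1 + m ^ 3)
cube-suc zero    = s≤s z≤n
cube-suc m@(suc j) = begin
  suc m ^ 3            ≤⟨ ^-monoˡ-≤ 3 (+-monoˡ-≤ m (s≤s (z≤n {j}))) ⟩
  (m + m) ^ 3          ≡⟨ solve 1 (λ m → (m :+ m) :^ 3 := con 8 :* m :^ 3) refl m ⟩
  8 * m ^ 3            ≤⟨ *-monoʳ-≤ 8 (n≤1+n (m ^ 3)) ⟩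
  8 * (1 + m ^ 3)      ∎
  where
  open ≤-Reasoning
  open +-*-Solver using (solve; con; _:+_; _:*_; _:=_; _:^_)

-- Linear terms are absorbed by X³, the search by P = s ^ μ * APSP n m.
total-time : ∀ {X Y P L Tp T₁ T₂ Tℓ T₃ R c₁ c₂ c₃ c g} → X ≤ Y → 1 ≤ Y →
  L ≤ 6 * X → Tp ≤ 22 * L + 32 → T₁ ≤ c₁ * Y → T₂ ≤ c₂ * X → Tℓ ≤ c * P + g → T₃ ≤ c₃ * X → R ≤ X + 1 →
  L + (Tp + (T₁ + (T₂ + (Tℓ + T₃)))) + R ≤ (172 + c₁ + c₂ + c₃ + g) * Y + c * P
total-time {X} {Y} {P} {L} {Tp} {T₁} {T₂} {Tℓ} {T₃} {R} {c₁} {c₂} {c₃} {c} {g} XY 1Y hL hp h₁ h₂ hℓ h₃ hR = begin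
  L + (Tp + (T₁ + (T₂ + (Tℓ + T₃)))) + R
    ≤⟨ +-mono-≤ (+-mono-≤ LY (+-mono-≤ pY (+-mono-≤ h₁ (+-mono-≤ (up c₂ h₂) (+-mono-≤ ℓY (up c₃ h₃)))))) RY ⟩
  -- The constant 172 is the sum of 6 for reading the input, 164 = 22 * 6 + 32 for computing the
  -- constants and 2 for the output.
  6 * Y + (164 * Y + (c₁ * Y + (c₂ * Y + ((c * P + g * Y) + c₃ * Y)))) + 2 * Y
    ≡⟨ solve 7 (λ Y c₁ c₂ c₃ g c P → con 6 :* Y :+ (con 164 :* Y :+ (c₁ :* Y :+ (c₂ :* Y :+ ((c :* P :+ g :* Y) :+ c₃ :* Y)))) :+ con 2 :* Y
                                  := (con 172 :+ c₁ :+ c₂ :+ c₃ :+ g) :* Y :+ c :* P) refl Y c₁ c₂ c₃ g c P ⟩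
  (172 + c₁ + c₂ + c₃ + g) * Y + c * P ∎
  where
  open ≤-Reasoning
  open +-*-Solver using (solve; con; _:+_; _:*_; _:=_)
  up : ∀ k {t} → t ≤ k * X → t ≤ k * Y
  up k h = ≤-trans h (*-monoʳ-≤ k XY)
  one : ∀ k → k ≤ k * Y
  one k = ≤-trans (≤-reflexive (sym (*-identityʳ k))) (*-monoʳ-≤ k 1Y)
  LY : L ≤ 6 * Y
  LY = up 6 hL
  pY : Tp ≤ 164 * Y
  pY = ≤-trans hp (≤-trans (+-mono-≤ (*-monoʳ-≤ 22 LY) (one 32)) (≤-reflexive (solve 1 (λ Y → con 22 :* (con 6 :* Y) :+ con 32 :* Y := con 164 :* Y) refl Y)))
  ℓY : Tℓ ≤ c * P + g * Y
  ℓY = ≤-trans hℓ (+-monoʳ-≤ (c * P) (one g))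
  RY : R ≤ 2 * Y
  RY = ≤-trans hR (≤-trans (+-mono-≤ XY 1Y) (≤-reflexive (cong (Y +_) (sym (+-identityʳ Y)))))

-- The linear work at a node is charged to its call, as `X ≤ A`. The factor 2 comes from `G-bound`,
-- and the 2 beside `cc` from `1 + A ≤ 2 * A`.
search-time : ∀ {X A g P G cp cc Tpop Tchk} → X ≤ A → 1 ≤ A → Tpop ≤ cp * X → Tchk ≤ cc * X → G ≤ 2 * P →
              G * (g + (Tpop + ((1 + A) + Tchk))) + g ≤ (2 * (g + (cp + (2 + cc)))) * (P * A) + g
search-time {X} {A} {g} {P} {G} {cp} {cc} {Tpop} {Tchk} XA 1A hp hc hG = +-monoˡ-≤ g (begin
  G * (g + (Tpop + ((1 + A) + Tchk)))                   ≤⟨ *-mono-≤ hG (+-mono-≤ gA (+-mono-≤ (≤-trans hp (*-monoʳ-≤ cp XA)) (+-mono-≤ (+-monoˡ-≤ A 1A) (≤-trans hc (*-monoʳ-≤ cc XA))))) ⟩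
  2 * P * (g * A + (cp * A + ((A + A) + cc * A)))       ≡⟨ solve 5 (λ P g A cp cc → con 2 :* P :* (g :* A :+ (cp :* A :+ ((A :+ A) :+ cc :* A))) := (con 2 :* (g :+ (cp :+ (con 2 :+ cc)))) :* (P :* A)) refl P g A cp cc ⟩
  (2 * (g + (cp + (2 + cc)))) * (P * A)                 ∎)
  where
  open ≤-Reasoning
  open +-*-Solver using (solve; con; _:+_; _:*_; _:=_)
  gA : g ≤ g * A
  gA = ≤-trans (≤-reflexive (sym (*-identityʳ g))) (*-monoʳ-≤ g 1A)

closing-time : ∀ {Y a c P Q E} → Y ≤ 8 * (1 + Q) → a * Y + c * P ≤ (8 * a + c) * (1 + P + Q + E)
closing-time {Y} {a} {c} {P} {Q} {E} h = begin
  a * Y + c * P                         ≤⟨ +-mono-≤ (*-monoʳ-≤ a h) ≤-refl ⟩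
  a * (8 * (1 + Q)) + c * P             ≤⟨ m≤m+n _ (8 * a * (P + E) + c * (1 + Q + E)) ⟩
  a * (8 * (1 + Q)) + c * P + (8 * a * (P + E) + c * (1 + Q + E))
    ≡⟨ solve 5 (λ a c P Q E → a :* (con 8 :* (con 1 :+ Q)) :+ c :* P :+ (con 8 :* a :* (P :+ E) :+ c :* (con 1 :+ Q :+ E)) := (con 8 :* a :+ c) :* (con 1 :+ P :+ Q :+ E)) refl a c P Q E ⟩
  (8 * a + c) * (1 + P + Q + E) ∎
  where
  open ≤-Reasoning
  open +-*-Solver using (solve; con; _:+_; _:*_; _:=_)

linear : ∀ {X} → 1 ≤ X → ∀ p → depth p ≡ 1 → time X p ≤ coef p * X
linear {X} h p eq = subst (λ y → time X p ≤ coef p * y) (*-identityʳ X) (subst (λ d → time X p ≤ coef p * X ^ d) eq (time-poly h p))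

common-bound : ∀ a b c d e f → ∃[ K ] a ≤ K × b ≤ K × c ≤ K × d ≤ K × e ≤ K × f ≤ K
common-bound a b c d e f = a + (b + (c + (d + (e + f)))) , m≤m+n a _ ,
  m≤n⇒m≤o+n a (m≤m+n b _) , m≤n⇒m≤o+n a (m≤n⇒m≤o+n b (m≤m+n c _)) , m≤n⇒m≤o+n a (m≤n⇒m≤o+n b (m≤n⇒m≤o+n c (m≤m+n d _))) ,
  m≤n⇒m≤o+n a (m≤n⇒m≤o+n b (m≤n⇒m≤o+n c (m≤n⇒m≤o+n d (m≤m+n e f)))) , m≤n⇒m≤o+n a (m≤n⇒m≤o+n b (m≤n⇒m≤o+n c (m≤n⇒m≤o+n d (m≤n+m f e))))

square-power : ∀ V k → (V * V) ^ k ≡ V ^ (2 * k)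
square-power V k = trans (cong (λ v → (V * v) ^ k) (sym (*-identityʳ V))) (^-*-assoc V 2 k)

-- A run pays for reading its input, and the encoded network has more than m numbers.
apsp-time : ∀ {n m} (N : Network n m) {k p ys T} → RunsWithin k p (encodeNetwork N) ys T → suc m ≤ T
apsp-time {n} {m} N {ys = ys} (τ , t , _ , _ , le) = ≤-trans (s≤s (≤-trans (≤-trans (≤-reflexive (sym (*-identityʳ m))) (*-monoʳ-≤ m (s≤s (z≤n {2})))) (n≤1+n (m * 3))))
  (≤-trans (≤-reflexive (sym (cong (2 +_) (length-blocks 3 block (λ _ → refl) m id)))) (≤-trans (m≤m+n _ t) (≤-trans (m≤m+n _ (length ys)) le)))
  where
  open Network N using (lo; hi; ℓ)
  block : Fin m → List ℕ
  block e = toℕ (lo e) ∷ toℕ (hi e) ∷ ℓ e ∷ []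

indicator-length : ∀ {m} (F : Subset m) → length (indicator F) ≡ m
indicator-length F = trans (List.length-map (λ b → if_then_else_ {A = ℕ} b 1 0) (Vec.toList F)) (Vec.length-toList F)

module Spanner (apsp : Cmd) (APSP : ℕ → ℕ → ℕ) (k : ℕ)
  (solves : ∀ {n m} (N : Network n m) → ∃[ ys ] RunsWithin k apsp (encodeNetwork N) ys (APSP n m) × IsDistanceMatrix N ys) where

  distances : ∀ {n m} (N : Network n m) → Σ[ D ∈ (Fin n → Fin n → ℕ) ] (∀ (u v : Fin n) → Network.Dist N full u v (D u v))
  distances = Loop.distances apsp APSP k solves

  -- Abstract because these numbers are far too large to be evaluated.
  abstract
    bounds : ∃[ K ] span preprocess ≤ K × span startP ≤ K × span popP ≤ K × span checkP ≤ K × span outputP ≤ K × 16 + 2 * k ≤ K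
    bounds = common-bound (span preprocess) (span startP) (span popP) (span checkP) (span outputP) (16 + 2 * k)

    c₁ c₂ c₃ cp cc : ℕ
    c₁ = coef preprocess
    c₂ = coef startP
    c₃ = coef outputP
    cp = coef popP
    cc = coef checkP

    preprocess-time : ∀ X → 1 ≤ X → time X preprocess ≤ c₁ * X ^ 3
    preprocess-time X h = time-poly h preprocess

    start-time : ∀ X → 1 ≤ X → time X startP ≤ c₂ * X
    start-time X h = linear h startP refl

    output-time : ∀ X → 1 ≤ X → time X outputP ≤ c₃ * X
    output-time X h = linear h outputP refl

    pop-time : ∀ X → 1 ≤ X → time X popP ≤ cp * X
    pop-time X h = linear h popP refl

    check-time : ∀ X → 1 ≤ X → time X checkP ≤ cc * X
    check-time X h = linear h checkP refl

  K : ℕ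
  K = proj₁ bounds

  preprocess≤K : span preprocess ≤ K
  preprocess≤K = proj₁ (proj₂ bounds)

  start≤K : span startP ≤ K
  start≤K = proj₁ (proj₂ (proj₂ bounds))

  pop≤K : span popP ≤ K
  pop≤K = proj₁ (proj₂ (proj₂ (proj₂ bounds)))

  check≤K : span checkP ≤ K
  check≤K = proj₁ (proj₂ (proj₂ (proj₂ (proj₂ bounds))))

  output≤K : span outputP ≤ K
  output≤K = proj₁ (proj₂ (proj₂ (proj₂ (proj₂ (proj₂ bounds)))))

  -- 16 serves the computation of the constants, and `2 * k` the calls, which need words up to
  -- `(V * V) ^ k`.
  16+2k≤K : 16 + 2 * k ≤ K
  16+2k≤K = proj₂ (proj₂ (proj₂ (proj₂ (proj₂ (proj₂ bounds)))))

  exponent guardC searchC constant : ℕ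
  exponent = 6 * K
  guardC = 1 + cost guardE
  searchC = 2 * (guardC + (cp + (2 + cc)))
  constant = 8 * (172 + c₁ + c₂ + c₃ + guardC) + searchC

  module ForInstance {n m} (I : Instance n m) (preprocessed : Instance.Preprocessed I) {s} (bs : Instance.IsBundleSize I s) where

    open Instance I using (network; μ)

    D = proj₁ (distances network)

    In : Input I
    In = Encoded.input I (λ u v → D u v , proj₂ (distances network) u v)

    open Prelude (encode I)
    open Encoded I (λ u v → D u v , proj₂ (distances network) u v) using (length-encode; 8≤Z)
    open Input In using (V; inp; con)

    X A B : ℕ
    X = suc m
    A = APSP n m
    B = wordBound exponent (encode I)

    8≤V : 8 ≤ V
    8≤V = subst (8 ≤_) (sym final-cap) 8≤Z

    Z^K≤B : Z ^ K ≤ B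
    Z^K≤B = cap-power K

    V^K≤B : V ^ K ≤ B
    V^K≤B = subst (λ v → v ^ K ≤ B) (sym final-cap) Z^K≤B

    1≤V : 1 ≤ V
    1≤V = ≤-trans (s≤s z≤n) 8≤V

    word≤ : (V * V) ^ k ≤ B
    word≤ = ≤-trans (≤-reflexive (square-power V k)) (≤-trans (^-mono 1≤V (≤-trans (m≤n+m (2 * k) 16) 16+2k≤K)) V^K≤B)

    16≤K : 16 ≤ K
    16≤K = ≤-trans (m≤m+n 16 (2 * k)) 16+2k≤K

    5≤K : 5 ≤ K
    5≤K = ≤-trans (≤ᵇ⇒≤ 5 16 tt) 16≤K

    span-part : ∀ j → j ≤ K → V ^ j ≤ B
    span-part j h = ≤-trans (^-mono 1≤V h) V^K≤B

    Found NoSolution : Store → Set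
    Found      = Theory.Found I In distances preprocessed
    NoSolution = Theory.NoSolution I In distances preprocessed

    n≤X : n ≤ X
    n≤X = connected⇒n≤1+m network D (proj₂ (distances network))

    small₀ : Small V X final
    small₀ = small (subst (λ v → ∀ a i → final a i ≤ v) (sym final-cap) final-≤)
      (subst (_≤ X) (sym (cong (λ f → f 1) final-input)) n≤X) (subst (_≤ X) (sym (cong (λ f → f 2) final-input)) (n≤1+n m))

    X≤A : X ≤ A
    X≤A = apsp-time network {k} {apsp} {proj₁ (solves network)} (proj₁ (proj₂ (solves network)))

    σ₁ σ₂ : Store
    σ₁ = run preprocess final
    σ₂ = run startP σ₁

    q₁ : σ₁ 0 ≡ inp
    q₁ = trans (run-frame preprocess final 0 tt) final-input

    q₁′ : σ₁ 2 ≡ con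
    q₁′ = run-frame preprocess final 2 tt

    prepared : Preprocessing.Prepared I In σ₁
    prepared = Preprocessing.preprocess-correct I In final final-input refl

    open Preprocessing.Prepared prepared using (thresholds; trivial; bundle)

    Searching : Store → Stack → Set
    Searching = Node.Searching I In distances preprocessed (σ₁ 12) (σ₁ 22) (σ₁ 23) thresholds trivial bundle

    Outcome : Store → Set
    Outcome = Loop.Run.Searching-loop.Outcome apsp APSP k solves I In preprocessed {B} {X} {K} 8≤V V^K≤B 5≤K pop≤K check≤K word≤ σ₁ prepared bs

    Searched : Set
    Searched = ∃[ τ ] ∃[ t ] Exec B (while guardE (searchBody apsp)) σ₂ τ t × t ≤ searchC * (s ^ μ * A) + guardC × Outcome τ

    search : Small V X σ₂ → Searched
    search sm = from (Start.start-correct I In distances preprocessed σ₁ prepared q₁ q₁′ bs)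
      where
      q₂ : σ₂ 0 ≡ inp
      q₂ = trans (run-frame startP σ₁ 0 tt) q₁
      q₂′ : σ₂ 2 ≡ con
      q₂′ = trans (run-frame startP σ₁ 2 tt) q₁′
      at-once : eval σ₂ guardE ≡ 0 → (Found σ₂ ⊎ NoSolution σ₂) → Searched
      at-once z o = σ₂ , _ , while-false (guard-fits 8≤V (span-part 5 5≤K) sm) z , m≤n+m guardC _ , o , sm , q₂ , q₂′
      from : (Found σ₂ ⊎ NoSolution σ₂) ⊎ (2 ≤ s × Searching σ₂ ((1 , m) ∷ [])) → Searched
      from (inj₁ o@(inj₁ fd)) = at-once (live-stops {σ₂} (proj₁ fd)) o
      from (inj₁ o@(inj₂ (_ , z , _))) = at-once (empty-stops {σ₂} z) o
      from (inj₂ (2≤s , S)) = within (Loop.Run.Searching-loop.loop apsp APSP k solves I In preprocessed {B} {X} {K} 8≤V V^K≤B 5≤K pop≤K check≤K word≤ σ₁ prepared bs (G s μ) σ₂ ((1 , m) ∷ []) S sm (≤-reflexive (+-identityʳ (G s μ))))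
        where
        within : (∃[ τ ] ∃[ t ] Exec B (while guardE (searchBody apsp)) σ₂ τ t × t ≤ G s μ * (guardC + nodeTime X A) + guardC × Outcome τ) → Searched
        within (τ , t , r , t≤ , o) = τ , t , r , ≤-trans t≤ (search-time {X} {A} {guardC} {s ^ μ} {G s μ} {cp} {cc} X≤A (≤-trans (s≤s z≤n) X≤A)
          (pop-time X (s≤s z≤n)) (check-time X (s≤s z≤n)) (≤-trans (m≤m+n (G s μ) 1) (G-bound 2≤s μ))) , o

    Bound : ℕ
    Bound = constant * (1 + s ^ μ * A + m ^ 3 + m ^ 2 * n * ⌊log₂ n ⌋)

    Result : Set
    Result = ∃[ ys ] RunsWithin exponent (spannerP apsp) (encode I) ys Bound × IsAnswer I ys

    Ran : Cmd → Store → Store → ℕ → Set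
    Ran c σ τ b = ∃[ t ] Exec B c σ τ t × t ≤ b

    bounded-by : ∀ {tp t₁ t₂ tℓ t₃} → tp ≤ 22 * length (encode I) + 32 → t₁ ≤ time X preprocess → t₂ ≤ time X startP →
                 tℓ ≤ searchC * (s ^ μ * A) + guardC → t₃ ≤ time X outputP → ∀ (ys : List ℕ) → length ys ≤ X + 1 →
                 length (encode I) + (tp + (t₁ + (t₂ + (tℓ + t₃)))) + length ys ≤ Bound
    bounded-by {tp} {t₁} {t₂} {tℓ} {t₃} bp b₁ b₂ bℓ b₃ ys le = ≤-trans
      (total-time {X} {X ^ 3} {s ^ μ * A} {length (encode I)} {tp} {t₁} {t₂} {tℓ} {t₃} {length ys} {c₁} {c₂} {c₃} {searchC} {guardC}
        X≤X³ (^-pos {X} 3 (s≤s z≤n)) len≤ bp (≤-trans b₁ (preprocess-time X (s≤s z≤n))) (≤-trans b₂ (start-time X (s≤s z≤n))) bℓ (≤-trans b₃ (output-time X (s≤s z≤n))) le)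
      (closing-time {X ^ 3} {172 + c₁ + c₂ + c₃ + guardC} {searchC} {s ^ μ * A} {m ^ 3} {m ^ 2 * n * ⌊log₂ n ⌋} (cube-suc m))
      where
      X≤X³ : X ≤ X ^ 3
      X≤X³ = ≤-trans (≤-reflexive (sym (*-identityʳ X))) (*-monoʳ-≤ X (^-pos {X} 2 (s≤s z≤n)))
      len≤ : length (encode I) ≤ 6 * X
      len≤ = ≤-trans (≤-reflexive length-encode) (≤-trans (+-monoʳ-≤ 6 (≤-trans (*-monoʳ-≤ m (≤ᵇ⇒≤ 4 6 tt)) (≤-reflexive (*-comm m 6)))) (≤-reflexive (sym (*-suc 6 m))))

    conclude : Ran preludeP (initial (encode I)) final (22 * length (encode I) + 32) → Ran (compile preprocess) final σ₁ (time X preprocess) →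
               Ran (compile startP) σ₁ σ₂ (time X startP) → ∀ {τ} → Ran (while guardE (searchBody apsp)) σ₂ τ (searchC * (s ^ μ * A) + guardC) →
               τ 0 ≡ inp → τ 2 ≡ con → Ran (compile outputP) τ (run outputP τ) (time X outputP) → Found τ ⊎ NoSolution τ → Result
    conclude (tp , rp , bp) (t₁ , r₁ , b₁) (t₂ , r₂ , b₂) {τ} (tℓ , rℓ , bℓ) τ₀ τ₂ (t₃ , r₃ , b₃) (inj₁ (o , sol)) =
      1 ∷ indicator (toSet {m} (τ 28)) ,
      (run outputP τ , _ , seq rp (seq r₁ (seq r₂ (seq rℓ r₃))) , Start.output-found I In distances preprocessed τ τ₀ τ₂ o , bounded-by bp b₁ b₂ bℓ b₃ (1 ∷ indicator (toSet {m} (τ 28))) len) ,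
      inj₁ (toSet (τ 28) , sol , refl)
      where
      len : length (1 ∷ indicator (toSet {m} (τ 28))) ≤ X + 1
      len = ≤-trans (s≤s (≤-reflexive (indicator-length (toSet {m} (τ 28))))) (m≤m+n X 1)
    conclude (tp , rp , bp) (t₁ , r₁ , b₁) (t₂ , r₂ , b₂) {τ} (tℓ , rℓ , bℓ) τ₀ τ₂ (t₃ , r₃ , b₃) (inj₂ (z , _ , none)) =
      0 ∷ [] , (run outputP τ , _ , seq rp (seq r₁ (seq r₂ (seq rℓ r₃))) , Start.output-none I In distances preprocessed τ z , bounded-by bp b₁ b₂ bℓ b₃ (0 ∷ []) (m≤n+m 1 X)) ,
      inj₂ (none , refl)

    answer : Result
    answer = prepare (run-within 8≤V preprocess tt (span-part (span preprocess) preprocess≤K) small₀)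
      where
      prelude : Ran preludeP (initial (encode I)) final (22 * length (encode I) + 32)
      prelude = prelude-exec K 8≤Z 16≤K Z^K≤B
      prepare : (∃[ t ] Exec B (compile preprocess) final σ₁ t × t ≤ time X preprocess × Small V X σ₁) → Result
      prepare (t₁ , r₁ , b₁ , s₁) = begin-search (run-within 8≤V startP tt (span-part (span startP) start≤K) s₁)
        where
        begin-search : (∃[ t ] Exec B (compile startP) σ₁ σ₂ t × t ≤ time X startP × Small V X σ₂) → Result
        begin-search (t₂ , r₂ , b₂ , s₂) = report (search s₂)
          where
          report : Searched → Result
          report (τ , tℓ , rℓ , bℓ , outcome , sτ , τ₀ , τ₂) = write (run-within 8≤V outputP tt (span-part (span outputP) output≤K) sτ)
            where
            write : (∃[ t ] Exec B (compile outputP) τ (run outputP τ) t × t ≤ time X outputP × Small V X (run outputP τ)) → Result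
            write (t₃ , r₃ , b₃ , _) = conclude prelude (t₁ , r₁ , b₁) (t₂ , r₂ , b₂) (tℓ , rℓ , bℓ) τ₀ τ₂ (t₃ , r₃ , b₃) outcome

theorem13 : (apsp : Cmd) (APSP : ℕ → ℕ → ℕ) → SolvesAPSP apsp APSP →
    ∃[ prog ] ∃[ k ] ∃[ c ]
    (∀ {n m} (I : Instance n m) → Instance.Preprocessed I →
    ∀ s → Instance.IsBundleSize I s →
    ∃[ ys ] RunsWithin k prog (encode I) ys
    (c * (1 + s ^ Instance.μ I * APSP n m
    + m ^ 3 + m ^ 2 * n * ⌊log₂ n ⌋))
    × IsAnswer I ys)
theorem13 apsp APSP (k , solves) =
  spannerP apsp , Spanner.exponent apsp APSP k solves , Spanner.constant apsp APSP k solves ,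
  λ I pre s bs → Spanner.ForInstance.answer apsp APSP k solves I pre bs
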